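{- There exists a planar hypotraceable graph on exactly $130$ vertices, and for every integer $n \geq 154$ there exists a planar hypotraceable graph on exactly $n$ vertices.
   Context: All graphs are finite and simple. A graph is traceable if it has a Hamiltonian path (a path through all of its vertices). A graph $G$ is hypotraceable if $G$ is not traceable, but for every vertex $v$ of $G$ the graph $G - v$ is traceable. -}

module Defs where

open import Data.Bool using (Bool; true; false)
open import Data.Nat using (ℕ; zero; suc)
open import Data.Fin using (Fin; punchIn)
open import Data.List using (List; []; _∷_)
open import Data.List.Relation.Unary.Unique.Propositional using (Unique)
open import Data.List.Membership.Propositional using (_∈_)
open import Data.Product using (Σ; Σ-syntax; ∃; _×_; _,_)
open import Data.Sum using (_⊎_)
open import Data.Empty using (⊥)
open import Data.Unit using (⊤)
open import Data.Rational using (ℚ; 0ℚ; 1ℚ; _+_; _*_; _-_; _≤_)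
open import Relation.Nullary using (¬_)
open import Relation.Binary.PropositionalEquality using (_≡_)

record Graph (n : ℕ) : Set where
  field
    adj    : Fin n → Fin n → Bool
    sym    : ∀ i j → adj i j ≡ adj j i
    irrefl : ∀ i → adj i i ≡ false
open Graph public

Adj : ∀ {n} → Graph n → Fin n → Fin n → Set
Adj G i j = adj G i j ≡ true

delete : ∀ {n} → Graph (suc n) → Fin (suc n) → Graph n
delete G v = record
  { adj    = λ i j → adj G (punchIn v i) (punchIn v j)
  ; sym    = λ i j → sym G (punchIn v i) (punchIn v j)
  ; irrefl = λ i → irrefl G (punchIn v i)
  }

Walk : ∀ {n} → Graph n → List (Fin n) → Set
Walk G []           = ⊤
Walk G (x ∷ [])     = ⊤
Walk G (x ∷ y ∷ xs) = Adj G x y × Walk G (y ∷ xs)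

IsHamiltonianPath : ∀ {n} → Graph n → List (Fin n) → Set
IsHamiltonianPath G p = Walk G p × Unique p × (∀ v → v ∈ p)

Traceable : ∀ {n} → Graph n → Set
Traceable G = ∃ λ p → IsHamiltonianPath G p

-- hypotraceable: not traceable, but every vertex-deleted subgraph is.
-- (The null graph is traceable via the empty path, hence not hypotraceable.)
Hypotraceable : ∀ {n} → Graph n → Set
Hypotraceable {zero}  G = ⊥
Hypotraceable {suc n} G = ¬ Traceable G × (∀ v → Traceable (delete G v))

-- Planarity: a straight-line plane embedding with rational coordinates.

Point : Set
Point = ℚ × ℚ

OnSegment : Point → Point → Point → Set
OnSegment (px , py) (ax , ay) (bx , by) =
  Σ[ s ∈ ℚ ] (0ℚ ≤ s × s ≤ 1ℚ
             × px ≡ ax + s * (bx - ax) × py ≡ ay + s * (by - ay))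

record PlaneEmbedding {n} (G : Graph n) : Set where
  field
    pos       : Fin n → Point
    injective : ∀ u v → pos u ≡ pos v → u ≡ v
    vertexOff : ∀ a b w → Adj G a b → ¬ w ≡ a → ¬ w ≡ b →
                ¬ OnSegment (pos w) (pos a) (pos b)
    edgesMeet : ∀ a b c d → Adj G a b → Adj G c d → ∀ p →
                OnSegment p (pos a) (pos b) → OnSegment p (pos c) (pos d) →
                (a ≡ c × b ≡ d) ⊎ (a ≡ d × b ≡ c) ⊎
                (Σ[ x ∈ Fin n ] ((x ≡ a ⊎ x ≡ b) × (x ≡ c ⊎ x ≡ d) × p ≡ pos x))

Planar : ∀ {n} → Graph n → Set
Planar G = PlaneEmbedding G

module Submission where

-- Thomassen's construction.  Take four fragments, each with an apex a and two further vertices b and c, identify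
-- the apices in pairs, and join the two b's and the two c's of fragments with different apices.  A Hamiltonian
-- path would traverse some fragment without ending in it; contracting the rest of the graph then gives a
-- Hamiltonian cycle of that fragment together with one more vertex joined to a, b and c, and there is none, by an
-- exhaustive search.  After the deletion of a vertex, spanning paths of the fragments between a, b and c fit
-- together to a Hamiltonian path.
--
-- There are explicit fragments with 33, 36 and 37 vertices, drawn with integer coordinates.  The last one has a
-- quadrangular face; a smaller quadrangle drawn inside it and joined to it by four spokes replaces two opposite
-- edges of the old quadrangle, which keeps all the properties and adds four vertices.  This gives graphs with 130
-- vertices, and with every number of vertices from 154 on.


-- A fragment without an end of the path may still be swept from b to c, its apex being left to the
-- other fragment there, so a single fragment gives no contradiction. The contraction only shows
-- that such a fragment makes no use of its apex. The contradiction is global: the path has two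
-- ends, hence two of the four fragments are free of ends; whether these are joined by bridges,
-- share an apex or lie diagonally, either the path never leaves some proper set of vertices or an
-- apex lacks a neighbour. A Hamiltonian cycle is treated as a relation of used edges, two at each
-- vertex, with connectedness tested on Boolean sets. Contraction and the replacement of a
-- quadrangle then change the relation locally, and no list is cut and reassembled. Tours, which
-- have to be exhibited, are lists. The growth step inherits two properties. A cycle of the larger
-- fragment induces one of the smaller, a finite matter of the 14 edges at the two quadrangles.
-- Tours extend over the four new vertices, because each given tour uses a deleted edge and can be
-- rerouted there.

module Refute where

  open import Data.Bool using (Bool; true; false; _∧_; _∨_; not; if_then_else_)
  open import Data.Nat using (ℕ; zero; suc; _≡ᵇ_)
  open import Data.List using (List; []; _∷_; map; _++_)
  open import Data.List.Relation.Unary.All as All using ([]; _∷_)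
  open import Data.List.Relation.Unary.Any as Any using ()
  open import Data.Maybe using (Maybe; just; nothing)
  open import Data.Product using (_×_; _,_)
  open import Data.Sum using (_⊎_)
  open import Relation.Nullary using (¬_)
  open import Relation.Binary.PropositionalEquality

  -- Hamiltonian cycles as relations of used edges

  record TwoNbrs {V : Set} (m : V → V → Bool) (v : V) : Set where
    constructor twoNbrs
    field
      x y  : V
      x≢y  : ¬ x ≡ y
      mx   : m v x ≡ true
      my   : m v y ≡ true
      only : ∀ z → m v z ≡ true → z ≡ x ⊎ z ≡ y

  Closed : {V : Set} → (V → V → Bool) → (V → Bool) → Set
  Closed m Z = ∀ u v → Z u ≡ true → m u v ≡ true → Z v ≡ true

  -- A 2-factor that no set separates: by `conn`, a set that the used edges do not leave is empty or
  -- everything. The quantifier over Boolean sets stands in for walks along the cycle.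
  record Cycle {V : Set} (R : V → V → Bool) : Set where
    field
      m     : V → V → Bool
      m-sym : ∀ u v → m u v ≡ true → m v u ≡ true
      m-adj : ∀ u v → m u v ≡ true → R u v ≡ true
      nbrs  : ∀ v → TwoNbrs m v
      conn  : ∀ Z → Closed m Z → ∀ u v → Z u ≡ true → Z v ≡ true

  -- Exhaustive search for a Hamiltonian cycle

  data Status : Set where
    unknown used unused clash : Status

  -- The table is an adjacency list in which each candidate edge carries its status at both of its
  -- ends; the fact `(u , v , b)` decides the edge uv.
  Entry Row Table Fact : Set
  Entry = ℕ × Status
  Row   = ℕ × List Entry
  Table = List Row
  Fact  = ℕ × ℕ × Bool

  merge : Bool → Status → Status
  merge true  unknown   = used
  merge true  used   = used
  merge true  unused    = clash
  merge true  clash = clash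
  merge false unknown   = unused
  merge false used   = clash
  merge false unused    = unused
  merge false clash = clash

  updateEntries : ℕ → Bool → List Entry → List Entry
  updateEntries v b []             = []
  updateEntries v b ((w , s) ∷ es) =
    if v ≡ᵇ w then (w , merge b s) ∷ es else (w , s) ∷ updateEntries v b es

  updateRow : ℕ → ℕ → Bool → Table → Table
  updateRow u v b []             = []
  updateRow u v b ((k , es) ∷ t) =
    if u ≡ᵇ k then (k , updateEntries v b es) ∷ t else (k , es) ∷ updateRow u v b t

  assert : Fact → Table → Table
  assert (u , v , b) t = updateRow u v b (updateRow v u b t)

  assertAll : List Fact → Table → Table
  assertAll []       t = t
  assertAll (f ∷ fs) t = assertAll fs (assert f t)

  possible : List Entry → List ℕ
  possible []               = []
  possible ((w , unused) ∷ es)  = possible es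
  possible ((w , _) ∷ es)   = w ∷ possible es

  unknowns : List Entry → List ℕ
  unknowns []               = []
  unknowns ((w , unknown) ∷ es) = w ∷ unknowns es
  unknowns ((w , _) ∷ es)   = unknowns es

  chosen : List Entry → List ℕ
  chosen []               = []
  chosen ((w , used) ∷ es) = w ∷ chosen es
  chosen ((w , _) ∷ es)   = chosen es

  clashing : List Entry → Bool
  clashing []                 = false
  clashing ((w , clash) ∷ es) = true
  clashing ((w , _) ∷ es)     = clashing es

  exclude : ℕ → ℕ → ℕ → List ℕ → List Fact
  exclude u a b []       = []
  exclude u a b (w ∷ ws) =
    if (a ≡ᵇ w) ∨ (b ≡ᵇ w) then exclude u a b ws else (u , w , false) ∷ exclude u a b ws

  fromChosen : ℕ → List ℕ → List ℕ → List Fact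
  fromChosen u (a ∷ b ∷ _) ws = if a ≡ᵇ b then [] else exclude u a b ws
  fromChosen u _           ws = []

  -- The degree rule: fewer than two edges left at u is a contradiction, exactly two are both used,
  -- and two used ones exclude the others. A third used edge turns into `clash` by its own exclusion
  -- and is detected in the next round.
  fromPossible : ℕ → List Entry → List ℕ → Maybe (List Fact)
  fromPossible u es []           = nothing
  fromPossible u es (a ∷ [])     = nothing
  fromPossible u es (a ∷ b ∷ []) = just (map (λ w → u , w , true) (unknowns es))
  fromPossible u es ws           = just (fromChosen u (chosen es) ws)

  rowFacts : Row → Maybe (List Fact)
  rowFacts (u , es) = if clashing es then nothing else fromPossible u es (possible es)

  append : Maybe (List Fact) → Maybe (List Fact) → Maybe (List Fact)
  append (just fs) (just gs) = just (fs ++ gs)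
  append _         _         = nothing

  facts : Table → Maybe (List Fact)
  facts []      = just []
  facts (r ∷ t) = append (rowFacts r) (facts t)

  propagate : ℕ → Table → Maybe Table
  propagate′ : ℕ → Table → Maybe (List Fact) → Maybe Table
  -- Without fuel the table is returned as it stands, which is sound since it holds only
  -- consequences.
  propagate zero    t = just t
  propagate (suc n) t = propagate′ n t (facts t)
  propagate′ n t nothing         = nothing
  propagate′ n t (just [])       = just t
  propagate′ n t (just (f ∷ fs)) = propagate n (assertAll (f ∷ fs) t)

  entries : ℕ → Table → List Entry
  entries u []             = []
  entries u ((k , es) ∷ t) = if u ≡ᵇ k then es else entries u t

  elemᵇ : ℕ → List ℕ → Bool
  elemᵇ u []       = false
  elemᵇ u (w ∷ ws) = (u ≡ᵇ w) ∨ elemᵇ u ws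

  other : ℕ → List ℕ → Maybe ℕ
  other p []       = nothing
  other p (w ∷ ws) = if p ≡ᵇ w then other p ws else just w

  -- The path of chosen edges that enters c from p, listed backwards in front of acc.
  follow : ℕ → Table → ℕ → ℕ → List ℕ → List ℕ
  follow′ : ℕ → Table → ℕ → List ℕ → Maybe ℕ → List ℕ
  follow zero    t p c acc = c ∷ acc
  follow (suc n) t p c acc = follow′ n t c (c ∷ acc) (other p (chosen (entries c t)))
  follow′ n t c acc nothing  = acc
  follow′ n t c acc (just d) = if elemᵇ d acc then acc else follow n t c d acc

  -- A vertex with a single used edge is an end of a maximal path of used edges. The fuel 50 exceeds
  -- the number of vertices of each table searched below.
  pathFrom : Table → ℕ → List ℕ → List ℕ
  pathFrom t u (w ∷ []) = follow 50 t u w (u ∷ [])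
  pathFrom t u _        = []

  linked : Table → List ℕ → Bool
  linked t (u ∷ v ∷ ws) = elemᵇ v (chosen (entries u t)) ∧ elemᵇ u (chosen (entries v t)) ∧ linked t (v ∷ ws)
  linked t _            = true

  uniqueᵇ : List ℕ → Bool
  uniqueᵇ []       = true
  uniqueᵇ (u ∷ us) = not (elemᵇ u us) ∧ uniqueᵇ us

  misses : Table → List ℕ → Bool
  misses []            ws = false
  misses ((k , _) ∷ t) ws = not (elemᵇ k ws) ∨ misses t ws

  lastOf : ℕ → List ℕ → ℕ
  lastOf a []       = a
  lastOf a (b ∷ bs) = lastOf b bs

  -- The used edges contain a path that misses some vertex; joining its ends would close a cycle
  -- that is too short. The first test sees that the closing edge is not excluded already, so that
  -- excluding it makes progress.
  closable : Table → List ℕ → Bool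
  closable t (a ∷ b ∷ c ∷ ws) =
    elemᵇ (lastOf c ws) (possible (entries a t))
    ∧ linked t (a ∷ b ∷ c ∷ ws) ∧ uniqueᵇ (a ∷ b ∷ c ∷ ws) ∧ misses t (a ∷ b ∷ c ∷ ws)
  closable t _ = false

  firstClosable : Table → Table → Maybe (List ℕ)
  firstClosable t []             = nothing
  firstClosable t ((u , es) ∷ r) =
    let p = pathFrom t u (chosen es) in
    if closable t p then just p else firstClosable t r

  pick : Table → Maybe (ℕ × ℕ)
  pickEntry : ℕ → List ℕ → Table → Maybe (ℕ × ℕ)
  pick []             = nothing
  pick ((u , es) ∷ t) = pickEntry u (unknowns es) t
  pickEntry u []      t = pick t
  pickEntry u (w ∷ _) t = just (u , w)

  -- Once every edge is decided and propagation has finished, the used edges form disjoint cycles,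
  -- and this lists the one through the first vertex. If it misses a vertex, the exclusion of its
  -- closing edge, which is used, produces a clash.
  wholeCycle : Table → List ℕ
  wholeCycle []             = []
  wholeCycle ((u , es) ∷ t) with chosen es
  ... | w ∷ _ = follow 50 ((u , es) ∷ t) u w (u ∷ [])
  ... | []    = []

  -- The value `true` certifies that no Hamiltonian cycle fits the table; the fuel bounds the depth
  -- of the search, and its exhaustion gives `false`.
  refute      : ℕ → Table → Bool
  refuteProp  : ℕ → Maybe Table → Bool
  refuteClose : ℕ → Table → Maybe (List ℕ) → Bool
  refutePick  : ℕ → Table → Maybe (ℕ × ℕ) → Bool
  closing     : List ℕ → Table → Table
  refute zero    t = false
  refute (suc n) t = refuteProp n (propagate 50 t)
  refuteProp n nothing  = true
  refuteProp n (just t) = refuteClose n t (firstClosable t t)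
  refuteClose n t (just p) = refute n (closing p t)
  refuteClose n t nothing  = refutePick n t (pick t)
  refutePick n t (just (u , v)) = refute n (assert (u , v , true) t) ∧ refute n (assert (u , v , false) t)
  refutePick n t nothing        =
    closable t (wholeCycle t) ∧ refute n (closing (wholeCycle t) t)
  closing []       t = t
  closing (a ∷ ws) t = assert (a , lastOf a ws , false) t

-- Soundness of the search

module Sound where

  open Refute
  open import Data.Bool using (Bool; true; false; _∧_; _∨_; not; T)
  open import Data.Nat using (ℕ; zero; suc; _≡ᵇ_)
  open import Data.Nat.Properties using (≡ᵇ⇒≡; ≡⇒≡ᵇ)
  open import Data.List using (List; []; _∷_)
  open import Data.List.Relation.Unary.All as All using (All; []; _∷_)
  open import Data.List.Relation.Unary.All.Properties using (++⁺; map⁺)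
  open import Data.List.Relation.Unary.Any using (here; there)
  open import Data.List.Membership.Propositional using (_∈_)
  open import Data.Maybe using (just; nothing)
  open import Data.Product using (∃; _×_; _,_; proj₁; proj₂)
  open import Data.Sum using (_⊎_; inj₁; inj₂; [_,_]′)
  open import Data.Empty using (⊥; ⊥-elim)
  open import Data.Unit using (⊤; tt)
  open import Relation.Nullary using (¬_)
  open import Relation.Binary.PropositionalEquality

  ∧⁻ : ∀ {a b} → a ∧ b ≡ true → a ≡ true × b ≡ true
  ∧⁻ {true} {true} _ = refl , refl

  ∨⁻ : ∀ {a b} → a ∨ b ≡ true → a ≡ true ⊎ b ≡ true
  ∨⁻ {true}  _ = inj₁ refl
  ∨⁻ {false} p = inj₂ p

  not⁻ : ∀ {a} → not a ≡ true → a ≡ false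
  not⁻ {false} _ = refl

  bool-ext : ∀ {a b} → (a ≡ true → b ≡ true) → (b ≡ true → a ≡ true) → a ≡ b
  bool-ext {true}  f g = sym (f refl)
  bool-ext {false} {true}  f g = g refl
  bool-ext {false} {false} f g = refl

  true≢false : ∀ {a} → a ≡ true → a ≡ false → ⊥
  true≢false refl ()

  ≢true⇒false : ∀ {a} → ¬ a ≡ true → a ≡ false
  ≢true⇒false {true}  p = ⊥-elim (p refl)
  ≢true⇒false {false} p = refl

  ≡ᵇ⁻ : ∀ {u v} → (u ≡ᵇ v) ≡ true → u ≡ v
  ≡ᵇ⁻ {u} {v} p = ≡ᵇ⇒≡ u v (subst T (sym p) tt)

  ≡ᵇ⁺ : ∀ {u v} → u ≡ v → (u ≡ᵇ v) ≡ true
  ≡ᵇ⁺ {u} {v} p with u ≡ᵇ v | ≡⇒≡ᵇ u v p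
  ... | true | _ = refl

  elemᵇ⁻ : ∀ {u} us → elemᵇ u us ≡ true → u ∈ us
  elemᵇ⁻ (w ∷ ws) p with ∨⁻ p
  ... | inj₁ q = here (≡ᵇ⁻ q)
  ... | inj₂ q = there (elemᵇ⁻ ws q)

  ∨⁺ʳ : ∀ a {b} → b ≡ true → a ∨ b ≡ true
  ∨⁺ʳ true  _ = refl
  ∨⁺ʳ false p = p

  elemᵇ⁺ : ∀ {u us} → u ∈ us → elemᵇ u us ≡ true
  elemᵇ⁺ {u} (here p)          rewrite ≡ᵇ⁺ p = refl
  elemᵇ⁺ {u} {w ∷ _} (there p) = ∨⁺ʳ (u ≡ᵇ w) (elemᵇ⁺ p)

  elemᵇ-∉ : ∀ {u us} → elemᵇ u us ≡ false → ¬ u ∈ us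
  elemᵇ-∉ p q = true≢false (elemᵇ⁺ q) p

  module Soundness {V : Set} {R : V → V → Bool} (H : Cycle R)
    (code : V → ℕ) (dec : ℕ → V) (dec-code : ∀ v → dec (code v) ≡ v) where

    open Cycle H

    -- `dec` is total, so that numbers outside the range of `code` decode as well; only the valid
    -- ones name a vertex faithfully.
    Valid : ℕ → Set
    Valid w = code (dec w) ≡ w

    dec-inj : ∀ {u w} → Valid u → Valid w → dec u ≡ dec w → u ≡ w
    dec-inj p q e = trans (sym p) (trans (cong code e) q)

    E : ℕ → ℕ → Set
    E u w = m (dec u) (dec w) ≡ true

    E-sym : ∀ {u w} → E u w → E w u
    E-sym = m-sym _ _

    Holds : ℕ → ℕ → Status → Set
    Holds u w unknown   = ⊤
    Holds u w used   = E u w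
    Holds u w unused    = m (dec u) (dec w) ≡ false
    Holds u w clash = ⊥

    EntryOK : ℕ → Entry → Set
    EntryOK u (w , s) = Valid w × Holds u w s

    -- The last component says that the row lists every cycle edge at u. The degree rule counts the
    -- candidates in the row and rests on this.
    RowOK : Row → Set
    RowOK (u , es) = Valid u × All (EntryOK u) es × (∀ z → m (dec u) z ≡ true → ∃ λ s → (code z , s) ∈ es)

    Sat : Table → Set
    Sat = All RowOK

    FactOK : Fact → Set
    FactOK (u , v , b) = m (dec u) (dec v) ≡ b

    merge-ok : ∀ {u w} b s → m (dec u) (dec w) ≡ b → Holds u w s → Holds u w (merge b s)
    merge-ok true  unknown p h = p
    merge-ok true  used p h = h
    merge-ok true  unused  p h = true≢false p h
    merge-ok false unknown p h = p
    merge-ok false used p h = true≢false h p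
    merge-ok false unused  p h = h

    updateEntries-ok : ∀ {u} v b es → m (dec u) (dec v) ≡ b → All (EntryOK u) es → All (EntryOK u) (updateEntries v b es)
    updateEntries-ok v b []             p []       = []
    updateEntries-ok v b ((w , s) ∷ es) p ((c , h) ∷ hs) with v ≡ᵇ w in eq
    ... | false = (c , h) ∷ updateEntries-ok v b es p hs
    ... | true with refl ← ≡ᵇ⁻ {v} {w} eq = (c , merge-ok b s p h) ∷ hs

    updateEntries-key : ∀ v b es {w s} → (w , s) ∈ es → ∃ λ s′ → (w , s′) ∈ updateEntries v b es
    updateEntries-key v b ((k , s) ∷ es) q with v ≡ᵇ k
    updateEntries-key v b ((k , s) ∷ es) (here refl) | true  = _ , here refl
    updateEntries-key v b ((k , s) ∷ es) (there q)   | true  = _ , there q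
    updateEntries-key v b ((k , s) ∷ es) (here refl) | false = _ , here refl
    updateEntries-key v b ((k , s) ∷ es) (there q)   | false =
      let s′ , i = updateEntries-key v b es q in s′ , there i

    updateRow-ok : ∀ u v b t → m (dec u) (dec v) ≡ b → Sat t → Sat (updateRow u v b t)
    updateRow-ok u v b []             p []       = []
    updateRow-ok u v b ((k , es) ∷ t) p ((c , h , cov) ∷ hs) with u ≡ᵇ k in eq
    ... | false = (c , h , cov) ∷ updateRow-ok u v b t p hs
    ... | true with refl ← ≡ᵇ⁻ {u} {k} eq =
      (c , updateEntries-ok v b es p h , λ z e → updateEntries-key v b es (proj₂ (cov z e))) ∷ hs

    assert-ok : ∀ f t → FactOK f → Sat t → Sat (assert f t)
    assert-ok (u , v , b) t p h = updateRow-ok u v b _ p (updateRow-ok v u b t (trans (bool-ext (m-sym _ _) (m-sym _ _)) p) h)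

    assertAll-ok : ∀ fs t → All FactOK fs → Sat t → Sat (assertAll fs t)
    assertAll-ok []       t []       h = h
    assertAll-ok (f ∷ fs) t (p ∷ ps) h = assertAll-ok fs _ ps (assert-ok f t p h)

    possible-complete : ∀ {u} es {w s} → E u w → All (EntryOK u) es → (w , s) ∈ es → w ∈ possible es
    possible-complete ((w , unknown)   ∷ es) e (h ∷ hs) (here refl) = here refl
    possible-complete ((w , used)   ∷ es) e (h ∷ hs) (here refl) = here refl
    possible-complete ((w , unused)    ∷ es) e (h ∷ hs) (here refl) = ⊥-elim (true≢false e (proj₂ h))
    possible-complete ((w , unknown)   ∷ es) e (h ∷ hs) (there q)   = there (possible-complete es e hs q)
    possible-complete ((w , used)   ∷ es) e (h ∷ hs) (there q)   = there (possible-complete es e hs q)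
    possible-complete ((w , unused)    ∷ es) e (h ∷ hs) (there q)   = possible-complete es e hs q
    possible-complete ((w , clash) ∷ es) e (h ∷ hs) q           = ⊥-elim (proj₂ h)

    possible-valid : ∀ {u} es → All (EntryOK u) es → All Valid (possible es)
    possible-valid []                 []       = []
    possible-valid ((w , unknown)   ∷ es) (h ∷ hs) = proj₁ h ∷ possible-valid es hs
    possible-valid ((w , used)   ∷ es) (h ∷ hs) = proj₁ h ∷ possible-valid es hs
    possible-valid ((w , unused)    ∷ es) (h ∷ hs) = possible-valid es hs
    possible-valid ((w , clash) ∷ es) (h ∷ hs) = proj₁ h ∷ possible-valid es hs

    unknowns⊆possible : ∀ es {w} → w ∈ unknowns es → w ∈ possible es
    unknowns⊆possible ((w , unknown)   ∷ es) (here refl) = here refl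
    unknowns⊆possible ((w , unknown)   ∷ es) (there q)   = there (unknowns⊆possible es q)
    unknowns⊆possible ((w , used)   ∷ es) q           = there (unknowns⊆possible es q)
    unknowns⊆possible ((w , unused)    ∷ es) q           = unknowns⊆possible es q
    unknowns⊆possible ((w , clash) ∷ es) q           = there (unknowns⊆possible es q)

    chosen-ok : ∀ {u} es → All (EntryOK u) es → All (λ w → Valid w × E u w) (chosen es)
    chosen-ok []                 []       = []
    chosen-ok ((w , unknown)   ∷ es) (h ∷ hs) = chosen-ok es hs
    chosen-ok ((w , used)   ∷ es) (h ∷ hs) = h ∷ chosen-ok es hs
    chosen-ok ((w , unused)    ∷ es) (h ∷ hs) = chosen-ok es hs
    chosen-ok ((w , clash) ∷ es) (h ∷ hs) = chosen-ok es hs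

    clashing-ok : ∀ {u} es → All (EntryOK u) es → clashing es ≡ true → ⊥
    clashing-ok ((w , unknown)   ∷ es) (h ∷ hs) p = clashing-ok es hs p
    clashing-ok ((w , used)   ∷ es) (h ∷ hs) p = clashing-ok es hs p
    clashing-ok ((w , unused)    ∷ es) (h ∷ hs) p = clashing-ok es hs p
    clashing-ok ((w , clash) ∷ es) (h ∷ hs) p = proj₂ h

    -- Two distinct neighbours exhaust the pair recorded by `nbrs`, in one order or the other.
    two-only : ∀ {v a b} → ¬ a ≡ b → m v a ≡ true → m v b ≡ true → ∀ z → m v z ≡ true → z ≡ a ⊎ z ≡ b
    two-only {v} a≢b ma mb z mz with nbrs v
    ... | twoNbrs x y _ _ _ only with only _ ma | only _ mb | only z mz
    ...   | inj₁ refl | inj₁ refl | _         = ⊥-elim (a≢b refl)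
    ...   | inj₂ refl | inj₂ refl | _         = ⊥-elim (a≢b refl)
    ...   | inj₁ refl | inj₂ refl | inj₁ refl = inj₁ refl
    ...   | inj₁ refl | inj₂ refl | inj₂ refl = inj₂ refl
    ...   | inj₂ refl | inj₁ refl | inj₁ refl = inj₂ refl
    ...   | inj₂ refl | inj₁ refl | inj₂ refl = inj₁ refl

    candidates : ∀ {u es} → RowOK (u , es) → ∀ z → m (dec u) z ≡ true → code z ∈ possible es
    candidates {u} {es} (_ , h , cov) z e =
      possible-complete es (subst (λ v → m (dec u) v ≡ true) (sym (dec-code z)) e) h (proj₂ (cov z e))

    exclude-ok : ∀ {u a b} ws → All Valid ws → (∀ w → Valid w → E u w → w ≡ a ⊎ w ≡ b) → All FactOK (exclude u a b ws)
    exclude-ok []                     _        f = []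
    exclude-ok {u} {a} {b} (w ∷ ws) (c ∷ cs) f with (a ≡ᵇ w) ∨ (b ≡ᵇ w) in eq
    ... | true  = exclude-ok ws cs f
    ... | false = ≢true⇒false (λ e → [ (λ { refl → true≢false (≡ᵇ⁺ {a} refl) (fst eq) })
                                     , (λ { refl → true≢false (≡ᵇ⁺ {b} refl) (snd eq) }) ]′ (f w c e))
                  ∷ exclude-ok ws cs f
      where
      fst : ∀ {x y} → x ∨ y ≡ false → x ≡ false
      fst {false} _ = refl
      snd : ∀ {x y} → x ∨ y ≡ false → y ≡ false
      snd {false} p = p

    fromChosen-ok : ∀ {u} cs ws → All (λ w → Valid w × E u w) cs → All Valid ws → All FactOK (fromChosen u cs ws)
    fromChosen-ok []       ws _ _ = []
    fromChosen-ok (_ ∷ []) ws _ _ = []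
    fromChosen-ok {u} (a ∷ b ∷ cs) ws ((va , ea) ∷ (vb , eb) ∷ _) vs with a ≡ᵇ b in eq
    ... | true  = []
    ... | false = exclude-ok ws vs λ w vw ew →
      [ (λ e → inj₁ (dec-inj vw va e)) , (λ e → inj₂ (dec-inj vw vb e)) ]′
        (two-only (λ e → true≢false (≡ᵇ⁺ (dec-inj va vb e)) eq) ea eb _ ew)

    code≢ : ∀ {x y} → ¬ x ≡ y → ¬ code x ≡ code y
    code≢ p e = p (trans (sym (dec-code _)) (trans (cong dec e) (dec-code _)))

    fromPossible-ok : ∀ {u es} ws {fs} → ws ≡ possible es → RowOK (u , es) →
                      fromPossible u es ws ≡ just fs → All FactOK fs
    fromPossible-ok {u} {es} (a ∷ b ∷ []) eq r refl = map⁺ (All.tabulate λ q → true-at (subst (_ ∈_) (sym eq) (unknowns⊆possible es q)))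
      where
      open TwoNbrs (nbrs (dec u))
      -- Both cycle neighbours of u are among a and b, and being distinct they take up both places.
      true-at : ∀ {w} → w ∈ (a ∷ b ∷ []) → E u w
      true-at q with subst (code x ∈_) (sym eq) (candidates r x mx) | subst (code y ∈_) (sym eq) (candidates r y my)
      true-at q | here p  | here p′ = ⊥-elim (code≢ x≢y (trans p (sym p′)))
      true-at q | there (here p) | there (here p′) = ⊥-elim (code≢ x≢y (trans p (sym p′)))
      true-at (here refl)         | here p         | there (here p′) = subst (λ v → m (dec u) v ≡ true) (trans (sym (dec-code x)) (cong dec p)) mx
      true-at (there (here refl)) | here p         | there (here p′) = subst (λ v → m (dec u) v ≡ true) (trans (sym (dec-code y)) (cong dec p′)) my
      true-at (here refl)         | there (here p) | here p′ = subst (λ v → m (dec u) v ≡ true) (trans (sym (dec-code y)) (cong dec p′)) my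
      true-at (there (here refl)) | there (here p) | here p′ = subst (λ v → m (dec u) v ≡ true) (trans (sym (dec-code x)) (cong dec p)) mx
    fromPossible-ok {u} {es} (a ∷ b ∷ c ∷ ws) eq (_ , h , _) refl =
      fromChosen-ok (chosen es) (a ∷ b ∷ c ∷ ws) (chosen-ok es h) (subst (All Valid) (sym eq) (possible-valid es h))

    fromPossible-⊥ : ∀ {u es} ws → ws ≡ possible es → RowOK (u , es) → fromPossible u es ws ≡ nothing → ⊥
    fromPossible-⊥ {u} []       eq r _ with subst (_ ∈_) (sym eq) (candidates r _ (TwoNbrs.mx (nbrs (dec u))))
    ... | ()
    fromPossible-⊥ {u} (a ∷ []) eq r _ with subst (code x ∈_) (sym eq) (candidates r x mx) | subst (code y ∈_) (sym eq) (candidates r y my)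
      where open TwoNbrs (nbrs (dec u))
    ... | here p | here p′ = code≢ (TwoNbrs.x≢y (nbrs (dec u))) (trans p (sym p′))
    fromPossible-⊥ (a ∷ b ∷ [])     eq r ()
    fromPossible-⊥ (a ∷ b ∷ c ∷ ws) eq r ()

    rowFacts-ok : ∀ r {fs} → RowOK r → rowFacts r ≡ just fs → All FactOK fs
    rowFacts-ok (u , es) h p with clashing es
    ... | false = fromPossible-ok (possible es) refl h p

    rowFacts-⊥ : ∀ r → RowOK r → rowFacts r ≡ nothing → ⊥
    rowFacts-⊥ (u , es) h p with clashing es in eq
    ... | false = fromPossible-⊥ (possible es) refl h p
    ... | true  = clashing-ok es (proj₁ (proj₂ h)) eq

    facts-ok : ∀ t {fs} → Sat t → facts t ≡ just fs → All FactOK fs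
    facts-ok []      []       refl = []
    facts-ok (r ∷ t) (h ∷ hs) p with rowFacts r in eq | facts t in eq′ | p
    ... | just _ | just _ | refl = ++⁺ (rowFacts-ok r h eq) (facts-ok t hs eq′)

    facts-⊥ : ∀ t → Sat t → facts t ≡ nothing → ⊥
    facts-⊥ (r ∷ t) (h ∷ hs) p with rowFacts r in eq | facts t in eq′ | p
    ... | nothing | _       | _ = rowFacts-⊥ r h eq
    ... | just _  | nothing | _ = facts-⊥ t hs eq′

    propagate-ok : ∀ n t {t′} → Sat t → propagate n t ≡ just t′ → Sat t′
    propagate-ok zero    t h refl = h
    propagate-ok (suc n) t h p with facts t in eq | p
    ... | just []       | refl = h
    ... | just (f ∷ fs) | q    = propagate-ok n _ (assertAll-ok (f ∷ fs) t (facts-ok t h eq) h) q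

    propagate-⊥ : ∀ n t → Sat t → propagate n t ≡ nothing → ⊥
    propagate-⊥ (suc n) t h p with facts t in eq | p
    ... | nothing       | _ = facts-⊥ t h eq
    ... | just (f ∷ fs) | q = propagate-⊥ n _ (assertAll-ok (f ∷ fs) t (facts-ok t h eq) h) q

    entries-ok : ∀ u t → Sat t → All (EntryOK u) (entries u t)
    entries-ok u []             []       = []
    entries-ok u ((k , es) ∷ t) (h ∷ hs) with u ≡ᵇ k in eq
    ... | true with refl ← ≡ᵇ⁻ {u} {k} eq = proj₁ (proj₂ h)
    ... | false = entries-ok u t hs

    misses-ok : ∀ t ws → Sat t → misses t ws ≡ true → ∃ λ k → Valid k × ¬ k ∈ ws
    misses-ok ((k , es) ∷ t) ws (h ∷ hs) p with ∨⁻ p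
    ... | inj₁ q = k , proj₁ h , elemᵇ-∉ (not⁻ q)
    ... | inj₂ q = misses-ok t ws hs q

    Linked : List ℕ → Set
    Linked (u ∷ v ∷ ws) = Valid u × Valid v × E u v × Linked (v ∷ ws)
    Linked _            = ⊤

    linked-ok : ∀ t ws → Sat t → linked t ws ≡ true → Linked ws
    linked-ok t []           h p = tt
    linked-ok t (u ∷ [])     h p = tt
    linked-ok t (u ∷ v ∷ ws) h p =
      let p₁ , p₂₃ = ∧⁻ p; p₂ , p₃ = ∧⁻ p₂₃
          vv , e = All.lookup (chosen-ok _ (entries-ok u t h)) (elemᵇ⁻ _ p₁)
          vu , _ = All.lookup (chosen-ok _ (entries-ok v t h)) (elemᵇ⁻ _ p₂)
      in vu , vv , e , linked-ok t (v ∷ ws) h p₃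

    lastOf∈ : ∀ a ws → lastOf a ws ∈ (a ∷ ws)
    lastOf∈ a []       = here refl
    lastOf∈ a (b ∷ ws) = there (lastOf∈ b ws)

    module Closing (p : List ℕ) where

      TwoIn : ℕ → Set
      TwoIn x = ∃ λ y → ∃ λ z → y ∈ p × z ∈ p × Valid y × Valid z × ¬ y ≡ z × E x y × E x z

      -- q precedes x on the cycle, a is its first vertex.
      inner : ∀ a q x ws → Valid a → Valid q → Linked (x ∷ ws) → E x q → E (lastOf x ws) a → ¬ q ≡ a →
              uniqueᵇ (x ∷ ws) ≡ true → ¬ q ∈ (x ∷ ws) → ¬ a ∈ (x ∷ ws) →
              a ∈ p → q ∈ p → (∀ {w} → w ∈ (x ∷ ws) → w ∈ p) → All TwoIn (x ∷ ws)
      inner a q x []       va vq l e c q≢a u q∉ a∉ ap qp f =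
        (q , a , qp , ap , vq , va , q≢a , e , c) ∷ []
      inner a q x (y ∷ ws) va vq (vx , vy , xy , l) e c q≢a u q∉ a∉ ap qp f =
        (q , y , qp , f (there (here refl)) , vq , vy , (λ { refl → q∉ (there (here refl)) }) , e , xy)
        ∷ inner a x y ws va vx l (E-sym xy) c (λ { refl → a∉ (here refl) }) (proj₂ (∧⁻ {not (elemᵇ x (y ∷ ws))} u))
            (elemᵇ-∉ (not⁻ (proj₁ (∧⁻ u)))) (λ i → a∉ (there i)) ap (f (here refl)) (λ i → f (there i))

    -- Were the closing edge used, every vertex of the path would have both of its cycle neighbours
    -- on the path. The path would then be a closed set and by `conn` contain the vertex that it
    -- misses.
    closable-ok : ∀ t p → Sat t → closable t p ≡ true → Sat (closing p t)
    closable-ok t (a ∷ b ∷ c ∷ ws) h q = assert-ok _ t (≢true⇒false no-close) h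
      where
      p = a ∷ b ∷ c ∷ ws
      q₂ = proj₂ (∧⁻ {elemᵇ (lastOf c ws) (possible (entries a t))} q)
      lk = linked-ok t p h (proj₁ (∧⁻ {linked t p} q₂))
      q₃ = proj₂ (∧⁻ {linked t p} q₂)
      un = proj₁ (∧⁻ {uniqueᵇ p} q₃)
      ms = misses-ok t p h (proj₂ (∧⁻ {uniqueᵇ p} q₃))
      un′ = proj₂ (∧⁻ {not (elemᵇ a (b ∷ c ∷ ws))} un)
      a∉ : ¬ a ∈ (b ∷ c ∷ ws)
      a∉ = elemᵇ-∉ (not⁻ (proj₁ (∧⁻ un)))
      b∉ : ¬ b ∈ (c ∷ ws)
      b∉ = elemᵇ-∉ (not⁻ (proj₁ (∧⁻ un′)))
      va = proj₁ lk
      vb = proj₁ (proj₂ lk)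
      ab = proj₁ (proj₂ (proj₂ lk))
      lk′ = proj₂ (proj₂ (proj₂ lk))
      vc = proj₁ (proj₂ lk′)
      bc = proj₁ (proj₂ (proj₂ lk′))
      lk″ = proj₂ (proj₂ (proj₂ lk′))
      last-valid : ∀ x ys → Valid x → Linked (x ∷ ys) → Valid (lastOf x ys)
      last-valid x []       v l = v
      last-valid x (y ∷ ys) v l = last-valid y ys (proj₁ (proj₂ l)) (proj₂ (proj₂ (proj₂ l)))
      no-close : ¬ m (dec a) (dec (lastOf c ws)) ≡ true
      no-close cl = proj₂ (proj₂ ms) (subst (_∈ p) (proj₁ (proj₂ ms)) (elemᵇ⁻ p
          (conn Z Z-closed (dec a) (dec (proj₁ ms)) (elemᵇ⁺ (subst (_∈ p) (sym va) (here refl))))))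
        where
        open Closing p
        all-two : All TwoIn p
        all-two =
          (b , lastOf c ws , there (here refl) , there (there (lastOf∈ c ws)) , vb , last-valid c ws vc lk″
            , (λ e → b∉ (subst (_∈ (c ∷ ws)) (sym e) (lastOf∈ c ws))) , ab , cl)
          ∷ (a , c , here refl , there (there (here refl)) , va , vc , (λ { refl → a∉ (there (here refl)) }) , E-sym ab , bc)
          ∷ inner a b c ws va vb lk″ (E-sym bc) (E-sym cl) (λ { refl → a∉ (here refl) }) (proj₂ (∧⁻ {not (elemᵇ b (c ∷ ws))} un′)) b∉ (λ i → a∉ (there i))
              (here refl) (there (here refl)) (λ i → there (there i))
        Z : V → Bool
        Z v = elemᵇ (code v) p
        Z-closed : Closed m Z
        Z-closed u v zu uv with All.lookup all-two (elemᵇ⁻ p zu)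
        ... | y , z , yp , zp , vy , vz , y≢z , ey , ez
          with two-only (λ e → y≢z (dec-inj vy vz e)) ey ez v (subst (λ x → m x v ≡ true) (sym (dec-code u)) uv)
        ...   | inj₁ refl = elemᵇ⁺ (subst (_∈ p) (sym vy) yp)
        ...   | inj₂ refl = elemᵇ⁺ (subst (_∈ p) (sym vz) zp)

    firstClosable-ok : ∀ t r {p} → firstClosable t r ≡ just p → closable t p ≡ true
    firstClosable-ok t ((u , es) ∷ r) q with closable t (pathFrom t u (chosen es)) in eq | q
    ... | true  | refl = eq
    ... | false | q′   = firstClosable-ok t r q′

    -- At each split a cycle satisfies the table of one branch, the one that agrees with its own
    -- status of the picked edge; so it would survive to a leaf, and every leaf is contradictory.
    refute-sound : ∀ n t → refute n t ≡ true → Sat t → ⊥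
    refute-sound (suc n) t p h with propagate 50 t in eq
    ... | nothing = propagate-⊥ 50 t h eq
    ... | just t₁ with propagate-ok 50 t h eq | firstClosable t₁ t₁ in eq₁
    ...   | h₁ | just q = refute-sound n _ p (closable-ok t₁ q h₁ (firstClosable-ok t₁ t₁ eq₁))
    ...   | h₁ | nothing with pick t₁
    ...     | nothing = let c , r = ∧⁻ {closable t₁ (wholeCycle t₁)} p in refute-sound n _ r (closable-ok t₁ (wholeCycle t₁) h₁ c)
    ...     | just (u , v) with m (dec u) (dec v) in e | ∧⁻ {refute n (assert (u , v , true) t₁)} p
    ...       | true  | r , _ = refute-sound n _ r (assert-ok (u , v , true) t₁ e h₁)
    ...       | false | _ , r = refute-sound n _ r (assert-ok (u , v , false) t₁ e h₁)

-- Closing a Hamiltonian path by an extra vertex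

module PathCycle where

  open Refute
  open Sound
  open import Data.Bool using (Bool; true; false; _∨_)
  open import Data.List using (List; []; _∷_; head)
  open import Data.List.Relation.Unary.All as All using (All; []; _∷_)
  open import Data.List.Relation.Unary.AllPairs using ([]; _∷_)
  open import Data.List.Relation.Unary.Any using (here; there)
  open import Data.List.Membership.Propositional using (_∈_)
  open import Data.List.Relation.Unary.Unique.Propositional using (Unique)
  open import Data.Maybe using (Maybe; just; nothing)
  open import Data.Maybe.Properties using (just-injective; ≡-dec)
  open import Data.Product using (_×_; _,_; proj₁; proj₂)
  open import Data.Sum using (_⊎_; inj₁; inj₂; [_,_]′)
  open import Data.Empty using (⊥; ⊥-elim)
  open import Data.Unit using (⊤)
  open import Relation.Nullary using (¬_; yes; no; ⌊_⌋; Dec)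
  open import Relation.Binary.Definitions using (DecidableEquality)
  open import Relation.Binary.PropositionalEquality

  Chain : {V : Set} → (V → V → Bool) → List V → Set
  Chain R []           = ⊤
  Chain R (x ∷ [])     = ⊤
  Chain R (x ∷ y ∷ xs) = R x y ≡ true × Chain R (y ∷ xs)

  isYes⁻ : ∀ {P : Set} (d : Dec P) → ⌊ d ⌋ ≡ true → P
  isYes⁻ (yes p) _ = p

  isYes⁺ : ∀ {P : Set} (d : Dec P) → P → ⌊ d ⌋ ≡ true
  isYes⁺ (yes _) _ = refl
  isYes⁺ (no ¬p) p = ⊥-elim (¬p p)

  module PathCycle {V : Set} (_≟_ : DecidableEquality V) where

    -- For a vertex of the path, `nothing` marks the end of the path. The same `nothing` serves as
    -- the extra vertex below, so the successor and the predecessor of a vertex are directly its two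
    -- neighbours on the closed cycle.
    nxt : List V → V → Maybe V
    nxt []      v = nothing
    nxt (x ∷ l) v with x ≟ v
    ... | yes _ = head l
    ... | no  _ = nxt l v

    -- The argument `q` is what comes before the list: `nothing` at the start of the path, the
    -- preceding vertex in the recursion.
    prv : Maybe V → List V → V → Maybe V
    prv q []      v = nothing
    prv q (x ∷ l) v with x ≟ v
    ... | yes _ = q
    ... | no  _ = prv (just x) l v

    ∉-head : ∀ {x y : V} {l} → All (λ z → ¬ x ≡ z) l → y ∈ l → ¬ x ≡ y
    ∉-head a i e = All.lookup a i e

    head∈ : ∀ l {v : V} → head l ≡ just v → v ∈ l
    head∈ (x ∷ l) refl = here refl

    nxt-∈ : ∀ l {u v} → nxt l u ≡ just v → u ∈ l × v ∈ l
    nxt-∈ (x ∷ l) {u} e with x ≟ u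
    ... | yes refl = here refl , there (head∈ l e)
    ... | no  _    = let i , j = nxt-∈ l e in there i , there j

    nxt⇒prv : ∀ q l {u v} → Unique l → nxt l u ≡ just v → prv q l v ≡ just u
    nxt⇒prv q (x ∷ l) {u} {v} (a ∷ un) e with x ≟ u | x ≟ v
    ... | yes refl | yes refl = ⊥-elim (∉-head a (head∈ l e) refl)
    ... | no  _    | yes refl = ⊥-elim (∉-head a (proj₂ (nxt-∈ l e)) refl)
    ... | no  _    | no  _    = nxt⇒prv (just x) l un e
    nxt⇒prv q (x ∷ y ∷ l) {u} {.y} (a ∷ un) refl | yes refl | no _ with y ≟ y
    ... | yes _ = refl
    ... | no ¬p = ⊥-elim (¬p refl)

    prv⇒nxt : ∀ q l {u v} → Unique l → prv q l v ≡ just u →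
              (q ≡ just u × head l ≡ just v) ⊎ nxt l u ≡ just v
    prv⇒nxt q (x ∷ l) {u} {v} (a ∷ un) e with x ≟ v
    ... | yes refl = inj₁ (e , refl)
    ... | no  _ with prv⇒nxt (just x) l un e | x ≟ u
    ...   | inj₁ (refl , h) | yes refl = inj₂ h
    ...   | inj₁ (refl , h) | no  ¬p   = ⊥-elim (¬p refl)
    ...   | inj₂ n          | yes refl = ⊥-elim (∉-head a (proj₁ (nxt-∈ l n)) refl)
    ...   | inj₂ n          | no  _    = inj₂ n

    nxt-asym : ∀ l {u v} → Unique l → nxt l u ≡ just v → nxt l v ≡ just u → ⊥
    nxt-asym (x ∷ l) {u} {v} (a ∷ un) e f with x ≟ u | x ≟ v
    ... | yes refl | yes refl = ∉-head a (head∈ l e) refl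
    ... | yes refl | no _     = ∉-head a (proj₂ (nxt-∈ l f)) refl
    ... | no _     | yes refl = ∉-head a (proj₂ (nxt-∈ l e)) refl
    ... | no _     | no _     = nxt-asym l un e f

    prv-just : ∀ w l {u} → u ∈ l → ¬ prv (just w) l u ≡ nothing
    prv-just w (x ∷ l) {u} i e with x ≟ u
    prv-just w (x ∷ l) i         () | yes _
    prv-just w (x ∷ l) (here p)  e  | no ¬p = ¬p (sym p)
    prv-just w (x ∷ l) (there i) e  | no ¬p = prv-just x l i e

    prv-nothing : ∀ x l {u} → u ∈ (x ∷ l) → prv nothing (x ∷ l) u ≡ nothing → u ≡ x
    prv-nothing x l {u} i e with x ≟ u
    prv-nothing x l i         e | yes refl = refl
    prv-nothing x l (here p)  e | no _ = p
    prv-nothing x l (there i) e | no _ = ⊥-elim (prv-just x l i e)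

    last : V → List V → V
    last x []      = x
    last x (y ∷ l) = last y l

    last∈ : ∀ x l → last x l ∈ (x ∷ l)
    last∈ x []      = here refl
    last∈ x (y ∷ l) = there (last∈ y l)

    nxt-nothing : ∀ x l {u} → u ∈ (x ∷ l) → nxt (x ∷ l) u ≡ nothing → u ≡ last x l
    nxt-nothing x l {u} i e with x ≟ u
    nxt-nothing x []      i        e | yes refl = refl
    nxt-nothing x (y ∷ l) i        () | yes refl
    nxt-nothing x []      (here p) e | no _ = p
    nxt-nothing x (y ∷ l) (here p) e | no ¬p = ⊥-elim (¬p (sym p))
    nxt-nothing x (y ∷ l) (there i) e | no _ = nxt-nothing y l i e

    nxt-last : ∀ x l → Unique (x ∷ l) → nxt (x ∷ l) (last x l) ≡ nothing
    nxt-last x [] _ with x ≟ x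
    ... | yes _ = refl
    ... | no  _ = refl
    nxt-last x (y ∷ l) (a ∷ un) with x ≟ last y l
    ... | yes p = ⊥-elim (∉-head a (last∈ y l) p)
    ... | no  _ = nxt-last y l un

    prv-head : ∀ x l → prv nothing (x ∷ l) x ≡ nothing
    prv-head x l with x ≟ x
    ... | yes _ = refl
    ... | no ¬p = ⊥-elim (¬p refl)

    nxt-adj : ∀ {R : V → V → Bool} l {u v} → Chain R l → nxt l u ≡ just v → R u v ≡ true
    nxt-adj (x ∷ l) {u} c e with x ≟ u
    nxt-adj (x ∷ y ∷ l) (r , c) refl | yes refl = r
    nxt-adj (x ∷ y ∷ l) (r , c) e    | no _     = nxt-adj (y ∷ l) c e

    module OfPath {R : V → V → Bool} (R-sym : ∀ u v → R u v ≡ true → R v u ≡ true)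
      (h h′ : V) (r : List V) (un : Unique (h ∷ h′ ∷ r)) (ch : Chain R (h ∷ h′ ∷ r))
      (full : ∀ v → v ∈ (h ∷ h′ ∷ r)) where

      p : List V
      p = h ∷ h′ ∷ r

      t : V
      t = last h′ r

      _≟M_ : DecidableEquality (Maybe V)
      _≟M_ = ≡-dec _≟_

      isNbr : V → Maybe V → Bool
      isNbr u z = ⌊ nxt p u ≟M z ⌋ ∨ ⌊ prv nothing p u ≟M z ⌋

      isNbr⁻ : ∀ u z → isNbr u z ≡ true → nxt p u ≡ z ⊎ prv nothing p u ≡ z
      isNbr⁻ u z e with ∨⁻ {⌊ nxt p u ≟M z ⌋} e
      ... | inj₁ q = inj₁ (isYes⁻ _ q)
      ... | inj₂ q = inj₂ (isYes⁻ _ q)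

      isNbr⁺ : ∀ u z → nxt p u ≡ z ⊎ prv nothing p u ≡ z → isNbr u z ≡ true
      isNbr⁺ u z (inj₁ q) rewrite isYes⁺ (nxt p u ≟M z) q = refl
      isNbr⁺ u z (inj₂ q) = ∨⁺ʳ ⌊ nxt p u ≟M z ⌋ (isYes⁺ (prv nothing p u ≟M z) q)

      m : Maybe V → Maybe V → Bool
      m (just u) z        = isNbr u z
      m nothing  (just u) = isNbr u nothing
      m nothing  nothing  = false

      -- Any vertex may be an end of the path, so the extra vertex is adjacent to all of them.
      R⁺ : Maybe V → Maybe V → Bool
      R⁺ (just u) (just v) = R u v
      R⁺ _        _        = true

      prv⇒nxt′ : ∀ {u v} → prv nothing p v ≡ just u → nxt p u ≡ just v
      prv⇒nxt′ e with prv⇒nxt nothing p un e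
      ... | inj₂ q = q

      m-sym : ∀ u v → m u v ≡ true → m v u ≡ true
      m-sym nothing  (just v) e = e
      m-sym (just u) nothing  e = e
      m-sym (just u) (just v) e with isNbr⁻ u (just v) e
      ... | inj₁ q = isNbr⁺ v (just u) (inj₂ (nxt⇒prv nothing p un q))
      ... | inj₂ q = isNbr⁺ v (just u) (inj₁ (prv⇒nxt′ q))

      m-adj : ∀ u v → m u v ≡ true → R⁺ u v ≡ true
      m-adj nothing  (just v) e = refl
      m-adj (just u) nothing  e = refl
      m-adj (just u) (just v) e with isNbr⁻ u (just v) e
      ... | inj₁ q = nxt-adj p ch q
      ... | inj₂ q = R-sym _ _ (nxt-adj p ch (prv⇒nxt′ q))

      h≢t : ¬ h ≡ t
      h≢t = apart un
        where
        apart : ∀ {x y l} → Unique (x ∷ y ∷ l) → ¬ x ≡ last y l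
        apart (a ∷ _) = ∉-head a (last∈ _ _)

      -- Equal vertices on both sides contradict that a list without repetition has no edge in both
      -- directions; `nothing` on both sides would make u the first and the last vertex, and these
      -- differ because the path has at least two vertices.
      nxt≢prv : ∀ u → ¬ nxt p u ≡ prv nothing p u
      nxt≢prv u e with nxt p u in eq
      ... | just v  = nxt-asym p un eq (prv⇒nxt′ (sym e))
      ... | nothing = h≢t (trans (sym (prv-nothing h (h′ ∷ r) (full u) (sym e))) (nxt-nothing h (h′ ∷ r) (full u) eq))

      nbrs : ∀ v → TwoNbrs m v
      nbrs (just u) = twoNbrs (nxt p u) (prv nothing p u) (nxt≢prv u)
        (isNbr⁺ u _ (inj₁ refl)) (isNbr⁺ u _ (inj₂ refl))
        (λ z e → [ (λ q → inj₁ (sym q)) , (λ q → inj₂ (sym q)) ]′ (isNbr⁻ u z e))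
      nbrs nothing = twoNbrs (just h) (just t) (λ e → h≢t (just-injective e))
        (isNbr⁺ h nothing (inj₂ (prv-head h (h′ ∷ r)))) (isNbr⁺ t nothing (inj₁ (nxt-last h (h′ ∷ r) un)))
        only
        where
        only : ∀ z → m nothing z ≡ true → z ≡ just h ⊎ z ≡ just t
        only (just u) e with isNbr⁻ u nothing e
        ... | inj₁ q = inj₂ (cong just (nxt-nothing h (h′ ∷ r) (full u) q))
        ... | inj₂ q = inj₁ (cong just (prv-nothing h (h′ ∷ r) (full u) q))

      constant : ∀ (Z : V → Bool) x l → Unique (x ∷ l) → (∀ u v → nxt (x ∷ l) u ≡ just v → Z u ≡ Z v) →
                 ∀ {u} → u ∈ (x ∷ l) → Z x ≡ Z u
      constant Z x l       un       f (here refl) = refl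
      constant Z x (y ∷ l) (a ∷ un) f (there i)   = trans (f x y step) (constant Z y l un rest i)
        where
        step : nxt (x ∷ y ∷ l) x ≡ just y
        step with x ≟ x
        ... | yes _ = refl
        ... | no ¬p = ⊥-elim (¬p refl)
        rest : ∀ u v → nxt (y ∷ l) u ≡ just v → Z u ≡ Z v
        rest u v e = f u v lifted
          where
          lifted : nxt (x ∷ y ∷ l) u ≡ just v
          lifted with x ≟ u
          ... | yes refl = ⊥-elim (∉-head a (proj₁ (nxt-∈ (y ∷ l) e)) refl)
          ... | no _     = e

      -- Stronger than `conn` below: the path is connected without the extra vertex. This form
      -- excludes sets of vertices that the cycle leaves only through the extra vertex.
      path-conn : ∀ (Z : V → Bool) → (∀ u v → Z u ≡ true → m (just u) (just v) ≡ true → Z v ≡ true) →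
                  ∀ u v → Z u ≡ true → Z v ≡ true
      path-conn Z cl u v zu = trans (sym (same v)) (trans (same u) zu)
        where
        same : ∀ w → Z h ≡ Z w
        same w = constant Z h (h′ ∷ r) un
          (λ x y e → bool-ext (λ zx → cl x y zx (isNbr⁺ x (just y) (inj₁ e)))
                              (λ zy → cl y x zy (m-sym (just x) (just y) (isNbr⁺ x (just y) (inj₁ e)))))
          (full w)

      conn : ∀ (Z : Maybe V → Bool) → Closed m Z → ∀ u v → Z u ≡ true → Z v ≡ true
      conn Z cl u v zu = spread v
        where
        hn : m nothing (just h) ≡ true
        hn = TwoNbrs.mx (nbrs nothing)
        at-h : ∀ u → Z u ≡ true → Z (just h) ≡ true
        at-h (just u) z = path-conn (λ x → Z (just x)) (λ x y → cl (just x) (just y)) u h z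
        at-h nothing  z = cl nothing (just h) z hn
        spread : ∀ v → Z v ≡ true
        spread (just v) = path-conn (λ x → Z (just x)) (λ x y → cl (just x) (just y)) h v (at-h u zu)
        spread nothing  = cl (just h) nothing (at-h u zu) hn

      cycle : Cycle R⁺
      cycle = record { m = m; m-sym = m-sym; m-adj = m-adj; nbrs = nbrs; conn = conn }

-- Contraction of the outside of a part of a cycle

module Contract where

  open Refute
  open Sound
  open PathCycle
  open import Data.Bool using (Bool; true; false; _∧_; _∨_; not; _xor_)
  open import Data.Bool.Properties using (xor-same; xor-identityʳ; xor-∧-commutativeRing)
  open import Algebra using (CommutativeRing)
  open import Algebra.Properties.CommutativeSemigroup (CommutativeRing.+-commutativeSemigroup xor-∧-commutativeRing) using (interchange)
  open import Data.List using (List; []; _∷_; map)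
  open import Data.Maybe using (Maybe; just; nothing)
  open import Data.Maybe.Properties using (≡-dec)
  open import Data.Product using (∃; _×_; _,_)
  open import Data.Sum using (_⊎_; inj₁; inj₂; [_,_]′)
  open import Data.Empty using (⊥; ⊥-elim)
  open import Relation.Nullary using (¬_; yes; no; ⌊_⌋)
  open import Relation.Binary.Definitions using (DecidableEquality)
  open import Relation.Binary.PropositionalEquality

  parity : {A : Set} → (A → Bool) → List A → Bool
  parity f []       = false
  parity f (x ∷ xs) = f x xor parity f xs

  parity-cong : ∀ {A : Set} {f g : A → Bool} → (∀ x → f x ≡ g x) → ∀ l → parity f l ≡ parity g l
  parity-cong e []      = refl
  parity-cong e (x ∷ l) = cong₂ _xor_ (e x) (parity-cong e l)

  parity-map : ∀ {A B : Set} (f : B → Bool) (g : A → B) l → parity f (map g l) ≡ parity (λ x → f (g x)) l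
  parity-map f g []      = refl
  parity-map f g (x ∷ l) = cong (f (g x) xor_) (parity-map f g l)

  parity-xor : ∀ {A : Set} (f g : A → Bool) l → parity (λ x → f x xor g x) l ≡ parity f l xor parity g l
  parity-xor f g []      = refl
  parity-xor f g (x ∷ l) = trans (cong ((f x xor g x) xor_) (parity-xor f g l)) (interchange (f x) (g x) _ _)

  parity-∧ : ∀ {A : Set} (f : A → Bool) b l → parity (λ x → f x ∧ b) l ≡ parity f l ∧ b
  parity-∧ f b []      = refl
  parity-∧ f b (x ∷ l) = trans (cong ((f x ∧ b) xor_) (parity-∧ f b l)) (distr (f x) (parity f l) b)
    where
    distr : ∀ a c b → (a ∧ b) xor (c ∧ b) ≡ (a xor c) ∧ b
    distr true  true  true  = refl
    distr true  true  false = refl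
    distr true  false true  = refl
    distr true  false false = refl
    distr false c     b     = refl

  parity-false : ∀ {A : Set} (l : List A) → parity (λ _ → false) l ≡ false
  parity-false []      = refl
  parity-false (x ∷ l) = parity-false l

  -- The handshake lemma modulo two: each pair of distinct positions is counted twice, and the
  -- diagonal contributes nothing.
  handshake : ∀ {A : Set} (f : A → A → Bool) → (∀ x y → f x y ≡ f y x) → (∀ x → f x x ≡ false) →
              ∀ l → parity (λ x → parity (f x) l) l ≡ false
  handshake f fs fi []      = refl
  handshake f fs fi (x ∷ l) = begin
    (f x x xor s) xor parity (λ y → f y x xor parity (f y) l) l    ≡⟨ cong ((f x x xor s) xor_) (parity-xor (λ y → f y x) _ l) ⟩
    (f x x xor s) xor (parity (λ y → f y x) l xor parity (λ y → parity (f y) l) l)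
      ≡⟨ cong₂ (λ a b → (f x x xor s) xor (a xor b)) (parity-cong (λ y → fs y x) l) (handshake f fs fi l) ⟩
    (f x x xor s) xor (s xor false)                                ≡⟨ cong₂ (λ a b → (a xor s) xor b) (fi x) (xor-identityʳ s) ⟩
    s xor s                                                        ≡⟨ xor-same s ⟩
    false ∎
    where
    open ≡-Reasoning
    s = parity (f x) l

  plus : {A : Set} → DecidableEquality A → (A → A → Bool) → A → A → A → Maybe A → Maybe A → Bool
  plus _≟_ R t₁ t₂ t₃ (just u) (just v) = R u v
  plus _≟_ R t₁ t₂ t₃ (just u) nothing  = ⌊ u ≟ t₁ ⌋ ∨ ⌊ u ≟ t₂ ⌋ ∨ ⌊ u ≟ t₃ ⌋
  plus _≟_ R t₁ t₂ t₃ nothing  (just u) = ⌊ u ≟ t₁ ⌋ ∨ ⌊ u ≟ t₂ ⌋ ∨ ⌊ u ≟ t₃ ⌋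
  plus _≟_ R t₁ t₂ t₃ nothing  nothing  = false

  -- A cycle through W that leaves the part ι A through at most three vertices
  -- becomes a cycle once the rest of W is contracted to the single vertex nothing.
  module Contraction {A W : Set} (_≟_ : DecidableEquality A)
    -- Only parities are counted, so it suffices that every vertex occurs an odd number of times in
    -- `as`.
    (as : List A) (once : ∀ t → parity (λ a → ⌊ a ≟ t ⌋) as ≡ true)
    {R : A → A → Bool} {S : W → W → Bool} (H : Cycle S)
    (ι : A → W) (view : W → Maybe A)
    (view-ι : ∀ a → view (ι a) ≡ just a) (ι-view : ∀ w a → view w ≡ just a → w ≡ ι a)
    (irr : ∀ a → Cycle.m H (ι a) (ι a) ≡ false)
    (inside : ∀ a b → Cycle.m H (ι a) (ι b) ≡ true → R a b ≡ true)
    -- Two edges that leave the part at one vertex would merge into a single edge under the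
    -- contraction, and that vertex would lose a neighbour.
    (unique-out : ∀ a u v → view u ≡ nothing → view v ≡ nothing →
                  Cycle.m H (ι a) u ≡ true → Cycle.m H (ι a) v ≡ true → u ≡ v)
    (t₁ t₂ t₃ : A) (t₁≢t₂ : ¬ t₁ ≡ t₂) (t₁≢t₃ : ¬ t₁ ≡ t₃) (t₂≢t₃ : ¬ t₂ ≡ t₃)
    (boundary : ∀ a w → view w ≡ nothing → Cycle.m H (ι a) w ≡ true → a ≡ t₁ ⊎ a ≡ t₂ ⊎ a ≡ t₃)
    (ω : W) (ω-out : view ω ≡ nothing)
    where

    open Cycle H using () renaming (m to m₀; m-sym to m₀-sym; nbrs to nbrs₀; conn to conn₀)

    isOut : Maybe A → Bool
    isOut nothing  = true
    isOut (just _) = false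

    out : A → Bool
    out a = isOut (view (TwoNbrs.x (nbrs₀ (ι a)))) ∨ isOut (view (TwoNbrs.y (nbrs₀ (ι a))))

    isOut⁻ : ∀ {z} → isOut z ≡ true → z ≡ nothing
    isOut⁻ {nothing} _ = refl

    out⁻ : ∀ a → out a ≡ true → ∃ λ w → view w ≡ nothing × m₀ (ι a) w ≡ true
    out⁻ a e with nbrs₀ (ι a)
    ... | twoNbrs x y _ mx my _ with ∨⁻ {isOut (view x)} e
    ...   | inj₁ p = x , isOut⁻ p , mx
    ...   | inj₂ p = y , isOut⁻ p , my

    out⁺ : ∀ a w → view w ≡ nothing → m₀ (ι a) w ≡ true → out a ≡ true
    out⁺ a w e mw with nbrs₀ (ι a)
    ... | twoNbrs x y _ _ _ only with only w mw
    ...   | inj₁ refl rewrite e = refl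
    ...   | inj₂ refl rewrite e = ∨⁺ʳ (isOut (view x)) refl

    m : Maybe A → Maybe A → Bool
    m (just u) (just v) = m₀ (ι u) (ι v)
    m (just u) nothing  = out u
    m nothing  (just v) = out v
    m nothing  nothing  = false

    m-sym : ∀ u v → m u v ≡ true → m v u ≡ true
    m-sym (just u) (just v) e = m₀-sym _ _ e
    m-sym (just u) nothing  e = e
    m-sym nothing  (just v) e = e

    m-irr : ∀ u → m u u ≡ false
    m-irr (just u) = irr u
    m-irr nothing  = refl

    m-view : ∀ u w → m₀ (ι u) w ≡ true → m (just u) (view w) ≡ true
    m-view u w e with view w in eq
    ... | nothing = out⁺ u w eq e
    ... | just a rewrite ι-view w a eq = e

    nbrs-just : ∀ u → TwoNbrs m (just u)
    nbrs-just u with nbrs₀ (ι u)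
    ... | twoNbrs x y x≢y mx my only =
      twoNbrs (view x) (view y) distinct (m-view u x mx) (m-view u y my) only′
      where
      distinct : ¬ view x ≡ view y
      distinct = differ refl refl
        where
        differ : ∀ {zx zy} → view x ≡ zx → view y ≡ zy → ¬ zx ≡ zy
        differ {nothing} ex ey refl = x≢y (unique-out u x y ex ey mx my)
        differ {just a}  ex ey refl = x≢y (trans (ι-view x a ex) (sym (ι-view y a ey)))
      only′ : ∀ z → m (just u) z ≡ true → z ≡ view x ⊎ z ≡ view y
      only′ (just a) e with only (ι a) e
      ... | inj₁ refl = inj₁ (sym (view-ι a))
      ... | inj₂ refl = inj₂ (sym (view-ι a))
      only′ nothing e with out⁻ u e
      ... | w , wo , mw with only w mw
      ...   | inj₁ refl = inj₁ (sym wo)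
      ...   | inj₂ refl = inj₂ (sym wo)

    out-terminal : ∀ a → out a ≡ true → a ≡ t₁ ⊎ a ≡ t₂ ⊎ a ≡ t₃
    out-terminal a e = let w , wo , mw = out⁻ a e in boundary a w wo mw

    _≟M_ : DecidableEquality (Maybe A)
    _≟M_ = ≡-dec _≟_

    all : List (Maybe A)
    all = nothing ∷ map just as

    once-all : ∀ t → parity (λ a → ⌊ a ≟M t ⌋) all ≡ true
    once-all nothing  = cong not (trans (parity-map _ just as) (trans (parity-cong (λ a → refl) as) (parity-false as)))
    once-all (just t) = trans (parity-map _ just as) (trans (parity-cong lemma as) (once t))
      where
      lemma : ∀ a → ⌊ just a ≟M just t ⌋ ≡ ⌊ a ≟ t ⌋
      lemma a with a ≟ t
      ... | yes _ = refl
      ... | no  _ = refl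

    degree-even : ∀ u → parity (m (just u)) all ≡ false
    degree-even u = trans (parity-cong pointwise all)
      (trans (parity-xor (λ z → ⌊ z ≟M x ⌋) (λ z → ⌊ z ≟M y ⌋) all) (cong₂ _xor_ (once-all x) (once-all y)))
      where
      open TwoNbrs (nbrs-just u)
      pointwise : ∀ z → m (just u) z ≡ ⌊ z ≟M x ⌋ xor ⌊ z ≟M y ⌋
      pointwise z with z ≟M x | z ≟M y
      ... | yes p | yes q = ⊥-elim (x≢y (trans (sym p) q))
      ... | yes p | no _  = trans (cong (m (just u)) p) mx
      ... | no _  | yes q = trans (cong (m (just u)) q) my
      ... | no p  | no q  = ≢true⇒false λ e → [ p , q ]′ (only z e)

    -- All vertices of the part keep degree two, so the handshake lemma forces an even degree on the
    -- contracted vertex.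
    crossings-even : parity out as ≡ false
    crossings-even = begin
      parity out as                                      ≡⟨ sym (parity-map (m nothing) just as) ⟩
      parity (m nothing) all                             ≡⟨ sym (xor-identityʳ _) ⟩
      parity (m nothing) all xor false                   ≡⟨ cong (parity (m nothing) all xor_) (sym rest) ⟩
      parity (λ u → parity (m u) all) all                ≡⟨ handshake m (λ u v → bool-ext (m-sym u v) (m-sym v u)) m-irr all ⟩
      false ∎
      where
      open ≡-Reasoning
      rest : parity (λ u → parity (m u) all) (map just as) ≡ false
      rest = trans (parity-map _ just as) (trans (parity-cong degree-even as) (parity-false as))

    three-even : out t₁ xor (out t₂ xor out t₃) ≡ false
    three-even = trans (sym total) crossings-even
      where
      is : A → A → Bool
      is t a = ⌊ a ≟ t ⌋
      pointwise : ∀ a → out a ≡ (is t₁ a ∧ out t₁) xor ((is t₂ a ∧ out t₂) xor (is t₃ a ∧ out t₃))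
      pointwise a with a ≟ t₁ | a ≟ t₂ | a ≟ t₃
      ... | yes refl | yes p    | _        = ⊥-elim (t₁≢t₂ p)
      ... | yes refl | no _     | yes p    = ⊥-elim (t₁≢t₃ p)
      ... | yes refl | no _     | no _     = sym (xor-identityʳ _)
      ... | no _     | yes refl | yes p    = ⊥-elim (t₂≢t₃ p)
      ... | no _     | yes refl | no _     = sym (xor-identityʳ _)
      ... | no _     | no _     | yes refl = refl
      ... | no p     | no q     | no r     = ≢true⇒false λ e → [ p , [ q , r ]′ ]′ (out-terminal a e)
      one : ∀ t → parity (λ a → is t a ∧ out t) as ≡ out t
      one t = trans (parity-∧ (is t) (out t) as) (cong (_∧ out t) (once t))
      total : parity out as ≡ out t₁ xor (out t₂ xor out t₃)
      total = trans (parity-cong pointwise as) (trans (parity-xor _ _ as)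
        (cong₂ _xor_ (one t₁) (trans (parity-xor _ _ as) (cong₂ _xor_ (one t₂) (one t₃)))))

    some-crossing : (∀ a → out a ≡ false) → ⊥
    some-crossing none = contra (conn₀ Z closed (ι t₁) ω start)
      where
      Z : W → Bool
      Z w = not (isOut (view w))
      start : Z (ι t₁) ≡ true
      start = cong (λ z → not (isOut z)) (view-ι t₁)
      contra : ¬ Z ω ≡ true
      contra e = true≢false e (cong (λ z → not (isOut z)) ω-out)
      closed : Closed m₀ Z
      closed u v zu e with view u in eu | view v in ev
      ... | just a | just _  = refl
      ... | just a | nothing = ⊥-elim (true≢false (out⁺ a v ev (subst (λ x → m₀ x v ≡ true) (ι-view u a eu) e)) (none a))
      ... | nothing | _ with zu
      ...   | ()

    -- The degree of the contracted vertex is even and at most three. It is not zero by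
    -- `some-crossing`, since the cycle connects the part with the outside vertex `ω`. Hence it is
    -- two.
    nbrs-nothing : TwoNbrs m nothing
    nbrs-nothing = select _ _ _ refl refl refl three-even
      where
      select : ∀ o₁ o₂ o₃ → out t₁ ≡ o₁ → out t₂ ≡ o₂ → out t₃ ≡ o₃ → o₁ xor (o₂ xor o₃) ≡ false → TwoNbrs m nothing
      select true true false e₁ e₂ e₃ _ = twoNbrs (just t₁) (just t₂) (λ { refl → t₁≢t₂ refl }) e₁ e₂ only
        where
        only : ∀ z → m nothing z ≡ true → z ≡ just t₁ ⊎ z ≡ just t₂
        only (just z) e with out-terminal z e
        ... | inj₁ refl        = inj₁ refl
        ... | inj₂ (inj₁ refl) = inj₂ refl
        ... | inj₂ (inj₂ refl) = ⊥-elim (true≢false e e₃)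
      select true false true e₁ e₂ e₃ _ = twoNbrs (just t₁) (just t₃) (λ { refl → t₁≢t₃ refl }) e₁ e₃ only
        where
        only : ∀ z → m nothing z ≡ true → z ≡ just t₁ ⊎ z ≡ just t₃
        only (just z) e with out-terminal z e
        ... | inj₁ refl        = inj₁ refl
        ... | inj₂ (inj₁ refl) = ⊥-elim (true≢false e e₂)
        ... | inj₂ (inj₂ refl) = inj₂ refl
      select false true true e₁ e₂ e₃ _ = twoNbrs (just t₂) (just t₃) (λ { refl → t₂≢t₃ refl }) e₂ e₃ only
        where
        only : ∀ z → m nothing z ≡ true → z ≡ just t₂ ⊎ z ≡ just t₃
        only (just z) e with out-terminal z e
        ... | inj₁ refl        = ⊥-elim (true≢false e e₁)
        ... | inj₂ (inj₁ refl) = inj₁ refl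
        ... | inj₂ (inj₂ refl) = inj₂ refl
      select false false false e₁ e₂ e₃ _ = ⊥-elim (some-crossing λ a → ≢true⇒false λ e → none a e (out-terminal a e))
        where
        none : ∀ a → out a ≡ true → a ≡ t₁ ⊎ a ≡ t₂ ⊎ a ≡ t₃ → ⊥
        none a e (inj₁ refl)        = true≢false e e₁
        none a e (inj₂ (inj₁ refl)) = true≢false e e₂
        none a e (inj₂ (inj₂ refl)) = true≢false e e₃

    m-adj : ∀ u v → m u v ≡ true → plus _≟_ R t₁ t₂ t₃ u v ≡ true
    m-adj (just u) (just v) e = inside u v e
    m-adj (just u) nothing  e = terminal u (out-terminal u e)
      where
      terminal : ∀ a → a ≡ t₁ ⊎ a ≡ t₂ ⊎ a ≡ t₃ → ⌊ a ≟ t₁ ⌋ ∨ ⌊ a ≟ t₂ ⌋ ∨ ⌊ a ≟ t₃ ⌋ ≡ true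
      terminal a (inj₁ p) rewrite isYes⁺ (a ≟ t₁) p = refl
      terminal a (inj₂ (inj₁ p)) rewrite isYes⁺ (a ≟ t₂) p = ∨⁺ʳ ⌊ a ≟ t₁ ⌋ refl
      terminal a (inj₂ (inj₂ p)) rewrite isYes⁺ (a ≟ t₃) p = ∨⁺ʳ ⌊ a ≟ t₁ ⌋ (∨⁺ʳ ⌊ a ≟ t₂ ⌋ refl)
    m-adj nothing (just v) e = m-adj (just v) nothing e

    -- A closed set of the contracted graph pulls back along `view` to a closed set of the original
    -- cycle.
    conn : ∀ Z → Closed m Z → ∀ u v → Z u ≡ true → Z v ≡ true
    conn Z cl u v zu = back v
      where
      Z₀ : W → Bool
      Z₀ w = Z (view w)
      closed : Closed m₀ Z₀
      closed x y zx e with view x in ex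
      ... | just a = cl (just a) (view y) zx (m-view a y (subst (λ w → m₀ w y ≡ true) (ι-view x a ex) e))
      ... | nothing with view y in ey
      ...   | nothing = zx
      ...   | just a  = cl nothing (just a) zx (out⁺ a x ex (subst (λ w → m₀ w x ≡ true) (ι-view y a ey) (m₀-sym _ _ e)))
      lift : Maybe A → W
      lift (just a) = ι a
      lift nothing  = ω
      view-lift : ∀ a → view (lift a) ≡ a
      view-lift (just a) = view-ι a
      view-lift nothing  = ω-out
      back : ∀ v → Z v ≡ true
      back v = subst (λ a → Z a ≡ true) (view-lift v)
        (conn₀ Z₀ closed (lift u) (lift v) (subst (λ a → Z a ≡ true) (sym (view-lift u)) zu))

    nbrs : ∀ v → TwoNbrs m v
    nbrs (just u) = nbrs-just u
    nbrs nothing  = nbrs-nothing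

    contracted : Cycle (plus _≟_ R t₁ t₂ t₃)
    contracted = record { m = m; m-sym = m-sym; m-adj = m-adj; nbrs = nbrs; conn = conn }

-- The frame of four fragments has no Hamiltonian path

module Frame where

  open Refute
  open Sound
  open PathCycle
  open Contract
  open import Data.Bool using (Bool; true; false; _∧_; _∨_; not; if_then_else_)
  open import Data.Bool.Properties using (∧-comm; ¬-not) renaming (_≟_ to _≟B_)
  open import Data.Nat using (ℕ; suc)
  open import Data.List using (List; []; _∷_; map)
  open import Data.List.Relation.Unary.All as All using ([]; _∷_)
  open import Data.List.Membership.Propositional using (_∈_)
  open import Data.List.Relation.Unary.Unique.Propositional using (Unique)
  open import Data.Maybe using (Maybe; just; nothing)
  open import Data.Maybe.Properties using (≡-dec; just-injective)
  open import Data.Product using (∃; _×_; _,_)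
  open import Data.Sum using (_⊎_; inj₁; inj₂)
  open import Data.Empty using (⊥; ⊥-elim)
  open import Relation.Nullary using (¬_; yes; no; ⌊_⌋)
  open import Relation.Binary.Definitions using (DecidableEquality)
  open import Relation.Binary.PropositionalEquality

  data Route {V : Set} (R : V → V → Bool) : V → List V → V → Set where
    stay : ∀ x → Route R x (x ∷ []) x
    step : ∀ {x y z l} → R x y ≡ true → Route R y l z → Route R x (x ∷ l) z

  occ : {V : Set} → DecidableEquality V → V → List V → ℕ
  occ _≟_ v []      = 0
  occ _≟_ v (x ∷ l) with x ≟ v
  ... | yes _ = suc (occ _≟_ v l)
  ... | no  _ = occ _≟_ v l

  indicator : Bool → ℕ
  indicator b = if b then 0 else 1

  -- l visits every vertex once, except the vertices with miss v ≡ true, which it avoids.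
  record Spans {V : Set} (_≟_ : DecidableEquality V) (miss : V → Bool) (l : List V) : Set where
    constructor spanning
    field visits : ∀ v → occ _≟_ v l ≡ indicator (miss v)
  open Spans public

  record Tour {V : Set} (_≟_ : DecidableEquality V) (R : V → V → Bool) (miss : V → Bool) (x y : V) : Set where
    constructor tour
    field
      list  : List V
      route : Route R x list y
      spans : Spans _≟_ miss list

  -- `nothing` is the apex a. Let H be the fragment with an extra vertex joined to a, b and c. Then
  -- `nonham` says that H is not Hamiltonian, while `b→c`, `b↠a`, `c↠a` and `avoid` make H minus any
  -- vertex other than the extra one Hamiltonian: each tour closes up through the extra vertex. For
  -- the extra vertex itself, spanning paths of the fragment from b and from c are asked for.
  record Fragment : Set₁ where
    field
      X       : Set
      _≟_     : DecidableEquality X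
      xs      : List X
      once    : ∀ x → parity (λ y → ⌊ y ≟ x ⌋) xs ≡ true
      adj     : Maybe X → Maybe X → Bool
      adj-sym : ∀ u v → adj u v ≡ adj v u
      adj-irr : ∀ u → adj u u ≡ false
      b c     : X
      b≢c     : ¬ b ≡ c

    _≟M_ : DecidableEquality (Maybe X)
    _≟M_ = ≡-dec _≟_

    is : Maybe X → Maybe X → Bool
    is u v = ⌊ u ≟M v ⌋

    field
      nonham : ¬ Cycle (plus _≟M_ adj nothing (just b) (just c))

      b→c    : Tour _≟M_ adj (is nothing) (just b) (just c)
      -- The vertex c is left out as well: in the assembled path it is visited separately, as an
      -- end.
      b↠a    : ∃ λ y → adj (just y) nothing ≡ true × Tour _≟M_ adj (λ v → is nothing v ∨ is (just c) v) (just b) (just y)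
      c↠a    : ∃ λ y → adj (just y) nothing ≡ true × Tour _≟M_ adj (λ v → is nothing v ∨ is (just b) v) (just c) (just y)
      b↠     : ∃ λ y → Tour _≟M_ adj (λ _ → false) (just b) y
      c↠     : ∃ λ y → Tour _≟M_ adj (λ _ → false) (just c) y
      avoid  : ∀ x → Tour _≟M_ adj (is (just x)) (just b) (just c)
                   ⊎ Tour _≟M_ adj (is (just x)) (just b) nothing
                   ⊎ Tour _≟M_ adj (is (just x)) (just c) nothing

  -- The parts with equal `i` form a half of the frame and are joined by bridges; the parts with
  -- equal `j` share an apex. So `across` is the bridged neighbour, and `far` is either part of the
  -- other half, reachable through an apex only.
  data Rel (i j : Bool) : Bool → Bool → Set where
    same   : Rel i j i j
    across : Rel i j i (not j)
    far    : ∀ j′ → Rel i j (not i) j′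

  compare : ∀ i j i′ j′ → Rel i j i′ j′
  compare false j     true  j′    = far j′
  compare true  j     false j′    = far j′
  compare false false false false = same
  compare false false false true  = across
  compare false true  false false = across
  compare false true  false true  = same
  compare true  false true  false = same
  compare true  false true  true  = across
  compare true  true  true  false = across
  compare true  true  true  true  = same

  module Frame (F : Bool → Bool → Fragment) where

    open module Part i j = Fragment (F i j) using (X; b; c; adj) public
    open module Part′ {i} {j} = Fragment (F i j) using () renaming (_≟_ to _≟X_; _≟M_ to _≟A_) public

    data V : Set where
      part : ∀ i j → X i j → V
      apex : Bool → V

    ι : ∀ i j → Maybe (X i j) → V
    ι i j nothing  = apex j
    ι i j (just x) = part i j x

    bridge : ∀ i j → X i j → X i (not j) → Bool
    bridge i j x y = (⌊ x ≟X b i j ⌋ ∧ ⌊ y ≟X b i (not j) ⌋) ∨ (⌊ x ≟X c i j ⌋ ∧ ⌊ y ≟X c i (not j) ⌋)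

    link : ∀ {i j i′ j′} → Rel i j i′ j′ → X i j → X i′ j′ → Bool
    link {i} {j} same    x y = adj i j (just x) (just y)
    link {i} {j} across  x y = bridge i j x y
    link         (far _) x y = false

    adjV : V → V → Bool
    adjV (apex _)     (apex _)       = false
    adjV (apex k)     (part i j x)   = ⌊ k ≟B j ⌋ ∧ adj i j nothing (just x)
    adjV (part i j x) (apex k)       = ⌊ k ≟B j ⌋ ∧ adj i j (just x) nothing
    adjV (part i j x) (part i′ j′ y) = link (compare i j i′ j′) x y

    bridge-comm : ∀ p q r s → (p ∧ q) ∨ (r ∧ s) ≡ (q ∧ p) ∨ (s ∧ r)
    bridge-comm p q r s = cong₂ _∨_ (∧-comm p q) (∧-comm r s)

    adjV-sym : ∀ u v → adjV u v ≡ adjV v u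
    adjV-sym (apex _)         (apex _)         = refl
    adjV-sym (apex k)         (part i j x)     = cong (⌊ k ≟B j ⌋ ∧_) (Fragment.adj-sym (F i j) _ _)
    adjV-sym (part i j x)     (apex k)         = cong (⌊ k ≟B j ⌋ ∧_) (Fragment.adj-sym (F i j) _ _)
    adjV-sym (part false j x) (part true j′ y) = refl
    adjV-sym (part true j x)  (part false j′ y) = refl
    adjV-sym (part false false x) (part false false y) = Fragment.adj-sym (F false false) _ _
    adjV-sym (part false true x)  (part false true y)  = Fragment.adj-sym (F false true) _ _
    adjV-sym (part true false x)  (part true false y)  = Fragment.adj-sym (F true false) _ _
    adjV-sym (part true true x)   (part true true y)   = Fragment.adj-sym (F true true) _ _
    adjV-sym (part false false x) (part false true y)  = bridge-comm ⌊ x ≟X b false false ⌋ _ ⌊ x ≟X c false false ⌋ _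
    adjV-sym (part false true x)  (part false false y) = bridge-comm ⌊ x ≟X b false true ⌋ _ ⌊ x ≟X c false true ⌋ _
    adjV-sym (part true false x)  (part true true y)   = bridge-comm ⌊ x ≟X b true false ⌋ _ ⌊ x ≟X c true false ⌋ _
    adjV-sym (part true true x)   (part true false y)  = bridge-comm ⌊ x ≟X b true true ⌋ _ ⌊ x ≟X c true true ⌋ _

    compare-same : ∀ i j → compare i j i j ≡ same
    compare-same false false = refl
    compare-same false true  = refl
    compare-same true  false = refl
    compare-same true  true  = refl

    compare-across : ∀ i j → compare i j i (not j) ≡ across
    compare-across false false = refl
    compare-across false true  = refl
    compare-across true  false = refl
    compare-across true  true  = refl

    ≟B-refl : ∀ k → ⌊ k ≟B k ⌋ ≡ true
    ≟B-refl false = refl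
    ≟B-refl true  = refl

    adjV-ι : ∀ i j u v → adjV (ι i j u) (ι i j v) ≡ adj i j u v
    adjV-ι i j nothing  nothing  = sym (Fragment.adj-irr (F i j) nothing)
    adjV-ι i j nothing  (just y) rewrite ≟B-refl j = refl
    adjV-ι i j (just x) nothing  rewrite ≟B-refl j = refl
    adjV-ι i j (just x) (just y) rewrite compare-same i j = refl

    adjV-irr : ∀ u → adjV u u ≡ false
    adjV-irr (apex k)     = refl
    adjV-irr (part i j x) = trans (adjV-ι i j (just x) (just x)) (Fragment.adj-irr (F i j) (just x))

    bridge-b : ∀ i j → adjV (part i j (b i j)) (part i (not j) (b i (not j))) ≡ true
    bridge-b i j rewrite compare-across i j | isYes⁺ (b i j ≟X b i j) refl | isYes⁺ (b i (not j) ≟X b i (not j)) refl = refl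

    bridge-c : ∀ i j → adjV (part i j (c i j)) (part i (not j) (c i (not j))) ≡ true
    bridge-c i j rewrite compare-across i j | isYes⁺ (c i j ≟X c i j) refl | isYes⁺ (c i (not j) ≟X c i (not j)) refl = ∨⁺ʳ _ refl

    _≟V_ : DecidableEquality V
    apex k     ≟V apex k′ with k ≟B k′
    ... | yes refl = yes refl
    ... | no ¬p    = no λ { refl → ¬p refl }
    apex k     ≟V part i j x = no λ ()
    part i j x ≟V apex k     = no λ ()
    part i j x ≟V part i′ j′ y with i ≟B i′ | j ≟B j′
    ... | no ¬p    | _        = no λ { refl → ¬p refl }
    ... | yes _    | no ¬p    = no λ { refl → ¬p refl }
    ... | yes refl | yes refl with x ≟X y
    ...   | yes refl = yes refl
    ...   | no ¬p    = no λ { refl → ¬p refl }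

    module Nontraceable (h h′ : V) (r : List V) (un : Unique (h ∷ h′ ∷ r)) (ch : Chain adjV (h ∷ h′ ∷ r))
      (full : ∀ v → v ∈ (h ∷ h′ ∷ r)) where

      open module P = PathCycle.PathCycle.OfPath _≟V_ (λ u v e → trans (sym (adjV-sym u v)) e) h h′ r un ch full
        using (m; m-sym; m-adj; nbrs; cycle; path-conn; t; R⁺)

      -- The outer `nothing` stands for all that lies outside the part: the other parts, the other
      -- apex and the extra vertex that closes the path.
      view : ∀ i j → Maybe V → Maybe (Maybe (X i j))
      viewPart : ∀ {i j i′ j′} → Rel i j i′ j′ → X i′ j′ → Maybe (Maybe (X i j))
      viewPart same    x = just (just x)
      viewPart across  x = nothing
      viewPart (far _) x = nothing
      view i j nothing                = nothing
      view i j (just (part i′ j′ x))  = viewPart (compare i j i′ j′) x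
      view i j (just (apex k))        = if ⌊ k ≟B j ⌋ then just nothing else nothing

      view-ι : ∀ i j a → view i j (just (ι i j a)) ≡ just a
      view-ι i j nothing  rewrite ≟B-refl j = refl
      view-ι i j (just x) rewrite compare-same i j = refl

      ι-view : ∀ i j w a → view i j w ≡ just a → w ≡ just (ι i j a)
      ι-view i j (just (apex k)) a e with k ≟B j | e
      ... | yes refl | refl = refl
      ι-view i j (just (part i′ j′ x)) a e with compare i j i′ j′ | e
      ... | same | refl = refl

      Exit : ∀ i j → X i j → V → Set
      Exit i j x w = (x ≡ b i j × w ≡ part i (not j) (b i (not j))) ⊎ (x ≡ c i j × w ≡ part i (not j) (c i (not j)))

      exits : ∀ i j x w → adjV (part i j x) w ≡ true → (∃ λ a → w ≡ ι i j a) ⊎ Exit i j x w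
      exits i j x (apex k) e with k ≟B j | e
      ... | yes refl | _ = inj₁ (nothing , refl)
      exits i j x (part i′ j′ y) e with compare i j i′ j′ | e
      ... | same   | _ = inj₁ (just y , refl)
      ... | across | e′ with ∨⁻ {⌊ x ≟X b i j ⌋ ∧ ⌊ y ≟X b i (not j) ⌋} e′
      ...   | inj₁ q = let q₁ , q₂ = ∧⁻ {⌊ x ≟X b i j ⌋} q in inj₂ (inj₁ (isYes⁻ (x ≟X _) q₁ , cong (part i (not j)) (isYes⁻ (y ≟X _) q₂)))
      ...   | inj₂ q = let q₁ , q₂ = ∧⁻ {⌊ x ≟X c i j ⌋} q in inj₂ (inj₂ (isYes⁻ (x ≟X _) q₁ , cong (part i (not j)) (isYes⁻ (y ≟X _) q₂)))

      apex-nbr : ∀ k w → adjV (apex k) w ≡ true → ∃ λ i → ∃ λ x → w ≡ part i k x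
      apex-nbr k (part i j x) e with k ≟B j | e
      ... | yes refl | _ = i , x , refl

      Endless : Bool → Bool → Set
      Endless i j = ∀ x → ¬ m (just (part i j x)) nothing ≡ true

      -- A part containing no end of the path is entered and left at b and c only: otherwise
      -- contracting its complement would give a Hamiltonian cycle of the fragment with a
      -- vertex joined to a, b and c.
      endless : ∀ i j → Endless i j → ∀ x → ¬ m (just (apex j)) (just (part i j x)) ≡ true
      endless i j free x₀ e₀ = Fragment.nonham (F i j)
        (Contraction.contracted (Fragment._≟M_ (F i j)) (nothing ∷ map just (Fragment.xs (F i j))) once′ cycle
          (λ a → just (ι i j a)) (view i j) (view-ι i j) (ι-view i j)
          (λ a → ≢true⇒false λ e → true≢false (m-adj (just (ι i j a)) (just (ι i j a)) e) (adjV-irr (ι i j a)))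
          (λ u v e → trans (sym (adjV-ι i j u v)) (m-adj (just (ι i j u)) (just (ι i j v)) e))
          unique-out nothing (just (b i j)) (just (c i j)) (λ ()) (λ ()) (λ e → Fragment.b≢c (F i j) (just-injective e))
          boundary nothing refl)
        where
        once′ : ∀ t → parity (λ a → ⌊ Fragment._≟M_ (F i j) a t ⌋) (nothing ∷ map just (Fragment.xs (F i j))) ≡ true
        once′ nothing  = cong not (trans (parity-map _ just (Fragment.xs (F i j))) (parity-false (Fragment.xs (F i j))))
        once′ (just y) = trans (parity-map _ just (Fragment.xs (F i j)))
          (trans (parity-cong (λ x → lemma x) (Fragment.xs (F i j))) (Fragment.once (F i j) y))
          where
          lemma : ∀ x → ⌊ Fragment._≟M_ (F i j) (just x) (just y) ⌋ ≡ ⌊ x ≟X y ⌋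
          lemma x with x ≟X y
          ... | yes _ = refl
          ... | no  _ = refl
        out-part : ∀ x w → view i j w ≡ nothing → m (just (part i j x)) w ≡ true → ∃ λ v → w ≡ just v × Exit i j x v
        -- An edge to the extra vertex would make x an end of the path.
        out-part x nothing  o e = ⊥-elim (free x e)
        out-part x (just v) o e with exits i j x v (m-adj (just (part i j x)) (just v) e)
        ... | inj₂ q = v , refl , q
        ... | inj₁ (a , refl) with trans (sym (view-ι i j a)) o
        ...   | ()
        boundary : ∀ a w → view i j w ≡ nothing → m (just (ι i j a)) w ≡ true →
                   a ≡ nothing ⊎ a ≡ just (b i j) ⊎ a ≡ just (c i j)
        boundary nothing  w o e = inj₁ refl
        boundary (just x) w o e with out-part x w o e
        ... | _ , _ , inj₁ (p , _) = inj₂ (inj₁ (cong just p))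
        ... | _ , _ , inj₂ (p , _) = inj₂ (inj₂ (cong just p))
        unique-out : ∀ a u v → view i j u ≡ nothing → view i j v ≡ nothing →
                     m (just (ι i j a)) u ≡ true → m (just (ι i j a)) v ≡ true → u ≡ v
        unique-out (just x) u v ou ov eu ev with out-part x u ou eu | out-part x v ov ev
        ... | _ , refl , inj₁ (_ , refl) | _ , refl , inj₁ (_ , refl) = refl
        ... | _ , refl , inj₂ (_ , refl) | _ , refl , inj₂ (_ , refl) = refl
        ... | _ , refl , inj₁ (p , _)    | _ , refl , inj₂ (q , _)    = ⊥-elim (Fragment.b≢c (F i j) (trans (sym p) q))
        ... | _ , refl , inj₂ (q , _)    | _ , refl , inj₁ (p , _)    = ⊥-elim (Fragment.b≢c (F i j) (trans (sym p) q))
        -- The apex is the only vertex of the part with many neighbours outside. Here the edge `e₀`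
        -- into the part takes one of its two places on the cycle, so at most one edge leaves.
        unique-out nothing u v ou ov eu ev = at (nbrs (just (apex j)))
          where
          inside≢ : ∀ {w} → view i j w ≡ nothing → ¬ w ≡ just (part i j x₀)
          inside≢ o refl with trans (sym (view-ι i j (just x₀))) o
          ... | ()
          at : TwoNbrs m (just (apex j)) → u ≡ v
          at (twoNbrs x y _ _ _ only) with only _ e₀ | only u eu | only v ev
          ... | inj₁ p | inj₁ q | _      = ⊥-elim (inside≢ ou (trans q (sym p)))
          ... | inj₁ p | inj₂ q | inj₁ s = ⊥-elim (inside≢ ov (trans s (sym p)))
          ... | inj₁ p | inj₂ q | inj₂ s = trans q (sym s)
          ... | inj₂ p | inj₂ q | _      = ⊥-elim (inside≢ ou (trans q (sym p)))
          ... | inj₂ p | inj₁ q | inj₂ s = ⊥-elim (inside≢ ov (trans s (sym p)))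
          ... | inj₂ p | inj₁ q | inj₁ s = trans q (sym s)

      -- The half `i` without its apices, together with the apex `j` if `k` holds. Such sets are the
      -- ones that the path fails to leave.
      Both : ∀ i j → Bool → V → Bool
      Both i j k (part i′ j′ x) = ⌊ i′ ≟B i ⌋
      Both i j k (apex k′)      = k ∧ ⌊ k′ ≟B j ⌋

      not≢ : ∀ i → ⌊ not i ≟B i ⌋ ≡ false
      not≢ true  = refl
      not≢ false = refl

      -- Without ends in the half `i`, neither of its parts uses its apex, and the bridges stay in
      -- the half; so the path never leaves it.
      claim₁ : ∀ i → Endless i false → Endless i true → ⊥
      claim₁ i e₀ e₁ = true≢false
        (path-conn Z closed (part i false (b i false)) (apex true) (≟B-refl i)) refl
        where
        Z : V → Bool
        Z = Both i false false
        no-apex : ∀ j x → ¬ m (just (part i j x)) (just (apex j)) ≡ true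
        no-apex false x e = endless i false e₀ x (m-sym (just (part i false x)) (just (apex false)) e)
        no-apex true  x e = endless i true  e₁ x (m-sym (just (part i true x)) (just (apex true)) e)
        closed : ∀ u v → Z u ≡ true → m (just u) (just v) ≡ true → Z v ≡ true
        closed (part i′ j x) v z e with i′ ≟B i
        ... | yes refl with exits i j x v (m-adj (just (part i j x)) (just v) e)
        ...   | inj₁ (nothing , refl)   = ⊥-elim (no-apex j x e)
        ...   | inj₁ (just y , refl)    = ≟B-refl i
        ...   | inj₂ (inj₁ (_ , refl))  = ≟B-refl i
        ...   | inj₂ (inj₂ (_ , refl))  = ≟B-refl i

      -- If neither part at the apex `j` uses it, the apex has no neighbour on the closed path but
      -- the extra vertex, and it needs two.
      claim₂ : ∀ j → Endless false j → Endless true j → ⊥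
      claim₂ j e₀ e₁ with nbrs (just (apex j))
      ... | twoNbrs x y x≢y mx my _ = x≢y (trans (end x mx) (sym (end y my)))
        where
        end : ∀ w → m (just (apex j)) w ≡ true → w ≡ nothing
        end nothing  e = refl
        end (just v) e with apex-nbr j v (m-adj (just (apex j)) (just v) e)
        ... | false , x , refl = ⊥-elim (endless false j e₀ x e)
        ... | true  , x , refl = ⊥-elim (endless true j e₁ x e)

      -- The part `(i , j)` does not use its apex, and at the other apex the part of the other half
      -- is not entered. Hence the half `i` together with the apex `not j` is never left.
      claim₃ : ∀ i j → Endless i j → Endless (not i) (not j) → ⊥
      claim₃ i j e₀ e₁ = true≢false
        (path-conn Z closed (part i j (b i j)) (part (not i) j (b (not i) j)) (≟B-refl i)) (not≢ i)
        where
        Z : V → Bool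
        Z = Both i (not j) true
        no-entry : ∀ i′ → i′ ≡ not i → ∀ x → ¬ m (just (apex (not j))) (just (part i′ (not j) x)) ≡ true
        no-entry _ refl = endless (not i) (not j) e₁
        closed : ∀ u v → Z u ≡ true → m (just u) (just v) ≡ true → Z v ≡ true
        closed (part i′ k x) v z e with i′ ≟B i
        ... | yes refl with exits i k x v (m-adj (just (part i k x)) (just v) e)
        ...   | inj₁ (just y , refl)    = ≟B-refl i
        ...   | inj₂ (inj₁ (_ , refl))  = ≟B-refl i
        ...   | inj₂ (inj₂ (_ , refl))  = ≟B-refl i
        ...   | inj₁ (nothing , refl) with k ≟B j
        ...     | yes refl = ⊥-elim (endless i j e₀ x (m-sym (just (part i j x)) (just (apex j)) e))
        ...     | no k≢j rewrite ¬-not k≢j = ≟B-refl (not j)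
        closed (apex k) v z e with k ≟B not j
        ... | yes refl with apex-nbr (not j) v (m-adj (just (apex (not j))) (just v) e)
        ...   | i′ , x , refl with i′ ≟B i
        ...     | yes _   = refl
        ...     | no i′≢i = ⊥-elim (no-entry i′ (¬-not i′≢i) x e)

      lies : V → Bool → Bool → Bool
      lies (apex _)     i j = false
      lies (part i′ j′ _) i j = ⌊ i′ ≟B i ⌋ ∧ ⌊ j′ ≟B j ⌋

      ends : ∀ i j → lies h i j ≡ false → lies t i j ≡ false → Endless i j
      ends i j lh lt x e with TwoNbrs.only (nbrs nothing) (just (part i j x)) e
      ... | inj₁ refl = true≢false (cong₂ _∧_ (≟B-refl i) (≟B-refl j)) lh
      ... | inj₂ p rewrite sym (just-injective p) = true≢false (cong₂ _∧_ (≟B-refl i) (≟B-refl j)) lt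

      elsewhere : ∀ u {i j} → lies u i j ≡ true → ∀ i′ j′ → ⌊ i ≟B i′ ⌋ ∧ ⌊ j ≟B j′ ⌋ ≡ false → lies u i′ j′ ≡ false
      elsewhere (part i j x) l i′ j′ d with ∧⁻ l
      ... | p , q with isYes⁻ (i ≟B _) p | isYes⁻ (j ≟B _) q
      ...   | refl | refl = d

      some-end : ∀ i → ∃ λ j → lies h i j ≡ true ⊎ lies t i j ≡ true
      some-end i with lies h i false in h₀ | lies t i false in t₀ | lies h i true in h₁ | lies t i true in t₁
      ... | true  | _     | _     | _     = false , inj₁ h₀
      ... | false | true  | _     | _     = false , inj₂ t₀
      ... | false | false | true  | _     = true , inj₁ h₁
      ... | false | false | false | true  = true , inj₂ t₁
      ... | false | false | false | false = ⊥-elim (claim₁ i (ends i false h₀ t₀) (ends i true h₁ t₁))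

      two-ends : ∀ u v → (∀ i j → lies u i j ≡ false → lies v i j ≡ false → Endless i j) →
                 ∀ j j′ → lies u false j ≡ true → lies v true j′ ≡ true → ⊥
      two-ends u v en j j′ lu lv = meet j j′ (free₀ j lu lv) (free₁ j′ lu lv)
        where
        free₀ : ∀ j → lies u false j ≡ true → lies v true j′ ≡ true → Endless false (not j)
        free₀ false lu lv = en false true (elsewhere u lu false true refl) (elsewhere v lv false true refl)
        free₀ true  lu lv = en false false (elsewhere u lu false false refl) (elsewhere v lv false false refl)
        free₁ : ∀ j′ → lies u false j ≡ true → lies v true j′ ≡ true → Endless true (not j′)
        free₁ false lu lv = en true true (elsewhere u lu true true refl) (elsewhere v lv true true refl)
        free₁ true  lu lv = en true false (elsewhere u lu true false refl) (elsewhere v lv true false refl)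
        meet : ∀ j j′ → Endless false (not j) → Endless true (not j′) → ⊥
        meet false false e e′ = claim₂ true e e′
        meet true  true  e e′ = claim₂ false e e′
        meet false true  e e′ = claim₃ false true e e′
        meet true  false e e′ = claim₃ false false e e′

      -- By `claim₁` each half holds an end of the path, so each holds exactly one. The part without
      -- an end in one half and that in the other share an apex or lie diagonally, against `claim₂`
      -- and `claim₃`.
      contradiction : ⊥
      contradiction with some-end false | some-end true
      ... | j , inj₁ a | j′ , inj₁ a′ = true≢false a (elsewhere h a′ false j refl)
      ... | j , inj₁ a | j′ , inj₂ a′ = two-ends h t ends j j′ a a′
      ... | j , inj₂ a | j′ , inj₁ a′ = two-ends t h (λ i j x y → ends i j y x) j j′ a a′
      ... | j , inj₂ a | j′ , inj₂ a′ = true≢false a (elsewhere t a′ false j refl)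

-- Hamiltonian paths of the frame minus a vertex

module FrameTours where

  open Sound
  open PathCycle
  open Frame
  open import Data.Bool using (Bool; true; false; _∧_; _∨_; not; if_then_else_)
  open import Data.Bool.Properties using () renaming (_≟_ to _≟B_)
  open import Data.Nat using (ℕ; suc; _+_)
  open import Data.Nat.Properties using (+-comm; +-identityʳ)
  open import Data.List using (List; []; _∷_; map; _++_; reverse)
  open import Data.List.Properties using (unfold-reverse)
  open import Data.Maybe using (Maybe; just; nothing)
  open import Data.Product using (Σ; ∃; _×_; _,_)
  open import Data.Sum using (inj₁; inj₂)
  open import Data.Empty using (⊥-elim)
  open import Relation.Nullary using (¬_; yes; no; ⌊_⌋)
  open import Relation.Binary.Definitions using (DecidableEquality)
  open import Relation.Binary.PropositionalEquality

  module _ {V : Set} {R : V → V → Bool} where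

    route-++ : ∀ {x y y′ z l l′} → Route R x l y → R y y′ ≡ true → Route R y′ l′ z → Route R x (l ++ l′) z
    route-++ (stay _)    e r′ = step e r′
    route-++ (step e′ r) e r′ = step e′ (route-++ r e r′)

    route-reverse : (∀ u v → R u v ≡ R v u) → ∀ {x y l} → Route R x l y → Route R y (reverse l) x
    route-reverse s (stay x) = stay x
    route-reverse s {x} (step {l = l} e r) rewrite unfold-reverse x l =
      route-++ (route-reverse s r) (trans (s _ _) e) (stay x)

  route-map : ∀ {V W : Set} {R : V → V → Bool} {S : W → W → Bool} (f : V → W) → (∀ u v → R u v ≡ true → S (f u) (f v) ≡ true) →
              ∀ {x y l} → Route R x l y → Route S (f x) (map f l) (f y)
  route-map f h (stay x)   = stay (f x)
  route-map f h (step e r) = step (h _ _ e) (route-map f h r)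

  module Occ {V : Set} (_≟_ : DecidableEquality V) where

    occ-++ : ∀ v l l′ → occ _≟_ v (l ++ l′) ≡ occ _≟_ v l + occ _≟_ v l′
    occ-++ v []      l′ = refl
    occ-++ v (x ∷ l) l′ with x ≟ v
    ... | yes _ = cong suc (occ-++ v l l′)
    ... | no  _ = occ-++ v l l′

    occ-snoc : ∀ v l x → occ _≟_ v (l ++ x ∷ []) ≡ occ _≟_ v (x ∷ l)
    occ-snoc v l x = trans (occ-++ v l (x ∷ [])) (trans (+-comm (occ _≟_ v l) _) (sym (occ-++ v (x ∷ []) l)))

    occ-reverse : ∀ v l → occ _≟_ v (reverse l) ≡ occ _≟_ v l
    occ-reverse v []      = refl
    occ-reverse v (x ∷ l) rewrite unfold-reverse x l =
      trans (occ-snoc v (reverse l) x) (consed (occ-reverse v l))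
      where
      consed : ∀ {l l′} → occ _≟_ v l ≡ occ _≟_ v l′ → occ _≟_ v (x ∷ l) ≡ occ _≟_ v (x ∷ l′)
      consed e with x ≟ v
      ... | yes _ = cong suc e
      ... | no  _ = e

    occ-single : ∀ x v → occ _≟_ v (x ∷ []) + indicator ⌊ x ≟ v ⌋ ≡ 1
    occ-single x v with x ≟ v
    ... | yes _ = refl
    ... | no  _ = refl

  module _ {V W : Set} (_≟V_ : DecidableEquality V) (_≟W_ : DecidableEquality W) (f : V → W) where

    occ-map : (∀ {u v} → f u ≡ f v → u ≡ v) → ∀ v l → occ _≟W_ (f v) (map f l) ≡ occ _≟V_ v l
    occ-map inj v []      = refl
    occ-map inj v (x ∷ l) with f x ≟W f v | x ≟V v
    ... | yes _ | yes _ = cong suc (occ-map inj v l)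
    ... | no _  | no _  = occ-map inj v l
    ... | yes p | no q  = ⊥-elim (q (inj p))
    ... | no p  | yes q = ⊥-elim (p (cong f q))

  occ-map-none : ∀ {V W : Set} (_≟W_ : DecidableEquality W) (f : V → W) w → (∀ v → ¬ f v ≡ w) → ∀ l → occ _≟W_ w (map f l) ≡ 0
  occ-map-none _≟W_ f w no-w []      = refl
  occ-map-none _≟W_ f w no-w (x ∷ l) with f x ≟W w
  ... | yes p = ⊥-elim (no-w x p)
  ... | no _  = occ-map-none _≟W_ f w no-w l

  reverse-tour : ∀ {V : Set} {_≟_ : DecidableEquality V} {R miss x y} → (∀ u v → R u v ≡ R v u) →
                 Tour _≟_ R miss x y → Tour _≟_ R miss y x
  reverse-tour {_≟_ = _≟_} s (tour l r sp) =
    tour (reverse l) (route-reverse s r) (spanning λ v → trans (Occ.occ-reverse _≟_ v l) (visits sp v))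

  module FrameTours (F : Bool → Bool → Fragment) where

    open Frame.Frame F

    ι-injective : ∀ i j {u v} → ι i j u ≡ ι i j v → u ≡ v
    ι-injective i j {nothing} {nothing} _    = refl
    ι-injective i j {just x}  {just .x} refl = refl

    hitsPart : ∀ {i j i′ j′} → Rel i j i′ j′ → X i′ j′ → List (Maybe (X i j)) → ℕ
    hitsPart same    x l = occ _≟A_ (just x) l
    hitsPart across  x l = 0
    hitsPart (far _) x l = 0

    hits : ∀ i j → V → List (Maybe (X i j)) → ℕ
    hits i j (part i′ j′ x) l = hitsPart (compare i j i′ j′) x l
    hits i j (apex k)       l = if ⌊ k ≟B j ⌋ then occ _≟A_ nothing l else 0

    occ-ι : ∀ i j u l → occ _≟V_ u (map (ι i j) l) ≡ hits i j u l
    occ-ι i j (apex k) l with k ≟B j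
    ... | yes refl = occ-map _≟A_ _≟V_ (ι i j) (ι-injective i j) nothing l
    ... | no k≢j   = occ-map-none _≟V_ (ι i j) (apex k) (λ { nothing refl → k≢j refl }) l
    occ-ι i j (part i′ j′ x) l with compare i j i′ j′
    ... | same   = occ-map _≟A_ _≟V_ (ι i j) (ι-injective i j) (just x) l
    ... | across = occ-map-none _≟V_ (ι i j) _ (λ { (just y) e → j≢notj j e }) l
      where
      j≢notj : ∀ j {x y} → ¬ part i j x ≡ part i (not j) y
      j≢notj true  ()
      j≢notj false ()
    ... | far _  = occ-map-none _≟V_ (ι i j) _ (λ { (just y) e → i≢noti i e }) l
      where
      i≢noti : ∀ i {j j′ x y} → ¬ part i j x ≡ part (not i) j′ y
      i≢noti true  ()
      i≢noti false ()

    -- A path of the frame is kept as a list of stretches, each within one part, so that the number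
    -- of visits to a vertex splits into counts that the single tours supply.
    Piece : Set
    Piece = Σ Bool λ i → Σ Bool λ j → List (Maybe (X i j))

    flatten : List Piece → List V
    flatten []                 = []
    flatten ((i , j , l) ∷ ps) = map (ι i j) l ++ flatten ps

    total : V → List Piece → ℕ
    total u []                 = 0
    total u ((i , j , l) ∷ ps) = hits i j u l + total u ps

    occ-flatten : ∀ u ps → occ _≟V_ u (flatten ps) ≡ total u ps
    occ-flatten u []                 = refl
    occ-flatten u ((i , j , l) ∷ ps) = trans (Occ.occ-++ _≟V_ u (map (ι i j) l) (flatten ps)) (cong₂ _+_ (occ-ι i j u l) (occ-flatten u ps))

    lift : ∀ i j {u v l} → Route (adj i j) u l v → Route adjV (ι i j u) (map (ι i j) l) (ι i j v)
    lift i j = route-map (ι i j) (λ u v e → trans (adjV-ι i j u v) e)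

    adj-symm : ∀ i j u v → adj i j u v ≡ adj i j v u
    adj-symm i j = Fragment.adj-sym (F i j)

    -- The vertices to be missed are given inside part (i , j).
    missing : ∀ i j → (Maybe (X i j) → Bool) → V → Bool
    missing i j miss (apex k) = ⌊ k ≟B j ⌋ ∧ miss nothing
    missing i j miss (part i′ j′ x) = there? (compare i j i′ j′) x
      where
      there? : ∀ {i′ j′} → Rel i j i′ j′ → X i′ j′ → Bool
      there? same    x = miss (just x)
      there? across  x = false
      there? (far _) x = false

    SpansOf : ∀ i j → (Maybe (X i j) → Bool) → List (Maybe (X i j)) → Set
    SpansOf i j = Spans (_≟A_ {i} {j})

    module _ {i j : Bool} where

      open Occ (_≟A_ {i} {j})

      whole : ∀ {miss l} → SpansOf i j miss l → ∀ v → occ _≟A_ v l + 0 ≡ indicator (miss v)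
      whole s v = trans (+-identityʳ _) (visits s v)

      whole′ : ∀ {miss l} → SpansOf i j miss l → ∀ v → occ _≟A_ v (reverse l) + 0 ≡ indicator (miss v)
      whole′ {l = l} s v = trans (+-identityʳ _) (trans (occ-reverse v l) (visits s v))

      first : ∀ {l} t → SpansOf i j (λ v → Fragment.is (F i j) nothing v ∨ Fragment.is (F i j) (just t) v) l →
              ∀ x → occ _≟A_ (just x) (just t ∷ []) + (occ _≟A_ (just x) l + 0) ≡ 1
      first t s x = trans (cong (occ _≟A_ (just x) (just t ∷ []) +_) (trans (+-identityʳ _) (visits s (just x)))) (occ-single (just t) (just x))

      last′ : ∀ {l} t → SpansOf i j (λ v → Fragment.is (F i j) nothing v ∨ Fragment.is (F i j) (just t) v) l →
              ∀ x → occ _≟A_ (just x) (reverse l) + (occ _≟A_ (just x) (just t ∷ []) + 0) ≡ 1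
      last′ {l} t s x = trans (+-comm (occ _≟A_ (just x) (reverse l)) _)
        (trans (cong₂ _+_ (+-identityʳ (occ _≟A_ (just x) (just t ∷ []))) (trans (occ-reverse (just x) l) (visits s (just x)))) (occ-single (just t) (just x)))

    near : ∀ m {n k} → m ≡ k → n ≡ 0 → m + (n + 0) ≡ k
    near m e refl = trans (+-identityʳ m) e

    beyond : ∀ {m n} → m ≡ 0 → n ≡ 0 → m + suc (n + 0) ≡ 1
    beyond refl refl = refl

    bridge-b′ : ∀ i j → adjV (part i (not j) (b i (not j))) (part i j (b i j)) ≡ true
    bridge-b′ i j = trans (adjV-sym (part i (not j) (b i (not j))) (part i j (b i j))) (bridge-b i j)

    bridge-c′ : ∀ i j → adjV (part i (not j) (c i (not j))) (part i j (c i j)) ≡ true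
    bridge-c′ i j = trans (adjV-sym (part i (not j) (c i (not j))) (part i j (c i j))) (bridge-c i j)

    -- The path starts at b of `(i , not j)`, crosses `(i , j)` from b to c, sweeps the rest of
    -- `(i , not j)` from c to its apex, runs from there through `(not i , not j)` to b, crosses
    -- `(not i , j)` from b to c and ends at c of `(not i , not j)`. The apex `j` is met in `l₁`,
    -- unless it is the deleted vertex.
    bc-pieces : ∀ i j → List (Maybe (X i j)) → List (Maybe (X i (not j))) → List (Maybe (X (not i) (not j))) →
                List (Maybe (X (not i) j)) → List Piece
    bc-pieces i j l₁ l₂ l₃ l₄ =
      (i , not j , just (b i (not j)) ∷ []) ∷ (i , j , l₁) ∷ (i , not j , l₂) ∷ (i , not j , nothing ∷ []) ∷
      (not i , not j , reverse l₃) ∷ (not i , j , l₄) ∷ (not i , not j , just (c (not i) (not j)) ∷ []) ∷ []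

    but : ∀ i j → X i j → Maybe (X i j) → Bool
    but i j t v = Fragment.is (F i j) nothing v ∨ Fragment.is (F i j) (just t) v

    -- The index Booleans are split because `compare` and `not` reduce only on values. After that
    -- the pieces of other parts contribute nothing to the count, and one of `whole`, `first` and
    -- `last′` remains.
    bc-count : ∀ i j {miss l₁ l₂ l₃ l₄} u → SpansOf i j miss l₁ → SpansOf i (not j) (but i (not j) (b i (not j))) l₂ →
               SpansOf (not i) (not j) (but (not i) (not j) (c (not i) (not j))) l₃ →
               SpansOf (not i) j (Fragment.is (F (not i) j) nothing) l₄ →
               total u (bc-pieces i j l₁ l₂ l₃ l₄) ≡ indicator (missing i j miss u)
    bc-count false false (part false false x) s₁ s₂ s₃ s₄ = whole s₁ (just x)
    bc-count false false (part false true  x) s₁ s₂ s₃ s₄ = first _ s₂ x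
    bc-count false false (part true  true  x) s₁ s₂ s₃ s₄ = last′ _ s₃ x
    bc-count false false (part true  false x) s₁ s₂ s₃ s₄ = whole s₄ (just x)
    bc-count false true  (part false true  x) s₁ s₂ s₃ s₄ = whole s₁ (just x)
    bc-count false true  (part false false x) s₁ s₂ s₃ s₄ = first _ s₂ x
    bc-count false true  (part true  false x) s₁ s₂ s₃ s₄ = last′ _ s₃ x
    bc-count false true  (part true  true  x) s₁ s₂ s₃ s₄ = whole s₄ (just x)
    bc-count true  false (part true  false x) s₁ s₂ s₃ s₄ = whole s₁ (just x)
    bc-count true  false (part true  true  x) s₁ s₂ s₃ s₄ = first _ s₂ x
    bc-count true  false (part false true  x) s₁ s₂ s₃ s₄ = last′ _ s₃ x
    bc-count true  false (part false false x) s₁ s₂ s₃ s₄ = whole s₄ (just x)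
    bc-count true  true  (part true  true  x) s₁ s₂ s₃ s₄ = whole s₁ (just x)
    bc-count true  true  (part true  false x) s₁ s₂ s₃ s₄ = first _ s₂ x
    bc-count true  true  (part false false x) s₁ s₂ s₃ s₄ = last′ _ s₃ x
    bc-count true  true  (part false true  x) s₁ s₂ s₃ s₄ = whole s₄ (just x)
    bc-count i false {l₁ = l₁} (apex false) s₁ s₂ s₃ s₄ = near (occ _≟A_ nothing l₁) (visits s₁ nothing) (visits s₄ nothing)
    bc-count i true  {l₁ = l₁} (apex true)  s₁ s₂ s₃ s₄ = near (occ _≟A_ nothing l₁) (visits s₁ nothing) (visits s₄ nothing)
    bc-count i false {l₃ = l₃} (apex true)  s₁ s₂ s₃ s₄ = beyond (visits s₂ nothing) (trans (Occ.occ-reverse _≟A_ nothing l₃) (visits s₃ nothing))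
    bc-count i true  {l₃ = l₃} (apex false) s₁ s₂ s₃ s₄ = beyond (visits s₂ nothing) (trans (Occ.occ-reverse _≟A_ nothing l₃) (visits s₃ nothing))

    ends-b-c : ∀ i j {miss} → Tour _≟A_ (adj i j) miss (just (b i j)) (just (c i j)) →
               ∃ λ x → ∃ λ y → Tour _≟V_ adjV (missing i j miss) x y
    ends-b-c i j (tour l₁ r₁ s₁)
      with Fragment.c↠a (F i (not j)) | Fragment.b↠a (F (not i) (not j)) | Fragment.b→c (F (not i) j)
    ... | y₂ , e₂ , tour l₂ r₂ s₂ | y₃ , e₃ , tour l₃ r₃ s₃ | tour l₄ r₄ s₄ =
      _ , _ , tour (flatten (bc-pieces i j l₁ l₂ l₃ l₄)) route
        (spanning λ u → trans (occ-flatten u (bc-pieces i j l₁ l₂ l₃ l₄)) (bc-count i j u s₁ s₂ s₃ s₄))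
      where
      route : Route adjV _ (flatten (bc-pieces i j l₁ l₂ l₃ l₄)) _
      route = step (bridge-b′ i j) (route-++ (lift i j r₁) (bridge-c i j)
        (route-++ (lift i (not j) r₂) (trans (adjV-ι i (not j) (just y₂) nothing) e₂)
        (step (trans (adjV-ι (not i) (not j) nothing (just y₃)) (trans (adj-symm (not i) (not j) nothing (just y₃)) e₃))
        (route-++ (lift (not i) (not j) (route-reverse (adj-symm (not i) (not j)) r₃)) (bridge-b′ (not i) j)
        (route-++ (lift (not i) j r₄) (bridge-c (not i) j) (stay _))))))

    -- For a tour `l₁` of `(i , j)` that ends at the apex. The path arrives through all of
    -- `(i , not j)` including its apex, follows `l₁`, goes on from the apex `j` through
    -- `(not i , j)` except t, crosses `(not i , not j)` between b and c, and ends at t, which is b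
    -- or c of `(not i , j)`.
    end-pieces : ∀ i j → List (Maybe (X i (not j))) → List (Maybe (X i j)) → List (Maybe (X (not i) j)) →
                 List (Maybe (X (not i) (not j))) → X (not i) j → List Piece
    end-pieces i j l₀ l₁ l₂ l₃ t =
      (i , not j , reverse l₀) ∷ (i , j , l₁) ∷ (not i , j , reverse l₂) ∷ (not i , not j , l₃) ∷ (not i , j , just t ∷ []) ∷ []

    end-count : ∀ i j {miss l₀ l₁ l₂ l₃} t u → SpansOf i (not j) (λ _ → false) l₀ → SpansOf i j miss l₁ →
                SpansOf (not i) j (but (not i) j t) l₂ → SpansOf (not i) (not j) (Fragment.is (F (not i) (not j)) nothing) l₃ →
                total u (end-pieces i j l₀ l₁ l₂ l₃ t) ≡ indicator (missing i j miss u)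
    end-count false false t (part false false x) s₀ s₁ s₂ s₃ = whole s₁ (just x)
    end-count false false t (part false true  x) s₀ s₁ s₂ s₃ = whole′ s₀ (just x)
    end-count false false t (part true  false x) s₀ s₁ s₂ s₃ = last′ t s₂ x
    end-count false false t (part true  true  x) s₀ s₁ s₂ s₃ = whole s₃ (just x)
    end-count false true  t (part false true  x) s₀ s₁ s₂ s₃ = whole s₁ (just x)
    end-count false true  t (part false false x) s₀ s₁ s₂ s₃ = whole′ s₀ (just x)
    end-count false true  t (part true  true  x) s₀ s₁ s₂ s₃ = last′ t s₂ x
    end-count false true  t (part true  false x) s₀ s₁ s₂ s₃ = whole s₃ (just x)
    end-count true  false t (part true  false x) s₀ s₁ s₂ s₃ = whole s₁ (just x)
    end-count true  false t (part true  true  x) s₀ s₁ s₂ s₃ = whole′ s₀ (just x)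
    end-count true  false t (part false false x) s₀ s₁ s₂ s₃ = last′ t s₂ x
    end-count true  false t (part false true  x) s₀ s₁ s₂ s₃ = whole s₃ (just x)
    end-count true  true  t (part true  true  x) s₀ s₁ s₂ s₃ = whole s₁ (just x)
    end-count true  true  t (part true  false x) s₀ s₁ s₂ s₃ = whole′ s₀ (just x)
    end-count true  true  t (part false true  x) s₀ s₁ s₂ s₃ = last′ t s₂ x
    end-count true  true  t (part false false x) s₀ s₁ s₂ s₃ = whole s₃ (just x)
    end-count i false {l₁ = l₁} {l₂} t (apex false) s₀ s₁ s₂ s₃ =
      near (occ _≟A_ nothing l₁) (visits s₁ nothing) (trans (Occ.occ-reverse _≟A_ nothing l₂) (visits s₂ nothing))
    end-count i true  {l₁ = l₁} {l₂} t (apex true)  s₀ s₁ s₂ s₃ =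
      near (occ _≟A_ nothing l₁) (visits s₁ nothing) (trans (Occ.occ-reverse _≟A_ nothing l₂) (visits s₂ nothing))
    end-count i false {l₀ = l₀} t (apex true)  s₀ s₁ s₂ s₃ =
      near (occ _≟A_ nothing (reverse l₀)) (trans (Occ.occ-reverse _≟A_ nothing l₀) (visits s₀ nothing)) (visits s₃ nothing)
    end-count i true  {l₀ = l₀} t (apex false) s₀ s₁ s₂ s₃ =
      near (occ _≟A_ nothing (reverse l₀)) (trans (Occ.occ-reverse _≟A_ nothing l₀) (visits s₀ nothing)) (visits s₃ nothing)

    ends-b-a : ∀ i j {miss} → Tour _≟A_ (adj i j) miss (just (b i j)) nothing →
               ∃ λ x → ∃ λ y → Tour _≟V_ adjV (missing i j miss) x y
    ends-b-a i j (tour l₁ r₁ s₁)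
      with Fragment.b↠ (F i (not j)) | Fragment.c↠a (F (not i) j)
         | reverse-tour (adj-symm (not i) (not j)) (Fragment.b→c (F (not i) (not j)))
    ... | y₀ , tour l₀ r₀ s₀ | y₂ , e₂ , tour l₂ r₂ s₂ | tour l₃ r₃ s₃ =
      _ , _ , tour (flatten ps) route (spanning λ u → trans (occ-flatten u ps) (end-count i j _ u s₀ s₁ s₂ s₃))
      where
      ps = end-pieces i j l₀ l₁ l₂ l₃ (b (not i) j)
      route : Route adjV _ (flatten ps) _
      route = route-++ (lift i (not j) (route-reverse (adj-symm i (not j)) r₀)) (bridge-b′ i j)
        (route-++ (lift i j r₁) (trans (adjV-ι (not i) j nothing (just y₂)) (trans (adj-symm (not i) j nothing (just y₂)) e₂))
        (route-++ (lift (not i) j (route-reverse (adj-symm (not i) j) r₂)) (bridge-c (not i) j)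
        (route-++ (lift (not i) (not j) r₃) (bridge-b′ (not i) j) (stay _))))

    ends-c-a : ∀ i j {miss} → Tour _≟A_ (adj i j) miss (just (c i j)) nothing →
               ∃ λ x → ∃ λ y → Tour _≟V_ adjV (missing i j miss) x y
    ends-c-a i j (tour l₁ r₁ s₁)
      with Fragment.c↠ (F i (not j)) | Fragment.b↠a (F (not i) j) | Fragment.b→c (F (not i) (not j))
    ... | y₀ , tour l₀ r₀ s₀ | y₂ , e₂ , tour l₂ r₂ s₂ | tour l₃ r₃ s₃ =
      _ , _ , tour (flatten ps) route (spanning λ u → trans (occ-flatten u ps) (end-count i j _ u s₀ s₁ s₂ s₃))
      where
      ps = end-pieces i j l₀ l₁ l₂ l₃ (c (not i) j)
      route : Route adjV _ (flatten ps) _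
      route = route-++ (lift i (not j) (route-reverse (adj-symm i (not j)) r₀)) (bridge-c′ i j)
        (route-++ (lift i j r₁) (trans (adjV-ι (not i) j nothing (just y₂)) (trans (adj-symm (not i) j nothing (just y₂)) e₂))
        (route-++ (lift (not i) j (route-reverse (adj-symm (not i) j) r₂)) (bridge-b (not i) j)
        (route-++ (lift (not i) (not j) r₃) (bridge-c′ (not i) j) (stay _))))

    missing-ι : ∀ i j t u → missing i j (Fragment.is (F i j) t) u ≡ ⌊ ι i j t ≟V u ⌋
    missing-ι i j t u = bool-ext (to u) (λ e → trans (cong (missing i j _) (sym (isYes⁻ (ι i j t ≟V u) e))) (at t))
      where
      to : ∀ u → missing i j (Fragment.is (F i j) t) u ≡ true → ⌊ ι i j t ≟V u ⌋ ≡ true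
      to (apex k) e with k ≟B j | e
      ... | yes refl | e′ = isYes⁺ (ι i j t ≟V apex j) (cong (ι i j) (isYes⁻ (t ≟A nothing) e′))
      to (part i′ j′ x) e with compare i j i′ j′ | e
      ... | same | e′ = isYes⁺ (ι i j t ≟V part i j x) (cong (ι i j) (isYes⁻ (t ≟A just x) e′))
      at : ∀ t → missing i j (Fragment.is (F i j) t) (ι i j t) ≡ true
      at nothing  rewrite ≟B-refl j = refl
      at (just x) rewrite compare-same i j = isYes⁺ (_≟A_ {i} {j} (just x) (just x)) refl

    tour-without : ∀ v → ∃ λ x → ∃ λ y → Tour _≟V_ adjV (λ u → ⌊ v ≟V u ⌋) x y
    tour-without v = named v (avoiding v)
      where
      Found : V → Set
      Found v = ∃ λ i → ∃ λ j → ∃ λ t → v ≡ ι i j t × (∃ λ x → ∃ λ y → Tour _≟V_ adjV (missing i j (Fragment.is (F i j) t)) x y)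
      avoiding : ∀ v → Found v
      -- Either part at the apex will do: its tour from b to c avoids the apex, and the rest of the
      -- assembled path does not visit it.
      avoiding (apex j) = false , j , nothing , refl , ends-b-c false j (Fragment.b→c (F false j))
      avoiding (part i j x) with Fragment.avoid (F i j) x
      ... | inj₁ τ        = i , j , just x , refl , ends-b-c i j τ
      ... | inj₂ (inj₁ τ) = i , j , just x , refl , ends-b-a i j τ
      ... | inj₂ (inj₂ τ) = i , j , just x , refl , ends-c-a i j τ
      named : ∀ v → Found v → ∃ λ x → ∃ λ y → Tour _≟V_ adjV (λ u → ⌊ v ≟V u ⌋) x y
      named v (i , j , t , refl , x , y , tour l r s) =
        x , y , tour l r (spanning λ u → trans (visits s u) (cong indicator (missing-ι i j t u)))

-- A ring solver over the rationals with integer coefficients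

module QSolver where

  open import Data.Rational
  open import Data.Rational.Properties
  import Data.Rational.Unnormalised as ℚᵘ
  import Data.Rational.Unnormalised.Properties as ℚᵘP
  open import Data.Integer as ℤ using (ℤ; +_; -[1+_])
  import Data.Integer.Properties as ℤP
  import Data.Nat.Coprimality as Coprimality
  open import Data.Maybe using (Maybe; just; nothing)
  open import Relation.Nullary using (yes; no)
  open import Relation.Binary.PropositionalEquality
  import Algebra.Solver.Ring
  open import Algebra.Solver.Ring.AlmostCommutativeRing

  -- The integer as a fraction already in lowest terms; the numerator is read off by computation.
  κ : ℤ → ℚ
  κ z = mkℚ z 0 (Coprimality.sym (Coprimality.1-coprimeTo _))

  κ-+ : ∀ a b → κ (a ℤ.+ b) ≡ κ a + κ b
  κ-+ a b = toℚᵘ-injective (ℚᵘP.≃-trans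
    (ℚᵘ.*≡* (cong (ℤ._* (+ 1)) (sym (cong₂ ℤ._+_ (ℤP.*-identityʳ a) (ℤP.*-identityʳ b)))))
    (ℚᵘP.≃-sym (toℚᵘ-homo-+ (κ a) (κ b))))

  κ-* : ∀ a b → κ (a ℤ.* b) ≡ κ a * κ b
  κ-* a b = toℚᵘ-injective (ℚᵘP.≃-trans (ℚᵘ.*≡* refl) (ℚᵘP.≃-sym (toℚᵘ-homo-* (κ a) (κ b))))

  κ-neg : ∀ a → κ (ℤ.- a) ≡ - κ a
  κ-neg (+ 0)                = refl
  κ-neg (ℤ.+[1+ n ])         = refl
  κ-neg -[1+ n ]             = refl

  coeff-eq : ∀ a b → Maybe (κ a ≡ κ b)
  coeff-eq a b with a ℤ.≟ b
  ... | yes p = just (cong κ p)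
  ... | no _  = nothing

  embedding : ℤ.+-*-rawRing -Raw-AlmostCommutative⟶ fromCommutativeRing +-*-commutativeRing
  embedding = record { ⟦_⟧ = κ; +-homo = κ-+; *-homo = κ-*; -‿homo = κ-neg; 0-homo = refl; 1-homo = refl }

  -- The solver of the library computes with rational coefficients, which is slow.
  open Algebra.Solver.Ring ℤ.+-*-rawRing (fromCommutativeRing +-*-commutativeRing) embedding coeff-eq
    public using (solve; _:+_; _:*_; _:-_; :-_; _:=_; con)

-- Segments and separating lines

module Plane where

  open import Defs using (Point; OnSegment)
  open import Data.Rational using (ℚ; 0ℚ; 1ℚ; _+_; _*_; _-_; -_; _≤_; _<_; *<*; *≤*; positive; nonNegative)
  open import Data.Rational.Properties
  open QSolver
  open import Data.Integer as ℤ using (ℤ; +_; -[1+_])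
  import Data.Integer.Properties as ℤP
  open import Data.Bool using (Bool; true; false; _∨_; not)
  open import Data.Nat using (zero; suc)
  open import Data.Product using (Σ-syntax; _×_; _,_; proj₁; proj₂)
  open import Data.Sum using (_⊎_; inj₁; inj₂; [_,_]′)
  open import Data.Empty using (⊥-elim)
  open import Relation.Binary.PropositionalEquality

  Line : Set
  Line = ℚ × ℚ × ℚ

  ev : Line → Point → ℚ
  ev (α , β , γ) (x , y) = α * x + β * y + γ

  -- An affine function is affine in the parameter of a segment. All geometry below is thereby
  -- reduced to signs of such functions at the ends of segments.
  ev-segment : ∀ (L : Line) (p a b : Point) s →
    proj₁ p ≡ proj₁ a + s * (proj₁ b - proj₁ a) → proj₂ p ≡ proj₂ a + s * (proj₂ b - proj₂ a) →
    ev L p ≡ ev L a + s * (ev L b - ev L a)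
  ev-segment (α , β , γ) (_ , _) (ax , ay) (bx , by) s refl refl =
    solve 8 (λ α β γ ax ay bx by s →
        α :* (ax :+ s :* (bx :- ax)) :+ β :* (ay :+ s :* (by :- ay)) :+ γ
        := (α :* ax :+ β :* ay :+ γ) :+ s :* ((α :* bx :+ β :* by :+ γ) :- (α :* ax :+ β :* ay :+ γ)))
      refl α β γ ax ay bx by s

  convex : ∀ s u v → u + s * (v - u) ≡ (1ℚ - s) * u + s * v
  convex = solve 3 (λ s u v → u :+ s :* (v :- u) := (con (+ 1) :- s) :* u :+ s :* v) refl

  convex-const : ∀ s m → (1ℚ - s) * m + s * m ≡ m
  convex-const = solve 2 (λ s m → (con (+ 1) :- s) :* m :+ s :* m := m) refl

  1-s≥0 : ∀ {s} → s ≤ 1ℚ → 0ℚ ≤ 1ℚ - s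
  1-s≥0 {s} h = subst (_≤ 1ℚ - s) (+-inverseʳ s) (+-monoˡ-≤ (- s) h)

  between-≥ : ∀ {s u v m} → 0ℚ ≤ s → s ≤ 1ℚ → m ≤ u → m ≤ v → m ≤ u + s * (v - u)
  between-≥ {s} {u} {v} {m} s≥0 s≤1 hu hv = subst₂ _≤_ (convex-const s m) (sym (convex s u v))
    (+-mono-≤ (*-monoˡ-≤-nonNeg (1ℚ - s) {{nonNegative (1-s≥0 s≤1)}} hu) (*-monoˡ-≤-nonNeg s {{nonNegative s≥0}} hv))

  between-≤ : ∀ {s u v m} → 0ℚ ≤ s → s ≤ 1ℚ → u ≤ m → v ≤ m → u + s * (v - u) ≤ m
  between-≤ {s} {u} {v} {m} s≥0 s≤1 hu hv = subst₂ _≤_ (sym (convex s u v)) (convex-const s m)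
    (+-mono-≤ (*-monoˡ-≤-nonNeg (1ℚ - s) {{nonNegative (1-s≥0 s≤1)}} hu) (*-monoˡ-≤-nonNeg s {{nonNegative s≥0}} hv))

  between-< : ∀ {s u v} → 0ℚ ≤ s → s ≤ 1ℚ → u < 0ℚ → v < 0ℚ → u + s * (v - u) < 0ℚ
  between-< {s} {u} {v} s≥0 s≤1 hu hv with ≤-total u v
  ... | inj₁ u≤v = ≤-<-trans (between-≤ s≥0 s≤1 u≤v ≤-refl) hv
  ... | inj₂ v≤u = ≤-<-trans (between-≤ s≥0 s≤1 ≤-refl v≤u) hu

  onSegment-sym : ∀ {p a b} → OnSegment p a b → OnSegment p b a
  onSegment-sym {px , py} {ax , ay} {bx , by} (s , s≥0 , s≤1 , ex , ey) =
    1ℚ - s , 1-s≥0 s≤1 ,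
    subst (1ℚ - s ≤_) (+-identityʳ 1ℚ) (+-monoʳ-≤ 1ℚ (neg-antimono-≤ s≥0)) ,
    trans ex (back ax bx s) , trans ey (back ay by s)
    where
    back : ∀ a b s → a + s * (b - a) ≡ b + (1ℚ - s) * (a - b)
    back = solve 3 (λ a b s → a :+ s :* (b :- a) := b :+ (con (+ 1) :- s) :* (a :- b)) refl

  only-start : ∀ {s u v q} → 0ℚ ≤ s → u ≡ 0ℚ → 0ℚ < v → q ≡ u + s * (v - u) → q ≤ 0ℚ → s ≡ 0ℚ
  only-start {s} {.0ℚ} {v} s≥0 refl hv refl hq = ≤-antisym (*-cancelʳ-≤-pos v {{positive hv}} below) s≥0
    where
    below : s * v ≤ 0ℚ * v
    below = subst₂ _≤_ (solve 2 (λ s v → con (+ 0) :+ s :* (v :- con (+ 0)) := s :* v) refl s v) (sym (*-zeroˡ v)) hq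

  collapse : ∀ {s q a b} → s ≡ 0ℚ → q ≡ a + s * (b - a) → q ≡ a
  collapse {a = a} {b} refl e = trans e (solve 2 (λ a b → a :+ con (+ 0) :* (b :- a) := a) refl a b)

  Meeting : {V : Set} → (V → Point) → V → V → V → V → Point → Set
  Meeting {V} pos a b c d p =
    (a ≡ c × b ≡ d) ⊎ (a ≡ d × b ≡ c) ⊎ (Σ[ x ∈ V ] ((x ≡ a ⊎ x ≡ b) × (x ≡ c ⊎ x ≡ d) × p ≡ pos x))

  -- The condition of a plane embedding on a single pair of edges, so that it can be proved pair by
  -- pair and moved along the symmetries of the pair.
  Meet : {V : Set} → (V → Point) → V → V → V → V → Set
  Meet pos a b c d = ∀ p → OnSegment p (pos a) (pos b) → OnSegment p (pos c) (pos d) → Meeting pos a b c d p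

  module Meets {V : Set} (pos : V → Point) where

    meeting-flip : ∀ {a b c d p} → Meeting pos a b c d p → Meeting pos c d a b p
    meeting-flip (inj₁ (refl , refl))            = inj₁ (refl , refl)
    meeting-flip (inj₂ (inj₁ (refl , refl)))     = inj₂ (inj₁ (refl , refl))
    meeting-flip (inj₂ (inj₂ (x , xa , xc , e))) = inj₂ (inj₂ (x , xc , xa , e))

    meeting-swap : ∀ {a b c d p} → Meeting pos a b c d p → Meeting pos b a c d p
    meeting-swap (inj₁ (refl , refl))            = inj₂ (inj₁ (refl , refl))
    meeting-swap (inj₂ (inj₁ (refl , refl)))     = inj₁ (refl , refl)
    meeting-swap (inj₂ (inj₂ (x , xa , xc , e))) = inj₂ (inj₂ (x , [ inj₂ , inj₁ ]′ xa , xc , e))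

    meet-flip : ∀ {a b c d} → Meet pos a b c d → Meet pos c d a b
    meet-flip m p i j = meeting-flip (m p j i)

    meet-swap : ∀ {a b c d} → Meet pos a b c d → Meet pos b a c d
    meet-swap {a} {b} m p i j = meeting-swap (m p (onSegment-sym {p} {pos b} {pos a} i) j)

    meet-same : ∀ {a b} → Meet pos a b a b
    meet-same p i j = inj₁ (refl , refl)

    -- A common point would have a value of at least zero as a point of ab and a negative value as a
    -- point of cd.
    strict : ∀ L {a b c d} → 0ℚ ≤ ev L (pos a) → 0ℚ ≤ ev L (pos b) → ev L (pos c) < 0ℚ → ev L (pos d) < 0ℚ →
             Meet pos a b c d
    strict L {a} {b} {c} {d} ha hb hc hd p (s , s≥0 , s≤1 , ex , ey) (t , t≥0 , t≤1 , fx , fy) =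
      ⊥-elim (<-irrefl refl (≤-<-trans
        (subst (0ℚ ≤_) (sym (ev-segment L p (pos a) (pos b) s ex ey)) (between-≥ s≥0 s≤1 ha hb))
        (subst (_< 0ℚ) (sym (ev-segment L p (pos c) (pos d) t fx fy)) (between-< t≥0 t≤1 hc hd))))

    -- Along xb the value is s times a positive number, along xd it is at most zero; so a common
    -- point has s = 0 and is x.
    fan : ∀ L {x b d} → ev L (pos x) ≡ 0ℚ → 0ℚ < ev L (pos b) → ev L (pos d) ≤ 0ℚ → Meet pos x b x d
    fan L {x} {b} {d} hx hb hd p (s , s≥0 , s≤1 , ex , ey) (t , t≥0 , t≤1 , fx , fy) =
      inj₂ (inj₂ (x , inj₁ refl , inj₁ refl , cong₂ _,_ (collapse {b = proj₁ (pos b)} s≡0 ex) (collapse {b = proj₂ (pos b)} s≡0 ey)))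
      where
      s≡0 : s ≡ 0ℚ
      s≡0 = only-start s≥0 hx hb (ev-segment L p (pos x) (pos b) s ex ey)
        (subst (_≤ 0ℚ) (sym (ev-segment L p (pos x) (pos d) t fx fy)) (between-≤ t≥0 t≤1 (≤-reflexive hx) hd))

  κ-< : ∀ {a b} → a ℤ.< b → κ a < κ b
  κ-< {a} {b} h = *<* (subst₂ ℤ._<_ (sym (ℤP.*-identityʳ a)) (sym (ℤP.*-identityʳ b)) h)

  κ-≤ : ∀ {a b} → a ℤ.≤ b → κ a ≤ κ b
  κ-≤ {a} {b} h = *≤* (subst₂ ℤ._≤_ (sym (ℤP.*-identityʳ a)) (sym (ℤP.*-identityʳ b)) h)

  Lineᶻ Pointᶻ : Set
  Lineᶻ  = ℤ × ℤ × ℤ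
  Pointᶻ = ℤ × ℤ

  evᶻ : Lineᶻ → Pointᶻ → ℤ
  evᶻ (α , β , γ) (x , y) = α ℤ.* x ℤ.+ β ℤ.* y ℤ.+ γ

  κᴸ : Lineᶻ → Line
  κᴸ (α , β , γ) = κ α , κ β , κ γ

  κᴾ : Pointᶻ → Point
  κᴾ (x , y) = κ x , κ y

  ev-κ : ∀ L p → ev (κᴸ L) (κᴾ p) ≡ κ (evᶻ L p)
  ev-κ (α , β , γ) (x , y) = sym (trans (κ-+ (α ℤ.* x ℤ.+ β ℤ.* y) γ)
    (cong (_+ κ γ) (trans (κ-+ (α ℤ.* x) (β ℤ.* y)) (cong₂ _+_ (κ-* α x) (κ-* β y)))))

  neg? zero? : ℤ → Bool
  neg? (+ _)    = false
  neg? -[1+ _ ] = true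
  zero? (+ 0)   = true
  zero? _       = false

  nonneg? pos? nonpos? : ℤ → Bool
  nonneg? z = not (neg? z)
  pos? z    = not (neg? z ∨ zero? z)
  nonpos? z = neg? z ∨ zero? z

  neg-ok : ∀ z → neg? z ≡ true → κ z < 0ℚ
  neg-ok -[1+ n ] _ = κ-< ℤ.-<+

  zero-ok : ∀ z → zero? z ≡ true → κ z ≡ 0ℚ
  zero-ok (+ zero) _ = refl

  nonneg-ok : ∀ z → nonneg? z ≡ true → 0ℚ ≤ κ z
  nonneg-ok (+ n) _ = κ-≤ (ℤ.+≤+ Data.Nat.z≤n)
    where import Data.Nat

  pos-ok : ∀ z → pos? z ≡ true → 0ℚ < κ z
  pos-ok (+ suc n) _ = κ-< (ℤ.+<+ (Data.Nat.s≤s Data.Nat.z≤n))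
    where import Data.Nat

  nonpos-ok : ∀ z → nonpos? z ≡ true → κ z ≤ 0ℚ
  nonpos-ok (+ zero) _ = ≤-refl
  nonpos-ok -[1+ n ] _ = <⇒≤ (neg-ok -[1+ n ] refl)

-- The drawing of the frame

module FramePlane where

  open import Defs using (Point; OnSegment)
  open Sound
  open PathCycle
  open Frame
  open Plane
  open import Data.Rational using (ℚ; 0ℚ; 1ℚ; _+_; _*_; _-_; -_; _≤_; _<_)
  open import Data.Rational.Properties
  open QSolver
  open import Data.Integer as ℤ using (+_; -[1+_])
  open import Data.Bool using (Bool; true; false; not; _∧_)
  open import Data.Bool.Properties using () renaming (_≟_ to _≟B_)
  open import Data.Maybe using (Maybe; just; nothing)
  open import Data.Product using (∃; _,_; proj₁; proj₂)
  open import Data.Sum using (inj₁; inj₂; [_,_]′)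
  open import Data.Empty using (⊥-elim)
  open import Relation.Nullary using (¬_; yes; no; ⌊_⌋)
  open import Relation.Binary.PropositionalEquality

  -- Each fragment is drawn in this triangle of the quadrant x < 0 < y, and the four parts are its
  -- mirror images in the axes. The corner a lies on the axis x = 0, so two images share it; b and c
  -- lie one unit above the axis y = 0, so the bridges are short vertical segments.
  corner-a corner-b corner-c : Pointᶻ
  corner-a = + 0 , + 300
  corner-b = -[1+ 599 ] , + 1
  corner-c = -[1+ 299 ] , + 1

  -- Supporting lines of the triangle with these corners at b and at c.
  line-b line-c : Lineᶻ
  line-b = + 1 , + 0 , + 600
  line-c = -[1+ 0 ] , + 2 , -[1+ 301 ]

  -- `left` and `above` keep the mirror images apart, `beyond-b` and `beyond-c` keep the bridges
  -- clear of the fragments. Through `nbr` and `nondegenerate` the injectivity of the placement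
  -- follows later from the conditions on edges alone.
  record Drawing (F : Fragment) : Set where
    open Fragment F
    field
      place   : Maybe X → Point
      at-a    : place nothing ≡ κᴾ corner-a
      at-b    : place (just b) ≡ κᴾ corner-b
      at-c    : place (just c) ≡ κᴾ corner-c
      left    : ∀ x → proj₁ (place (just x)) < 0ℚ
      above   : ∀ x → 0ℚ < proj₂ (place (just x))
      beyond-b : ∀ x → ¬ x ≡ b → 0ℚ < ev (κᴸ line-b) (place (just x))
      beyond-c : ∀ x → ¬ x ≡ c → 0ℚ < ev (κᴸ line-c) (place (just x))
      nbr      : ∀ u → ∃ λ v → adj u v ≡ true
      nondegenerate : ∀ u v → adj u v ≡ true → ¬ place u ≡ place v
      planar  : ∀ u v w z → adj u v ≡ true → adj w z ≡ true → Meet place u v w z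

  mirror : Bool → ℚ → ℚ
  mirror false q = q
  mirror true  q = - q

  mirror² : ∀ i q → mirror i (mirror i q) ≡ q
  mirror² false q = refl
  mirror² true  q = solve 1 (λ q → :- :- q := q) refl q

  flip : Bool → Bool → Point → Point
  flip i j (x , y) = mirror i x , mirror j y

  flip² : ∀ i j p → flip i j (flip i j p) ≡ p
  flip² i j (x , y) = cong₂ _,_ (mirror² i x) (mirror² j y)

  flipᴸ : Bool → Bool → Line → Line
  flipᴸ i j (α , β , γ) = mirror i α , mirror j β , γ

  mirror-* : ∀ i a x → mirror i a * mirror i x ≡ a * x
  mirror-* false a x = refl
  mirror-* true  a x = solve 2 (λ a x → (:- a) :* (:- x) := a :* x) refl a x

  ev-flip : ∀ i j L p → ev (flipᴸ i j L) (flip i j p) ≡ ev L p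
  ev-flip i j (α , β , γ) (x , y) = cong₂ (λ s t → s + t + γ) (mirror-* i α x) (mirror-* j β y)

  mirror-segment : ∀ i {q} a b s → q ≡ mirror i a + s * (mirror i b - mirror i a) → mirror i q ≡ a + s * (b - a)
  mirror-segment false a b s e    = e
  mirror-segment true  a b s refl =
    solve 3 (λ a b s → :- (:- a :+ s :* (:- b :- :- a)) := a :+ s :* (b :- a)) refl a b s

  flip-segment : ∀ i j {p a b} → OnSegment p (flip i j a) (flip i j b) → OnSegment (flip i j p) a b
  flip-segment i j {px , py} {ax , ay} {bx , by} (s , s≥0 , s≤1 , ex , ey) =
    s , s≥0 , s≤1 , mirror-segment i ax bx s ex , mirror-segment j ay by s ey

  -- The signs are such that on the image with the same index the value is the coordinate before
  -- mirroring, hence negative for `LX` off the apex and positive for `LY`.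
  LX LY : Bool → Line
  LX i = mirror i 1ℚ , 0ℚ , 0ℚ
  LY j = 0ℚ , mirror j 1ℚ , 0ℚ

  evX : ∀ i j p → ev (LX i) (flip i j p) ≡ proj₁ p
  evX false j (x , y) = solve 2 (λ x y → con (+ 1) :* x :+ con (+ 0) :* y :+ con (+ 0) := x) refl x (mirror j y)
  evX true  j (x , y) = solve 2 (λ x y → (:- con (+ 1)) :* (:- x) :+ con (+ 0) :* y :+ con (+ 0) := x) refl x (mirror j y)

  evX′ : ∀ i j p → ev (LX i) (flip (not i) j p) ≡ - proj₁ p
  evX′ false j (x , y) = solve 2 (λ x y → con (+ 1) :* (:- x) :+ con (+ 0) :* y :+ con (+ 0) := :- x) refl x (mirror j y)
  evX′ true  j (x , y) = solve 2 (λ x y → (:- con (+ 1)) :* x :+ con (+ 0) :* y :+ con (+ 0) := :- x) refl x (mirror j y)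

  evY : ∀ i j p → ev (LY j) (flip i j p) ≡ proj₂ p
  evY i false (x , y) = solve 2 (λ x y → con (+ 0) :* x :+ con (+ 1) :* y :+ con (+ 0) := y) refl (mirror i x) y
  evY i true  (x , y) = solve 2 (λ x y → con (+ 0) :* x :+ (:- con (+ 1)) :* (:- y) :+ con (+ 0) := y) refl (mirror i x) y

  evY′ : ∀ i j p → ev (LY j) (flip i (not j) p) ≡ - proj₂ p
  evY′ i false (x , y) = solve 2 (λ x y → con (+ 0) :* x :+ con (+ 1) :* (:- y) :+ con (+ 0) := :- y) refl (mirror i x) y
  evY′ i true  (x , y) = solve 2 (λ x y → con (+ 0) :* x :+ (:- con (+ 1)) :* y :+ con (+ 0) := :- y) refl (mirror i x) y

  negᴸ : Line → Line
  negᴸ (α , β , γ) = - α , - β , - γ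

  ev-neg : ∀ L p → ev (negᴸ L) p ≡ - ev L p
  ev-neg (α , β , γ) (x , y) =
    solve 5 (λ α β γ x y → (:- α) :* x :+ (:- β) :* y :+ (:- γ) := :- (α :* x :+ β :* y :+ γ)) refl α β γ x y

  module FramePlane (F : Bool → Bool → Fragment) (D : ∀ i j → Drawing (F i j)) where

    open Frame.Frame F

    posA : ∀ i j → Maybe (X i j) → Point
    posA i j = Drawing.place (D i j)

    posV : V → Point
    posV (part i j x) = flip i j (posA i j (just x))
    posV (apex j)     = flip false j (κᴾ corner-a)

    open Meets posV

    posV-ι : ∀ i j u → posV (ι i j u) ≡ flip i j (posA i j u)
    posV-ι i     j (just x) = refl
    posV-ι false j nothing  = cong (flip false j) (sym (Drawing.at-a (D false j)))
    posV-ι true  j nothing  = cong (flip true j) (sym (Drawing.at-a (D true j)))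

    upper : ∀ i j u → 0ℚ < proj₂ (posA i j u)
    upper i j (just x) = Drawing.above (D i j) x
    upper i j nothing  = subst (λ p → 0ℚ < proj₂ p) (sym (Drawing.at-a (D i j))) (pos-ok (+ 300) refl)

    data Edge : V → V → Set where
      inner   : ∀ i j u v → adj i j u v ≡ true → Edge (ι i j u) (ι i j v)
      bridgeᵇ : ∀ i j → Edge (part i j (b i j)) (part i (not j) (b i (not j)))
      bridgeᶜ : ∀ i j → Edge (part i j (c i j)) (part i (not j) (c i (not j)))

    edge : ∀ u v → adjV u v ≡ true → Edge u v
    edge (apex k) (part i j x) e with k ≟B j | e
    ... | yes refl | e′ = inner i j nothing (just x) e′
    edge (part i j x) (apex k) e with k ≟B j | e
    ... | yes refl | e′ = inner i j (just x) nothing e′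
    edge (part i j x) (part i′ j′ y) e with compare i j i′ j′ | e
    ... | same   | e′ = inner i j (just x) (just y) e′
    ... | across | e′ with ∨⁻ {⌊ x ≟X b i j ⌋ ∧ ⌊ y ≟X b i (not j) ⌋} e′
    ...   | inj₁ q with isYes⁻ (x ≟X _) (proj₁ (∧⁻ {⌊ x ≟X b i j ⌋} q)) | isYes⁻ (y ≟X _) (proj₂ (∧⁻ {⌊ x ≟X b i j ⌋} q))
    ...     | refl | refl = bridgeᵇ i j
    edge (part i j x) (part i′ j′ y) e | across | e′ | inj₂ q
      with isYes⁻ (x ≟X _) (proj₁ (∧⁻ {⌊ x ≟X c i j ⌋} q)) | isYes⁻ (y ≟X _) (proj₂ (∧⁻ {⌊ x ≟X c i j ⌋} q))
    ...     | refl | refl = bridgeᶜ i j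

    x<0 : ∀ i j x → ev (LX i) (posV (part i j x)) < 0ℚ
    x<0 i j x = subst (_< 0ℚ) (sym (evX i j _)) (Drawing.left (D i j) x)

    x>0 : ∀ i j x → 0ℚ < ev (LX i) (posV (part (not i) j x))
    x>0 i j x = subst (0ℚ <_) (sym (evX′ i j _)) (neg-antimono-< (Drawing.left (D (not i) j) x))

    x≡0 : ∀ i j → ev (LX i) (posV (apex j)) ≡ 0ℚ
    x≡0 i false = evX₀ i
      where
      evX₀ : ∀ i → ev (LX i) (κᴾ corner-a) ≡ 0ℚ
      evX₀ false = refl
      evX₀ true  = refl
    x≡0 i true = evX₀ i
      where
      evX₀ : ∀ i → ev (LX i) (flip false true (κᴾ corner-a)) ≡ 0ℚ
      evX₀ false = refl
      evX₀ true  = refl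

    x≥0 : ∀ i j u → 0ℚ ≤ ev (LX i) (posV (ι (not i) j u))
    x≥0 i j (just x) = <⇒≤ (x>0 i j x)
    x≥0 i j nothing  = ≤-reflexive (sym (x≡0 i j))

    y>0 : ∀ i j u → 0ℚ < ev (LY j) (posV (ι i j u))
    y>0 i j u = subst (0ℚ <_) (sym (trans (cong (ev (LY j)) (posV-ι i j u)) (evY i j _))) (upper i j u)

    y<0 : ∀ i j u → ev (LY j) (posV (ι i (not j) u)) < 0ℚ
    y<0 i j u = subst (_< 0ℚ) (sym (trans (cong (ev (LY j)) (posV-ι i (not j) u)) (evY′ i j _))) (neg-antimono-< (upper i (not j) u))

    vertical : ∀ i i′ j u v w z → Meet posV (ι i j u) (ι i j v) (ι i′ (not j) w) (ι i′ (not j) z)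
    vertical i i′ j u v w z = strict (LY j) (<⇒≤ (y>0 i j u)) (<⇒≤ (y>0 i j v)) (y<0 i′ j w) (y<0 i′ j z)

    sideways : ∀ i j j′ x y w z → Meet posV (part i j x) (part i j y) (ι (not i) j′ w) (ι (not i) j′ z)
    sideways i j j′ x y w z = meet-flip (strict (LX i) (x≥0 i j′ w) (x≥0 i j′ z) (x<0 i j x) (x<0 i j y))

    sideways′ : ∀ i j j′ x y w z → Meet posV (ι i j x) (ι i j y) (part (not i) j′ w) (part (not i) j′ z)
    sideways′ true  j j′ x y w z = meet-flip (sideways false j′ j w z x y)
    sideways′ false j j′ x y w z = meet-flip (sideways true j′ j w z x y)

    at-apex : ∀ i j x y → Meet posV (apex j) (part i j x) (apex j) (part (not i) j y)
    at-apex i j x y = meet-flip (fan (LX i) (x≡0 i j) (x>0 i j y) (<⇒≤ (x<0 i j x)))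

    -- The axis through the apex separates the two parts. Only edges that both end at the apex
    -- touch, and there they form a fan.
    beside : ∀ i j u v w z → adj i j u v ≡ true → adj (not i) j w z ≡ true →
             Meet posV (ι i j u) (ι i j v) (ι (not i) j w) (ι (not i) j z)
    beside i j nothing nothing w z e f = ⊥-elim (true≢false e (Fragment.adj-irr (F i j) nothing))
    beside i j u v nothing nothing e f = ⊥-elim (true≢false f (Fragment.adj-irr (F (not i) j) nothing))
    beside i j (just x) (just y) w z e f = sideways i j j x y w z
    beside i j u v (just x) (just y) e f = sideways′ i j j u v x y
    beside i j nothing (just x) nothing (just y) e f = at-apex i j x y
    beside i j (just x) nothing nothing (just y) e f = meet-swap (at-apex i j x y)
    beside i j nothing (just x) (just y) nothing e f = meet-flip (meet-swap (meet-flip (at-apex i j x y)))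
    beside i j (just x) nothing (just y) nothing e f = meet-swap (meet-flip (meet-swap (meet-flip (at-apex i j x y))))

    together : ∀ i j u v w z → adj i j u v ≡ true → adj i j w z ≡ true →
               Meet posV (ι i j u) (ι i j v) (ι i j w) (ι i j z)
    together i j u v w z e f p p₁ p₂ =
      placed (Drawing.planar (D i j) u v w z e f (flip i j p) (back u v p₁) (back w z p₂))
      where
      back : ∀ u v → OnSegment p (posV (ι i j u)) (posV (ι i j v)) → OnSegment (flip i j p) (posA i j u) (posA i j v)
      back u v o = flip-segment i j {p} {posA i j u} {posA i j v} (subst₂ (OnSegment p) (posV-ι i j u) (posV-ι i j v) o)
      placed : Meeting (posA i j) u v w z (flip i j p) → Meeting posV (ι i j u) (ι i j v) (ι i j w) (ι i j z) p
      placed (inj₁ (refl , refl))            = inj₁ (refl , refl)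
      placed (inj₂ (inj₁ (refl , refl)))     = inj₂ (inj₁ (refl , refl))
      placed (inj₂ (inj₂ (x , xa , xb , q))) = inj₂ (inj₂ (ι i j x
        , [ (λ { refl → inj₁ refl }) , (λ { refl → inj₂ refl }) ]′ xa
        , [ (λ { refl → inj₁ refl }) , (λ { refl → inj₂ refl }) ]′ xb
        , trans (sym (flip² i j p)) (trans (cong (flip i j) q) (sym (posV-ι i j x)))))

    support : ∀ i j L u → ev (flipᴸ i j L) (posV (ι i j u)) ≡ ev L (posA i j u)
    support i j L u = trans (cong (ev (flipᴸ i j L)) (posV-ι i j u)) (ev-flip i j L _)

    -- A bridge leaves the triangle of part (i , j) at the corner t, where L supports the triangle.
    module Leaving (i j : Bool) (t : X i j) (t′ : V) (L : Line)
      (at-t : ev L (posA i j (just t)) ≡ 0ℚ) (out : ev (flipᴸ i j L) (posV t′) ≤ 0ℚ)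
      (rest : ∀ u → ¬ u ≡ just t → 0ℚ < ev L (posA i j u)) where

      on-t : ev (flipᴸ i j L) (posV (part i j t)) ≡ 0ℚ
      on-t = trans (support i j L (just t)) at-t

      fans : ∀ u → ¬ u ≡ just t → Meet posV (part i j t) (ι i j u) (part i j t) t′
      fans u u≢t = fan (flipᴸ i j L) on-t (subst (0ℚ <_) (sym (support i j L u)) (rest u u≢t)) out

      minus : ∀ u → ¬ u ≡ just t → ev (negᴸ (flipᴸ i j L)) (posV (ι i j u)) < 0ℚ
      minus u u≢t = subst (_< 0ℚ) (sym (trans (ev-neg (flipᴸ i j L) (posV (ι i j u))) (cong -_ (support i j L u)))) (neg-antimono-< (rest u u≢t))

      apart : ∀ u v → ¬ u ≡ just t → ¬ v ≡ just t → Meet posV (ι i j u) (ι i j v) (part i j t) t′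
      apart u v u≢t v≢t = meet-flip (strict (negᴸ (flipᴸ i j L))
        (≤-reflexive (sym (trans (ev-neg (flipᴸ i j L) (posV (part i j t))) (cong -_ on-t))))
        (subst (0ℚ ≤_) (sym (ev-neg (flipᴸ i j L) (posV t′))) (neg-antimono-≤ out))
        (minus u u≢t) (minus v v≢t))

      leaving : ∀ u v → adj i j u v ≡ true → Meet posV (ι i j u) (ι i j v) (part i j t) t′
      leaving u v e with Fragment._≟M_ (F i j) u (just t) | Fragment._≟M_ (F i j) v (just t)
      ... | yes refl | yes refl = ⊥-elim (true≢false e (Fragment.adj-irr (F i j) u))
      ... | yes refl | no q     = fans v q
      ... | no p     | yes refl = meet-swap (fans u p)
      ... | no p     | no q     = apart u v p q

    leaving-b : ∀ i j u v → adj i j u v ≡ true → Meet posV (ι i j u) (ι i j v) (part i j (b i j)) (part i (not j) (b i (not j)))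
    leaving-b i j = Leaving.leaving i j (b i j) _ (κᴸ line-b)
      (trans (cong (ev (κᴸ line-b)) (Drawing.at-b (D i j))) refl)
      (≤-reflexive (trans (cong (λ p → ev (flipᴸ i j (κᴸ line-b)) (flip i (not j) p)) (Drawing.at-b (D i (not j)))) (value i j)))
      λ { nothing _ → subst (λ p → 0ℚ < ev (κᴸ line-b) p) (sym (Drawing.at-a (D i j))) (pos-ok (+ 600) refl)
        ; (just x) p → Drawing.beyond-b (D i j) x (λ { refl → p refl }) }
      where
      value : ∀ i j → ev (flipᴸ i j (κᴸ line-b)) (flip i (not j) (κᴾ corner-b)) ≡ 0ℚ
      value false false = refl
      value false true  = refl
      value true  false = refl
      value true  true  = refl

    leaving-c : ∀ i j u v → adj i j u v ≡ true → Meet posV (ι i j u) (ι i j v) (part i j (c i j)) (part i (not j) (c i (not j)))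
    leaving-c i j = Leaving.leaving i j (c i j) _ (κᴸ line-c)
      (trans (cong (ev (κᴸ line-c)) (Drawing.at-c (D i j))) refl)
      (subst (_≤ 0ℚ) (sym (trans (cong (λ p → ev (flipᴸ i j (κᴸ line-c)) (flip i (not j) p)) (Drawing.at-c (D i (not j)))) (value i j)))
        -- The other end (-300 , -1) of the bridge has the value 300 - 2 - 302 = -4 on `line-c`.
        -- That line is tilted because a horizontal line through c would contain b and a vertical
        -- one would cut the triangle.
        (<⇒≤ (neg-ok -[1+ 3 ] refl)))
      λ { nothing _ → subst (λ p → 0ℚ < ev (κᴸ line-c) p) (sym (Drawing.at-a (D i j))) (pos-ok (+ 298) refl)
        ; (just x) p → Drawing.beyond-c (D i j) x (λ { refl → p refl }) }
      where
      value : ∀ i j → ev (flipᴸ i j (κᴸ line-c)) (flip i (not j) (κᴾ corner-c)) ≡ κ -[1+ 3 ]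
      value false false = refl
      value false true  = refl
      value true  false = refl
      value true  true  = refl

    bridges-apart : ∀ i i′ j j′ x y z w → ¬ i ≡ i′ → Meet posV (part i j x) (part i (not j) y) (part i′ j′ z) (part i′ (not j′) w)
    bridges-apart false false j j′ x y z w p = ⊥-elim (p refl)
    bridges-apart true  true  j j′ x y z w p = ⊥-elim (p refl)
    bridges-apart false true  j j′ x y z w p = meet-flip (strict (LX false) (x≥0 false j′ (just z)) (x≥0 false (not j′) (just w)) (x<0 false j x) (x<0 false (not j) y))
    bridges-apart true  false j j′ x y z w p = meet-flip (strict (LX true) (x≥0 true j′ (just z)) (x≥0 true (not j′) (just w)) (x<0 true j x) (x<0 true (not j) y))

    inner-bridge-apart : ∀ i i′ j j′ u v z w → ¬ i ≡ i′ → Meet posV (ι i j u) (ι i j v) (part i′ j′ z) (part i′ (not j′) w)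
    inner-bridge-apart false false j j′ u v z w p = ⊥-elim (p refl)
    inner-bridge-apart true  true  j j′ u v z w p = ⊥-elim (p refl)
    inner-bridge-apart false true  j j′ u v z w p = strict (LX true) (x≥0 true j u) (x≥0 true j v) (x<0 true j′ z) (x<0 true (not j′) w)
    inner-bridge-apart true  false j j′ u v z w p = strict (LX false) (x≥0 false j u) (x≥0 false j v) (x<0 false j′ z) (x<0 false (not j′) w)

    -- The vertical line x = -450, halfway between b and c and hence between the two bridges of a
    -- half.
    line-bc : Lineᶻ
    line-bc = + 1 , + 0 , + 450

    module _ (i j : Bool) where

      bc-value : ∀ k {p} q → posA i k q ≡ κᴾ p → ev (flipᴸ i j (κᴸ line-bc)) (flip i k (posA i k q)) ≡ κ (evᶻ line-bc p)
      bc-value k {p} q e = trans (cong (λ r → ev (flipᴸ i j (κᴸ line-bc)) (flip i k r)) e) (trans (flatly i j k (κᴾ p)) (ev-κ line-bc p))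
        where
        flatly : ∀ i j k p → ev (flipᴸ i j (κᴸ line-bc)) (flip i k p) ≡ ev (κᴸ line-bc) p
        flatly i j k (x , y) = cong₂ (λ s t → s + t + κ (+ 450)) (mirror-* i (κ (+ 1)) x)
          (trans (cong (_* mirror k y) (mirror-0 j)) (trans (*-zeroˡ (mirror k y)) (sym (*-zeroˡ y))))
          where
          mirror-0 : ∀ j → mirror j 0ℚ ≡ 0ℚ
          mirror-0 true  = refl
          mirror-0 false = refl

      b-c-apart : Meet posV (part i j (b i j)) (part i (not j) (b i (not j))) (part i j (c i j)) (part i (not j) (c i (not j)))
      b-c-apart = meet-flip (strict (flipᴸ i j (κᴸ line-bc)) (positive-c j) (positive-c (not j)) (negative-b j) (negative-b (not j)))
        where
        positive-c : ∀ k → 0ℚ ≤ ev (flipᴸ i j (κᴸ line-bc)) (posV (part i k (c i k)))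
        positive-c k = subst (0ℚ ≤_) (sym (bc-value k _ (Drawing.at-c (D i k)))) (nonneg-ok (+ 150) refl)
        negative-b : ∀ k → ev (flipᴸ i j (κᴸ line-bc)) (posV (part i k (b i k))) < 0ℚ
        negative-b k = subst (_< 0ℚ) (sym (bc-value k _ (Drawing.at-b (D i k)))) (neg-ok -[1+ 149 ] refl)

    upside : ∀ j → not (not j) ≡ j
    upside true  = refl
    upside false = refl

    -- A bridge has two names, one from each of the parts that it joins; this passes from one name
    -- to the other.
    reversedᵇ : ∀ i j {u v} → Meet posV u v (part i j (b i j)) (part i (not j) (b i (not j))) →
                Meet posV u v (part i (not j) (b i (not j))) (part i (not (not j)) (b i (not (not j))))
    reversedᵇ i j {u} {v} m rewrite upside j = meet-flip (meet-swap (meet-flip m))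

    reversedᶜ : ∀ i j {u v} → Meet posV u v (part i j (c i j)) (part i (not j) (c i (not j))) →
                Meet posV u v (part i (not j) (c i (not j))) (part i (not (not j)) (c i (not (not j))))
    reversedᶜ i j {u} {v} m rewrite upside j = meet-flip (meet-swap (meet-flip m))

    data Turn (j : Bool) : Bool → Set where
      kept   : Turn j j
      turned : Turn j (not j)

    turn : ∀ j j′ → Turn j j′
    turn false false = kept
    turn false true  = turned
    turn true  false = turned
    turn true  true  = kept

    inner-bridgeᵇ : ∀ i j u v i′ j′ → adj i j u v ≡ true →
                    Meet posV (ι i j u) (ι i j v) (part i′ j′ (b i′ j′)) (part i′ (not j′) (b i′ (not j′)))
    inner-bridgeᵇ i j u v i′ j′ e with i ≟B i′
    ... | no p     = inner-bridge-apart i i′ j j′ u v _ _ p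
    ... | yes refl with turn j j′
    ...   | kept   = leaving-b i j u v e
    ...   | turned = reversedᵇ i j (leaving-b i j u v e)

    inner-bridgeᶜ : ∀ i j u v i′ j′ → adj i j u v ≡ true →
                    Meet posV (ι i j u) (ι i j v) (part i′ j′ (c i′ j′)) (part i′ (not j′) (c i′ (not j′)))
    inner-bridgeᶜ i j u v i′ j′ e with i ≟B i′
    ... | no p     = inner-bridge-apart i i′ j j′ u v _ _ p
    ... | yes refl with turn j j′
    ...   | kept   = leaving-c i j u v e
    ...   | turned = reversedᶜ i j (leaving-c i j u v e)

    bridgeᵇᶜ : ∀ i j i′ j′ → Meet posV (part i j (b i j)) (part i (not j) (b i (not j))) (part i′ j′ (c i′ j′)) (part i′ (not j′) (c i′ (not j′)))
    bridgeᵇᶜ i j i′ j′ with i ≟B i′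
    ... | no p     = bridges-apart i i′ j j′ _ _ _ _ p
    ... | yes refl with turn j j′
    ...   | kept   = b-c-apart i j
    ...   | turned = reversedᶜ i j (b-c-apart i j)

    edges-meet : ∀ {u v w z} → Edge u v → Edge w z → Meet posV u v w z
    edges-meet (inner i j u v e) (inner i′ j′ w z f) with compare i j i′ j′
    ... | same    = together i j u v w z e f
    ... | across  = vertical i i j u v w z
    ... | far j″ with turn j j″
    ...   | kept   = beside i j u v w z e f
    ...   | turned = vertical i (not i) j u v w z
    edges-meet (inner i j u v e) (bridgeᵇ i′ j′) = inner-bridgeᵇ i j u v i′ j′ e
    edges-meet (inner i j u v e) (bridgeᶜ i′ j′) = inner-bridgeᶜ i j u v i′ j′ e
    edges-meet (bridgeᵇ i j) (inner i′ j′ w z f) = meet-flip (inner-bridgeᵇ i′ j′ w z i j f)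
    edges-meet (bridgeᶜ i j) (inner i′ j′ w z f) = meet-flip (inner-bridgeᶜ i′ j′ w z i j f)
    edges-meet (bridgeᵇ i j) (bridgeᶜ i′ j′) = bridgeᵇᶜ i j i′ j′
    edges-meet (bridgeᶜ i j) (bridgeᵇ i′ j′) = meet-flip (bridgeᵇᶜ i′ j′ i j)
    edges-meet (bridgeᵇ i j) (bridgeᵇ i′ j′) with i ≟B i′
    ... | no p     = bridges-apart i i′ j j′ _ _ _ _ p
    ... | yes refl with turn j j′
    ...   | kept   = meet-same
    ...   | turned = reversedᵇ i j meet-same
    edges-meet (bridgeᶜ i j) (bridgeᶜ i′ j′) with i ≟B i′
    ... | no p     = bridges-apart i i′ j j′ _ _ _ _ p
    ... | yes refl with turn j j′
    ...   | kept   = meet-same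
    ...   | turned = reversedᶜ i j meet-same

    frame-planar : ∀ u v w z → adjV u v ≡ true → adjV w z ≡ true → Meet posV u v w z
    frame-planar u v w z e f = edges-meet (edge u v e) (edge w z f)

    nbrV : ∀ u → ∃ λ v → adjV u v ≡ true
    nbrV (apex j)     = let v , e = Drawing.nbr (D false j) nothing in ι false j v , trans (adjV-ι false j nothing v) e
    nbrV (part i j x) = let v , e = Drawing.nbr (D i j) (just x) in ι i j v , trans (adjV-ι i j (just x) v) e

    edge-nondegenerate : ∀ {u v} → Edge u v → ¬ posV u ≡ posV v
    edge-nondegenerate (inner i j u v e) p = Drawing.nondegenerate (D i j) u v e
      (trans (sym (flip² i j _)) (trans (cong (flip i j) (trans (sym (posV-ι i j u)) (trans p (posV-ι i j v)))) (flip² i j _)))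
    edge-nondegenerate (bridgeᵇ i j) p = <-irrefl (cong (ev (LY j)) (sym p)) (<-trans (y<0 i j (just (b i (not j)))) (y>0 i j (just (b i j))))
    edge-nondegenerate (bridgeᶜ i j) p = <-irrefl (cong (ev (LY j)) (sym p)) (<-trans (y<0 i j (just (c i (not j)))) (y>0 i j (just (c i j))))

-- Transfer to graphs on initial segments

module Transfer where

  open import Defs renaming (adj to adjG; sym to symG; irrefl to irreflG; delete to deleteG)
  open PathCycle
  open Frame
  open FrameTours
  open Plane
  open FramePlane
  open import Data.Bool using (Bool; true; false)
  open import Data.Nat using (ℕ; suc; _+_; _≤_; z≤n)
  import Data.Nat.Properties as ℕP
  open import Data.Fin using (Fin; punchIn; punchOut)
  open import Data.Fin.Properties using (punchIn-punchOut; punchInᵢ≢i; punchIn-injective; +↔⊎; 2↔Bool)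
  open import Data.List using (List; []; _∷_; map)
  open import Data.List.Properties using (∷-injectiveˡ; ∷-injectiveʳ)
  open import Data.List.Relation.Unary.All as All using (All; []; _∷_)
  open import Data.List.Relation.Unary.AllPairs using ([]; _∷_)
  open import Data.List.Relation.Unary.Any using (here; there)
  open import Data.List.Membership.Propositional using (_∈_)
  open import Data.List.Membership.Propositional.Properties using (∈-map⁺; ∈-map⁻)
  open import Data.List.Relation.Unary.Unique.Propositional using (Unique)
  import Data.List.Relation.Unary.Unique.Propositional.Properties as Uniq
  open import Data.Product using (Σ-syntax; ∃; _×_; _,_; proj₁; proj₂)
  open import Data.Sum using (_⊎_; inj₁; inj₂; [_,_]′)
  open import Data.Sum.Function.Propositional using (_⊎-↔_)
  open import Data.Empty using (⊥; ⊥-elim)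
  open import Data.Rational using (0ℚ; 1ℚ; _*_; _-_) renaming (_+_ to _+ℚ_)
  import Data.Rational.Properties as ℚP
  open import Data.Integer using (+_)
  open QSolver
  open import Function.Bundles using (_↔_; mk↔ₛ′; Inverse)
  open import Function.Construct.Composition using (_↔-∘_)
  open import Function.Construct.Symmetry using (↔-sym)
  open import Relation.Nullary using (¬_; yes; no; ⌊_⌋)
  open import Relation.Binary.Definitions using (DecidableEquality)
  open import Relation.Binary.PropositionalEquality

  module _ {V : Set} (_≟_ : DecidableEquality V) where

    occ-zero : ∀ v l → occ _≟_ v l ≡ 0 → All (λ x → ¬ v ≡ x) l
    occ-zero v []      e = []
    occ-zero v (x ∷ l) e with x ≟ v
    ... | no ¬p = (λ q → ¬p (sym q)) ∷ occ-zero v l e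

    occ-∈ : ∀ v l → occ _≟_ v l ≡ 1 → v ∈ l
    occ-∈ v (x ∷ l) e with x ≟ v
    ... | yes p = here (sym p)
    ... | no _  = there (occ-∈ v l e)

    occ-unique : ∀ l → (∀ v → occ _≟_ v l ≤ 1) → Unique l
    occ-unique []      f = []
    occ-unique (x ∷ l) f = occ-zero x l (ℕP.n≤0⇒n≡0 (ℕP.≤-pred (head-once (f x)))) ∷ occ-unique l tail-once
      where
      head-once : occ _≟_ x (x ∷ l) ≤ 1 → suc (occ _≟_ x l) ≤ 1
      head-once h with x ≟ x
      ... | yes _ = h
      ... | no ¬p = ⊥-elim (¬p refl)
      tail-once : ∀ v → occ _≟_ v l ≤ 1
      tail-once v with x ≟ v | f v
      ... | yes _ | h = ℕP.≤-trans (ℕP.n≤1+n _) h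
      ... | no _  | h = h

  onSegment-start : ∀ p q → OnSegment p p q
  onSegment-start (px , py) (qx , qy) = 0ℚ , ℚP.≤-refl , ℚP.nonNegative⁻¹ 1ℚ , start px qx , start py qy
    where
    start : ∀ a b → a ≡ a +ℚ 0ℚ * (b - a)
    start a b = solve 2 (λ a b → a := a :+ con (+ 0) :* (b :- a)) refl a b

  punchIn-list : ∀ {n} (v : Fin (suc n)) (l : List (Fin (suc n))) → All (λ x → ¬ v ≡ x) l → ∃ λ q → map (punchIn v) q ≡ l
  punchIn-list v []      []       = [] , refl
  punchIn-list v (x ∷ l) (p ∷ ps) = let q , e = punchIn-list v l ps in punchOut p ∷ q , cong₂ _∷_ (punchIn-punchOut p) e

  route-chain : ∀ {V : Set} {R : V → V → Bool} {x l y} → Route R x l y → Chain R l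
  route-chain (stay _)            = _
  route-chain (step e (stay _))   = e , _
  route-chain (step e (step f r)) = e , route-chain (step f r)

  module Transfer (F : Bool → Bool → Fragment) (D : ∀ i j → Drawing (F i j)) where

    open Frame.Frame F
    open FrameTours.FrameTours F using (tour-without)
    open FramePlane.FramePlane F D using (posV; frame-planar; nbrV; edge-nondegenerate; edge)

    module _ {n : ℕ} (bij : V ↔ Fin (suc n)) where

      f : V → Fin (suc n)
      f = Inverse.to bij

      g : Fin (suc n) → V
      g = Inverse.from bij

      gf : ∀ v → g (f v) ≡ v
      gf v = Inverse.inverseʳ bij refl

      fg : ∀ i → f (g i) ≡ i
      fg i = Inverse.inverseˡ bij refl

      g-injective : ∀ {i j} → g i ≡ g j → i ≡ j
      g-injective e = trans (sym (fg _)) (trans (cong f e) (fg _))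

      f-injective : ∀ {u v} → f u ≡ f v → u ≡ v
      f-injective e = trans (sym (gf _)) (trans (cong g e) (gf _))

      G : Graph (suc n)
      G = record
        { adj    = λ i j → adjV (g i) (g j)
        ; sym    = λ i j → adjV-sym (g i) (g j)
        ; irrefl = λ i → adjV-irr (g i)
        }

      walk-chain : ∀ p → Walk G p → Chain adjV (map g p)
      walk-chain []          w       = _
      walk-chain (x ∷ [])    w       = _
      walk-chain (x ∷ y ∷ p) (e , w) = e , walk-chain (y ∷ p) w

      nontraceable : ¬ Traceable G
      nontraceable (p , w , un , all) = by p w un all
        where
        by : ∀ p → Walk G p → Unique p → (∀ v → v ∈ p) → ⊥
        by []      w un all with all (f (apex false))
        ... | ()
        -- A path with a single vertex cannot contain both apices; the construction of the cycle
        -- starts from two vertices.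
        by (x ∷ []) w un all with all (f (apex false)) | all (f (apex true))
        ... | here p | here q with f-injective (trans p (sym q))
        ...   | ()
        by (x ∷ y ∷ p) w un all = Nontraceable.contradiction (g x) (g y) (map g p)
          (Uniq.map⁺ g-injective un) (walk-chain (x ∷ y ∷ p) w)
          (λ v → subst (_∈ map g (x ∷ y ∷ p)) (gf v) (∈-map⁺ g (all (f v))))

      chain-walk : ∀ v q l → map (punchIn v) q ≡ map f l → Chain adjV l → Walk (deleteG G v) q
      chain-walk v []          l           e c = _
      chain-walk v (x ∷ [])    l           e c = _
      chain-walk v (x ∷ y ∷ q) (a ∷ b ∷ l) e (r , c) =
        subst₂ (λ s t → adjV s t ≡ true) (back (∷-injectiveˡ e)) (back (∷-injectiveˡ (∷-injectiveʳ e))) r ,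
        chain-walk v (y ∷ q) (b ∷ l) (∷-injectiveʳ e) c
        where
        back : ∀ {x a} → punchIn v x ≡ f a → a ≡ g (punchIn v x)
        back e = trans (sym (gf _)) (cong g (sym e))

      deleted-traceable : ∀ v → Traceable (deleteG G v)
      deleted-traceable v with tour-without (g v)
      ... | x , y , tour l r sp = q , chain-walk v q l eq (route-chain r) , unique-q , all-q
        where
        at-most-one : ∀ u → occ _≟V_ u l ≤ 1
        at-most-one u rewrite visits sp u with ⌊ g v ≟V u ⌋
        ... | true  = z≤n
        ... | false = ℕP.≤-refl
        absent : All (λ u → ¬ g v ≡ u) l
        absent = occ-zero _≟V_ (g v) l (trans (visits sp (g v)) (cong indicator (isYes⁺ (g v ≟V g v) refl)))
        absent-f : ∀ {l} → All (λ u → ¬ g v ≡ u) l → All (λ i → ¬ v ≡ i) (map f l)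
        absent-f []       = []
        absent-f (p ∷ ps) = (λ e → p (trans (cong g e) (gf _))) ∷ absent-f ps
        q = proj₁ (punchIn-list v (map f l) (absent-f absent))
        eq : map (punchIn v) q ≡ map f l
        eq = proj₂ (punchIn-list v (map f l) (absent-f absent))
        unique-q : Unique q
        unique-q = unmap q (subst Unique (sym eq) (Uniq.map⁺ f-injective (occ-unique _≟V_ l at-most-one)))
          where
          unmap : ∀ q → Unique (map (punchIn v) q) → Unique q
          unmap []      []       = []
          unmap (x ∷ q) (a ∷ un) = All.tabulate (λ {z} i e → All.lookup a (∈-map⁺ (punchIn v) i) (cong (punchIn v) e)) ∷ unmap q un
        all-q : ∀ u → u ∈ q
        all-q u with ∈-map⁻ (punchIn v) (subst (punchIn v u ∈_) (sym eq)
          (subst (_∈ map f l) (fg _) (∈-map⁺ f (occ-∈ _≟V_ (g (punchIn v u)) l once))))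
          where
          once : occ _≟V_ (g (punchIn v u)) l ≡ 1
          once with g v ≟V g (punchIn v u) | visits sp (g (punchIn v u))
          ... | yes p | _ = ⊥-elim (punchInᵢ≢i v u (sym (g-injective p)))
          ... | no _  | e = e
        ... | w , w∈q , e = subst (_∈ q) (sym (punchIn-injective v u w e)) w∈q

      place : Fin (suc n) → Point
      place i = posV (g i)

      meets : ∀ a b c d → Adj G a b → Adj G c d → Meet place a b c d
      meets a b c d e h p i j = named (frame-planar (g a) (g b) (g c) (g d) e h p i j)
        where
        named : Meeting posV (g a) (g b) (g c) (g d) p → Meeting place a b c d p
        named (inj₁ (x , y))        = inj₁ (g-injective x , g-injective y)
        named (inj₂ (inj₁ (x , y))) = inj₂ (inj₁ (g-injective x , g-injective y))
        named (inj₂ (inj₂ (x , u , v , q))) = inj₂ (inj₂ (f x , endpoint u , endpoint v , trans q (cong posV (sym (gf x)))))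
          where
          endpoint : ∀ {s t} → x ≡ g s ⊎ x ≡ g t → f x ≡ s ⊎ f x ≡ t
          endpoint (inj₁ refl) = inj₁ (fg _)
          endpoint (inj₂ refl) = inj₂ (fg _)

      neighbour : ∀ a → ∃ λ b → Adj G a b
      neighbour a = let v , e = nbrV (g a) in f v , subst (λ z → adjV (g a) z ≡ true) (sym (gf v)) e

      separate : ∀ a b → Adj G a b → ¬ place a ≡ place b
      separate a b e = edge-nondegenerate (edge (g a) (g b) e)

      -- Each vertex has a neighbour, so two vertices at one point are ends of edges that meet
      -- there. The condition on the pair of edges identifies the two vertices, since no edge is
      -- degenerate.
      injective : ∀ u v → place u ≡ place v → u ≡ v
      injective u v e with neighbour u | neighbour v
      ... | u′ , a | v′ , b = decide (meets u u′ v v′ a b (place u) (onSegment-start (place u) (place u′))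
                                      (subst (λ p → OnSegment p (place v) (place v′)) (sym e) (onSegment-start (place v) (place v′))))
        where
        decide : Meeting place u u′ v v′ (place u) → u ≡ v
        decide (inj₁ (p , _))           = p
        decide (inj₂ (inj₁ (p , q)))    = ⊥-elim (separate u u′ a (trans e (cong place (sym q))))
        decide (inj₂ (inj₂ (x , inj₂ refl , _ , q)))         = ⊥-elim (separate u u′ a q)
        decide (inj₂ (inj₂ (x , inj₁ refl , inj₁ q , _)))    = q
        decide (inj₂ (inj₂ (x , inj₁ refl , inj₂ refl , _))) = ⊥-elim (separate v v′ b (sym e))

      -- An edge at w meets ab in the point of w, and the condition on this pair makes w an end of
      -- ab or the edge at w degenerate.
      vertexOff : ∀ a b w → Adj G a b → ¬ w ≡ a → ¬ w ≡ b → ¬ OnSegment (place w) (place a) (place b)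
      vertexOff a b w e w≢a w≢b o with neighbour w
      ... | y , wy = decide (meets a b w y e wy (place w) o (onSegment-start (place w) (place y)))
        where
        decide : ¬ Meeting place a b w y (place w)
        decide (inj₁ (p , _))                             = w≢a (sym p)
        decide (inj₂ (inj₁ (_ , p)))                      = w≢b (sym p)
        decide (inj₂ (inj₂ (x , inj₁ p , inj₁ q , _)))    = w≢a (trans (sym q) p)
        decide (inj₂ (inj₂ (x , inj₂ p , inj₁ q , _)))    = w≢b (trans (sym q) p)
        decide (inj₂ (inj₂ (x , _ , inj₂ refl , q)))      = separate w x wy q

      planar : Planar G
      planar = record { pos = place; injective = injective; vertexOff = vertexOff; edgesMeet = meets }

      result : Σ[ G ∈ Graph (suc n) ] (Planar G × Hypotraceable G)
      result = G , planar , nontraceable , deleted-traceable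

    V↔⊎ : V ↔ (X false false ⊎ (X false true ⊎ (X true false ⊎ (X true true ⊎ Bool))))
    V↔⊎ = mk↔ₛ′ to from to-from from-to
      where
      to : V → _
      to (part false false x) = inj₁ x
      to (part false true x)  = inj₂ (inj₁ x)
      to (part true false x)  = inj₂ (inj₂ (inj₁ x))
      to (part true true x)   = inj₂ (inj₂ (inj₂ (inj₁ x)))
      to (apex j)             = inj₂ (inj₂ (inj₂ (inj₂ j)))
      from : _ → V
      from (inj₁ x)                      = part false false x
      from (inj₂ (inj₁ x))               = part false true x
      from (inj₂ (inj₂ (inj₁ x)))        = part true false x
      from (inj₂ (inj₂ (inj₂ (inj₁ x)))) = part true true x
      from (inj₂ (inj₂ (inj₂ (inj₂ j)))) = apex j
      to-from : ∀ y → to (from y) ≡ y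
      to-from (inj₁ x)                      = refl
      to-from (inj₂ (inj₁ x))               = refl
      to-from (inj₂ (inj₂ (inj₁ x)))        = refl
      to-from (inj₂ (inj₂ (inj₂ (inj₁ x)))) = refl
      to-from (inj₂ (inj₂ (inj₂ (inj₂ j)))) = refl
      from-to : ∀ v → from (to v) ≡ v
      from-to (part false false x) = refl
      from-to (part false true x)  = refl
      from-to (part true false x)  = refl
      from-to (part true true x)   = refl
      from-to (apex j)             = refl

    V↔Fin : ∀ {s₀ s₁ s₂ s₃} → X false false ↔ Fin s₀ → X false true ↔ Fin s₁ → X true false ↔ Fin s₂ → X true true ↔ Fin s₃ →
            V ↔ Fin (s₀ + (s₁ + (s₂ + (s₃ + 2))))
    V↔Fin e₀ e₁ e₂ e₃ = V↔⊎ then (join e₀ (join e₁ (join e₂ (join e₃ (↔-sym 2↔Bool)))))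
      where
      _then_ : ∀ {A B C : Set} → A ↔ B → B ↔ C → A ↔ C
      p then q = q ↔-∘ p
      join : ∀ {A B m n} → A ↔ Fin m → B ↔ Fin n → (A ⊎ B) ↔ Fin (m + n)
      join p q = (p ⊎-↔ q) then (↔-sym +↔⊎)

-- Boolean checks for fragments given by tables

module Base where

  open import Defs using (Point)
  open Refute
  open Sound
  open PathCycle
  open Contract
  open Frame
  open Plane
  open import Data.Bool using (Bool; true; false; _∧_; _∨_; not; if_then_else_)
  open import Data.Nat using (ℕ; zero; suc; _+_; _≡ᵇ_; _<_; s≤s; z≤n)
  import Data.Nat.Properties as ℕP
  open import Data.Fin using (Fin; zero; suc; toℕ)
  open import Data.Fin.Properties using (toℕ<n)
  open import Data.Integer as ℤ using (ℤ; +_)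
  open import Data.Rational using (0ℚ; ↥_)
  open import Data.List using (List; []; _∷_; map)
  open import Data.List.Relation.Unary.All as All using (All; []; _∷_)
  open import Data.List.Relation.Unary.All.Properties using (map⁺)
  open import Data.List.Relation.Unary.Any using (here; there)
  open import Data.List.Membership.Propositional using (_∈_)
  open import Data.Maybe using (Maybe; just; nothing)
  open import Data.Maybe.Properties using (≡-dec; just-injective)
  open import Data.Product using (_,_; proj₁; proj₂)
  open import Data.Sum using (inj₁; inj₂; [_,_]′)
  open import Data.Empty using (⊥-elim)
  open import Data.Unit using (tt)
  open import Relation.Nullary using (¬_; yes; no; ⌊_⌋)
  open import Relation.Binary.Definitions using (DecidableEquality)
  open import Relation.Binary.PropositionalEquality

  below : ℕ → (ℕ → Bool) → Bool
  below zero    P = true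
  below (suc n) P = P n ∧ below n P

  below-ok : ∀ n P → below n P ≡ true → ∀ k → k < n → P k ≡ true
  below-ok (suc n) P h k k<n with k ℕP.≟ n
  ... | yes refl = proj₁ (∧⁻ h)
  ... | no k≢n   = below-ok n P (proj₂ (∧⁻ {P n} h)) k (ℕP.≤∧≢⇒< (ℕP.≤-pred k<n) k≢n)

  allᵇ : {A : Set} → (A → Bool) → List A → Bool
  allᵇ P []       = true
  allᵇ P (x ∷ xs) = P x ∧ allᵇ P xs

  allᵇ-ok : ∀ {A : Set} (P : A → Bool) l → allᵇ P l ≡ true → All (λ x → P x ≡ true) l
  allᵇ-ok P []       h = []
  allᵇ-ok P (x ∷ xs) h = proj₁ (∧⁻ h) ∷ allᵇ-ok P xs (proj₂ (∧⁻ {P x} h))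

  _⇒ᵇ_ : Bool → Bool → Bool
  true  ⇒ᵇ b = b
  false ⇒ᵇ b = true

  ⇒ᵇ-ok : ∀ {a b} → a ⇒ᵇ b ≡ true → a ≡ true → b ≡ true
  ⇒ᵇ-ok h refl = h

  _iffᵇ_ : Bool → Bool → Bool
  true  iffᵇ b = b
  false iffᵇ b = not b

  iffᵇ-ok : ∀ {a b} → a iffᵇ b ≡ true → a ≡ b
  iffᵇ-ok {true}  h = sym h
  iffᵇ-ok {false} h = sym (not⁻ h)

  nth : {A : Set} → A → List A → ℕ → A
  nth d []       k       = d
  nth d (x ∷ xs) zero    = x
  nth d (x ∷ xs) (suc k) = nth d xs k

  -- Numbers beyond the range go to the last index, so that tables and paths can be plain lists of
  -- numbers.
  clamp : ∀ {N} → ℕ → Fin (suc N)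
  clamp {zero}  k       = zero
  clamp {suc N} zero    = zero
  clamp {suc N} (suc k) = suc (clamp k)

  clamp-toℕ : ∀ {N} (i : Fin (suc N)) → clamp (toℕ i) ≡ i
  clamp-toℕ {zero}  zero    = refl
  clamp-toℕ {suc N} zero    = refl
  clamp-toℕ {suc N} (suc i) = cong suc (clamp-toℕ i)

  -- The value at p is the cross product of b - a and p - a, so its sign is the orientation of the
  -- triangle a b p.
  lineThrough : Pointᶻ → Pointᶻ → Lineᶻ
  lineThrough (ax , ay) (bx , by) =
    ay ℤ.- by , bx ℤ.- ax , (by ℤ.- ay) ℤ.* ax ℤ.- (bx ℤ.- ax) ℤ.* ay

  negᶻ : Lineᶻ → Lineᶻ
  negᶻ (α , β , γ) = ℤ.- α , ℤ.- β , ℤ.- γ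

  strictᵇ fanᵇ : Lineᶻ → Pointᶻ → Pointᶻ → Pointᶻ → Pointᶻ → Bool
  strictᵇ L a b c d = neg? (evᶻ L c) ∧ neg? (evᶻ L d) ∧ nonneg? (evᶻ L a) ∧ nonneg? (evᶻ L b)
  fanᵇ L x b _ d = zero? (evᶻ L x) ∧ pos? (evᶻ L b) ∧ nonpos? (evᶻ L d)

  eitherSide : (Lineᶻ → Bool) → Lineᶻ → Bool
  eitherSide P L = P L ∨ P (negᶻ L)

  -- Disjoint segments that are not collinear are separated by the line through one of them: if each
  -- of the two lines met the other segment, their intersection would lie on both segments. So two
  -- candidate lines with two orientations suffice.
  apartᵇ : Pointᶻ → Pointᶻ → Pointᶻ → Pointᶻ → Bool
  apartᵇ a b c d = eitherSide (λ L → strictᵇ L a b c d) (lineThrough a b) ∨ eitherSide (λ L → strictᵇ L c d a b) (lineThrough c d)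

  forkᵇ : Pointᶻ → Pointᶻ → Pointᶻ → Bool
  forkᵇ x b d = eitherSide (λ L → fanᵇ L x b x d) (lineThrough x d)

  module Base {N : ℕ} {X : Set} (_≟_ : DecidableEquality X)
    (enc : X → Fin (suc N)) (dc : Fin (suc N) → X) (dc-enc : ∀ x → dc (enc x) ≡ x)
    (table : List (List ℕ)) (coords : List Pointᶻ) where

    A : Set
    A = Maybe X

    _≟A_ : DecidableEquality A
    _≟A_ = ≡-dec _≟_

    _≟W_ : DecidableEquality (Maybe A)
    _≟W_ = ≡-dec _≟A_

    keys : ℕ → List ℕ
    keys = nth [] table

    -- 0 is the extra vertex, 1 the vertex a.
    code : Maybe A → ℕ
    code nothing         = 0
    code (just nothing)  = 1
    code (just (just x)) = 2 + toℕ (enc x)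

    dec : ℕ → Maybe A
    dec 0             = nothing
    dec 1             = just nothing
    dec (suc (suc k)) = just (just (dc (clamp k)))

    dec-code : ∀ v → dec (code v) ≡ v
    dec-code nothing         = refl
    dec-code (just nothing)  = refl
    dec-code (just (just x)) = cong (λ x → just (just x)) (trans (cong dc (clamp-toℕ (enc x))) (dc-enc x))

    code-injective : ∀ {u v} → code u ≡ code v → u ≡ v
    code-injective e = trans (sym (dec-code _)) (trans (cong dec e) (dec-code _))

    codeA : A → ℕ
    codeA a = code (just a)

    codeA-injective : ∀ {u v} → codeA u ≡ codeA v → u ≡ v
    codeA-injective {u} {v} e = just-injective (code-injective {just u} {just v} e)

    size : ℕ
    size = 3 + N

    code< : ∀ v → code v < size
    code< nothing         = s≤s z≤n
    code< (just nothing)  = s≤s (s≤s z≤n)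
    code< (just (just x)) = s≤s (s≤s (toℕ<n (enc x)))

    -- Codes of vertices in `A` start at 1, so the entries 0 of the table, which mark the neighbours
    -- of the extra vertex, have no effect here.
    adj : A → A → Bool
    adj u v = elemᵇ (codeA v) (keys (codeA u))

    everywhere : (ℕ → Bool) → Bool
    everywhere = below size

    everywhere-ok : ∀ P → everywhere P ≡ true → ∀ v → P (code v) ≡ true
    everywhere-ok P h v = below-ok size P h (code v) (code< v)

    mutual? : ℕ → ℕ → Bool
    mutual? u v = elemᵇ u (keys v) iffᵇ elemᵇ v (keys u)

    symmetricᵇ : Bool
    symmetricᵇ = everywhere λ u → everywhere (mutual? u)

    irreflexiveᵇ : Bool
    irreflexiveᵇ = everywhere λ u → not (elemᵇ u (keys u))

    adj-sym : symmetricᵇ ≡ true → ∀ u v → adj u v ≡ adj v u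
    adj-sym h u v = iffᵇ-ok (everywhere-ok (mutual? (codeA v)) (everywhere-ok (λ u → everywhere (mutual? u)) h (just v)) (just u))

    adj-irr : irreflexiveᵇ ≡ true → ∀ u → adj u u ≡ false
    adj-irr h u = not⁻ (everywhere-ok (λ u → not (elemᵇ u (keys u))) h (just u))

    initial : List ℕ → Table
    initial = map λ u → u , map (λ w → w , unknown) (keys u)

    validCode validRow : ℕ → Bool
    validCode w = code (dec w) ≡ᵇ w
    validRow u  = validCode u ∧ allᵇ validCode (keys u)

    validᵇ : List ℕ → Bool
    validᵇ order = allᵇ validRow order

    -- `order` is the order of the rows in the table of the search. It steers where `pick` branches
    -- and so the size of the search; soundness holds for any list of valid rows.
    module Nonham (t₁ t₂ : X) (order : List ℕ)
      (t₀-ok : elemᵇ 0 (keys 1) ∧ elemᵇ 1 (keys 0) ≡ true)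
      (t₁-ok : elemᵇ 0 (keys (codeA (just t₁))) ∧ elemᵇ (codeA (just t₁)) (keys 0) ≡ true)
      (t₂-ok : elemᵇ 0 (keys (codeA (just t₂))) ∧ elemᵇ (codeA (just t₂)) (keys 0) ≡ true)
      (valid : validᵇ order ≡ true) (refuted : refute 200 (initial order) ≡ true) where

      R : Maybe A → Maybe A → Bool
      R = plus _≟A_ adj nothing (just t₁) (just t₂)

      terminal : ∀ u → ⌊ u ≟A nothing ⌋ ∨ ⌊ u ≟A just t₁ ⌋ ∨ ⌊ u ≟A just t₂ ⌋ ≡ true →
                 elemᵇ 0 (keys (codeA u)) ∧ elemᵇ (codeA u) (keys 0) ≡ true
      terminal u e with ∨⁻ {⌊ u ≟A nothing ⌋} e
      ... | inj₁ p rewrite isYes⁻ (u ≟A nothing) p = t₀-ok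
      ... | inj₂ q with ∨⁻ {⌊ u ≟A just t₁ ⌋} q
      ...   | inj₁ p rewrite isYes⁻ (u ≟A just t₁) p = t₁-ok
      ...   | inj₂ p rewrite isYes⁻ (u ≟A just t₂) p = t₂-ok

      R-keys : ∀ u v → R u v ≡ true → code v ∈ keys (code u)
      R-keys (just u) (just v) e = elemᵇ⁻ _ e
      R-keys (just u) nothing  e = elemᵇ⁻ _ (proj₁ (∧⁻ (terminal u e)))
      R-keys nothing  (just v) e = elemᵇ⁻ _ (proj₂ (∧⁻ {elemᵇ 0 (keys (codeA v))} (terminal v e)))

      nonham : ¬ Cycle R
      nonham H = refute-sound 200 (initial order) refuted (map⁺ (All.map row (allᵇ-ok validRow order valid)))
        where
        open Soundness H code dec dec-code
        open Cycle H using (m; m-adj)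
        entry : ∀ {u} ws → All (λ w → validCode w ≡ true) ws → All (EntryOK u) (map (λ w → w , unknown) ws)
        entry []       []       = []
        entry (w ∷ ws) (p ∷ ps) = (≡ᵇ⁻ p , tt) ∷ entry ws ps
        listed : ∀ {w} ws → w ∈ ws → (w , unknown) ∈ map (λ w → w , unknown) ws
        listed (_ ∷ _)  (here refl) = here refl
        listed (_ ∷ ws) (there i)   = there (listed ws i)
        row : ∀ {u} → validRow u ≡ true →
              RowOK (u , map (λ w → w , unknown) (keys u))
        row {u} h = ≡ᵇ⁻ (proj₁ (∧⁻ h)) , entry (keys u) (allᵇ-ok validCode (keys u) (proj₂ (∧⁻ {validCode u} h))) ,
          λ z e → unknown , listed (keys u) (subst (λ k → code z ∈ keys k) (≡ᵇ⁻ (proj₁ (∧⁻ h))) (R-keys (dec u) z (m-adj (dec u) z e)))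

    atIndex : (A → Bool) → ℕ → Bool
    atIndex P zero    = P nothing
    atIndex P (suc k) = P (just (dc (clamp k)))

    allA : (A → Bool) → Bool
    allA P = below (2 + N) (atIndex P)

    allA-ok : ∀ P → allA P ≡ true → ∀ a → P a ≡ true
    allA-ok P h nothing  = below-ok (2 + N) (atIndex P) h 0 (s≤s z≤n)
    allA-ok P h (just x) = subst (λ y → P (just y) ≡ true) (trans (cong dc (clamp-toℕ (enc x))) (dc-enc x))
      (below-ok (2 + N) (atIndex P) h (suc (toℕ (enc x))) (s≤s (toℕ<n (enc x))))

    onwardᵇ routeᵇ : (A → A → Bool) → A → List A → A → Bool
    onwardᵇ R a []      y = ⌊ a ≟A y ⌋
    onwardᵇ R a (b ∷ l) y = R a b ∧ onwardᵇ R b l y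
    routeᵇ R x []      y = false
    routeᵇ R x (a ∷ l) y = ⌊ x ≟A a ⌋ ∧ onwardᵇ R a l y

    onwardᵇ-ok : ∀ R a l y → onwardᵇ R a l y ≡ true → Route R a (a ∷ l) y
    onwardᵇ-ok R a []      y h = subst (Route R a (a ∷ [])) (isYes⁻ (a ≟A y) h) (stay a)
    onwardᵇ-ok R a (b ∷ l) y h = step (proj₁ (∧⁻ h)) (onwardᵇ-ok R b l y (proj₂ (∧⁻ {R a b} h)))

    routeᵇ-ok : ∀ R x l y → routeᵇ R x l y ≡ true → Route R x l y
    routeᵇ-ok R x (a ∷ l) y h = subst (λ z → Route R z (a ∷ l) y) (sym (isYes⁻ (x ≟A a) (proj₁ (∧⁻ h))))
      (onwardᵇ-ok R a l y (proj₂ (∧⁻ {⌊ x ≟A a ⌋} h)))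

    spansᵇ : (A → Bool) → List A → Bool
    spansᵇ miss l = allA λ a → occ _≟A_ a l ≡ᵇ indicator (miss a)

    spansᵇ-ok : ∀ miss l → spansᵇ miss l ≡ true → Spans _≟A_ miss l
    spansᵇ-ok miss l h = spanning λ a → ≡ᵇ⁻ (allA-ok (λ a → occ _≟A_ a l ≡ᵇ indicator (miss a)) h a)

    tourᵇ : (A → Bool) → A → List A → A → Bool
    tourᵇ miss x l y = routeᵇ adj x l y ∧ spansᵇ miss l

    tourᵇ-ok : ∀ miss x l y → tourᵇ miss x l y ≡ true → Tour _≟A_ adj miss x y
    tourᵇ-ok miss x l y h = tour l (routeᵇ-ok adj x l y (proj₁ (∧⁻ h))) (spansᵇ-ok miss l (proj₂ (∧⁻ {routeᵇ adj x l y} h)))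

    vertex : ℕ → A
    vertex 1             = nothing
    vertex (suc (suc k)) = just (dc (clamp k))
    vertex 0             = nothing

    path : List ℕ → List A
    path = map vertex

    posᶻ : ℕ → Pointᶻ
    posᶻ = nth (+ 0 , + 0) coords

    place : A → Point
    place a = κᴾ (posᶻ (codeA a))

    open Meets place

    -- Edges with a common end have to coincide or to fork there, other pairs have to be separated.
    crossFree : ℕ → ℕ → ℕ → ℕ → Bool
    crossFree u v w z =
      if u ≡ᵇ w then (v ≡ᵇ z) ∨ forkᵇ (posᶻ u) (posᶻ v) (posᶻ z)
      else if u ≡ᵇ z then (v ≡ᵇ w) ∨ forkᵇ (posᶻ u) (posᶻ v) (posᶻ w)
      else if v ≡ᵇ w then forkᵇ (posᶻ v) (posᶻ u) (posᶻ z)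
      else if v ≡ᵇ z then forkᵇ (posᶻ v) (posᶻ u) (posᶻ w)
      else apartᵇ (posᶻ u) (posᶻ v) (posᶻ w) (posᶻ z)

    realᵇ : ℕ → Bool
    realᵇ k = not (k ≡ᵇ 0)

    edgeRow : (ℕ → ℕ → Bool) → ℕ → Bool
    edgeRow P u = realᵇ u ⇒ᵇ allᵇ (λ v → realᵇ v ⇒ᵇ P u v) (keys u)

    edgesᵇ : (ℕ → ℕ → Bool) → Bool
    edgesᵇ P = everywhere (edgeRow P)

    edgesᵇ-ok : ∀ P → edgesᵇ P ≡ true → ∀ u v → adj u v ≡ true → P (codeA u) (codeA v) ≡ true
    edgesᵇ-ok P h u v e = ⇒ᵇ-ok (All.lookup (allᵇ-ok (λ v → realᵇ v ⇒ᵇ P (codeA u) v) (keys (codeA u)) (⇒ᵇ-ok (everywhere-ok (edgeRow P) h (just u)) (real u))) (elemᵇ⁻ _ e)) (real v)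
      where
      real : ∀ a → realᵇ (codeA a) ≡ true
      real nothing  = refl
      real (just x) = refl

    planarᵇ : Bool
    planarᵇ = edgesᵇ λ u v → edgesᵇ (crossFree u v)

    strictᵇ-ok : ∀ L a b c d → strictᵇ L (posᶻ (codeA a)) (posᶻ (codeA b)) (posᶻ (codeA c)) (posᶻ (codeA d)) ≡ true → Meet place a b c d
    strictᵇ-ok L a b c d h =
      let h₁ , h′ = ∧⁻ {neg? (evᶻ L (posᶻ (codeA c)))} h; h₂ , h″ = ∧⁻ {neg? (evᶻ L (posᶻ (codeA d)))} h′
          h₃ , h₄ = ∧⁻ {nonneg? (evᶻ L (posᶻ (codeA a)))} h″
      in strict (κᴸ L) (subst (0ℚ Data.Rational.≤_) (sym (ev-κ L _)) (nonneg-ok _ h₃)) (subst (0ℚ Data.Rational.≤_) (sym (ev-κ L _)) (nonneg-ok _ h₄))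
           (subst (Data.Rational._< 0ℚ) (sym (ev-κ L _)) (neg-ok _ h₁)) (subst (Data.Rational._< 0ℚ) (sym (ev-κ L _)) (neg-ok _ h₂))

    fanᵇ-ok : ∀ L x b d → fanᵇ L (posᶻ (codeA x)) (posᶻ (codeA b)) (posᶻ (codeA x)) (posᶻ (codeA d)) ≡ true → Meet place x b x d
    fanᵇ-ok L x b d h =
      let h₁ , h′ = ∧⁻ {zero? (evᶻ L (posᶻ (codeA x)))} h; h₂ , h₃ = ∧⁻ {pos? (evᶻ L (posᶻ (codeA b)))} h′
      in fan (κᴸ L) (trans (ev-κ L _) (zero-ok _ h₁)) (subst (0ℚ Data.Rational.<_) (sym (ev-κ L _)) (pos-ok _ h₂))
           (subst (Data.Rational._≤ 0ℚ) (sym (ev-κ L _)) (nonpos-ok _ h₃))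

    forkᵇ-ok : ∀ x b d → forkᵇ (posᶻ (codeA x)) (posᶻ (codeA b)) (posᶻ (codeA d)) ≡ true → Meet place x b x d
    forkᵇ-ok x b d h = [ fanᵇ-ok L x b d , fanᵇ-ok (negᶻ L) x b d ]′ (∨⁻ {fanᵇ L (posᶻ (codeA x)) (posᶻ (codeA b)) (posᶻ (codeA x)) (posᶻ (codeA d))} h)
      where
      L = lineThrough (posᶻ (codeA x)) (posᶻ (codeA d))

    eitherSide-ok : ∀ L a b c d → eitherSide (λ L → strictᵇ L (posᶻ (codeA a)) (posᶻ (codeA b)) (posᶻ (codeA c)) (posᶻ (codeA d))) L ≡ true → Meet place a b c d
    eitherSide-ok L a b c d h = [ strictᵇ-ok L a b c d , strictᵇ-ok (negᶻ L) a b c d ]′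
      (∨⁻ {strictᵇ L (posᶻ (codeA a)) (posᶻ (codeA b)) (posᶻ (codeA c)) (posᶻ (codeA d))} h)

    apartᵇ-ok : ∀ a b c d → apartᵇ (posᶻ (codeA a)) (posᶻ (codeA b)) (posᶻ (codeA c)) (posᶻ (codeA d)) ≡ true → Meet place a b c d
    apartᵇ-ok a b c d h = [ eitherSide-ok L a b c d , (λ p → meet-flip (eitherSide-ok L′ c d a b p)) ]′
      (∨⁻ {eitherSide (λ L → strictᵇ L (posᶻ (codeA a)) (posᶻ (codeA b)) (posᶻ (codeA c)) (posᶻ (codeA d))) L} h)
      where
      L  = lineThrough (posᶻ (codeA a)) (posᶻ (codeA b))
      L′ = lineThrough (posᶻ (codeA c)) (posᶻ (codeA d))

    crossFree-ok : ∀ a b c d → crossFree (codeA a) (codeA b) (codeA c) (codeA d) ≡ true → Meet place a b c d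
    crossFree-ok a b c d h with codeA a ≡ᵇ codeA c in ac
    crossFree-ok a b c d h | true with codeA-injective {a} {c} (≡ᵇ⁻ ac) | ∨⁻ {codeA b ≡ᵇ codeA d} h
    ... | refl | inj₁ p rewrite codeA-injective {b} {d} (≡ᵇ⁻ p) = meet-same
    ... | refl | inj₂ p = forkᵇ-ok a b d p
    crossFree-ok a b c d h | false with codeA a ≡ᵇ codeA d in ad
    crossFree-ok a b c d h | false | true with codeA-injective {a} {d} (≡ᵇ⁻ ad) | ∨⁻ {codeA b ≡ᵇ codeA c} h
    ... | refl | inj₁ p rewrite codeA-injective {b} {c} (≡ᵇ⁻ p) = meet-swap meet-same
    ... | refl | inj₂ p = meet-flip (meet-swap (meet-flip (forkᵇ-ok a b c p)))
    crossFree-ok a b c d h | false | false with codeA b ≡ᵇ codeA c in bc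
    crossFree-ok a b c d h | false | false | true with codeA-injective {b} {c} (≡ᵇ⁻ bc)
    ... | refl = meet-swap (forkᵇ-ok b a d h)
    crossFree-ok a b c d h | false | false | false with codeA b ≡ᵇ codeA d in bd
    crossFree-ok a b c d h | false | false | false | true with codeA-injective {b} {d} (≡ᵇ⁻ bd)
    ... | refl = meet-swap (meet-flip (meet-swap (meet-flip (forkᵇ-ok b a c h))))
    crossFree-ok a b c d h | false | false | false | false = apartᵇ-ok a b c d h

    planarᵇ-ok : planarᵇ ≡ true → ∀ a b c d → adj a b ≡ true → adj c d ≡ true → Meet place a b c d
    planarᵇ-ok h a b c d e f = crossFree-ok a b c d (edgesᵇ-ok (crossFree (codeA a) (codeA b)) (edgesᵇ-ok (λ u v → edgesᵇ (crossFree u v)) h a b e) c d f)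

    samePoint : Pointᶻ → Pointᶻ → Bool
    samePoint (a , b) (c , d) = ⌊ a ℤ.≟ c ⌋ ∧ ⌊ b ℤ.≟ d ⌋

    distinct? : ℕ → ℕ → Bool
    distinct? u v = not (samePoint (posᶻ u) (posᶻ v))

    nondegenerateᵇ : Bool
    nondegenerateᵇ = edgesᵇ distinct?

    nondegenerateᵇ-ok : nondegenerateᵇ ≡ true → ∀ u v → adj u v ≡ true → ¬ place u ≡ place v
    nondegenerateᵇ-ok h u v e p = true≢false
      (cong₂ _∧_ (isYes⁺ (_ ℤ.≟ _) (cong (λ q → ↥ (proj₁ q)) p)) (isYes⁺ (_ ℤ.≟ _) (cong (λ q → ↥ (proj₂ q)) p)))
      (not⁻ (edgesᵇ-ok distinct? h u v e))

    -- The entry 0 is skipped because the extra vertex does not belong to the fragment.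
    neighbour : A → A
    neighbour a = vertex (other-than-0 (keys (codeA a)))
      where
      other-than-0 : List ℕ → ℕ
      other-than-0 []       = 0
      other-than-0 (0 ∷ ks) = other-than-0 ks
      other-than-0 (k ∷ ks) = k

    neighbourᵇ : Bool
    neighbourᵇ = allA λ a → adj a (neighbour a)

    pointsᵇ : (Pointᶻ → Bool) → Bool
    pointsᵇ P = below (suc N) λ k → P (posᶻ (2 + k))

    pointsᵇ-ok : ∀ P → pointsᵇ P ≡ true → ∀ x → P (posᶻ (codeA (just x))) ≡ true
    pointsᵇ-ok P h x = below-ok (suc N) (λ k → P (posᶻ (2 + k))) h (toℕ (enc x)) (toℕ<n (enc x))

    beyondᵇ : ℕ → Lineᶻ → Bool
    beyondᵇ t L = below (suc N) λ k → (k ≡ᵇ t) ∨ pos? (evᶻ L (posᶻ (2 + k)))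

    beyondᵇ-ok : ∀ b L → beyondᵇ (toℕ (enc b)) L ≡ true → ∀ x → ¬ x ≡ b → 0ℚ Data.Rational.< ev (κᴸ L) (place (just x))
    beyondᵇ-ok b L h x x≢b with ∨⁻ {toℕ (enc x) ≡ᵇ toℕ (enc b)} (below-ok (suc N) (λ k → (k ≡ᵇ toℕ (enc b)) ∨ pos? (evᶻ L (posᶻ (2 + k)))) h (toℕ (enc x)) (toℕ<n (enc x)))
    ... | inj₁ p = ⊥-elim (x≢b (just-injective (codeA-injective {just x} {just b} (cong (λ k → suc (suc k)) (≡ᵇ⁻ p)))))
    ... | inj₂ p = subst (0ℚ Data.Rational.<_) (sym (ev-κ L _)) (pos-ok _ p)

-- Fragments from finite data

module Static where

  open Refute
  open Sound
  open Contract
  open Frame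
  open Plane
  open FramePlane
  open Base
  open import Data.Bool using (Bool; true; false; _∧_; _∨_)
  open import Data.Nat using (ℕ; zero; suc; _∸_)
  open import Data.Fin using (Fin; zero; suc; toℕ; _≟_)
  open import Data.Fin.Properties using (toℕ<n)
  open import Data.List using (List; []; _∷_; map; upTo)
  open import Data.Maybe using (just; nothing)
  open import Data.Product using (_×_; _,_; proj₁; proj₂)
  open import Data.Sum using (_⊎_; inj₁; inj₂)
  open import Relation.Nullary using (⌊_⌋)
  open import Relation.Binary.PropositionalEquality

  -- All lists use the codes of the table: 0 for the extra vertex, 1 for a, 2 for b, 3 for c. An
  -- entry of `avoiding` is tagged by the ends of its tour: 0 for b and c, 1 for b and a, 2 for c
  -- and a.
  record Data : Set where
    field
      table                       : List (List ℕ)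
      order                       : List ℕ
      coords                      : List Pointᶻ
      tour-bc tour-ba tour-ca     : List ℕ
      tour-b tour-c               : List ℕ
      avoiding                    : List (ℕ × List ℕ)

  module Static (N : ℕ) (𝔻 : Data) where

    open Data 𝔻
    open Base.Base {suc N} {Fin (suc (suc N))} _≟_ (λ x → x) (λ x → x) (λ _ → refl) table coords public

    b c : Fin (suc (suc N))
    b = zero
    c = suc zero

    xs : List (Fin (suc (suc N)))
    xs = map clamp (upTo (suc (suc N)))

    indexᵇ : (Fin (suc (suc N)) → Bool) → Bool
    indexᵇ P = below (suc (suc N)) λ k → P (clamp k)

    indexᵇ-ok : ∀ P → indexᵇ P ≡ true → ∀ x → P x ≡ true
    indexᵇ-ok P h x = subst (λ y → P y ≡ true) (clamp-toℕ x) (below-ok (suc (suc N)) (λ k → P (clamp k)) h (toℕ x) (toℕ<n x))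

    end : List ℕ → Fin (suc (suc N))
    end []           = zero
    -- The codes 0 and 1 belong to the extra vertex and to the apex, so the indices in `X` are
    -- shifted by two.
    end (k ∷ [])     = clamp (k ∸ 2)
    end (_ ∷ k ∷ ks) = end (k ∷ ks)

    is : A → A → Bool
    is u v = ⌊ u ≟A v ⌋

    avoidᵇ : Fin (suc (suc N)) → ℕ × List ℕ → Bool
    avoidᵇ x (0 , ks) = tourᵇ (is (just x)) (just b) (path ks) (just c)
    avoidᵇ x (1 , ks) = tourᵇ (is (just x)) (just b) (path ks) nothing
    avoidᵇ x (_ , ks) = tourᵇ (is (just x)) (just c) (path ks) nothing

    avoidAt : Fin (suc (suc N)) → Bool
    avoidAt x = avoidᵇ x (nth (0 , []) avoiding (toℕ x))

    record Checks : Set where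
      field
        symmetric     : symmetricᵇ ≡ true
        irreflexive   : irreflexiveᵇ ≡ true
        once          : indexᵇ (λ x → parity (λ y → ⌊ y ≟ x ⌋) xs) ≡ true
        terminals     : (elemᵇ 0 (keys 1) ∧ elemᵇ 1 (keys 0)) ∧ (elemᵇ 0 (keys 2) ∧ elemᵇ 2 (keys 0)) ∧ (elemᵇ 0 (keys 3) ∧ elemᵇ 3 (keys 0)) ≡ true
        valid         : validᵇ order ≡ true
        refuted       : refute 200 (initial order) ≡ true
        bc            : tourᵇ (is nothing) (just b) (path tour-bc) (just c) ≡ true
        ba            : adj (just (end tour-ba)) nothing ∧ tourᵇ (λ v → is nothing v ∨ is (just c) v) (just b) (path tour-ba) (just (end tour-ba)) ≡ true
        ca            : adj (just (end tour-ca)) nothing ∧ tourᵇ (λ v → is nothing v ∨ is (just b) v) (just c) (path tour-ca) (just (end tour-ca)) ≡ true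
        b-all         : tourᵇ (λ _ → false) (just b) (path tour-b) (just (end tour-b)) ≡ true
        c-all         : tourᵇ (λ _ → false) (just c) (path tour-c) (just (end tour-c)) ≡ true
        avoids        : indexᵇ avoidAt ≡ true
        left          : pointsᵇ (λ p → neg? (proj₁ p)) ≡ true
        above         : pointsᵇ (λ p → pos? (proj₂ p)) ≡ true
        beyond-b      : beyondᵇ 0 line-b ≡ true
        beyond-c      : beyondᵇ 1 line-c ≡ true
        neighbours    : neighbourᵇ ≡ true
        nondegenerate : nondegenerateᵇ ≡ true
        planar        : planarᵇ ≡ true
        corners       : (posᶻ 1 ≡ corner-a) × (posᶻ 2 ≡ corner-b) × (posᶻ 3 ≡ corner-c)

    module _ (checks : Checks) where

      private
        module C = Checks checks

      fragment : Fragment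
      fragment = record
        { X = Fin (suc (suc N)); _≟_ = _≟_; xs = xs
        ; once = indexᵇ-ok (λ x → parity (λ y → ⌊ y ≟ x ⌋) xs) C.once
        ; adj = adj; adj-sym = adj-sym C.symmetric; adj-irr = adj-irr C.irreflexive
        ; b = b; c = c; b≢c = λ ()
        ; nonham = Nonham.nonham b c order (proj₁ t) (proj₁ t′) (proj₂ t′) C.valid C.refuted
        ; b→c = tourᵇ-ok (is nothing) (just b) (path tour-bc) (just c) C.bc
        ; b↠a = end tour-ba , proj₁ ba , tourᵇ-ok (λ v → is nothing v ∨ is (just c) v) (just b) (path tour-ba) (just (end tour-ba)) (proj₂ ba)
        ; c↠a = end tour-ca , proj₁ ca , tourᵇ-ok (λ v → is nothing v ∨ is (just b) v) (just c) (path tour-ca) (just (end tour-ca)) (proj₂ ca)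
        ; b↠ = _ , tourᵇ-ok (λ _ → false) (just b) (path tour-b) (just (end tour-b)) C.b-all
        ; c↠ = _ , tourᵇ-ok (λ _ → false) (just c) (path tour-c) (just (end tour-c)) C.c-all
        ; avoid = λ x → kind x (nth (0 , []) avoiding (toℕ x)) (indexᵇ-ok avoidAt C.avoids x)
        }
        where
        t  = ∧⁻ {elemᵇ 0 (keys 1) ∧ elemᵇ 1 (keys 0)} C.terminals
        t′ = ∧⁻ {elemᵇ 0 (keys 2) ∧ elemᵇ 2 (keys 0)} (proj₂ t)
        ba = ∧⁻ {adj (just (end tour-ba)) nothing} C.ba
        ca = ∧⁻ {adj (just (end tour-ca)) nothing} C.ca
        kind : ∀ x r → avoidᵇ x r ≡ true → Tour _≟A_ adj (is (just x)) (just b) (just c)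
               ⊎ Tour _≟A_ adj (is (just x)) (just b) nothing ⊎ Tour _≟A_ adj (is (just x)) (just c) nothing
        kind x (0 , ks)           h = inj₁ (tourᵇ-ok (is (just x)) (just b) (path ks) (just c) h)
        kind x (1 , ks)           h = inj₂ (inj₁ (tourᵇ-ok (is (just x)) (just b) (path ks) nothing h))
        kind x (suc (suc _) , ks) h = inj₂ (inj₂ (tourᵇ-ok (is (just x)) (just c) (path ks) nothing h))

      drawing : Drawing fragment
      drawing = record
        { place = place
        ; at-a = cong κᴾ (proj₁ C.corners); at-b = cong κᴾ (proj₁ (proj₂ C.corners)); at-c = cong κᴾ (proj₂ (proj₂ C.corners))
        ; left = λ x → neg-ok _ (pointsᵇ-ok (λ p → neg? (proj₁ p)) C.left x)
        ; above = λ x → pos-ok _ (pointsᵇ-ok (λ p → pos? (proj₂ p)) C.above x)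
        ; beyond-b = beyondᵇ-ok b line-b C.beyond-b
        ; beyond-c = beyondᵇ-ok c line-c C.beyond-c
        ; nbr = λ u → neighbour u , allA-ok (λ a → adj a (neighbour a)) C.neighbours u
        ; nondegenerate = nondegenerateᵇ-ok C.nondegenerate
        ; planar = planarᵇ-ok C.planar
        }

-- The fragments with 33 and 36 vertices

module Graphs where

  open Static
  open import Data.Integer using (+_; -[1+_])
  open import Data.List using ([]; _∷_)
  open import Data.Product using (_,_)
  open import Relation.Binary.PropositionalEquality

  -- The index counts the rows of the table, including row 0 of the extra vertex. The vertices 4, 6,
  -- 7, 8 form a quadrangle, at which the seed of the growing fragments is obtained below.
  data₃₄ : Data
  data₃₄ = record
    { table =
        (2 ∷ 3 ∷ 1 ∷ [])
        ∷ (4 ∷ 0 ∷ 11 ∷ 15 ∷ [])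
        ∷ (4 ∷ 5 ∷ 0 ∷ [])
        ∷ (5 ∷ 0 ∷ 12 ∷ 22 ∷ [])
        ∷ (2 ∷ 6 ∷ 8 ∷ 1 ∷ [])
        ∷ (2 ∷ 6 ∷ 3 ∷ 9 ∷ [])
        ∷ (4 ∷ 5 ∷ 7 ∷ [])
        ∷ (6 ∷ 8 ∷ 9 ∷ [])
        ∷ (4 ∷ 7 ∷ 10 ∷ 30 ∷ [])
        ∷ (5 ∷ 7 ∷ 13 ∷ 33 ∷ [])
        ∷ (8 ∷ 11 ∷ 32 ∷ [])
        ∷ (1 ∷ 10 ∷ 16 ∷ [])
        ∷ (3 ∷ 13 ∷ 24 ∷ [])
        ∷ (9 ∷ 12 ∷ 27 ∷ [])
        ∷ (15 ∷ 16 ∷ 19 ∷ [])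
        ∷ (1 ∷ 14 ∷ 22 ∷ [])
        ∷ (11 ∷ 14 ∷ 21 ∷ [])
        ∷ (19 ∷ 20 ∷ 21 ∷ [])
        ∷ (19 ∷ 22 ∷ 24 ∷ [])
        ∷ (14 ∷ 17 ∷ 18 ∷ [])
        ∷ (17 ∷ 24 ∷ 26 ∷ [])
        ∷ (16 ∷ 17 ∷ 32 ∷ [])
        ∷ (3 ∷ 15 ∷ 18 ∷ [])
        ∷ (24 ∷ 25 ∷ 27 ∷ [])
        ∷ (12 ∷ 18 ∷ 20 ∷ 23 ∷ [])
        ∷ (23 ∷ 26 ∷ 29 ∷ [])
        ∷ (20 ∷ 25 ∷ 32 ∷ [])
        ∷ (13 ∷ 23 ∷ 28 ∷ [])
        ∷ (27 ∷ 29 ∷ 33 ∷ [])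
        ∷ (25 ∷ 28 ∷ 31 ∷ [])
        ∷ (8 ∷ 31 ∷ 33 ∷ [])
        ∷ (29 ∷ 30 ∷ 32 ∷ [])
        ∷ (10 ∷ 21 ∷ 26 ∷ 31 ∷ [])
        ∷ (9 ∷ 28 ∷ 30 ∷ [])
        ∷ []
    ; order = 25 ∷ 23 ∷ 26 ∷ 29 ∷ 24 ∷ 27 ∷ 20 ∷ 32 ∷ 28 ∷ 31 ∷ 12 ∷ 18 ∷ 13 ∷ 17 ∷ 10 ∷ 21 ∷ 33 ∷ 30 ∷ 3 ∷ 19 ∷ 22 ∷ 9 ∷ 8 ∷ 11 ∷ 16 ∷ 5 ∷ 0 ∷ 14 ∷ 15 ∷ 7 ∷ 4 ∷ 1 ∷ 2 ∷ 6 ∷ []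
    ; coords =
        (+ 0 , + 0)
        ∷ (+ 0 , + 300)
        ∷ (-[1+ 599 ] , + 1)
        ∷ (-[1+ 299 ] , + 1)
        ∷ (-[1+ 298 ] , + 129)
        ∷ (-[1+ 385 ] , + 43)
        ∷ (-[1+ 328 ] , + 90)
        ∷ (-[1+ 302 ] , + 98)
        ∷ (-[1+ 266 ] , + 125)
        ∷ (-[1+ 313 ] , + 79)
        ∷ (-[1+ 199 ] , + 158)
        ∷ (-[1+ 118 ] , + 212)
        ∷ (-[1+ 275 ] , + 58)
        ∷ (-[1+ 285 ] , + 77)
        ∷ (-[1+ 155 ] , + 169)
        ∷ (-[1+ 122 ] , + 190)
        ∷ (-[1+ 154 ] , + 177)
        ∷ (-[1+ 201 ] , + 136)
        ∷ (-[1+ 214 ] , + 113)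
        ∷ (-[1+ 190 ] , + 139)
        ∷ (-[1+ 222 ] , + 119)
        ∷ (-[1+ 190 ] , + 151)
        ∷ (-[1+ 212 ] , + 101)
        ∷ (-[1+ 250 ] , + 101)
        ∷ (-[1+ 240 ] , + 98)
        ∷ (-[1+ 242 ] , + 112)
        ∷ (-[1+ 226 ] , + 123)
        ∷ (-[1+ 267 ] , + 93)
        ∷ (-[1+ 266 ] , + 101)
        ∷ (-[1+ 250 ] , + 111)
        ∷ (-[1+ 263 ] , + 115)
        ∷ (-[1+ 243 ] , + 122)
        ∷ (-[1+ 215 ] , + 138)
        ∷ (-[1+ 281 ] , + 98)
        ∷ []
    ; tour-bc = 2 ∷ 4 ∷ 6 ∷ 5 ∷ 9 ∷ 7 ∷ 8 ∷ 30 ∷ 33 ∷ 28 ∷ 29 ∷ 31 ∷ 32 ∷ 10 ∷ 11 ∷ 16 ∷ 21 ∷ 17 ∷ 19 ∷ 14 ∷ 15 ∷ 22 ∷ 18 ∷ 24 ∷ 20 ∷ 26 ∷ 25 ∷ 23 ∷ 27 ∷ 13 ∷ 12 ∷ 3 ∷ []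
    ; tour-ba = 2 ∷ 5 ∷ 6 ∷ 4 ∷ 8 ∷ 7 ∷ 9 ∷ 13 ∷ 12 ∷ 24 ∷ 23 ∷ 27 ∷ 28 ∷ 33 ∷ 30 ∷ 31 ∷ 29 ∷ 25 ∷ 26 ∷ 20 ∷ 17 ∷ 19 ∷ 18 ∷ 22 ∷ 15 ∷ 14 ∷ 16 ∷ 21 ∷ 32 ∷ 10 ∷ 11 ∷ []
    ; tour-ca = 3 ∷ 5 ∷ 6 ∷ 4 ∷ 8 ∷ 7 ∷ 9 ∷ 13 ∷ 12 ∷ 24 ∷ 23 ∷ 27 ∷ 28 ∷ 33 ∷ 30 ∷ 31 ∷ 29 ∷ 25 ∷ 26 ∷ 20 ∷ 17 ∷ 21 ∷ 32 ∷ 10 ∷ 11 ∷ 16 ∷ 14 ∷ 19 ∷ 18 ∷ 22 ∷ 15 ∷ []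
    ; tour-b = 2 ∷ 4 ∷ 1 ∷ 11 ∷ 10 ∷ 8 ∷ 7 ∷ 6 ∷ 5 ∷ 3 ∷ 22 ∷ 15 ∷ 14 ∷ 16 ∷ 21 ∷ 32 ∷ 31 ∷ 30 ∷ 33 ∷ 9 ∷ 13 ∷ 12 ∷ 24 ∷ 18 ∷ 19 ∷ 17 ∷ 20 ∷ 26 ∷ 25 ∷ 23 ∷ 27 ∷ 28 ∷ 29 ∷ []
    ; tour-c = 3 ∷ 22 ∷ 18 ∷ 19 ∷ 14 ∷ 15 ∷ 1 ∷ 11 ∷ 16 ∷ 21 ∷ 17 ∷ 20 ∷ 26 ∷ 32 ∷ 10 ∷ 8 ∷ 7 ∷ 6 ∷ 4 ∷ 2 ∷ 5 ∷ 9 ∷ 13 ∷ 12 ∷ 24 ∷ 23 ∷ 27 ∷ 28 ∷ 33 ∷ 30 ∷ 31 ∷ 29 ∷ 25 ∷ []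
    ; avoiding =
        (2 , 3 ∷ 5 ∷ 6 ∷ 4 ∷ 8 ∷ 7 ∷ 9 ∷ 13 ∷ 12 ∷ 24 ∷ 23 ∷ 27 ∷ 28 ∷ 33 ∷ 30 ∷ 31 ∷ 29 ∷ 25 ∷ 26 ∷ 20 ∷ 17 ∷ 21 ∷ 32 ∷ 10 ∷ 11 ∷ 16 ∷ 14 ∷ 19 ∷ 18 ∷ 22 ∷ 15 ∷ 1 ∷ [])
        ∷ (1 , 2 ∷ 5 ∷ 6 ∷ 4 ∷ 8 ∷ 7 ∷ 9 ∷ 13 ∷ 12 ∷ 24 ∷ 23 ∷ 27 ∷ 28 ∷ 33 ∷ 30 ∷ 31 ∷ 29 ∷ 25 ∷ 26 ∷ 20 ∷ 17 ∷ 19 ∷ 18 ∷ 22 ∷ 15 ∷ 14 ∷ 16 ∷ 21 ∷ 32 ∷ 10 ∷ 11 ∷ 1 ∷ [])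
        ∷ (0 , 2 ∷ 5 ∷ 6 ∷ 7 ∷ 8 ∷ 10 ∷ 11 ∷ 1 ∷ 15 ∷ 14 ∷ 16 ∷ 21 ∷ 32 ∷ 26 ∷ 25 ∷ 23 ∷ 27 ∷ 28 ∷ 29 ∷ 31 ∷ 30 ∷ 33 ∷ 9 ∷ 13 ∷ 12 ∷ 24 ∷ 20 ∷ 17 ∷ 19 ∷ 18 ∷ 22 ∷ 3 ∷ [])
        ∷ (0 , 2 ∷ 4 ∷ 6 ∷ 7 ∷ 8 ∷ 10 ∷ 11 ∷ 1 ∷ 15 ∷ 14 ∷ 16 ∷ 21 ∷ 32 ∷ 26 ∷ 25 ∷ 23 ∷ 27 ∷ 28 ∷ 29 ∷ 31 ∷ 30 ∷ 33 ∷ 9 ∷ 13 ∷ 12 ∷ 24 ∷ 20 ∷ 17 ∷ 19 ∷ 18 ∷ 22 ∷ 3 ∷ [])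
        ∷ (2 , 3 ∷ 12 ∷ 13 ∷ 27 ∷ 28 ∷ 33 ∷ 30 ∷ 31 ∷ 29 ∷ 25 ∷ 23 ∷ 24 ∷ 20 ∷ 26 ∷ 32 ∷ 21 ∷ 17 ∷ 19 ∷ 18 ∷ 22 ∷ 15 ∷ 14 ∷ 16 ∷ 11 ∷ 10 ∷ 8 ∷ 7 ∷ 9 ∷ 5 ∷ 2 ∷ 4 ∷ 1 ∷ [])
        ∷ (0 , 2 ∷ 4 ∷ 6 ∷ 5 ∷ 9 ∷ 33 ∷ 28 ∷ 27 ∷ 13 ∷ 12 ∷ 24 ∷ 23 ∷ 25 ∷ 29 ∷ 31 ∷ 30 ∷ 8 ∷ 10 ∷ 11 ∷ 1 ∷ 15 ∷ 14 ∷ 16 ∷ 21 ∷ 32 ∷ 26 ∷ 20 ∷ 17 ∷ 19 ∷ 18 ∷ 22 ∷ 3 ∷ [])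
        ∷ (0 , 2 ∷ 4 ∷ 1 ∷ 15 ∷ 22 ∷ 18 ∷ 19 ∷ 14 ∷ 16 ∷ 11 ∷ 10 ∷ 32 ∷ 21 ∷ 17 ∷ 20 ∷ 26 ∷ 25 ∷ 23 ∷ 24 ∷ 12 ∷ 13 ∷ 27 ∷ 28 ∷ 29 ∷ 31 ∷ 30 ∷ 33 ∷ 9 ∷ 7 ∷ 6 ∷ 5 ∷ 3 ∷ [])
        ∷ (1 , 2 ∷ 5 ∷ 3 ∷ 12 ∷ 13 ∷ 27 ∷ 23 ∷ 24 ∷ 18 ∷ 22 ∷ 15 ∷ 14 ∷ 19 ∷ 17 ∷ 20 ∷ 26 ∷ 25 ∷ 29 ∷ 28 ∷ 33 ∷ 30 ∷ 31 ∷ 32 ∷ 21 ∷ 16 ∷ 11 ∷ 10 ∷ 8 ∷ 7 ∷ 6 ∷ 4 ∷ 1 ∷ [])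
        ∷ (0 , 2 ∷ 4 ∷ 1 ∷ 11 ∷ 16 ∷ 14 ∷ 15 ∷ 22 ∷ 18 ∷ 19 ∷ 17 ∷ 21 ∷ 32 ∷ 26 ∷ 20 ∷ 24 ∷ 12 ∷ 13 ∷ 9 ∷ 33 ∷ 28 ∷ 27 ∷ 23 ∷ 25 ∷ 29 ∷ 31 ∷ 30 ∷ 8 ∷ 7 ∷ 6 ∷ 5 ∷ 3 ∷ [])
        ∷ (0 , 2 ∷ 4 ∷ 1 ∷ 15 ∷ 14 ∷ 16 ∷ 21 ∷ 32 ∷ 10 ∷ 8 ∷ 7 ∷ 6 ∷ 5 ∷ 9 ∷ 13 ∷ 12 ∷ 24 ∷ 23 ∷ 27 ∷ 28 ∷ 33 ∷ 30 ∷ 31 ∷ 29 ∷ 25 ∷ 26 ∷ 20 ∷ 17 ∷ 19 ∷ 18 ∷ 22 ∷ 3 ∷ [])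
        ∷ (0 , 2 ∷ 4 ∷ 1 ∷ 11 ∷ 10 ∷ 8 ∷ 7 ∷ 6 ∷ 5 ∷ 9 ∷ 13 ∷ 27 ∷ 23 ∷ 25 ∷ 29 ∷ 28 ∷ 33 ∷ 30 ∷ 31 ∷ 32 ∷ 26 ∷ 20 ∷ 24 ∷ 18 ∷ 19 ∷ 17 ∷ 21 ∷ 16 ∷ 14 ∷ 15 ∷ 22 ∷ 3 ∷ [])
        ∷ (0 , 2 ∷ 4 ∷ 1 ∷ 11 ∷ 10 ∷ 8 ∷ 7 ∷ 6 ∷ 5 ∷ 9 ∷ 33 ∷ 30 ∷ 31 ∷ 29 ∷ 28 ∷ 27 ∷ 23 ∷ 25 ∷ 26 ∷ 32 ∷ 21 ∷ 16 ∷ 14 ∷ 15 ∷ 22 ∷ 18 ∷ 19 ∷ 17 ∷ 20 ∷ 24 ∷ 12 ∷ 3 ∷ [])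
        ∷ (0 , 2 ∷ 4 ∷ 1 ∷ 15 ∷ 22 ∷ 18 ∷ 19 ∷ 17 ∷ 20 ∷ 24 ∷ 12 ∷ 13 ∷ 27 ∷ 23 ∷ 25 ∷ 26 ∷ 32 ∷ 21 ∷ 16 ∷ 11 ∷ 10 ∷ 8 ∷ 30 ∷ 31 ∷ 29 ∷ 28 ∷ 33 ∷ 9 ∷ 7 ∷ 6 ∷ 5 ∷ 3 ∷ [])
        ∷ (0 , 2 ∷ 5 ∷ 6 ∷ 7 ∷ 9 ∷ 13 ∷ 12 ∷ 24 ∷ 23 ∷ 27 ∷ 28 ∷ 33 ∷ 30 ∷ 8 ∷ 4 ∷ 1 ∷ 11 ∷ 10 ∷ 32 ∷ 31 ∷ 29 ∷ 25 ∷ 26 ∷ 20 ∷ 17 ∷ 21 ∷ 16 ∷ 14 ∷ 19 ∷ 18 ∷ 22 ∷ 3 ∷ [])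
        ∷ (0 , 2 ∷ 4 ∷ 8 ∷ 7 ∷ 6 ∷ 5 ∷ 9 ∷ 33 ∷ 30 ∷ 31 ∷ 29 ∷ 28 ∷ 27 ∷ 13 ∷ 12 ∷ 24 ∷ 23 ∷ 25 ∷ 26 ∷ 20 ∷ 17 ∷ 21 ∷ 32 ∷ 10 ∷ 11 ∷ 1 ∷ 15 ∷ 14 ∷ 19 ∷ 18 ∷ 22 ∷ 3 ∷ [])
        ∷ (0 , 2 ∷ 4 ∷ 6 ∷ 5 ∷ 9 ∷ 7 ∷ 8 ∷ 10 ∷ 11 ∷ 1 ∷ 15 ∷ 22 ∷ 18 ∷ 19 ∷ 14 ∷ 16 ∷ 21 ∷ 32 ∷ 31 ∷ 30 ∷ 33 ∷ 28 ∷ 29 ∷ 25 ∷ 26 ∷ 20 ∷ 24 ∷ 23 ∷ 27 ∷ 13 ∷ 12 ∷ 3 ∷ [])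
        ∷ (0 , 2 ∷ 4 ∷ 1 ∷ 11 ∷ 16 ∷ 21 ∷ 32 ∷ 10 ∷ 8 ∷ 7 ∷ 6 ∷ 5 ∷ 9 ∷ 13 ∷ 12 ∷ 24 ∷ 23 ∷ 27 ∷ 28 ∷ 33 ∷ 30 ∷ 31 ∷ 29 ∷ 25 ∷ 26 ∷ 20 ∷ 17 ∷ 19 ∷ 14 ∷ 15 ∷ 22 ∷ 3 ∷ [])
        ∷ (0 , 2 ∷ 4 ∷ 1 ∷ 11 ∷ 10 ∷ 8 ∷ 7 ∷ 6 ∷ 5 ∷ 9 ∷ 13 ∷ 27 ∷ 23 ∷ 25 ∷ 29 ∷ 28 ∷ 33 ∷ 30 ∷ 31 ∷ 32 ∷ 26 ∷ 20 ∷ 17 ∷ 21 ∷ 16 ∷ 14 ∷ 15 ∷ 22 ∷ 18 ∷ 24 ∷ 12 ∷ 3 ∷ [])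
        ∷ (0 , 2 ∷ 4 ∷ 1 ∷ 11 ∷ 16 ∷ 21 ∷ 17 ∷ 19 ∷ 14 ∷ 15 ∷ 22 ∷ 18 ∷ 24 ∷ 23 ∷ 25 ∷ 26 ∷ 32 ∷ 10 ∷ 8 ∷ 7 ∷ 6 ∷ 5 ∷ 9 ∷ 33 ∷ 30 ∷ 31 ∷ 29 ∷ 28 ∷ 27 ∷ 13 ∷ 12 ∷ 3 ∷ [])
        ∷ (0 , 2 ∷ 4 ∷ 1 ∷ 11 ∷ 16 ∷ 14 ∷ 15 ∷ 22 ∷ 18 ∷ 19 ∷ 17 ∷ 20 ∷ 24 ∷ 12 ∷ 13 ∷ 27 ∷ 23 ∷ 25 ∷ 26 ∷ 32 ∷ 10 ∷ 8 ∷ 30 ∷ 31 ∷ 29 ∷ 28 ∷ 33 ∷ 9 ∷ 7 ∷ 6 ∷ 5 ∷ 3 ∷ [])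
        ∷ (0 , 2 ∷ 4 ∷ 6 ∷ 5 ∷ 9 ∷ 7 ∷ 8 ∷ 30 ∷ 33 ∷ 28 ∷ 29 ∷ 31 ∷ 32 ∷ 10 ∷ 11 ∷ 1 ∷ 15 ∷ 14 ∷ 16 ∷ 21 ∷ 17 ∷ 19 ∷ 18 ∷ 24 ∷ 20 ∷ 26 ∷ 25 ∷ 23 ∷ 27 ∷ 13 ∷ 12 ∷ 3 ∷ [])
        ∷ (0 , 2 ∷ 4 ∷ 1 ∷ 11 ∷ 10 ∷ 8 ∷ 7 ∷ 6 ∷ 5 ∷ 9 ∷ 13 ∷ 27 ∷ 28 ∷ 33 ∷ 30 ∷ 31 ∷ 29 ∷ 25 ∷ 26 ∷ 32 ∷ 21 ∷ 16 ∷ 14 ∷ 15 ∷ 22 ∷ 18 ∷ 19 ∷ 17 ∷ 20 ∷ 24 ∷ 12 ∷ 3 ∷ [])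
        ∷ (0 , 2 ∷ 4 ∷ 6 ∷ 5 ∷ 9 ∷ 7 ∷ 8 ∷ 10 ∷ 11 ∷ 1 ∷ 15 ∷ 22 ∷ 18 ∷ 19 ∷ 14 ∷ 16 ∷ 21 ∷ 17 ∷ 20 ∷ 26 ∷ 32 ∷ 31 ∷ 30 ∷ 33 ∷ 28 ∷ 29 ∷ 25 ∷ 23 ∷ 27 ∷ 13 ∷ 12 ∷ 3 ∷ [])
        ∷ (1 , 2 ∷ 5 ∷ 3 ∷ 12 ∷ 13 ∷ 9 ∷ 33 ∷ 30 ∷ 31 ∷ 29 ∷ 28 ∷ 27 ∷ 23 ∷ 24 ∷ 18 ∷ 22 ∷ 15 ∷ 14 ∷ 19 ∷ 17 ∷ 20 ∷ 26 ∷ 32 ∷ 21 ∷ 16 ∷ 11 ∷ 10 ∷ 8 ∷ 7 ∷ 6 ∷ 4 ∷ 1 ∷ [])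
        ∷ (0 , 2 ∷ 4 ∷ 1 ∷ 11 ∷ 10 ∷ 8 ∷ 7 ∷ 6 ∷ 5 ∷ 9 ∷ 13 ∷ 27 ∷ 23 ∷ 25 ∷ 29 ∷ 28 ∷ 33 ∷ 30 ∷ 31 ∷ 32 ∷ 21 ∷ 16 ∷ 14 ∷ 15 ∷ 22 ∷ 18 ∷ 19 ∷ 17 ∷ 20 ∷ 24 ∷ 12 ∷ 3 ∷ [])
        ∷ (0 , 2 ∷ 4 ∷ 1 ∷ 11 ∷ 10 ∷ 8 ∷ 30 ∷ 33 ∷ 28 ∷ 29 ∷ 31 ∷ 32 ∷ 21 ∷ 16 ∷ 14 ∷ 15 ∷ 22 ∷ 18 ∷ 19 ∷ 17 ∷ 20 ∷ 26 ∷ 25 ∷ 23 ∷ 24 ∷ 12 ∷ 13 ∷ 9 ∷ 7 ∷ 6 ∷ 5 ∷ 3 ∷ [])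
        ∷ (0 , 2 ∷ 4 ∷ 1 ∷ 11 ∷ 10 ∷ 8 ∷ 7 ∷ 6 ∷ 5 ∷ 9 ∷ 33 ∷ 30 ∷ 31 ∷ 29 ∷ 25 ∷ 23 ∷ 27 ∷ 13 ∷ 12 ∷ 24 ∷ 18 ∷ 19 ∷ 17 ∷ 20 ∷ 26 ∷ 32 ∷ 21 ∷ 16 ∷ 14 ∷ 15 ∷ 22 ∷ 3 ∷ [])
        ∷ (0 , 2 ∷ 4 ∷ 1 ∷ 11 ∷ 10 ∷ 8 ∷ 7 ∷ 6 ∷ 5 ∷ 9 ∷ 13 ∷ 27 ∷ 28 ∷ 33 ∷ 30 ∷ 31 ∷ 32 ∷ 21 ∷ 16 ∷ 14 ∷ 15 ∷ 22 ∷ 18 ∷ 19 ∷ 17 ∷ 20 ∷ 26 ∷ 25 ∷ 23 ∷ 24 ∷ 12 ∷ 3 ∷ [])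
        ∷ (0 , 2 ∷ 4 ∷ 6 ∷ 7 ∷ 8 ∷ 10 ∷ 11 ∷ 1 ∷ 15 ∷ 22 ∷ 18 ∷ 19 ∷ 14 ∷ 16 ∷ 21 ∷ 17 ∷ 20 ∷ 26 ∷ 32 ∷ 31 ∷ 29 ∷ 25 ∷ 23 ∷ 24 ∷ 12 ∷ 13 ∷ 27 ∷ 28 ∷ 33 ∷ 9 ∷ 5 ∷ 3 ∷ [])
        ∷ (0 , 2 ∷ 4 ∷ 1 ∷ 11 ∷ 10 ∷ 32 ∷ 21 ∷ 16 ∷ 14 ∷ 15 ∷ 22 ∷ 18 ∷ 19 ∷ 17 ∷ 20 ∷ 26 ∷ 25 ∷ 29 ∷ 28 ∷ 27 ∷ 23 ∷ 24 ∷ 12 ∷ 13 ∷ 9 ∷ 33 ∷ 30 ∷ 8 ∷ 7 ∷ 6 ∷ 5 ∷ 3 ∷ [])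
        ∷ (0 , 2 ∷ 4 ∷ 6 ∷ 7 ∷ 8 ∷ 10 ∷ 11 ∷ 1 ∷ 15 ∷ 22 ∷ 18 ∷ 19 ∷ 14 ∷ 16 ∷ 21 ∷ 17 ∷ 20 ∷ 26 ∷ 25 ∷ 23 ∷ 24 ∷ 12 ∷ 13 ∷ 27 ∷ 28 ∷ 29 ∷ 31 ∷ 30 ∷ 33 ∷ 9 ∷ 5 ∷ 3 ∷ [])
        ∷ (0 , 2 ∷ 4 ∷ 1 ∷ 11 ∷ 10 ∷ 8 ∷ 30 ∷ 31 ∷ 29 ∷ 28 ∷ 27 ∷ 23 ∷ 25 ∷ 26 ∷ 32 ∷ 21 ∷ 16 ∷ 14 ∷ 15 ∷ 22 ∷ 18 ∷ 19 ∷ 17 ∷ 20 ∷ 24 ∷ 12 ∷ 13 ∷ 9 ∷ 7 ∷ 6 ∷ 5 ∷ 3 ∷ [])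
        ∷ []
    }

  -- Besides the apex it has 35 vertices, which is 3 modulo 4; this opens the residue classes of
  -- orders that fragments with 32 + 4k such vertices do not reach.
  data₃₇ : Data
  data₃₇ = record
    { table =
        (1 ∷ 2 ∷ 3 ∷ [])
        ∷ (0 ∷ 4 ∷ 6 ∷ 7 ∷ [])
        ∷ (0 ∷ 4 ∷ 10 ∷ 12 ∷ [])
        ∷ (0 ∷ 7 ∷ 10 ∷ [])
        ∷ (1 ∷ 2 ∷ 5 ∷ [])
        ∷ (4 ∷ 6 ∷ 12 ∷ [])
        ∷ (1 ∷ 5 ∷ 8 ∷ 32 ∷ [])
        ∷ (1 ∷ 3 ∷ 9 ∷ 18 ∷ [])
        ∷ (6 ∷ 9 ∷ 36 ∷ [])
        ∷ (7 ∷ 8 ∷ 14 ∷ [])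
        ∷ (2 ∷ 3 ∷ 13 ∷ 22 ∷ [])
        ∷ (12 ∷ 13 ∷ 29 ∷ [])
        ∷ (2 ∷ 5 ∷ 11 ∷ 33 ∷ 35 ∷ [])
        ∷ (10 ∷ 11 ∷ 34 ∷ [])
        ∷ (9 ∷ 16 ∷ 20 ∷ [])
        ∷ (16 ∷ 17 ∷ 24 ∷ [])
        ∷ (14 ∷ 15 ∷ 36 ∷ [])
        ∷ (15 ∷ 20 ∷ 25 ∷ 27 ∷ [])
        ∷ (7 ∷ 20 ∷ 22 ∷ [])
        ∷ (20 ∷ 21 ∷ 26 ∷ [])
        ∷ (14 ∷ 17 ∷ 18 ∷ 19 ∷ [])
        ∷ (19 ∷ 22 ∷ 34 ∷ [])
        ∷ (10 ∷ 18 ∷ 21 ∷ [])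
        ∷ (24 ∷ 25 ∷ 33 ∷ [])
        ∷ (15 ∷ 23 ∷ 31 ∷ [])
        ∷ (17 ∷ 23 ∷ 35 ∷ [])
        ∷ (19 ∷ 27 ∷ 28 ∷ [])
        ∷ (17 ∷ 26 ∷ 30 ∷ [])
        ∷ (26 ∷ 29 ∷ 34 ∷ [])
        ∷ (11 ∷ 28 ∷ 30 ∷ [])
        ∷ (27 ∷ 29 ∷ 35 ∷ [])
        ∷ (24 ∷ 32 ∷ 36 ∷ [])
        ∷ (6 ∷ 31 ∷ 33 ∷ [])
        ∷ (12 ∷ 23 ∷ 32 ∷ [])
        ∷ (13 ∷ 21 ∷ 28 ∷ [])
        ∷ (12 ∷ 25 ∷ 30 ∷ [])
        ∷ (8 ∷ 16 ∷ 31 ∷ [])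
        ∷ []
    ; order = 27 ∷ 17 ∷ 26 ∷ 30 ∷ 15 ∷ 20 ∷ 25 ∷ 19 ∷ 28 ∷ 29 ∷ 35 ∷ 16 ∷ 24 ∷ 14 ∷ 18 ∷ 23 ∷ 21 ∷ 34 ∷ 11 ∷ 12 ∷ 36 ∷ 31 ∷ 9 ∷ 7 ∷ 22 ∷ 33 ∷ 13 ∷ 2 ∷ 5 ∷ 8 ∷ 32 ∷ 1 ∷ 3 ∷ 10 ∷ 0 ∷ 4 ∷ 6 ∷ []
    ; coords =
        (+ 0 , + 0)
        ∷ (+ 0 , + 300)
        ∷ (-[1+ 599 ] , + 1)
        ∷ (-[1+ 299 ] , + 1)
        ∷ (-[1+ 297 ] , + 147)
        ∷ (-[1+ 294 ] , + 139)
        ∷ (-[1+ 196 ] , + 184)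
        ∷ (-[1+ 202 ] , + 136)
        ∷ (-[1+ 228 ] , + 154)
        ∷ (-[1+ 232 ] , + 138)
        ∷ (-[1+ 404 ] , + 35)
        ∷ (-[1+ 374 ] , + 77)
        ∷ (-[1+ 388 ] , + 85)
        ∷ (-[1+ 378 ] , + 63)
        ∷ (-[1+ 266 ] , + 125)
        ∷ (-[1+ 291 ] , + 120)
        ∷ (-[1+ 271 ] , + 128)
        ∷ (-[1+ 310 ] , + 107)
        ∷ (-[1+ 279 ] , + 106)
        ∷ (-[1+ 323 ] , + 93)
        ∷ (-[1+ 295 ] , + 108)
        ∷ (-[1+ 340 ] , + 81)
        ∷ (-[1+ 341 ] , + 74)
        ∷ (-[1+ 313 ] , + 115)
        ∷ (-[1+ 291 ] , + 123)
        ∷ (-[1+ 325 ] , + 105)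
        ∷ (-[1+ 334 ] , + 91)
        ∷ (-[1+ 330 ] , + 97)
        ∷ (-[1+ 349 ] , + 84)
        ∷ (-[1+ 357 ] , + 84)
        ∷ (-[1+ 347 ] , + 92)
        ∷ (-[1+ 270 ] , + 136)
        ∷ (-[1+ 262 ] , + 145)
        ∷ (-[1+ 321 ] , + 115)
        ∷ (-[1+ 356 ] , + 76)
        ∷ (-[1+ 354 ] , + 94)
        ∷ (-[1+ 256 ] , + 139)
        ∷ []
    ; tour-bc = 2 ∷ 4 ∷ 5 ∷ 6 ∷ 8 ∷ 36 ∷ 16 ∷ 14 ∷ 9 ∷ 7 ∷ 18 ∷ 20 ∷ 19 ∷ 26 ∷ 28 ∷ 29 ∷ 30 ∷ 27 ∷ 17 ∷ 15 ∷ 24 ∷ 31 ∷ 32 ∷ 33 ∷ 23 ∷ 25 ∷ 35 ∷ 12 ∷ 11 ∷ 13 ∷ 34 ∷ 21 ∷ 22 ∷ 10 ∷ 3 ∷ []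
    ; tour-ba = 2 ∷ 4 ∷ 5 ∷ 6 ∷ 8 ∷ 9 ∷ 14 ∷ 16 ∷ 36 ∷ 31 ∷ 32 ∷ 33 ∷ 12 ∷ 35 ∷ 25 ∷ 23 ∷ 24 ∷ 15 ∷ 17 ∷ 27 ∷ 30 ∷ 29 ∷ 11 ∷ 13 ∷ 10 ∷ 22 ∷ 21 ∷ 34 ∷ 28 ∷ 26 ∷ 19 ∷ 20 ∷ 18 ∷ 7 ∷ []
    ; tour-ca = 3 ∷ 10 ∷ 13 ∷ 34 ∷ 21 ∷ 22 ∷ 18 ∷ 7 ∷ 9 ∷ 8 ∷ 36 ∷ 16 ∷ 14 ∷ 20 ∷ 19 ∷ 26 ∷ 28 ∷ 29 ∷ 11 ∷ 12 ∷ 33 ∷ 23 ∷ 25 ∷ 35 ∷ 30 ∷ 27 ∷ 17 ∷ 15 ∷ 24 ∷ 31 ∷ 32 ∷ 6 ∷ 5 ∷ 4 ∷ []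
    ; tour-b = 2 ∷ 4 ∷ 5 ∷ 6 ∷ 1 ∷ 7 ∷ 3 ∷ 10 ∷ 13 ∷ 11 ∷ 29 ∷ 30 ∷ 35 ∷ 12 ∷ 33 ∷ 32 ∷ 31 ∷ 36 ∷ 8 ∷ 9 ∷ 14 ∷ 16 ∷ 15 ∷ 24 ∷ 23 ∷ 25 ∷ 17 ∷ 27 ∷ 26 ∷ 28 ∷ 34 ∷ 21 ∷ 22 ∷ 18 ∷ 20 ∷ 19 ∷ []
    ; tour-c = 3 ∷ 7 ∷ 18 ∷ 22 ∷ 10 ∷ 2 ∷ 4 ∷ 1 ∷ 6 ∷ 5 ∷ 12 ∷ 33 ∷ 32 ∷ 31 ∷ 36 ∷ 8 ∷ 9 ∷ 14 ∷ 16 ∷ 15 ∷ 24 ∷ 23 ∷ 25 ∷ 35 ∷ 30 ∷ 29 ∷ 11 ∷ 13 ∷ 34 ∷ 21 ∷ 19 ∷ 20 ∷ 17 ∷ 27 ∷ 26 ∷ 28 ∷ []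
    ; avoiding =
        (2 , 3 ∷ 10 ∷ 13 ∷ 34 ∷ 21 ∷ 22 ∷ 18 ∷ 7 ∷ 9 ∷ 8 ∷ 36 ∷ 16 ∷ 14 ∷ 20 ∷ 19 ∷ 26 ∷ 28 ∷ 29 ∷ 11 ∷ 12 ∷ 33 ∷ 23 ∷ 25 ∷ 35 ∷ 30 ∷ 27 ∷ 17 ∷ 15 ∷ 24 ∷ 31 ∷ 32 ∷ 6 ∷ 5 ∷ 4 ∷ 1 ∷ [])
        ∷ (1 , 2 ∷ 4 ∷ 5 ∷ 6 ∷ 8 ∷ 9 ∷ 14 ∷ 16 ∷ 36 ∷ 31 ∷ 32 ∷ 33 ∷ 12 ∷ 35 ∷ 25 ∷ 23 ∷ 24 ∷ 15 ∷ 17 ∷ 27 ∷ 30 ∷ 29 ∷ 11 ∷ 13 ∷ 10 ∷ 22 ∷ 21 ∷ 34 ∷ 28 ∷ 26 ∷ 19 ∷ 20 ∷ 18 ∷ 7 ∷ 1 ∷ [])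
        ∷ (1 , 2 ∷ 10 ∷ 3 ∷ 7 ∷ 18 ∷ 22 ∷ 21 ∷ 34 ∷ 13 ∷ 11 ∷ 29 ∷ 28 ∷ 26 ∷ 19 ∷ 20 ∷ 14 ∷ 9 ∷ 8 ∷ 36 ∷ 16 ∷ 15 ∷ 17 ∷ 27 ∷ 30 ∷ 35 ∷ 25 ∷ 23 ∷ 24 ∷ 31 ∷ 32 ∷ 33 ∷ 12 ∷ 5 ∷ 6 ∷ 1 ∷ [])
        ∷ (0 , 2 ∷ 4 ∷ 1 ∷ 6 ∷ 8 ∷ 36 ∷ 16 ∷ 14 ∷ 9 ∷ 7 ∷ 18 ∷ 20 ∷ 19 ∷ 26 ∷ 28 ∷ 29 ∷ 30 ∷ 27 ∷ 17 ∷ 15 ∷ 24 ∷ 31 ∷ 32 ∷ 33 ∷ 23 ∷ 25 ∷ 35 ∷ 12 ∷ 11 ∷ 13 ∷ 34 ∷ 21 ∷ 22 ∷ 10 ∷ 3 ∷ [])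
        ∷ (1 , 2 ∷ 10 ∷ 3 ∷ 7 ∷ 18 ∷ 22 ∷ 21 ∷ 34 ∷ 13 ∷ 11 ∷ 29 ∷ 28 ∷ 26 ∷ 19 ∷ 20 ∷ 14 ∷ 9 ∷ 8 ∷ 36 ∷ 16 ∷ 15 ∷ 17 ∷ 27 ∷ 30 ∷ 35 ∷ 25 ∷ 23 ∷ 24 ∷ 31 ∷ 32 ∷ 33 ∷ 12 ∷ 5 ∷ 4 ∷ 1 ∷ [])
        ∷ (0 , 2 ∷ 12 ∷ 5 ∷ 4 ∷ 1 ∷ 6 ∷ 32 ∷ 33 ∷ 23 ∷ 24 ∷ 31 ∷ 36 ∷ 8 ∷ 9 ∷ 14 ∷ 16 ∷ 15 ∷ 17 ∷ 25 ∷ 35 ∷ 30 ∷ 27 ∷ 26 ∷ 19 ∷ 20 ∷ 18 ∷ 22 ∷ 21 ∷ 34 ∷ 28 ∷ 29 ∷ 11 ∷ 13 ∷ 10 ∷ 3 ∷ [])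
        ∷ (0 , 2 ∷ 4 ∷ 1 ∷ 7 ∷ 9 ∷ 14 ∷ 16 ∷ 36 ∷ 31 ∷ 32 ∷ 6 ∷ 5 ∷ 12 ∷ 33 ∷ 23 ∷ 24 ∷ 15 ∷ 17 ∷ 25 ∷ 35 ∷ 30 ∷ 27 ∷ 26 ∷ 28 ∷ 29 ∷ 11 ∷ 13 ∷ 34 ∷ 21 ∷ 19 ∷ 20 ∷ 18 ∷ 22 ∷ 10 ∷ 3 ∷ [])
        ∷ (0 , 2 ∷ 4 ∷ 1 ∷ 7 ∷ 18 ∷ 22 ∷ 21 ∷ 19 ∷ 20 ∷ 14 ∷ 16 ∷ 15 ∷ 24 ∷ 23 ∷ 33 ∷ 32 ∷ 31 ∷ 36 ∷ 8 ∷ 6 ∷ 5 ∷ 12 ∷ 11 ∷ 29 ∷ 30 ∷ 35 ∷ 25 ∷ 17 ∷ 27 ∷ 26 ∷ 28 ∷ 34 ∷ 13 ∷ 10 ∷ 3 ∷ [])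
        ∷ (0 , 2 ∷ 4 ∷ 1 ∷ 6 ∷ 5 ∷ 12 ∷ 11 ∷ 13 ∷ 34 ∷ 28 ∷ 29 ∷ 30 ∷ 35 ∷ 25 ∷ 23 ∷ 33 ∷ 32 ∷ 31 ∷ 24 ∷ 15 ∷ 16 ∷ 36 ∷ 8 ∷ 9 ∷ 14 ∷ 20 ∷ 17 ∷ 27 ∷ 26 ∷ 19 ∷ 21 ∷ 22 ∷ 18 ∷ 7 ∷ 3 ∷ [])
        ∷ (0 , 2 ∷ 4 ∷ 1 ∷ 6 ∷ 5 ∷ 12 ∷ 33 ∷ 32 ∷ 31 ∷ 36 ∷ 8 ∷ 9 ∷ 7 ∷ 18 ∷ 22 ∷ 21 ∷ 19 ∷ 26 ∷ 27 ∷ 17 ∷ 20 ∷ 14 ∷ 16 ∷ 15 ∷ 24 ∷ 23 ∷ 25 ∷ 35 ∷ 30 ∷ 29 ∷ 28 ∷ 34 ∷ 13 ∷ 10 ∷ 3 ∷ [])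
        ∷ (0 , 2 ∷ 10 ∷ 13 ∷ 11 ∷ 29 ∷ 28 ∷ 34 ∷ 21 ∷ 22 ∷ 18 ∷ 20 ∷ 19 ∷ 26 ∷ 27 ∷ 30 ∷ 35 ∷ 25 ∷ 17 ∷ 15 ∷ 16 ∷ 14 ∷ 9 ∷ 8 ∷ 36 ∷ 31 ∷ 24 ∷ 23 ∷ 33 ∷ 32 ∷ 6 ∷ 5 ∷ 4 ∷ 1 ∷ 7 ∷ 3 ∷ [])
        ∷ (0 , 2 ∷ 4 ∷ 1 ∷ 7 ∷ 9 ∷ 8 ∷ 6 ∷ 5 ∷ 12 ∷ 11 ∷ 29 ∷ 28 ∷ 34 ∷ 21 ∷ 19 ∷ 26 ∷ 27 ∷ 30 ∷ 35 ∷ 25 ∷ 17 ∷ 15 ∷ 24 ∷ 23 ∷ 33 ∷ 32 ∷ 31 ∷ 36 ∷ 16 ∷ 14 ∷ 20 ∷ 18 ∷ 22 ∷ 10 ∷ 3 ∷ [])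
        ∷ (0 , 2 ∷ 4 ∷ 5 ∷ 6 ∷ 1 ∷ 7 ∷ 9 ∷ 8 ∷ 36 ∷ 16 ∷ 15 ∷ 24 ∷ 31 ∷ 32 ∷ 33 ∷ 23 ∷ 25 ∷ 17 ∷ 20 ∷ 18 ∷ 22 ∷ 21 ∷ 19 ∷ 26 ∷ 27 ∷ 30 ∷ 35 ∷ 12 ∷ 11 ∷ 29 ∷ 28 ∷ 34 ∷ 13 ∷ 10 ∷ 3 ∷ [])
        ∷ (1 , 2 ∷ 10 ∷ 3 ∷ 7 ∷ 9 ∷ 8 ∷ 36 ∷ 16 ∷ 14 ∷ 20 ∷ 18 ∷ 22 ∷ 21 ∷ 19 ∷ 26 ∷ 28 ∷ 34 ∷ 13 ∷ 11 ∷ 29 ∷ 30 ∷ 27 ∷ 17 ∷ 25 ∷ 35 ∷ 12 ∷ 33 ∷ 23 ∷ 24 ∷ 31 ∷ 32 ∷ 6 ∷ 5 ∷ 4 ∷ 1 ∷ [])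
        ∷ (0 , 2 ∷ 4 ∷ 5 ∷ 6 ∷ 1 ∷ 7 ∷ 18 ∷ 22 ∷ 21 ∷ 19 ∷ 20 ∷ 14 ∷ 9 ∷ 8 ∷ 36 ∷ 31 ∷ 32 ∷ 33 ∷ 23 ∷ 24 ∷ 15 ∷ 17 ∷ 25 ∷ 35 ∷ 12 ∷ 11 ∷ 29 ∷ 30 ∷ 27 ∷ 26 ∷ 28 ∷ 34 ∷ 13 ∷ 10 ∷ 3 ∷ [])
        ∷ (0 , 2 ∷ 4 ∷ 5 ∷ 6 ∷ 1 ∷ 7 ∷ 18 ∷ 20 ∷ 14 ∷ 9 ∷ 8 ∷ 36 ∷ 16 ∷ 15 ∷ 24 ∷ 31 ∷ 32 ∷ 33 ∷ 23 ∷ 25 ∷ 35 ∷ 12 ∷ 11 ∷ 13 ∷ 34 ∷ 28 ∷ 29 ∷ 30 ∷ 27 ∷ 26 ∷ 19 ∷ 21 ∷ 22 ∷ 10 ∷ 3 ∷ [])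
        ∷ (0 , 2 ∷ 4 ∷ 5 ∷ 6 ∷ 1 ∷ 7 ∷ 9 ∷ 8 ∷ 36 ∷ 16 ∷ 14 ∷ 20 ∷ 19 ∷ 26 ∷ 28 ∷ 29 ∷ 30 ∷ 27 ∷ 17 ∷ 15 ∷ 24 ∷ 31 ∷ 32 ∷ 33 ∷ 23 ∷ 25 ∷ 35 ∷ 12 ∷ 11 ∷ 13 ∷ 34 ∷ 21 ∷ 22 ∷ 10 ∷ 3 ∷ [])
        ∷ (0 , 2 ∷ 4 ∷ 5 ∷ 6 ∷ 1 ∷ 7 ∷ 18 ∷ 20 ∷ 14 ∷ 9 ∷ 8 ∷ 36 ∷ 16 ∷ 15 ∷ 24 ∷ 31 ∷ 32 ∷ 33 ∷ 23 ∷ 25 ∷ 17 ∷ 27 ∷ 26 ∷ 28 ∷ 29 ∷ 30 ∷ 35 ∷ 12 ∷ 11 ∷ 13 ∷ 34 ∷ 21 ∷ 22 ∷ 10 ∷ 3 ∷ [])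
        ∷ (0 , 2 ∷ 4 ∷ 1 ∷ 7 ∷ 18 ∷ 22 ∷ 21 ∷ 19 ∷ 26 ∷ 27 ∷ 30 ∷ 35 ∷ 25 ∷ 17 ∷ 15 ∷ 24 ∷ 23 ∷ 33 ∷ 32 ∷ 31 ∷ 36 ∷ 16 ∷ 14 ∷ 9 ∷ 8 ∷ 6 ∷ 5 ∷ 12 ∷ 11 ∷ 29 ∷ 28 ∷ 34 ∷ 13 ∷ 10 ∷ 3 ∷ [])
        ∷ (0 , 2 ∷ 4 ∷ 5 ∷ 12 ∷ 11 ∷ 29 ∷ 28 ∷ 34 ∷ 13 ∷ 10 ∷ 22 ∷ 18 ∷ 20 ∷ 19 ∷ 26 ∷ 27 ∷ 30 ∷ 35 ∷ 25 ∷ 17 ∷ 15 ∷ 24 ∷ 23 ∷ 33 ∷ 32 ∷ 31 ∷ 36 ∷ 16 ∷ 14 ∷ 9 ∷ 8 ∷ 6 ∷ 1 ∷ 7 ∷ 3 ∷ [])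
        ∷ (0 , 2 ∷ 4 ∷ 5 ∷ 6 ∷ 1 ∷ 7 ∷ 18 ∷ 20 ∷ 14 ∷ 9 ∷ 8 ∷ 36 ∷ 16 ∷ 15 ∷ 17 ∷ 25 ∷ 23 ∷ 24 ∷ 31 ∷ 32 ∷ 33 ∷ 12 ∷ 35 ∷ 30 ∷ 27 ∷ 26 ∷ 19 ∷ 21 ∷ 34 ∷ 28 ∷ 29 ∷ 11 ∷ 13 ∷ 10 ∷ 3 ∷ [])
        ∷ (0 , 2 ∷ 4 ∷ 5 ∷ 6 ∷ 1 ∷ 7 ∷ 9 ∷ 8 ∷ 36 ∷ 16 ∷ 14 ∷ 20 ∷ 18 ∷ 22 ∷ 21 ∷ 19 ∷ 26 ∷ 27 ∷ 30 ∷ 35 ∷ 25 ∷ 17 ∷ 15 ∷ 24 ∷ 31 ∷ 32 ∷ 33 ∷ 12 ∷ 11 ∷ 29 ∷ 28 ∷ 34 ∷ 13 ∷ 10 ∷ 3 ∷ [])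
        ∷ (0 , 2 ∷ 4 ∷ 5 ∷ 6 ∷ 1 ∷ 7 ∷ 9 ∷ 8 ∷ 36 ∷ 31 ∷ 32 ∷ 33 ∷ 23 ∷ 25 ∷ 35 ∷ 12 ∷ 11 ∷ 13 ∷ 34 ∷ 21 ∷ 19 ∷ 26 ∷ 28 ∷ 29 ∷ 30 ∷ 27 ∷ 17 ∷ 15 ∷ 16 ∷ 14 ∷ 20 ∷ 18 ∷ 22 ∷ 10 ∷ 3 ∷ [])
        ∷ (0 , 2 ∷ 4 ∷ 5 ∷ 12 ∷ 35 ∷ 30 ∷ 27 ∷ 26 ∷ 28 ∷ 29 ∷ 11 ∷ 13 ∷ 34 ∷ 21 ∷ 19 ∷ 20 ∷ 17 ∷ 15 ∷ 24 ∷ 23 ∷ 33 ∷ 32 ∷ 31 ∷ 36 ∷ 16 ∷ 14 ∷ 9 ∷ 8 ∷ 6 ∷ 1 ∷ 7 ∷ 18 ∷ 22 ∷ 10 ∷ 3 ∷ [])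
        ∷ (0 , 2 ∷ 4 ∷ 5 ∷ 6 ∷ 1 ∷ 7 ∷ 18 ∷ 22 ∷ 21 ∷ 19 ∷ 20 ∷ 14 ∷ 9 ∷ 8 ∷ 36 ∷ 16 ∷ 15 ∷ 17 ∷ 27 ∷ 30 ∷ 35 ∷ 25 ∷ 23 ∷ 24 ∷ 31 ∷ 32 ∷ 33 ∷ 12 ∷ 11 ∷ 29 ∷ 28 ∷ 34 ∷ 13 ∷ 10 ∷ 3 ∷ [])
        ∷ (0 , 2 ∷ 4 ∷ 5 ∷ 6 ∷ 1 ∷ 7 ∷ 18 ∷ 22 ∷ 21 ∷ 34 ∷ 28 ∷ 26 ∷ 19 ∷ 20 ∷ 17 ∷ 25 ∷ 23 ∷ 24 ∷ 15 ∷ 16 ∷ 14 ∷ 9 ∷ 8 ∷ 36 ∷ 31 ∷ 32 ∷ 33 ∷ 12 ∷ 35 ∷ 30 ∷ 29 ∷ 11 ∷ 13 ∷ 10 ∷ 3 ∷ [])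
        ∷ (0 , 2 ∷ 4 ∷ 5 ∷ 6 ∷ 1 ∷ 7 ∷ 9 ∷ 8 ∷ 36 ∷ 31 ∷ 32 ∷ 33 ∷ 12 ∷ 35 ∷ 30 ∷ 29 ∷ 11 ∷ 13 ∷ 34 ∷ 21 ∷ 19 ∷ 26 ∷ 27 ∷ 17 ∷ 25 ∷ 23 ∷ 24 ∷ 15 ∷ 16 ∷ 14 ∷ 20 ∷ 18 ∷ 22 ∷ 10 ∷ 3 ∷ [])
        ∷ (0 , 2 ∷ 4 ∷ 5 ∷ 6 ∷ 1 ∷ 7 ∷ 18 ∷ 22 ∷ 21 ∷ 34 ∷ 28 ∷ 26 ∷ 19 ∷ 20 ∷ 14 ∷ 9 ∷ 8 ∷ 36 ∷ 16 ∷ 15 ∷ 24 ∷ 31 ∷ 32 ∷ 33 ∷ 23 ∷ 25 ∷ 17 ∷ 27 ∷ 30 ∷ 35 ∷ 12 ∷ 11 ∷ 13 ∷ 10 ∷ 3 ∷ [])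
        ∷ (0 , 2 ∷ 4 ∷ 5 ∷ 6 ∷ 1 ∷ 7 ∷ 9 ∷ 8 ∷ 36 ∷ 16 ∷ 14 ∷ 20 ∷ 18 ∷ 22 ∷ 21 ∷ 19 ∷ 26 ∷ 27 ∷ 17 ∷ 15 ∷ 24 ∷ 31 ∷ 32 ∷ 33 ∷ 23 ∷ 25 ∷ 35 ∷ 12 ∷ 11 ∷ 29 ∷ 28 ∷ 34 ∷ 13 ∷ 10 ∷ 3 ∷ [])
        ∷ (0 , 2 ∷ 4 ∷ 1 ∷ 7 ∷ 9 ∷ 8 ∷ 36 ∷ 16 ∷ 14 ∷ 20 ∷ 18 ∷ 22 ∷ 21 ∷ 19 ∷ 26 ∷ 27 ∷ 30 ∷ 35 ∷ 25 ∷ 17 ∷ 15 ∷ 24 ∷ 23 ∷ 33 ∷ 32 ∷ 6 ∷ 5 ∷ 12 ∷ 11 ∷ 29 ∷ 28 ∷ 34 ∷ 13 ∷ 10 ∷ 3 ∷ [])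
        ∷ (0 , 2 ∷ 4 ∷ 5 ∷ 12 ∷ 33 ∷ 23 ∷ 25 ∷ 35 ∷ 30 ∷ 29 ∷ 11 ∷ 13 ∷ 34 ∷ 28 ∷ 26 ∷ 27 ∷ 17 ∷ 15 ∷ 24 ∷ 31 ∷ 36 ∷ 16 ∷ 14 ∷ 9 ∷ 8 ∷ 6 ∷ 1 ∷ 7 ∷ 18 ∷ 20 ∷ 19 ∷ 21 ∷ 22 ∷ 10 ∷ 3 ∷ [])
        ∷ (0 , 2 ∷ 4 ∷ 5 ∷ 12 ∷ 11 ∷ 13 ∷ 10 ∷ 22 ∷ 18 ∷ 20 ∷ 14 ∷ 9 ∷ 8 ∷ 36 ∷ 16 ∷ 15 ∷ 17 ∷ 27 ∷ 26 ∷ 19 ∷ 21 ∷ 34 ∷ 28 ∷ 29 ∷ 30 ∷ 35 ∷ 25 ∷ 23 ∷ 24 ∷ 31 ∷ 32 ∷ 6 ∷ 1 ∷ 7 ∷ 3 ∷ [])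
        ∷ (0 , 2 ∷ 4 ∷ 5 ∷ 6 ∷ 1 ∷ 7 ∷ 9 ∷ 8 ∷ 36 ∷ 16 ∷ 14 ∷ 20 ∷ 18 ∷ 22 ∷ 21 ∷ 19 ∷ 26 ∷ 28 ∷ 29 ∷ 30 ∷ 27 ∷ 17 ∷ 15 ∷ 24 ∷ 31 ∷ 32 ∷ 33 ∷ 23 ∷ 25 ∷ 35 ∷ 12 ∷ 11 ∷ 13 ∷ 10 ∷ 3 ∷ [])
        ∷ (0 , 2 ∷ 4 ∷ 5 ∷ 12 ∷ 11 ∷ 13 ∷ 34 ∷ 21 ∷ 19 ∷ 26 ∷ 28 ∷ 29 ∷ 30 ∷ 27 ∷ 17 ∷ 25 ∷ 23 ∷ 33 ∷ 32 ∷ 6 ∷ 1 ∷ 7 ∷ 9 ∷ 8 ∷ 36 ∷ 31 ∷ 24 ∷ 15 ∷ 16 ∷ 14 ∷ 20 ∷ 18 ∷ 22 ∷ 10 ∷ 3 ∷ [])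
        ∷ (0 , 2 ∷ 4 ∷ 5 ∷ 12 ∷ 11 ∷ 13 ∷ 10 ∷ 22 ∷ 18 ∷ 20 ∷ 17 ∷ 27 ∷ 26 ∷ 19 ∷ 21 ∷ 34 ∷ 28 ∷ 29 ∷ 30 ∷ 35 ∷ 25 ∷ 23 ∷ 33 ∷ 32 ∷ 31 ∷ 24 ∷ 15 ∷ 16 ∷ 14 ∷ 9 ∷ 8 ∷ 6 ∷ 1 ∷ 7 ∷ 3 ∷ [])
        ∷ []
    }

  -- The argument does not count b and c: `X` has 30 + 2 vertices besides the apex.
  module G34 = Static.Static 30 data₃₄

  checks₃₄ : G34.Checks
  checks₃₄ = record
    { symmetric = refl; irreflexive = refl; once = refl; terminals = refl; valid = refl; refuted = refl
    ; bc = refl; ba = refl; ca = refl; b-all = refl; c-all = refl; avoids = refl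
    ; left = refl; above = refl; beyond-b = refl; beyond-c = refl; neighbours = refl; nondegenerate = refl
    ; planar = refl; corners = refl , refl , refl
    }

  module G37 = Static.Static 33 data₃₇

  checks₃₇ : G37.Checks
  checks₃₇ = record
    { symmetric = refl; irreflexive = refl; once = refl; terminals = refl; valid = refl; refuted = refl
    ; bc = refl; ba = refl; ca = refl; b-all = refl; c-all = refl; avoids = refl
    ; left = refl; above = refl; beyond-b = refl; beyond-c = refl; neighbours = refl; nondegenerate = refl
    ; planar = refl; corners = refl , refl , refl
    }

-- Growth at a quadrangle: cycles

module Grow where

  open Refute
  open Sound
  open PathCycle
  open Contract
  open Base using (_⇒ᵇ_; ⇒ᵇ-ok; _iffᵇ_; iffᵇ-ok)
  open import Data.Bool using (Bool; true; false; _∧_; _∨_; not; if_then_else_)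
  open import Data.Bool.Properties using (∧-comm)
  open import Data.Nat using (zero; suc)
  open import Data.Fin using (Fin; zero; suc) renaming (_≟_ to _≟F_)
  open import Data.List using ([]; _∷_; map)
  open import Data.Maybe using (Maybe; just; nothing)
  open import Data.Maybe.Properties using (≡-dec)
  open import Data.Vec using (Vec; []; _∷_)
  open import Data.Product using (∃; _×_; _,_; proj₁; proj₂)
  open import Data.Sum using (_⊎_; inj₁; inj₂; [_,_]′)
  import Data.Sum.Properties as SumP
  open import Data.Empty using (⊥; ⊥-elim)
  open import Relation.Nullary using (¬_; yes; no; ⌊_⌋)
  open import Relation.Binary.Definitions using (DecidableEquality)
  open import Relation.Binary.PropositionalEquality

  pattern 0F = zero
  pattern 1F = suc zero
  pattern 2F = suc (suc zero)
  pattern 3F = suc (suc (suc zero))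

  -- The two perfect matchings of the quadrangle 0 1 2 3: `mate` pairs along the edges that the
  -- growth step deletes, `opp` along those that it keeps. Neither is the diagonally opposite
  -- vertex.
  mate opp : Fin 4 → Fin 4
  mate 0F = 1F
  mate 1F = 0F
  mate 2F = 3F
  mate 3F = 2F
  opp 0F = 3F
  opp 1F = 2F
  opp 2F = 1F
  opp 3F = 0F

  mate² : ∀ i → mate (mate i) ≡ i
  mate² 0F = refl
  mate² 1F = refl
  mate² 2F = refl
  mate² 3F = refl

  opp² : ∀ i → opp (opp i) ≡ i
  opp² 0F = refl
  opp² 1F = refl
  opp² 2F = refl
  opp² 3F = refl

  mate≢ : ∀ i → ¬ mate i ≡ i
  mate≢ 0F ()
  mate≢ 1F ()
  mate≢ 2F ()
  mate≢ 3F ()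

  opp≢ : ∀ i → ¬ opp i ≡ i
  opp≢ 0F ()
  opp≢ 1F ()
  opp≢ 2F ()
  opp≢ 3F ()

  mate≢opp : ∀ i → ¬ mate i ≡ opp i
  mate≢opp 0F ()
  mate≢opp 1F ()
  mate≢opp 2F ()
  mate≢opp 3F ()

  ringAdj : Fin 4 → Fin 4 → Bool
  ringAdj i j = ⌊ j ≟F mate i ⌋ ∨ ⌊ j ≟F opp i ⌋

  all₄ : (Fin 4 → Bool) → Bool
  all₄ f = f 0F ∧ f 1F ∧ f 2F ∧ f 3F

  all₄-ok : ∀ f → all₄ f ≡ true → ∀ i → f i ≡ true
  all₄-ok f h = λ { 0F → proj₁ (∧⁻ h) ; 1F → proj₁ (∧⁻ h₁) ; 2F → proj₁ (∧⁻ h₂) ; 3F → proj₂ (∧⁻ {f 2F} h₂) }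
    where
    h₁ = proj₂ (∧⁻ {f 0F} h)
    h₂ = proj₂ (∧⁻ {f 1F} h₁)

  all₄⁺ : ∀ f → (∀ i → f i ≡ true) → all₄ f ≡ true
  all₄⁺ f h = cong₂ _∧_ (h 0F) (cong₂ _∧_ (h 1F) (cong₂ _∧_ (h 2F) (h 3F)))

  allBits : ∀ n → (Vec Bool n → Bool) → Bool
  allBits zero    f = f []
  allBits (suc n) f = allBits n (λ v → f (true ∷ v)) ∧ allBits n (λ v → f (false ∷ v))

  allBits-ok : ∀ n f → allBits n f ≡ true → ∀ v → f v ≡ true
  allBits-ok zero    f h []          = h
  allBits-ok (suc n) f h (true  ∷ v) = allBits-ok n _ (proj₁ (∧⁻ h)) v
  allBits-ok (suc n) f h (false ∷ v) = allBits-ok n _ (proj₂ (∧⁻ {allBits n (λ v → f (true ∷ v))} h)) v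

  -- Exactly two of the three: the degree condition of a cycle at a vertex of degree three.
  two : Bool → Bool → Bool → Bool
  two true  true  z     = not z
  two true  false z     = z
  two false true  z     = z
  two false false z     = false

  two-cong : ∀ {a b c a′ b′ c′} → a ≡ a′ → b ≡ b′ → c ≡ c′ → two a b c ≡ true → two a′ b′ c′ ≡ true
  two-cong refl refl refl h = h

  two-of : ∀ {V : Set} {m : V → V → Bool} {v x₁ x₂ x₃} → TwoNbrs m v → ¬ x₁ ≡ x₂ → ¬ x₁ ≡ x₃ → ¬ x₂ ≡ x₃ →
           (∀ z → m v z ≡ true → z ≡ x₁ ⊎ z ≡ x₂ ⊎ z ≡ x₃) → two (m v x₁) (m v x₂) (m v x₃) ≡ true
  two-of {m = m} {v} {x₁} {x₂} {x₃} (twoNbrs x y x≢y mx my only) d₁₂ d₁₃ d₂₃ cover with cover x mx | cover y my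
  ... | inj₁ refl        | inj₁ refl        = ⊥-elim (x≢y refl)
  ... | inj₂ (inj₁ refl) | inj₂ (inj₁ refl) = ⊥-elim (x≢y refl)
  ... | inj₂ (inj₂ refl) | inj₂ (inj₂ refl) = ⊥-elim (x≢y refl)
  ... | inj₁ refl        | inj₂ (inj₁ refl) rewrite mx | my = cong not (≢true⇒false λ e → [ (λ p → d₁₃ (sym p)) , (λ p → d₂₃ (sym p)) ]′ (only x₃ e))
  ... | inj₂ (inj₁ refl) | inj₁ refl        rewrite mx | my = cong not (≢true⇒false λ e → [ (λ p → d₂₃ (sym p)) , (λ p → d₁₃ (sym p)) ]′ (only x₃ e))
  ... | inj₁ refl        | inj₂ (inj₂ refl) rewrite mx | my | ≢true⇒false {m v x₂} (λ e → [ (λ p → d₁₂ (sym p)) , d₂₃ ]′ (only x₂ e)) = refl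
  ... | inj₂ (inj₂ refl) | inj₁ refl        rewrite mx | my | ≢true⇒false {m v x₂} (λ e → [ d₂₃ , (λ p → d₁₂ (sym p)) ]′ (only x₂ e)) = refl
  ... | inj₂ (inj₁ refl) | inj₂ (inj₂ refl) rewrite mx | my | ≢true⇒false {m v x₁} (λ e → [ d₁₂ , d₁₃ ]′ (only x₁ e)) = refl
  ... | inj₂ (inj₂ refl) | inj₂ (inj₁ refl) rewrite mx | my | ≢true⇒false {m v x₁} (λ e → [ d₁₃ , d₁₂ ]′ (only x₁ e)) = refl

  two-nbrs : ∀ {V : Set} {m : V → V → Bool} {v} x₁ x₂ x₃ → ¬ x₁ ≡ x₂ → ¬ x₁ ≡ x₃ → ¬ x₂ ≡ x₃ →
             (∀ z → m v z ≡ true → z ≡ x₁ ⊎ z ≡ x₂ ⊎ z ≡ x₃) → two (m v x₁) (m v x₂) (m v x₃) ≡ true → TwoNbrs m v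
  two-nbrs {V} {m} {v} x₁ x₂ x₃ d₁₂ d₁₃ d₂₃ cover t = select _ _ _ refl refl refl t
    where
    select : ∀ a b c → m v x₁ ≡ a → m v x₂ ≡ b → m v x₃ ≡ c → two a b c ≡ true → TwoNbrs m v
    select true true false a b c _ = twoNbrs x₁ x₂ d₁₂ a b only
      where
      only : ∀ z → m v z ≡ true → z ≡ x₁ ⊎ z ≡ x₂
      only z e with cover z e
      ... | inj₁ p           = inj₁ p
      ... | inj₂ (inj₁ p)    = inj₂ p
      ... | inj₂ (inj₂ refl) = ⊥-elim (true≢false e c)
    select true false true a b c _ = twoNbrs x₁ x₃ d₁₃ a c only
      where
      only : ∀ z → m v z ≡ true → z ≡ x₁ ⊎ z ≡ x₃
      only z e with cover z e
      ... | inj₁ p           = inj₁ p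
      ... | inj₂ (inj₁ refl) = ⊥-elim (true≢false e b)
      ... | inj₂ (inj₂ p)    = inj₂ p
    select false true true a b c _ = twoNbrs x₂ x₃ d₂₃ b c only
      where
      only : ∀ z → m v z ≡ true → z ≡ x₂ ⊎ z ≡ x₃
      only z e with cover z e
      ... | inj₁ refl        = ⊥-elim (true≢false e a)
      ... | inj₂ p           = p

  -- The edges used at an old ring 0 1 2 3 and at the new ring inside it: p and c at the old ring
  -- (to the outside, and the surviving chord to opp i), s the spokes, d and d′ the edges of the
  -- new ring (to mate i and to opp i).
  Bits : Set
  Bits = Vec Bool 14

  p s c d d′ : Bits → Fin 4 → Bool
  p (x ∷ _ ∷ _ ∷ _ ∷ _) 0F = x
  p (_ ∷ x ∷ _ ∷ _ ∷ _) 1F = x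
  p (_ ∷ _ ∷ x ∷ _ ∷ _) 2F = x
  p (_ ∷ _ ∷ _ ∷ x ∷ _) 3F = x
  s (_ ∷ _ ∷ _ ∷ _ ∷ x ∷ _) 0F = x
  s (_ ∷ _ ∷ _ ∷ _ ∷ _ ∷ x ∷ _) 1F = x
  s (_ ∷ _ ∷ _ ∷ _ ∷ _ ∷ _ ∷ x ∷ _) 2F = x
  s (_ ∷ _ ∷ _ ∷ _ ∷ _ ∷ _ ∷ _ ∷ x ∷ _) 3F = x
  c (_ ∷ _ ∷ _ ∷ _ ∷ _ ∷ _ ∷ _ ∷ _ ∷ x ∷ y ∷ _) i = if ⌊ i ≟F 1F ⌋ ∨ ⌊ i ≟F 2F ⌋ then x else y
  d (_ ∷ _ ∷ _ ∷ _ ∷ _ ∷ _ ∷ _ ∷ _ ∷ _ ∷ _ ∷ x ∷ y ∷ _) i = if ⌊ i ≟F 0F ⌋ ∨ ⌊ i ≟F 1F ⌋ then x else y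
  d′ (_ ∷ _ ∷ _ ∷ _ ∷ _ ∷ _ ∷ _ ∷ _ ∷ _ ∷ _ ∷ _ ∷ _ ∷ x ∷ y ∷ []) i = if ⌊ i ≟F 1F ⌋ ∨ ⌊ i ≟F 2F ⌋ then x else y

  -- The cycle obtained by removing the new ring uses e i from i to mate i and e′ i from i to opp i.
  e e′ : Bits → Fin 4 → Bool
  -- With four exits the cycle runs through the two rings in two paths, and the old ring alone joins
  -- the exits in the same pairs: along `opp` unless all spokes are used, in which case the new ring
  -- shows the pairs. With two exits, which are neighbours on the ring, the rim is the path that
  -- avoids the edge between them.
  e  v i = if all₄ (p v) then all₄ (s v) ∧ d v i else not (p v i ∧ p v (mate i))
  e′ v i = if all₄ (p v) then not (all₄ (s v)) ∨ d′ v i else not (p v i ∧ p v (opp i))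

  -- No used edge leaves the set of old ring vertices in r and new ring vertices in n.
  closedAt : Bits → (Fin 4 → Bool) → (Fin 4 → Bool) → Fin 4 → Bool
  closedAt v r n i =
    (r i ⇒ᵇ not (p v i)) ∧ ((r i ∧ c v i) ⇒ᵇ r (opp i)) ∧ ((r i ∧ s v i) ⇒ᵇ n i) ∧
    ((n i ∧ s v i) ⇒ᵇ r i) ∧ ((n i ∧ d v i) ⇒ᵇ n (mate i)) ∧ ((n i ∧ d′ v i) ⇒ᵇ n (opp i))

  closed₈ : Bits → (Fin 4 → Bool) × (Fin 4 → Bool) → Bool
  closed₈ v (r , n) = all₄ (closedAt v r n)

  none every left₄ right₄ : Fin 4 → Bool
  none i   = false
  every i  = true
  left₄ i  = ⌊ i ≟F 1F ⌋ ∨ ⌊ i ≟F 2F ⌋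
  right₄ i = not (left₄ i)

  degreesAt : Bits → Fin 4 → Bool
  degreesAt v i = two (p v i) (s v i) (c v i) ∧ two (s v i) (d v i) (d′ v i)

  -- The degree conditions alone admit cycles confined to the eight ring vertices. The listed sets
  -- are those whose closedness has to be excluded for the finite check to succeed; `left₄` is the
  -- pair 1 2 joined by a kept edge, `right₄` the pair 0 3.
  premise : Bits → Bool
  premise v = all₄ (degreesAt v) ∧ not (closed₈ v (none , every)) ∧ not (closed₈ v (left₄ , left₄)) ∧ not (closed₈ v (right₄ , right₄)) ∧
    not (closed₈ v (left₄ , every)) ∧ not (closed₈ v (right₄ , every)) ∧ not (closed₈ v (every , every))

  -- The old ring vertex whose side of a closed set the new vertex i is on.
  anchor : Bits → Fin 4 → Fin 4
  anchor v i = if s v i then i else mate i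

  entry : Vec Bool 4 → Fin 4 → Bool
  entry (x ∷ _ ∷ _ ∷ _ ∷ []) 0F = x
  entry (_ ∷ x ∷ _ ∷ _ ∷ []) 1F = x
  entry (_ ∷ _ ∷ x ∷ _ ∷ []) 2F = x
  entry (_ ∷ _ ∷ _ ∷ x ∷ []) 3F = x

  -- These transport connectedness. A set of old ring vertices that the rim edges respect is
  -- extended to the new ring by `anchor`, and the extension has to be respected by the edges of the
  -- larger cycle.
  rimClosedAt liftedAt : Bits → (Fin 4 → Bool) → Fin 4 → Bool
  rimClosedAt v z i = (e v i ⇒ᵇ (z i iffᵇ z (mate i))) ∧ (e′ v i ⇒ᵇ (z i iffᵇ z (opp i)))
  liftedAt v z i = (c v i ⇒ᵇ (z i iffᵇ z (opp i))) ∧ (d v i ⇒ᵇ (z (anchor v i) iffᵇ z (anchor v (mate i)))) ∧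
                   (d′ v i ⇒ᵇ (z (anchor v i) iffᵇ z (anchor v (opp i))))

  rimDegreeAt : Bits → Fin 4 → Bool
  rimDegreeAt v i = two (e v i) (e′ v i) (p v i)

  lifts : Bits → Vec Bool 4 → Bool
  lifts v z = all₄ (rimClosedAt v (entry z)) ⇒ᵇ all₄ (liftedAt v (entry z))

  conclusion : Bits → Bool
  conclusion v = all₄ (rimDegreeAt v) ∧ allBits 4 (lifts v)

  -- All configurations of the 14 edges, each with all 16 traces of a closed set on the old ring,
  -- are evaluated. The reason behind it is that the eight vertices with these edges form a
  -- bipartite graph with four in each class. Counting edges from both classes shows that the exits
  -- are split evenly, so two exits are never diagonal, the case in which the rim would fail.
  reducible : ∀ v → (premise v ⇒ᵇ conclusion v) ≡ true
  reducible = allBits-ok 14 (λ v → premise v ⇒ᵇ conclusion v) refl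

  module Ring {O : Set} (_≟O_ : DecidableEquality O) where

    X X′ : Set
    X  = O ⊎ Fin 4
    X′ = X ⊎ Fin 4

    _≟X_ : DecidableEquality X
    _≟X_ = SumP.≡-dec _≟O_ _≟F_

    _≟X′_ : DecidableEquality X′
    _≟X′_ = SumP.≡-dec _≟X_ _≟F_

    _≟A_ : DecidableEquality (Maybe X)
    _≟A_ = ≡-dec _≟X_

    _≟A′_ : DecidableEquality (Maybe X′)
    _≟A′_ = ≡-dec _≟X′_

    module Step (adj : Maybe X → Maybe X → Bool) where

      -- The edges of the old fragment that survive the growth step.
      kept : Maybe X → Maybe X → Bool
      kept (just (inj₂ i)) (just (inj₂ j)) = adj (just (inj₂ i)) (just (inj₂ j)) ∧ not ⌊ j ≟F mate i ⌋
      kept u v = adj u v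

      adj′ : Maybe X′ → Maybe X′ → Bool
      adj′ (just (inj₂ i))        (just (inj₂ j))        = ringAdj i j
      adj′ (just (inj₂ i))        (just (inj₁ (inj₂ j))) = ⌊ i ≟F j ⌋
      adj′ (just (inj₂ i))        (just (inj₁ (inj₁ o))) = false
      adj′ (just (inj₂ i))        nothing                = false
      adj′ (just (inj₁ (inj₂ j))) (just (inj₂ i))        = ⌊ i ≟F j ⌋
      adj′ (just (inj₁ (inj₁ o))) (just (inj₂ i))        = false
      adj′ nothing                (just (inj₂ i))        = false
      adj′ (just (inj₁ x))        (just (inj₁ y))        = kept (just x) (just y)
      adj′ (just (inj₁ x))        nothing                = kept (just x) nothing
      adj′ nothing                (just (inj₁ y))        = kept nothing (just y)
      adj′ nothing                nothing                = kept nothing nothing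

      old : Maybe X → Maybe X′
      old nothing  = nothing
      old (just x) = just (inj₁ x)

      adj′-old : ∀ u v → adj′ (old u) (old v) ≡ kept u v
      adj′-old nothing         nothing         = refl
      adj′-old nothing         (just (inj₁ o)) = refl
      adj′-old nothing         (just (inj₂ j)) = refl
      adj′-old (just (inj₁ o)) nothing         = refl
      adj′-old (just (inj₁ o)) (just (inj₁ q)) = refl
      adj′-old (just (inj₁ o)) (just (inj₂ j)) = refl
      adj′-old (just (inj₂ i)) nothing         = refl
      adj′-old (just (inj₂ i)) (just (inj₁ o)) = refl
      adj′-old (just (inj₂ i)) (just (inj₂ j)) = refl

      kept⇒adj : ∀ u v → kept u v ≡ true → adj u v ≡ true
      kept⇒adj nothing         v               h = h
      kept⇒adj (just (inj₁ o)) v               h = h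
      kept⇒adj (just (inj₂ i)) nothing         h = h
      kept⇒adj (just (inj₂ i)) (just (inj₁ o)) h = h
      kept⇒adj (just (inj₂ i)) (just (inj₂ j)) h = proj₁ (∧⁻ h)

      module Nonham
        (ring-mate : ∀ i → adj (just (inj₂ i)) (just (inj₂ (mate i))) ≡ true)
        (ring-opp : ∀ i → adj (just (inj₂ i)) (just (inj₂ (opp i))) ≡ true)
        (out : Fin 4 → Maybe O)
        (ring-nbrs : ∀ i z → adj (just (inj₂ i)) z ≡ true →
                     z ≡ just (inj₂ (mate i)) ⊎ z ≡ just (inj₂ (opp i)) ⊎ z ≡ Data.Maybe.map inj₁ (out i))
        (b₀ c₀ : O) where

        W W′ : Set
        W  = Maybe (Maybe X)
        W′ = Maybe (Maybe X′)

        R : W → W → Bool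
        R = plus _≟A_ adj nothing (just (inj₁ b₀)) (just (inj₁ c₀))

        R′ : W′ → W′ → Bool
        R′ = plus _≟A′_ adj′ nothing (just (inj₁ (inj₁ b₀))) (just (inj₁ (inj₁ c₀)))

        ring : Fin 4 → W
        ring i = just (just (inj₂ i))

        outer : Fin 4 → W
        outer i = just (Data.Maybe.map inj₁ (out i))

        lift : W → W′
        lift nothing  = nothing
        lift (just u) = just (old u)

        ring′ new : Fin 4 → W′
        ring′ i = just (just (inj₁ (inj₂ i)))
        new i   = just (just (inj₂ i))

        outer≢ : ∀ i j → ¬ outer i ≡ ring j
        outer≢ i j e with out i | e
        ... | just _  | ()
        ... | nothing | ()

        outer′≢new : ∀ i j → ¬ lift (outer i) ≡ new j
        outer′≢new i j e with out i | e
        ... | just _  | ()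
        ... | nothing | ()

        outer′≢ring : ∀ i j → ¬ lift (outer i) ≡ ring′ j
        outer′≢ring i j e with out i | e
        ... | just _  | ()
        ... | nothing | ()

        ring-injective : ∀ {i j} → ring i ≡ ring j → i ≡ j
        ring-injective refl = refl

        new-injective : ∀ {i j} → new i ≡ new j → i ≡ j
        new-injective refl = refl

        ring′-cover : ∀ i z → R′ (ring′ i) z ≡ true → z ≡ lift (outer i) ⊎ z ≡ new i ⊎ z ≡ ring′ (opp i)
        ring′-cover i (just (just (inj₂ j))) h with j ≟F i | h
        ... | yes refl | _ = inj₂ (inj₁ refl)
        ring′-cover i (just (just (inj₁ (inj₂ j)))) h
          with ring-nbrs i _ (proj₁ (∧⁻ h)) | not⁻ (proj₂ (∧⁻ {adj (just (inj₂ i)) (just (inj₂ j))} h))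
        ... | inj₁ refl        | q = ⊥-elim (true≢false (isYes⁺ (mate i ≟F mate i) refl) q)
        ... | inj₂ (inj₁ refl) | _ = inj₂ (inj₂ refl)
        ... | inj₂ (inj₂ q)    | _ = ⊥-elim (outer≢ i j (cong just (sym q)))
        ring′-cover i (just (just (inj₁ (inj₁ o)))) h with ring-nbrs i (just (inj₁ o)) h
        ... | inj₂ (inj₂ q) = inj₁ (cong lift (cong just q))
        ring′-cover i (just nothing) h with ring-nbrs i nothing h
        ... | inj₂ (inj₂ q) = inj₁ (cong lift (cong just q))

        new-cover : ∀ i z → R′ (new i) z ≡ true → z ≡ ring′ i ⊎ z ≡ new (mate i) ⊎ z ≡ new (opp i)
        new-cover i (just (just (inj₂ j))) h with ∨⁻ {⌊ j ≟F mate i ⌋} h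
        ... | inj₁ q = inj₂ (inj₁ (cong new (isYes⁻ (j ≟F mate i) q)))
        ... | inj₂ q = inj₂ (inj₂ (cong new (isYes⁻ (j ≟F opp i) q)))
        new-cover i (just (just (inj₁ (inj₂ j)))) h = inj₁ (cong ring′ (sym (isYes⁻ (i ≟F j) h)))

        plain : W → Bool
        plain (just (just (inj₂ i))) = false
        plain _                      = true

        plain-nbr : ∀ u z → plain u ≡ true → R′ (lift u) z ≡ true → ∃ λ v → z ≡ lift v
        plain-nbr u nothing                h r = nothing , refl
        plain-nbr u (just nothing)         h r = just nothing , refl
        plain-nbr u (just (just (inj₁ x))) h r = just (just x) , refl
        plain-nbr (just nothing)         (just (just (inj₂ j))) h ()
        plain-nbr (just (just (inj₁ o))) (just (just (inj₂ j))) h ()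

        R-lift : ∀ u v → R′ (lift u) (lift v) ≡ true → R u v ≡ true
        R-lift nothing  nothing  h = h
        R-lift nothing  (just v) h = terminal v h
          where
          terminal : ∀ v → R′ nothing (just (old v)) ≡ true → R nothing (just v) ≡ true
          terminal nothing         h = refl
          terminal (just (inj₁ o)) h with o ≟O b₀ | o ≟O c₀ | h
          ... | yes _ | _     | _ = refl
          ... | no _  | yes _ | _ = refl
        R-lift (just u) nothing  h = R-lift nothing (just u) h
        R-lift (just u) (just v) h = kept⇒adj u v (trans (sym (adj′-old u v)) h)

        module _ (H : Cycle R′) where

          open Cycle H using () renaming (m to m′; m-sym to m′-sym; m-adj to m′-adj; nbrs to nbrs′; conn to conn′)

          m′-comm : ∀ u v → m′ u v ≡ m′ v u
          m′-comm u v = bool-ext (m′-sym u v) (m′-sym v u)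

          bits : Bits
          bits = P 0F ∷ P 1F ∷ P 2F ∷ P 3F ∷ S 0F ∷ S 1F ∷ S 2F ∷ S 3F ∷
                 m′ (ring′ 1F) (ring′ 2F) ∷ m′ (ring′ 0F) (ring′ 3F) ∷
                 m′ (new 0F) (new 1F) ∷ m′ (new 2F) (new 3F) ∷ m′ (new 1F) (new 2F) ∷ m′ (new 0F) (new 3F) ∷ []
            where
            P S : Fin 4 → Bool
            P i = m′ (ring′ i) (lift (outer i))
            S i = m′ (ring′ i) (new i)

          p-is : ∀ i → m′ (ring′ i) (lift (outer i)) ≡ p bits i
          p-is 0F = refl
          p-is 1F = refl
          p-is 2F = refl
          p-is 3F = refl

          s-is : ∀ i → m′ (ring′ i) (new i) ≡ s bits i
          s-is 0F = refl
          s-is 1F = refl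
          s-is 2F = refl
          s-is 3F = refl

          c-is : ∀ i → m′ (ring′ i) (ring′ (opp i)) ≡ c bits i
          c-is 0F = refl
          c-is 1F = refl
          c-is 2F = m′-comm (ring′ 2F) (ring′ 1F)
          c-is 3F = m′-comm (ring′ 3F) (ring′ 0F)

          d-is : ∀ i → m′ (new i) (new (mate i)) ≡ d bits i
          d-is 0F = refl
          d-is 1F = m′-comm (new 1F) (new 0F)
          d-is 2F = refl
          d-is 3F = m′-comm (new 3F) (new 2F)

          d′-is : ∀ i → m′ (new i) (new (opp i)) ≡ d′ bits i
          d′-is 0F = refl
          d′-is 1F = refl
          d′-is 2F = m′-comm (new 2F) (new 1F)
          d′-is 3F = m′-comm (new 3F) (new 0F)

          degrees : ∀ i → degreesAt bits i ≡ true
          degrees i = cong₂ _∧_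
            (two-cong (p-is i) (s-is i) (c-is i)
              (two-of (nbrs′ (ring′ i)) (outer′≢new i i) (outer′≢ring i (opp i)) (λ ()) (λ z h → ring′-cover i z (m′-adj _ z h))))
            (two-cong (trans (m′-comm (new i) (ring′ i)) (s-is i)) (d-is i) (d′-is i)
              (two-of (nbrs′ (new i)) (λ ()) (λ ()) (λ q → mate≢opp i (new-injective q)) (λ z h → new-cover i z (m′-adj _ z h))))

          -- A nonempty closed set within the eight ring vertices would by `conn′` contain the extra
          -- vertex.
          not-closed : ∀ rn → (∃ λ i → proj₁ rn i ≡ true ⊎ proj₂ rn i ≡ true) → not (closed₈ bits rn) ≡ true
          not-closed (r , n) (i , member) = cong not (≢true⇒false λ h → start (closed h) member)
            where
            Z : W′ → Bool
            Z (just (just (inj₁ (inj₂ i)))) = r i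
            Z (just (just (inj₂ i)))        = n i
            Z _                             = false
            start : Closed m′ Z → r i ≡ true ⊎ n i ≡ true → ⊥
            start cl (inj₁ q) = true≢false (conn′ Z cl (ring′ i) nothing q) refl
            start cl (inj₂ q) = true≢false (conn′ Z cl (new i) nothing q) refl
            closed : closed₈ bits (r , n) ≡ true → Closed m′ Z
            closed h = go
              where
              at : ∀ i → closedAt bits r n i ≡ true
              at = all₄-ok (closedAt bits r n) h
              module At (i : Fin 4) where
                h₁ = ∧⁻ {r i ⇒ᵇ not (p bits i)} (at i)
                h₂ = ∧⁻ {(r i ∧ c bits i) ⇒ᵇ r (opp i)} (proj₂ h₁)
                h₃ = ∧⁻ {(r i ∧ s bits i) ⇒ᵇ n i} (proj₂ h₂)
                h₄ = ∧⁻ {(n i ∧ s bits i) ⇒ᵇ r i} (proj₂ h₃)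
                h₅ = ∧⁻ {(n i ∧ d bits i) ⇒ᵇ n (mate i)} (proj₂ h₄)
              go : Closed m′ Z
              go (just (just (inj₁ (inj₂ i)))) v z e with ring′-cover i v (m′-adj _ v e)
              ... | inj₁ refl        = ⊥-elim (true≢false (trans (sym (p-is i)) e) (not⁻ (⇒ᵇ-ok (proj₁ (At.h₁ i)) z)))
              ... | inj₂ (inj₁ refl) = ⇒ᵇ-ok (proj₁ (At.h₃ i)) (cong₂ _∧_ z (trans (sym (s-is i)) e))
              ... | inj₂ (inj₂ refl) = ⇒ᵇ-ok (proj₁ (At.h₂ i)) (cong₂ _∧_ z (trans (sym (c-is i)) e))
              go (just (just (inj₂ i))) v z e with new-cover i v (m′-adj _ v e)
              ... | inj₁ refl        = ⇒ᵇ-ok (proj₁ (At.h₄ i)) (cong₂ _∧_ z (trans (sym (trans (m′-comm (new i) (ring′ i)) (s-is i))) e))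
              ... | inj₂ (inj₁ refl) = ⇒ᵇ-ok (proj₁ (At.h₅ i)) (cong₂ _∧_ z (trans (sym (d-is i)) e))
              ... | inj₂ (inj₂ refl) = ⇒ᵇ-ok (proj₂ (At.h₅ i)) (cong₂ _∧_ z (trans (sym (d′-is i)) e))

          premise-holds : premise bits ≡ true
          premise-holds = cong₂ _∧_ (all₄⁺ (degreesAt bits) degrees)
            (cong₂ _∧_ (not-closed (none , every) (0F , inj₂ refl)) (cong₂ _∧_ (not-closed (left₄ , left₄) (1F , inj₂ refl))
            (cong₂ _∧_ (not-closed (right₄ , right₄) (0F , inj₂ refl)) (cong₂ _∧_ (not-closed (left₄ , every) (0F , inj₂ refl))
            (cong₂ _∧_ (not-closed (right₄ , every) (0F , inj₂ refl)) (not-closed (every , every) (0F , inj₂ refl)))))))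

          concluded : conclusion bits ≡ true
          concluded = ⇒ᵇ-ok (reducible bits) premise-holds

          rim : Fin 4 → Fin 4 → Bool
          rim i j = (⌊ j ≟F mate i ⌋ ∧ e bits i) ∨ (⌊ j ≟F opp i ⌋ ∧ e′ bits i)

          -- Only pairs of ring vertices are treated anew, so every other vertex keeps its two
          -- neighbours.
          m : W → W → Bool
          m (just (just (inj₂ i))) (just (just (inj₂ j))) = rim i j
          m u v = m′ (lift u) (lift v)

          rim-mate : ∀ i → rim i (mate i) ≡ e bits i
          rim-mate 0F with e bits 0F
          ... | true  = refl
          ... | false = refl
          rim-mate 1F with e bits 1F
          ... | true  = refl
          ... | false = refl
          rim-mate 2F with e bits 2F
          ... | true  = refl
          ... | false = refl
          rim-mate 3F with e bits 3F
          ... | true  = refl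
          ... | false = refl

          rim-opp : ∀ i → rim i (opp i) ≡ e′ bits i
          rim-opp 0F = refl
          rim-opp 1F = refl
          rim-opp 2F = refl
          rim-opp 3F = refl

          m-plain : ∀ u v → plain u ≡ true → m u v ≡ m′ (lift u) (lift v)
          m-plain nothing                v h = refl
          m-plain (just nothing)         v h = refl
          m-plain (just (just (inj₁ o))) v h = refl

          m-outer : ∀ i → m (ring i) (outer i) ≡ p bits i
          m-outer i = trans lemma (p-is i)
            where
            lemma : m (ring i) (outer i) ≡ m′ (ring′ i) (lift (outer i))
            lemma with out i
            ... | just _  = refl
            ... | nothing = refl

          e-comm : ∀ i → e bits i ≡ e bits (mate i)
          e-comm 0F rewrite ∧-comm (p bits 0F) (p bits 1F) = refl
          e-comm 1F rewrite ∧-comm (p bits 0F) (p bits 1F) = refl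
          e-comm 2F rewrite ∧-comm (p bits 2F) (p bits 3F) = refl
          e-comm 3F rewrite ∧-comm (p bits 2F) (p bits 3F) = refl

          e′-comm : ∀ i → e′ bits i ≡ e′ bits (opp i)
          e′-comm 0F rewrite ∧-comm (p bits 0F) (p bits 3F) = refl
          e′-comm 1F rewrite ∧-comm (p bits 1F) (p bits 2F) = refl
          e′-comm 2F rewrite ∧-comm (p bits 1F) (p bits 2F) = refl
          e′-comm 3F rewrite ∧-comm (p bits 0F) (p bits 3F) = refl

          rim-cases : ∀ i j → rim i j ≡ true → (j ≡ mate i × e bits i ≡ true) ⊎ (j ≡ opp i × e′ bits i ≡ true)
          rim-cases i j h with ∨⁻ {⌊ j ≟F mate i ⌋ ∧ e bits i} h
          ... | inj₁ q = inj₁ (isYes⁻ (j ≟F mate i) (proj₁ (∧⁻ q)) , proj₂ (∧⁻ {⌊ j ≟F mate i ⌋} q))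
          ... | inj₂ q = inj₂ (isYes⁻ (j ≟F opp i) (proj₁ (∧⁻ q)) , proj₂ (∧⁻ {⌊ j ≟F opp i ⌋} q))

          m-sym : ∀ u v → m u v ≡ true → m v u ≡ true
          m-sym (just (just (inj₂ i))) (just (just (inj₂ j))) h with rim-cases i j h
          ... | inj₁ (refl , q) = subst (λ k → rim (mate i) k ≡ true) (mate² i) (trans (rim-mate (mate i)) (trans (sym (e-comm i)) q))
          ... | inj₂ (refl , q) = subst (λ k → rim (opp i) k ≡ true) (opp² i) (trans (rim-opp (opp i)) (trans (sym (e′-comm i)) q))
          m-sym (just (just (inj₂ i))) nothing                h = m′-sym _ _ h
          m-sym (just (just (inj₂ i))) (just nothing)         h = m′-sym _ _ h
          m-sym (just (just (inj₂ i))) (just (just (inj₁ o))) h = m′-sym _ _ h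
          m-sym nothing                v h = back nothing v refl h
            where
            back : ∀ u v → plain u ≡ true → m u v ≡ true → m v u ≡ true
            back u (just (just (inj₂ i))) pl h = trans (ring-plain i u pl) (m′-sym _ _ (trans (sym (m-plain u _ pl)) h))
              where
              ring-plain : ∀ i u → plain u ≡ true → m (ring i) u ≡ m′ (ring′ i) (lift u)
              ring-plain i nothing                _ = refl
              ring-plain i (just nothing)         _ = refl
              ring-plain i (just (just (inj₁ o))) _ = refl
            back u nothing                pl h = m′-sym _ _ (trans (sym (m-plain u nothing pl)) h)
            back u (just nothing)         pl h = m′-sym _ _ (trans (sym (m-plain u (just nothing) pl)) h)
            back u (just (just (inj₁ o))) pl h = m′-sym _ _ (trans (sym (m-plain u (just (just (inj₁ o))) pl)) h)
          m-sym (just nothing)         (just (just (inj₂ i))) h = m′-sym _ _ h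
          m-sym (just nothing)         nothing                h = m′-sym _ _ h
          m-sym (just nothing)         (just nothing)         h = m′-sym _ _ h
          m-sym (just nothing)         (just (just (inj₁ o))) h = m′-sym _ _ h
          m-sym (just (just (inj₁ o))) (just (just (inj₂ i))) h = m′-sym _ _ h
          m-sym (just (just (inj₁ o))) nothing                h = m′-sym _ _ h
          m-sym (just (just (inj₁ o))) (just nothing)         h = m′-sym _ _ h
          m-sym (just (just (inj₁ o))) (just (just (inj₁ q))) h = m′-sym _ _ h

          m-adj : ∀ u v → m u v ≡ true → R u v ≡ true
          m-adj (just (just (inj₂ i))) (just (just (inj₂ j))) h with rim-cases i j h
          ... | inj₁ (refl , _) = ring-mate i
          ... | inj₂ (refl , _) = ring-opp i
          m-adj (just (just (inj₂ i))) nothing                h = R-lift (ring i) nothing (m′-adj _ _ h)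
          m-adj (just (just (inj₂ i))) (just nothing)         h = R-lift (ring i) (just nothing) (m′-adj _ _ h)
          m-adj (just (just (inj₂ i))) (just (just (inj₁ o))) h = R-lift (ring i) (just (just (inj₁ o))) (m′-adj _ _ h)
          m-adj nothing                v h = R-lift nothing v (m′-adj _ _ h)
          m-adj (just nothing)         v h = R-lift (just nothing) v (m′-adj _ _ h)
          m-adj (just (just (inj₁ o))) v h = R-lift (just (just (inj₁ o))) v (m′-adj _ _ h)

          lift-injective : ∀ u v → lift u ≡ lift v → u ≡ v
          lift-injective nothing         nothing         q    = refl
          lift-injective (just nothing)  (just nothing)  q    = refl
          lift-injective (just (just x)) (just (just .x)) refl = refl
          lift-injective nothing         (just nothing)  ()
          lift-injective nothing         (just (just x)) ()
          lift-injective (just nothing)  nothing         ()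
          lift-injective (just nothing)  (just (just x)) ()
          lift-injective (just (just x)) nothing         ()
          lift-injective (just (just x)) (just nothing)  ()

          nbrs-plain : ∀ u → plain u ≡ true → TwoNbrs m u
          nbrs-plain u pl with nbrs′ (lift u)
          ... | twoNbrs x y x≢y mx my only with plain-nbr u x pl (m′-adj _ x mx) | plain-nbr u y pl (m′-adj _ y my)
          ...   | x₀ , refl | y₀ , refl = twoNbrs x₀ y₀ (λ { refl → x≢y refl })
            (trans (m-plain u x₀ pl) mx) (trans (m-plain u y₀ pl) my)
            (λ z h → [ (λ q → inj₁ (lift-injective z x₀ q)) , (λ q → inj₂ (lift-injective z y₀ q)) ]′ (only (lift z) (trans (sym (m-plain u z pl)) h)))

          nbrs-ring : ∀ i → TwoNbrs m (ring i)
          nbrs-ring i = two-nbrs (ring (mate i)) (ring (opp i)) (outer i) (λ q → mate≢opp i (ring-injective q))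
            (λ q → outer≢ i (mate i) (sym q)) (λ q → outer≢ i (opp i) (sym q)) cover
            (trans (cong₂ (λ a b → two a b (m (ring i) (outer i))) (rim-mate i) (rim-opp i))
              (trans (cong (two (e bits i) (e′ bits i)) (m-outer i)) (all₄-ok (rimDegreeAt bits) (proj₁ (∧⁻ concluded)) i)))
            where
            cover : ∀ z → m (ring i) z ≡ true → z ≡ ring (mate i) ⊎ z ≡ ring (opp i) ⊎ z ≡ outer i
            cover z h with z | m-adj (ring i) z h
            ... | just u | r with ring-nbrs i u r
            ...   | inj₁ q        = inj₁ (cong just q)
            ...   | inj₂ (inj₁ q) = inj₂ (inj₁ (cong just q))
            ...   | inj₂ (inj₂ q) = inj₂ (inj₂ (cong just q))

          nbrs : ∀ v → TwoNbrs m v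
          nbrs nothing                = nbrs-plain nothing refl
          nbrs (just nothing)         = nbrs-plain (just nothing) refl
          nbrs (just (just (inj₁ o))) = nbrs-plain (just (just (inj₁ o))) refl
          nbrs (just (just (inj₂ i))) = nbrs-ring i

          module Conn (Z : W → Bool) (cl : Closed m Z) where

            z : Vec Bool 4
            z = Z (ring 0F) ∷ Z (ring 1F) ∷ Z (ring 2F) ∷ Z (ring 3F) ∷ []

            z-is : ∀ i → entry z i ≡ Z (ring i)
            z-is 0F = refl
            z-is 1F = refl
            z-is 2F = refl
            z-is 3F = refl

            equal : ∀ u v → m u v ≡ true → Z u ≡ Z v
            equal u v h = bool-ext (λ q → cl u v q h) (λ q → cl v u q (m-sym u v h))

            iff⁺ : ∀ {a b} → a ≡ b → (a iffᵇ b) ≡ true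
            iff⁺ {true}  refl = refl
            iff⁺ {false} refl = refl

            ⇒⁺ : ∀ a {b} → (a ≡ true → b ≡ true) → (a ⇒ᵇ b) ≡ true
            ⇒⁺ true  f = f refl
            ⇒⁺ false f = refl

            rim-closed : all₄ (rimClosedAt bits (entry z)) ≡ true
            rim-closed = all₄⁺ (rimClosedAt bits (entry z)) λ i → cong₂ _∧_
              (⇒⁺ (e bits i) λ h → iff⁺ (trans (z-is i) (trans (equal (ring i) (ring (mate i)) (trans (rim-mate i) h)) (sym (z-is (mate i))))))
              (⇒⁺ (e′ bits i) λ h → iff⁺ (trans (z-is i) (trans (equal (ring i) (ring (opp i)) (trans (rim-opp i) h)) (sym (z-is (opp i))))))

            lifted : ∀ i → liftedAt bits (entry z) i ≡ true
            lifted = all₄-ok (liftedAt bits (entry z))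
              (⇒ᵇ-ok (allBits-ok 4 (lifts bits) (proj₂ (∧⁻ {all₄ (rimDegreeAt bits)} concluded)) z) rim-closed)

            along : ∀ {a} i j → (a ⇒ᵇ (entry z i iffᵇ entry z j)) ≡ true → a ≡ true → Z (ring i) ≡ Z (ring j)
            along i j h q = trans (sym (z-is i)) (trans (iffᵇ-ok (⇒ᵇ-ok h q)) (z-is j))

            Z′ : W′ → Bool
            Z′ nothing                = Z nothing
            Z′ (just nothing)         = Z (just nothing)
            Z′ (just (just (inj₁ x))) = Z (just (just x))
            Z′ (just (just (inj₂ i))) = Z (ring (anchor bits i))

            Z′-lift : ∀ u → Z′ (lift u) ≡ Z u
            Z′-lift nothing         = refl
            Z′-lift (just nothing)  = refl
            Z′-lift (just (just x)) = refl

            anchored : ∀ i → s bits i ≡ true → Z (ring i) ≡ Z (ring (anchor bits i))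
            anchored i h rewrite h = refl

            plain-closed : ∀ u v → plain u ≡ true → Z u ≡ true → m′ (lift u) v ≡ true → Z′ v ≡ true
            plain-closed u v pl zu h with plain-nbr u v pl (m′-adj _ v h)
            ... | v₀ , refl = trans (Z′-lift v₀) (cl u v₀ zu (trans (m-plain u v₀ pl) h))

            closed : Closed m′ Z′
            closed nothing                       v zu h = plain-closed nothing v refl zu h
            closed (just nothing)                v zu h = plain-closed (just nothing) v refl zu h
            closed (just (just (inj₁ (inj₁ o)))) v zu h = plain-closed (just (just (inj₁ o))) v refl zu h
            closed (just (just (inj₁ (inj₂ i)))) v zu h with ring′-cover i v (m′-adj _ v h)
            ... | inj₁ refl        = trans (Z′-lift (outer i)) (cl (ring i) (outer i) zu (trans (m-outer i) (trans (sym (p-is i)) h)))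
            ... | inj₂ (inj₁ refl) = trans (sym (anchored i (trans (sym (s-is i)) h))) zu
            ... | inj₂ (inj₂ refl) = trans (sym (along i (opp i) (proj₁ (∧⁻ (lifted i))) (trans (sym (c-is i)) h))) zu
            closed (just (just (inj₂ i))) v zu h with new-cover i v (m′-adj _ v h)
            ... | inj₁ refl        = trans (anchored i (trans (sym (trans (m′-comm (new i) (ring′ i)) (s-is i))) h)) zu
            ... | inj₂ (inj₁ refl) = trans (sym (along (anchor bits i) (anchor bits (mate i))
                    (proj₁ (∧⁻ (proj₂ (∧⁻ {c bits i ⇒ᵇ (entry z i iffᵇ entry z (opp i))} (lifted i))))) (trans (sym (d-is i)) h))) zu
            ... | inj₂ (inj₂ refl) = trans (sym (along (anchor bits i) (anchor bits (opp i))
                    (proj₂ (∧⁻ {d bits i ⇒ᵇ (entry z (anchor bits i) iffᵇ entry z (anchor bits (mate i)))}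
                      (proj₂ (∧⁻ {c bits i ⇒ᵇ (entry z i iffᵇ entry z (opp i))} (lifted i))))) (trans (sym (d′-is i)) h))) zu

            conn : ∀ u v → Z u ≡ true → Z v ≡ true
            conn u v zu = trans (sym (Z′-lift v)) (conn′ Z′ closed (lift u) (lift v) (trans (Z′-lift u) zu))

          reduced : Cycle R
          reduced = record { m = m; m-sym = m-sym; m-adj = m-adj; nbrs = nbrs; conn = Conn.conn }

-- Growth at a quadrangle: tours

module GrowRoutes where

  open Sound
  open PathCycle
  open Contract
  open Frame
  open FrameTours
  open Grow
  open import Data.Bool using (Bool; true; false; _∧_; _∨_; not)
  open import Data.Nat using (ℕ; zero; suc; _+_; _≡ᵇ_)
  open import Data.Nat.Properties using (+-identityʳ)
  open import Data.Nat.Tactic.RingSolver using (solve-∀)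
  open import Data.Fin using (Fin; zero; suc) renaming (_≟_ to _≟F_)
  open import Data.List using (List; []; _∷_; map; _++_)
  open import Data.Maybe using (Maybe; just; nothing)
  open import Data.Product using (_,_)
  open import Data.Sum using (_⊎_; inj₁; inj₂; [_,_]′)
  open import Relation.Nullary using (⌊_⌋)
  open import Relation.Binary.Definitions using (DecidableEquality)
  open import Relation.Binary.PropositionalEquality

  parity-++ : ∀ {A : Set} (f : A → Bool) l l′ → parity f (l ++ l′) ≡ parity f l Data.Bool.xor parity f l′
  parity-++ f []      l′ = refl
  parity-++ f (x ∷ l) l′ = trans (cong (f x Data.Bool.xor_) (parity-++ f l l′)) (sym (xor-assoc (f x) (parity f l) (parity f l′)))
    where open import Data.Bool.Properties using (xor-assoc)

  module Passes {O : Set} (_≟O_ : DecidableEquality O) where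

    open Ring _≟O_ public

    q : Fin 4 → Maybe X
    q i = just (inj₂ i)

    is : Maybe X → Maybe X → Bool
    is u v = ⌊ u ≟A v ⌋

    module Pass (adj : Maybe X → Maybe X → Bool) where

      open Step adj public

      -- The vertex w is an end of the deleted ring edge that does not contain u.
      Other : Fin 4 → Fin 4 → Set
      Other u w = w ≡ opp u ⊎ w ≡ mate (opp u)

      -- Tours that use exactly one, or both, of the two ring edges {0 , 1} and {2 , 3}.
      record Once (allowed : Fin 4 → Set) (miss : Maybe X → Bool) (x y : Maybe X) : Set where
        constructor onceAt
        field
          u     : Fin 4
          ok    : allowed u
          l₁ l₂ : List (Maybe X)
          r₁    : Route kept x l₁ (q u)
          r₂    : Route kept (q (mate u)) l₂ y
          sp    : Spans _≟A_ miss (l₁ ++ l₂)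

      record Twice (miss : Maybe X → Bool) (x y : Maybe X) : Set where
        constructor twiceAt
        field
          u w      : Fin 4
          apart    : Other u w
          l₁ l₂ l₃ : List (Maybe X)
          r₁       : Route kept x l₁ (q u)
          r₂       : Route kept (q (mate u)) l₂ (q w)
          r₃       : Route kept (q (mate w)) l₃ y
          sp       : Spans _≟A_ miss (l₁ ++ (l₂ ++ l₃))

      -- The trivial restriction, with `Bool` as an inhabited type.
      Anywhere : Fin 4 → Set
      Anywhere _ = Bool

      -- A tour through a deleted ring edge can be rerouted over the new ring and picks up the four
      -- new vertices there. So what a growing fragment has to hand on is that its tours use at
      -- least one such edge.
      Passing : (Maybe X → Bool) → Maybe X → Maybe X → Set
      Passing miss x y = Once Anywhere miss x y ⊎ Twice miss x y

      relax : ∀ {allowed miss x y} → Once allowed miss x y → Passing miss x y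
      relax (onceAt u _ l₁ l₂ r₁ r₂ sp) = inj₁ (onceAt u true l₁ l₂ r₁ r₂ sp)

      module _ (ring-mate : ∀ i → adj (q i) (q (mate i)) ≡ true) where

        unkeep : ∀ {x l y} → Route kept x l y → Route adj x l y
        unkeep (stay x)            = stay x
        unkeep (step {x} {y} h r)  = step (kept⇒adj x y h) (unkeep r)

        passing-tour : ∀ {miss x y} → Passing miss x y → Tour _≟A_ adj miss x y
        passing-tour (inj₁ (onceAt u _ l₁ l₂ r₁ r₂ sp)) = tour (l₁ ++ l₂) (route-++ (unkeep r₁) (ring-mate u) (unkeep r₂)) sp
        passing-tour (inj₂ (twiceAt u w _ l₁ l₂ l₃ r₁ r₂ r₃ sp)) =
          tour (l₁ ++ (l₂ ++ l₃)) (route-++ (unkeep r₁) (ring-mate u) (route-++ (unkeep r₂) (ring-mate w) (unkeep r₃))) sp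

      respan : ∀ {miss miss′ l} → (∀ v → miss v ≡ miss′ v) → Spans _≟A_ miss l → Spans _≟A_ miss′ l
      respan h sp = spanning λ v → trans (visits sp v) (cong indicator (h v))

      once-cong : ∀ {al miss miss′ x y} → (∀ v → miss v ≡ miss′ v) → Once al miss x y → Once al miss′ x y
      once-cong h (onceAt u o l₁ l₂ r₁ r₂ sp) = onceAt u o l₁ l₂ r₁ r₂ (respan h sp)

      passing-cong : ∀ {miss miss′ x y} → (∀ v → miss v ≡ miss′ v) → Passing miss x y → Passing miss′ x y
      passing-cong h (inj₁ o) = inj₁ (once-cong h o)
      passing-cong h (inj₂ (twiceAt u w o l₁ l₂ l₃ r₁ r₂ r₃ sp)) = inj₂ (twiceAt u w o l₁ l₂ l₃ r₁ r₂ r₃ (respan h sp))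

  module Lift {O : Set} (_≟O_ : DecidableEquality O)
    (adj : Maybe (O ⊎ Fin 4) → Maybe (O ⊎ Fin 4) → Bool) where

    open Passes _≟O_
    open Pass adj
    module P′ = Passes _≟X_
    module N = P′.Pass adj′

    new : Fin 4 → Maybe X′
    new = P′.q

    up : (Maybe X → Bool) → Maybe X′ → Bool
    up miss nothing         = miss nothing
    up miss (just (inj₁ x)) = miss (just x)
    up miss (just (inj₂ j)) = false

    old-injective : ∀ {u v} → old u ≡ old v → u ≡ v
    old-injective {nothing} {nothing} _    = refl
    old-injective {just x}  {just .x} refl = refl

    kept′-old : ∀ u v → kept u v ≡ true → N.kept (old u) (old v) ≡ true
    kept′-old nothing  v        h = trans (adj′-old nothing v) h
    kept′-old (just x) nothing  h = trans (adj′-old (just x) nothing) h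
    kept′-old (just x) (just y) h = trans (adj′-old (just x) (just y)) h

    lift : ∀ {x l y} → Route kept x l y → Route N.kept (old x) (map old l) (old y)
    lift = route-map old kept′-old

    spoke : ∀ i → N.kept (old (q i)) (new i) ≡ true
    spoke i = isYes⁺ (i ≟F i) refl

    spoke′ : ∀ i → N.kept (new i) (old (q i)) ≡ true
    spoke′ i = isYes⁺ (i ≟F i) refl

    rung : ∀ i → N.kept (new i) (new (opp i)) ≡ true
    rung 0F = refl
    rung 1F = refl
    rung 2F = refl
    rung 3F = refl

    rung′ : ∀ i → N.kept (new (mate (opp i))) (new (mate i)) ≡ true
    rung′ 0F = refl
    rung′ 1F = refl
    rung′ 2F = refl
    rung′ 3F = refl

    open module Oc = Occ _≟A′_ using (occ-++)

    occ′ : Maybe X′ → List (Maybe X′) → ℕ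
    occ′ = occ _≟A′_

    occ-old : ∀ a l → occ′ (old a) (map old l) ≡ occ _≟A_ a l
    occ-old = occ-map _≟A_ _≟A′_ old old-injective

    occ-new : ∀ j l → occ′ (new j) (map old l) ≡ 0
    occ-new j = occ-map-none _≟A′_ old (new j) λ { nothing () ; (just x) () }

    base : (Maybe X → Bool) → Maybe X′ → ℕ
    base miss nothing         = indicator (miss nothing)
    base miss (just (inj₁ x)) = indicator (miss (just x))
    base miss (just (inj₂ j)) = 0

    at-old : ∀ {miss l} → Spans _≟A_ miss l → ∀ v → occ′ v (map old l) ≡ base miss v
    at-old {l = l} sp nothing         = trans (occ-old nothing l) (visits sp nothing)
    at-old {l = l} sp (just (inj₁ x)) = trans (occ-old (just x) l) (visits sp (just x))
    at-old {l = l} sp (just (inj₂ j)) = occ-new j l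

    map-++ : ∀ l₁ l₂ → map old (l₁ ++ l₂) ≡ map old l₁ ++ map old l₂
    map-++ = Data.List.Properties.map-++ old
      where import Data.List.Properties

    insert : ∀ {miss miss′} l₁ l₂ n₁ n₂ → Spans _≟A_ miss (l₁ ++ l₂) →
             (∀ v → occ′ v (n₁ ++ n₂) + base miss v ≡ indicator (miss′ v)) →
             Spans _≟A′_ miss′ ((map old l₁ ++ n₁) ++ (n₂ ++ map old l₂))
    insert {miss} l₁ l₂ n₁ n₂ sp h = spanning λ v → trans (count v) (h v)
      where
      shuffle : ∀ a b c d → (a + b) + (c + d) ≡ (b + c) + (a + d)
      shuffle = solve-∀
      count : ∀ v → occ′ v ((map old l₁ ++ n₁) ++ (n₂ ++ map old l₂)) ≡ occ′ v (n₁ ++ n₂) + base miss v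
      count v = begin
        occ′ v ((map old l₁ ++ n₁) ++ (n₂ ++ map old l₂))
          ≡⟨ trans (occ-++ v (map old l₁ ++ n₁) _) (cong₂ _+_ (occ-++ v (map old l₁) n₁) (occ-++ v n₂ (map old l₂))) ⟩
        (occ′ v (map old l₁) + occ′ v n₁) + (occ′ v n₂ + occ′ v (map old l₂))
          ≡⟨ shuffle (occ′ v (map old l₁)) (occ′ v n₁) (occ′ v n₂) (occ′ v (map old l₂)) ⟩
        (occ′ v n₁ + occ′ v n₂) + (occ′ v (map old l₁) + occ′ v (map old l₂))
          ≡⟨ cong₂ _+_ (sym (occ-++ v n₁ n₂)) (trans (sym (occ-++ v (map old l₁) (map old l₂))) (cong (occ′ v) (sym (map-++ l₁ l₂)))) ⟩
        occ′ v (n₁ ++ n₂) + occ′ v (map old (l₁ ++ l₂))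
          ≡⟨ cong (occ′ v (n₁ ++ n₂) +_) (at-old sp v) ⟩
        occ′ v (n₁ ++ n₂) + base miss v ∎
        where open ≡-Reasoning

    insert₂ : ∀ {miss miss′} l₁ l₂ l₃ n₁ n₂ n₃ n₄ → Spans _≟A_ miss (l₁ ++ (l₂ ++ l₃)) →
              (∀ v → occ′ v (n₁ ++ n₂) + (occ′ v (n₃ ++ n₄) + base miss v) ≡ indicator (miss′ v)) →
              Spans _≟A′_ miss′ ((map old l₁ ++ n₁) ++ ((n₂ ++ (map old l₂ ++ n₃)) ++ (n₄ ++ map old l₃)))
    insert₂ {miss} l₁ l₂ l₃ n₁ n₂ n₃ n₄ sp h = spanning λ v → trans (count v) (h v)
      where
      shuffle : ∀ a b c d e f g → (a + b) + ((c + (d + e)) + (f + g)) ≡ (b + c) + ((e + f) + (a + (d + g)))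
      shuffle = solve-∀
      count : ∀ v → occ′ v ((map old l₁ ++ n₁) ++ ((n₂ ++ (map old l₂ ++ n₃)) ++ (n₄ ++ map old l₃))) ≡
              occ′ v (n₁ ++ n₂) + (occ′ v (n₃ ++ n₄) + base miss v)
      count v = begin
        occ′ v ((map old l₁ ++ n₁) ++ ((n₂ ++ (map old l₂ ++ n₃)) ++ (n₄ ++ map old l₃)))
          ≡⟨ trans (occ-++ v (map old l₁ ++ n₁) _) (cong₂ _+_ (occ-++ v (map old l₁) n₁)
               (trans (occ-++ v (n₂ ++ (map old l₂ ++ n₃)) _) (cong₂ _+_
                 (trans (occ-++ v n₂ _) (cong (occ′ v n₂ +_) (occ-++ v (map old l₂) n₃))) (occ-++ v n₄ (map old l₃))))) ⟩
        (occ′ v (map old l₁) + occ′ v n₁) + ((occ′ v n₂ + (occ′ v (map old l₂) + occ′ v n₃)) + (occ′ v n₄ + occ′ v (map old l₃)))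
          ≡⟨ shuffle (occ′ v (map old l₁)) (occ′ v n₁) (occ′ v n₂) (occ′ v (map old l₂)) (occ′ v n₃) (occ′ v n₄) (occ′ v (map old l₃)) ⟩
        (occ′ v n₁ + occ′ v n₂) + ((occ′ v n₃ + occ′ v n₄) + (occ′ v (map old l₁) + (occ′ v (map old l₂) + occ′ v (map old l₃))))
          ≡⟨ cong₂ _+_ (sym (occ-++ v n₁ n₂)) (cong₂ _+_ (sym (occ-++ v n₃ n₄)) (sym together)) ⟩
        occ′ v (n₁ ++ n₂) + (occ′ v (n₃ ++ n₄) + occ′ v (map old (l₁ ++ (l₂ ++ l₃))))
          ≡⟨ cong (λ z → occ′ v (n₁ ++ n₂) + (occ′ v (n₃ ++ n₄) + z)) (at-old sp v) ⟩
        occ′ v (n₁ ++ n₂) + (occ′ v (n₃ ++ n₄) + base miss v) ∎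
        where
        open ≡-Reasoning
        together : occ′ v (map old (l₁ ++ (l₂ ++ l₃))) ≡ occ′ v (map old l₁) + (occ′ v (map old l₂) + occ′ v (map old l₃))
        together = trans (cong (occ′ v) (trans (map-++ l₁ (l₂ ++ l₃)) (cong (map old l₁ ++_) (map-++ l₂ l₃))))
          (trans (occ-++ v (map old l₁) _) (cong (occ′ v (map old l₁) +_) (occ-++ v (map old l₂) _)))

    onto : (Fin 4 → Fin 4 → ℕ) → Bool
    onto f = all₄ λ u → all₄ λ j → f u j ≡ᵇ 1

    onto-ok : ∀ f → onto f ≡ true → ∀ u j → f u j ≡ 1
    onto-ok f h u j = ≡ᵇ⁻ (all₄-ok (λ j → f u j ≡ᵇ 1) (all₄-ok (λ u → all₄ λ j → f u j ≡ᵇ 1) h u) j)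

    -- The edge from u to `mate u` is replaced by a detour over all four new vertices: new u, new
    -- `opp u`, then their mates in reverse. The cut moves to the edge of the new ring at `opp u`,
    -- which the next growth step deletes.
    once-up : ∀ {al miss x y} → Once al miss x y → N.Once (λ _ → Bool) (up miss) (old x) (old y)
    once-up {miss = miss} (onceAt u _ l₁ l₂ r₁ r₂ sp) = N.onceAt (opp u) true
      (map old l₁ ++ n₁) (n₂ ++ map old l₂)
      (route-++ (lift r₁) (spoke u) (step (rung u) (stay _)))
      (step (rung′ u) (step (spoke′ (mate u)) (lift r₂)))
      (insert l₁ l₂ n₁ n₂ sp once)
      where
      n₁ = new u ∷ new (opp u) ∷ []
      n₂ = new (mate (opp u)) ∷ new (mate u) ∷ []
      once : ∀ v → occ′ v (n₁ ++ n₂) + base miss v ≡ indicator (up miss v)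
      once nothing         = refl
      once (just (inj₁ x)) = refl
      once (just (inj₂ j)) = trans (+-identityʳ _)
        (onto-ok (λ u j → occ′ (new j) (new u ∷ new (opp u) ∷ new (mate (opp u)) ∷ new (mate u) ∷ [])) refl u j)

    -- Each deleted edge is bypassed over the parallel edge of the new ring, and the two parallel
    -- edges cover the four new vertices.
    twice-up : ∀ {miss x y} → Twice miss x y → N.Twice (up miss) (old x) (old y)
    twice-up {miss} (twiceAt u w ap l₁ l₂ l₃ r₁ r₂ r₃ sp) = N.twiceAt u w ap
      (map old l₁ ++ new u ∷ []) (new (mate u) ∷ (map old l₂ ++ new w ∷ [])) (new (mate w) ∷ map old l₃)
      (route-++ (lift r₁) (spoke u) (stay _))
      (step (spoke′ (mate u)) (route-++ (lift r₂) (spoke w) (stay _)))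
      (step (spoke′ (mate w)) (lift r₃))
      (insert₂ l₁ l₂ l₃ (new u ∷ []) (new (mate u) ∷ []) (new w ∷ []) (new (mate w) ∷ []) sp once)
      where
      each : ∀ u w → Other u w → ∀ j → occ′ (new j) (new u ∷ new (mate u) ∷ []) + (occ′ (new j) (new w ∷ new (mate w) ∷ []) + 0) ≡ 1
      each u w (inj₁ refl) = onto-ok (λ u j → occ′ (new j) (new u ∷ new (mate u) ∷ []) + (occ′ (new j) (new (opp u) ∷ new (mate (opp u)) ∷ []) + 0)) refl u
      each u w (inj₂ refl) = onto-ok (λ u j → occ′ (new j) (new u ∷ new (mate u) ∷ []) + (occ′ (new j) (new (mate (opp u)) ∷ new (mate (mate (opp u))) ∷ []) + 0)) refl u
      once : ∀ v → occ′ v (new u ∷ new (mate u) ∷ []) + (occ′ v (new w ∷ new (mate w) ∷ []) + base miss v) ≡ indicator (up miss v)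
      once nothing         = refl
      once (just (inj₁ x)) = refl
      once (just (inj₂ j)) = each u w ap j

    passing-up : ∀ {miss x y} → Passing miss x y → N.Passing (up miss) (old x) (old y)
    passing-up (inj₁ o) = inj₁ (once-up o)
    passing-up (inj₂ t) = inj₂ (twice-up t)

    module _ (mate-adj : ∀ i → adj (q i) (q (opp i)) ≡ true) where

      chord : ∀ i → N.kept (old (q i)) (old (q (opp i))) ≡ true
      chord i = trans (adj′-old (q i) (q (opp i))) (cong₂ _∧_ (mate-adj i) (kept-chord i))
        where
        kept-chord : ∀ i → not ⌊ opp i ≟F mate i ⌋ ≡ true
        kept-chord 0F = refl
        kept-chord 1F = refl
        kept-chord 2F = refl
        kept-chord 3F = refl

      -- A tour that misses the new vertex i comes from one that misses the old vertex `mate i` and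
      -- uses the other deleted edge. The detour in place of that edge picks up the old vertex
      -- `mate i` over its kept ring edge and the three new vertices other than i, so it uses just
      -- the edge of the new ring away from i.
      dodge : ∀ {x y} i → Once (Other (mate i)) (is (q (mate i))) x y → N.Once (N.Other i) (P′.is (new i)) (old x) (old y)
      dodge i (onceAt u (inj₁ refl) l₁ l₂ r₁ r₂ sp) = N.onceAt (opp (mate i)) (inj₂ (swap i))
        (map old l₁ ++ n₁) (n₂ ++ map old l₂)
        (route-++ (lift r₁) (subst (λ k → N.kept (old (q (opp (mate i)))) (old (q k)) ≡ true) (opp² (mate i)) (chord (opp (mate i))))
          (step (spoke (mate i)) (step (rung (mate i)) (stay _))))
        (step (spoke′ (mate (opp (mate i)))) (lift r₂))
        (insert l₁ l₂ n₁ n₂ sp once)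
        where
        swap : ∀ i → opp (mate i) ≡ mate (opp i)
        swap 0F = refl
        swap 1F = refl
        swap 2F = refl
        swap 3F = refl
        n₁ = old (q (mate i)) ∷ new (mate i) ∷ new (opp (mate i)) ∷ []
        n₂ = new (mate (opp (mate i))) ∷ []
        once : ∀ v → occ′ v (n₁ ++ n₂) + base (is (q (mate i))) v ≡ indicator (P′.is (new i) v)
        once nothing                = refl
        once (just (inj₁ (inj₁ o))) = refl
        once (just (inj₁ (inj₂ k))) = onto-ok (λ i k → occ′ (old (q k)) (old (q (mate i)) ∷ new (mate i) ∷ new (opp (mate i)) ∷ new (mate (opp (mate i))) ∷ []) + indicator (is (q (mate i)) (q k))) refl i k
        once (just (inj₂ j))        = trans (+-identityʳ _) (≡ᵇ⁻ (all₄-ok (at i) (all₄-ok (λ i → all₄ (at i)) refl i) j))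
          where
          at : Fin 4 → Fin 4 → Bool
          at i j = occ′ (new j) (old (q (mate i)) ∷ new (mate i) ∷ new (opp (mate i)) ∷ new (mate (opp (mate i))) ∷ []) ≡ᵇ indicator (P′.is (new i) (new j))
      dodge i (onceAt u (inj₂ refl) l₁ l₂ r₁ r₂ sp) = N.onceAt (mate (opp (mate i))) (inj₁ (swap i))
        (map old l₁ ++ n₁) (n₂ ++ map old l₂)
        (route-++ (lift r₁) (spoke (mate (opp (mate i)))) (stay _))
        (step (hop i) (step (spoke′ (mate i)) (step (subst (λ k → N.kept (old (q (mate i))) (old (q k)) ≡ true) (sym (mate² (opp (mate i)))) (chord (mate i))) (lift r₂))))
        (insert l₁ l₂ n₁ n₂ sp once)
        where
        swap : ∀ i → mate (opp (mate i)) ≡ opp i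
        swap 0F = refl
        swap 1F = refl
        swap 2F = refl
        swap 3F = refl
        hop : ∀ i → N.kept (new (mate (mate (opp (mate i))))) (new (mate i)) ≡ true
        hop 0F = refl
        hop 1F = refl
        hop 2F = refl
        hop 3F = refl
        n₁ = new (mate (opp (mate i))) ∷ []
        n₂ = new (mate (mate (opp (mate i)))) ∷ new (mate i) ∷ old (q (mate i)) ∷ []
        once : ∀ v → occ′ v (n₁ ++ n₂) + base (is (q (mate i))) v ≡ indicator (P′.is (new i) v)
        once nothing                = refl
        once (just (inj₁ (inj₁ o))) = refl
        once (just (inj₁ (inj₂ k))) = onto-ok (λ i k → occ′ (old (q k)) (new (mate (opp (mate i))) ∷ new (mate (mate (opp (mate i)))) ∷ new (mate i) ∷ old (q (mate i)) ∷ []) + indicator (is (q (mate i)) (q k))) refl i k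
        once (just (inj₂ j))        = trans (+-identityʳ _) (≡ᵇ⁻ (all₄-ok (at i) (all₄-ok (λ i → all₄ (at i)) refl i) j))
          where
          at : Fin 4 → Fin 4 → Bool
          at i j = occ′ (new j) (new (mate (opp (mate i))) ∷ new (mate (mate (opp (mate i)))) ∷ new (mate i) ∷ old (q (mate i)) ∷ []) ≡ᵇ indicator (P′.is (new i) (new j))

    is-up : ∀ t v → up (is t) v ≡ P′.is (old t) v
    is-up nothing  nothing         = refl
    is-up nothing  (just (inj₁ y)) = refl
    is-up nothing  (just (inj₂ j)) = refl
    is-up (just x) nothing         = refl
    is-up (just x) (just (inj₂ j)) = refl
    is-up (just x) (just (inj₁ y)) = bool-ext
      (λ h → isYes⁺ (_≟A′_ (just (inj₁ x)) (just (inj₁ y))) (cong old (isYes⁻ (just x ≟A just y) h)))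
      (λ h → isYes⁺ (just x ≟A just y) (old-injective (isYes⁻ (_≟A′_ (just (inj₁ x)) (just (inj₁ y))) h)))

-- Fragments that can be grown

module Growth where

  open Refute
  open Sound
  open PathCycle
  open Contract
  open Frame
  open Base using (_iffᵇ_; iffᵇ-ok)
  open Grow hiding (p; s; c; d; d′; e; e′)
  open GrowRoutes
  open import Data.Bool using (Bool; true; false; _∧_; _∨_; _xor_; not)
  open import Data.Bool.Properties using (xor-identityʳ)
  open import Data.Nat using (ℕ; zero; suc; _+_; _*_)
  open import Data.Fin using (Fin; zero; suc) renaming (_≟_ to _≟F_)
  open import Data.Fin.Properties using (+↔⊎)
  open import Data.List using (List; []; _∷_; map; _++_)
  open import Data.Maybe using (Maybe; just; nothing)
  open import Data.Product using (Σ; ∃; _×_; _,_; proj₁; proj₂)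
  open import Data.Sum using (_⊎_; inj₁; inj₂; [_,_]′)
  open import Data.Sum.Algebra using (⊎-comm)
  open import Data.Sum.Function.Propositional using (_⊎-↔_)
  open import Function.Bundles using (_↔_)
  open import Function.Construct.Composition using (_↔-∘_)
  open import Function.Construct.Symmetry using (↔-sym)
  open import Function.Construct.Identity using (↔-id)
  open import Relation.Nullary using (¬_; yes; no; ⌊_⌋)
  open import Relation.Binary.Definitions using (DecidableEquality)
  open import Relation.Binary.PropositionalEquality

  -- A fragment with a distinguished quadrangle, whose vertices `inj₂ i` have one neighbour `out i`
  -- outside of it, `nothing` being the apex. The conditions on tours are those of a fragment,
  -- strengthened to forms that the grown fragment inherits.
  record Growing : Set₁ where
    field
      O    : Set
      _≟O_ : DecidableEquality O
      os   : List O
      once : ∀ o → parity (λ y → ⌊ y ≟O o ⌋) os ≡ true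

    open Passes _≟O_ public

    field
      adj : Maybe X → Maybe X → Bool

    open Pass adj public

    field
      adj-sym   : ∀ u v → adj u v ≡ adj v u
      adj-irr   : ∀ u → adj u u ≡ false
      ring-mate : ∀ i → adj (q i) (q (mate i)) ≡ true
      ring-opp  : ∀ i → adj (q i) (q (opp i)) ≡ true
      out       : Fin 4 → Maybe O
      ring-nbrs : ∀ i z → adj (q i) z ≡ true → z ≡ q (mate i) ⊎ z ≡ q (opp i) ⊎ z ≡ Data.Maybe.map inj₁ (out i)
      b c       : O
      b≢c       : ¬ b ≡ c

    B : Maybe X
    B = just (inj₁ b)

    C : Maybe X
    C = just (inj₁ c)

    Linked : (Maybe X → Maybe X → Set) → Set
    Linked P = P B C ⊎ P B nothing ⊎ P C nothing

    field
      nonham    : ¬ Cycle (plus _≟A_ adj nothing B C)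
      b→c       : Passing (is nothing) B C
      b↠a       : Σ O λ y → adj (just (inj₁ y)) nothing ≡ true × Passing (λ v → is nothing v ∨ is C v) B (just (inj₁ y))
      c↠a       : Σ O λ y → adj (just (inj₁ y)) nothing ≡ true × Passing (λ v → is nothing v ∨ is B v) C (just (inj₁ y))
      b↠        : ∃ λ y → Passing (λ _ → false) B y
      c↠        : ∃ λ y → Passing (λ _ → false) C y
      avoid     : ∀ o → Linked (Passing (is (just (inj₁ o))))
      -- Stronger than `Passing`: the single deleted edge that is used lies away from i. This is the
      -- form that `dodge` takes and returns.
      avoidRing : ∀ i → Linked (Once (Other i) (is (q i)))

    whole : List X
    whole = map inj₁ os ++ map inj₂ (0F ∷ 1F ∷ 2F ∷ 3F ∷ [])

    whole-once : ∀ x → parity (λ y → ⌊ y ≟X x ⌋) whole ≡ true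
    whole-once x = trans (parity-++ (λ y → ⌊ y ≟X x ⌋) (map inj₁ os) _)
      (trans (cong (_xor parity (λ y → ⌊ y ≟X x ⌋) (map inj₂ (0F ∷ 1F ∷ 2F ∷ 3F ∷ []))) (parity-map (λ y → ⌊ y ≟X x ⌋) inj₁ os)) (at x))
      where
      inj₁-is : ∀ o y → ⌊ inj₁ y ≟X inj₁ o ⌋ ≡ ⌊ y ≟O o ⌋
      inj₁-is o y with y ≟O o
      ... | yes _ = refl
      ... | no _  = refl
      ring : Fin 4 → Bool
      ring i = parity (λ y → ⌊ y ≟X inj₂ i ⌋) (map inj₂ (0F ∷ 1F ∷ 2F ∷ 3F ∷ []))
      at : ∀ x → parity (λ y → ⌊ inj₁ y ≟X x ⌋) os xor parity (λ y → ⌊ y ≟X x ⌋) (map inj₂ (0F ∷ 1F ∷ 2F ∷ 3F ∷ [])) ≡ true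
      at (inj₁ o) = trans (xor-identityʳ _) (trans (parity-cong (inj₁-is o) os) (once o))
      at (inj₂ i) = trans (cong (_xor ring i) (parity-false os)) (all₄-ok ring refl i)

  linked-map : ∀ {A B : Set} {P : A → A → Set} {Q : B → B → Set} (f : A → B) → (∀ {x y} → P x y → Q (f x) (f y)) → ∀ {b c a} →
               P b c ⊎ P b a ⊎ P c a → Q (f b) (f c) ⊎ Q (f b) (f a) ⊎ Q (f c) (f a)
  linked-map f g (inj₁ r)        = inj₁ (g r)
  linked-map f g (inj₂ (inj₁ r)) = inj₂ (inj₁ (g r))
  linked-map f g (inj₂ (inj₂ r)) = inj₂ (inj₂ (g r))

  fragment : Growing → Fragment
  fragment G = record
    { X = X; _≟_ = _≟X_; xs = whole; once = whole-once
    ; adj = adj; adj-sym = adj-sym; adj-irr = adj-irr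
    ; b = inj₁ b; c = inj₁ c; b≢c = λ { refl → b≢c refl }
    ; nonham = nonham
    ; b→c = tours b→c
    ; b↠a = inj₁ (proj₁ b↠a) , proj₁ (proj₂ b↠a) , tours (proj₂ (proj₂ b↠a))
    ; c↠a = inj₁ (proj₁ c↠a) , proj₁ (proj₂ c↠a) , tours (proj₂ (proj₂ c↠a))
    ; b↠ = proj₁ b↠ , tours (proj₂ b↠)
    ; c↠ = proj₁ c↠ , tours (proj₂ c↠)
    ; avoid = avoids
    }
    where
    open Growing G
    tours : ∀ {miss x y} → Passing miss x y → Tour _≟A_ adj miss x y
    tours = passing-tour ring-mate
    avoids : ∀ x → Linked (Tour _≟A_ adj (is (just x)))
    avoids (inj₁ o) = linked-map {P = Passing (is (just (inj₁ o)))} {Q = Tour _≟A_ adj (is (just (inj₁ o)))} (λ v → v) tours (avoid o)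
    avoids (inj₂ i) = linked-map {P = Once (Other i) (is (q i))} {Q = Tour _≟A_ adj (is (q i))} (λ v → v) (λ r → tours (relax r)) (avoidRing i)

  ringAdj-sym : ∀ i j → ringAdj i j ≡ ringAdj j i
  ringAdj-sym i j = iffᵇ-ok (all₄-ok (λ j → ringAdj i j iffᵇ ringAdj j i) (all₄-ok (λ i → all₄ λ j → ringAdj i j iffᵇ ringAdj j i) refl i) j)

  mate-comm : ∀ i j → ⌊ j ≟F mate i ⌋ ≡ ⌊ i ≟F mate j ⌋
  mate-comm i j = iffᵇ-ok (all₄-ok (λ j → ⌊ j ≟F mate i ⌋ iffᵇ ⌊ i ≟F mate j ⌋) (all₄-ok (λ i → all₄ λ j → ⌊ j ≟F mate i ⌋ iffᵇ ⌊ i ≟F mate j ⌋) refl i) j)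

  module Next (G : Growing) where

    open Growing G
    open Lift _≟O_ adj

    kept-sym : ∀ u v → kept u v ≡ kept v u
    kept-sym nothing         nothing         = adj-sym _ _
    kept-sym nothing         (just (inj₁ o)) = adj-sym _ _
    kept-sym nothing         (just (inj₂ i)) = adj-sym _ _
    kept-sym (just (inj₁ o)) nothing         = adj-sym _ _
    kept-sym (just (inj₁ o)) (just (inj₁ _)) = adj-sym _ _
    kept-sym (just (inj₁ o)) (just (inj₂ i)) = adj-sym _ _
    kept-sym (just (inj₂ i)) nothing         = adj-sym _ _
    kept-sym (just (inj₂ i)) (just (inj₁ o)) = adj-sym _ _
    kept-sym (just (inj₂ i)) (just (inj₂ j)) = cong₂ (λ a b → a ∧ not b) (adj-sym _ _) (mate-comm i j)

    old-sym : ∀ u v → adj′ (old u) (old v) ≡ adj′ (old v) (old u)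
    old-sym u v = trans (adj′-old u v) (trans (kept-sym u v) (sym (adj′-old v u)))

    adj′-sym : ∀ u v → adj′ u v ≡ adj′ v u
    adj′-sym nothing                nothing                = old-sym nothing nothing
    adj′-sym nothing                (just (inj₁ y))        = old-sym nothing (just y)
    adj′-sym nothing                (just (inj₂ j))        = refl
    adj′-sym (just (inj₁ x))        nothing                = old-sym (just x) nothing
    adj′-sym (just (inj₁ x))        (just (inj₁ y))        = old-sym (just x) (just y)
    adj′-sym (just (inj₁ (inj₁ o))) (just (inj₂ j))        = refl
    adj′-sym (just (inj₁ (inj₂ i))) (just (inj₂ j))        = refl
    adj′-sym (just (inj₂ i))        nothing                = refl
    adj′-sym (just (inj₂ i))        (just (inj₁ (inj₁ o))) = refl
    adj′-sym (just (inj₂ i))        (just (inj₁ (inj₂ j))) = refl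
    adj′-sym (just (inj₂ i))        (just (inj₂ j))        = ringAdj-sym i j

    adj′-irr : ∀ u → adj′ u u ≡ false
    adj′-irr nothing                = adj-irr nothing
    adj′-irr (just (inj₁ (inj₁ o))) = adj-irr _
    adj′-irr (just (inj₁ (inj₂ i))) = cong (_∧ not ⌊ i ≟F mate i ⌋) (adj-irr _)
    adj′-irr (just (inj₂ i))        = not⁻ (all₄-ok (λ i → not (ringAdj i i)) refl i)

    ring-nbrs′ : ∀ i z → adj′ (new i) z ≡ true → z ≡ new (mate i) ⊎ z ≡ new (opp i) ⊎ z ≡ just (inj₁ (inj₂ i))
    ring-nbrs′ i (just (inj₂ j))        h = [ (λ e → inj₁ (cong new (isYes⁻ (j ≟F mate i) e))) ,
      (λ e → inj₂ (inj₁ (cong new (isYes⁻ (j ≟F opp i) e)))) ]′ (∨⁻ {⌊ j ≟F mate i ⌋} h)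
    ring-nbrs′ i (just (inj₁ (inj₂ j))) h = inj₂ (inj₂ (cong (λ k → just (inj₁ (inj₂ k))) (sym (isYes⁻ (i ≟F j) h))))

    up-∨ : ∀ f g v → up (λ u → f u ∨ g u) v ≡ up f v ∨ up g v
    up-∨ f g nothing         = refl
    up-∨ f g (just (inj₁ x)) = refl
    up-∨ f g (just (inj₂ j)) = refl

    up-false : ∀ v → up (λ _ → false) v ≡ false
    up-false nothing         = refl
    up-false (just (inj₁ x)) = refl
    up-false (just (inj₂ j)) = refl

    missing : ∀ t {x y} → Passing (is t) x y → N.Passing (P′.is (old t)) (old x) (old y)
    missing t r = N.passing-cong (is-up t) (passing-up r)

    missing₂ : ∀ t {x y} → Passing (λ v → is nothing v ∨ is t v) x y → N.Passing (λ v → P′.is nothing v ∨ P′.is (old t) v) (old x) (old y)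
    missing₂ t r = N.passing-cong (λ v → trans (up-∨ (is nothing) (is t) v) (cong₂ _∨_ (is-up nothing v) (is-up t v))) (passing-up r)

    missing₀ : ∀ {x y} → Passing (λ _ → false) x y → N.Passing (λ _ → false) (old x) (old y)
    missing₀ r = N.passing-cong up-false (passing-up r)

    avoid′ : ∀ x → N.Passing (P′.is (just (inj₁ x))) (old B) (old C) ⊎ N.Passing (P′.is (just (inj₁ x))) (old B) nothing ⊎ N.Passing (P′.is (just (inj₁ x))) (old C) nothing
    avoid′ (inj₁ o) = linked-map {P = Passing (is (just (inj₁ o)))} {Q = N.Passing (P′.is (just (inj₁ (inj₁ o))))} old (missing (just (inj₁ o))) (avoid o)
    avoid′ (inj₂ i) = linked-map {P = Once (Other i) (is (q i))} {Q = N.Passing (P′.is (old (q i)))} old (λ r → missing (q i) (relax r)) (avoidRing i)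

    next : Growing
    next = record
      { O = X; _≟O_ = _≟X_; os = whole; once = whole-once
      ; adj = adj′; adj-sym = adj′-sym; adj-irr = adj′-irr
      ; ring-mate = λ i → all₄-ok (λ i → ringAdj i (mate i)) refl i
      ; ring-opp = λ i → all₄-ok (λ i → ringAdj i (opp i)) refl i
      -- The old ring now belongs to the outer vertices, and a new ring vertex has its spoke as the
      -- only edge out of the ring.
      ; out = λ i → just (inj₂ i); ring-nbrs = ring-nbrs′
      ; b = inj₁ b; c = inj₁ c; b≢c = λ { refl → b≢c refl }
      ; nonham = λ H → nonham (Nonham.reduced ring-mate ring-opp out ring-nbrs b c H)
      ; b→c = missing nothing b→c
      ; b↠a = inj₁ (proj₁ b↠a) , proj₁ (proj₂ b↠a) , missing₂ C (proj₂ (proj₂ b↠a))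
      ; c↠a = inj₁ (proj₁ c↠a) , proj₁ (proj₂ c↠a) , missing₂ B (proj₂ (proj₂ c↠a))
      ; b↠ = old (proj₁ b↠) , missing₀ (proj₂ b↠)
      ; c↠ = old (proj₁ c↠) , missing₀ (proj₂ c↠)
      ; avoid = avoid′
      ; avoidRing = λ i → linked-map {P = Once (Other (mate i)) (is (q (mate i)))} {Q = N.Once (N.Other i) (P′.is (new i))} old (dodge ring-opp i) (avoidRing (mate i))
      }

  open Next public using (next)

  grow : ℕ → Growing → Growing
  grow zero    G = G
  grow (suc k) G = next (grow k G)

  -- The new vertices are counted first, so that the size agrees with `suc k * 4 + m` by
  -- computation.
  ringed : ∀ {A : Set} {m} → A ↔ Fin m → (A ⊎ Fin 4) ↔ Fin (4 + m)
  ringed {A} e = ↔-sym +↔⊎ ↔-∘ ((↔-id (Fin 4) ⊎-↔ e) ↔-∘ ⊎-comm A (Fin 4))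

  grow-size : ∀ {m} k G → Growing.O G ↔ Fin m → Growing.O (grow k G) ↔ Fin (k * 4 + m)
  grow-size zero    G e = e
  grow-size (suc k) G e = ringed (grow-size k G e)

-- The drawings of the growing fragments

module GrowPlane where

  open import Defs using (Point; OnSegment)
  open Sound using (∧⁻; ∨⁻)
  open PathCycle using (isYes⁻; isYes⁺)
  open QSolver
  open Plane
  open FramePlane using (corner-a; corner-b; corner-c; line-b; line-c; Drawing; mirror)
  open Base using (_iffᵇ_; iffᵇ-ok)
  open Grow hiding (p; s; c; d; d′; e; e′)
  open GrowRoutes using (module Lift)
  open Growth using (Growing; fragment; next; grow)
  open import Data.Bool using (Bool; true; false; _∧_; _∨_; _xor_; not)
  open import Data.Nat using (zero; suc)
  open import Data.Fin using (Fin; zero; suc) renaming (_≟_ to _≟F_)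
  open import Data.Integer using (+_)
  open import Data.Maybe using (Maybe; just; nothing)
  open import Data.Product using (∃; _×_; _,_; proj₁; proj₂)
  open import Data.Rational using (ℚ; 0ℚ; 1ℚ; ½; _+_; _*_; _-_; -_; _≤_; _<_; _<?_; _≤?_; positive)
  open import Data.Rational.Properties
  open import Data.Sum using (_⊎_; inj₁; inj₂; [_,_]′)
  open import Data.Empty using (⊥-elim)
  open import Relation.Nullary using (¬_; ⌊_⌋)
  open import Relation.Nullary.Decidable using (from-yes)
  open import Relation.Binary.PropositionalEquality

  0<-⁺ : ∀ {m d} → m < d → 0ℚ < d - m
  0<-⁺ {m} {d} h = subst (_< d - m) (+-inverseʳ m) (+-monoˡ-< (- m) h)

  -<0⁺ : ∀ {m d} → d < m → d - m < 0ℚ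
  -<0⁺ {m} {d} h = subst (d - m <_) (+-inverseʳ m) (+-monoˡ-< (- m) h)

  -≡0⁺ : ∀ {m d} → d ≡ m → d - m ≡ 0ℚ
  -≡0⁺ {m} refl = +-inverseʳ m

  -- An axis is a boolean, false for the first coordinate; a sign is a boolean, true for negative.
  π : Bool → Point → ℚ
  π false = proj₁
  π true  = proj₂

  -- The corner 0 of the square is on the upper right, and 0 1 2 3 run counterclockwise.
  negative : Bool → Fin 4 → Bool
  negative false 0F = false
  negative false 1F = true
  negative false 2F = true
  negative false 3F = false
  negative true  0F = false
  negative true  1F = false
  negative true  2F = true
  negative true  3F = true

  -- The other corner on the same side of the square, the side perpendicular to the given axis.
  cross : Bool → Fin 4 → Fin 4
  cross false = opp
  cross true  = mate

  far : Fin 4 → Fin 4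
  far i = mate (opp i)

  xor-not : ∀ a b → a xor b ≡ true → b ≡ not a
  xor-not false true  _ = refl
  xor-not true  false _ = refl

  all₂ : (Bool → Bool) → Bool
  all₂ f = f false ∧ f true

  all₂-ok : ∀ f → all₂ f ≡ true → ∀ b → f b ≡ true
  all₂-ok f h false = proj₁ (∧⁻ h)
  all₂-ok f h true  = proj₂ (∧⁻ {f false} h)

  negative-far : ∀ ax i → negative ax (far i) ≡ not (negative ax i)
  negative-far ax i = xor-not _ _ (all₄-ok (at ax) (all₂-ok (λ ax → all₄ (at ax)) refl ax) i)
    where
    at : Bool → Fin 4 → Bool
    at ax i = negative ax i xor negative ax (far i)

  negative-cross : ∀ ax i → negative ax (cross ax i) ≡ negative ax i
  negative-cross ax i = iffᵇ-ok (all₄-ok (at ax) (all₂-ok (λ ax → all₄ (at ax)) refl ax) i)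
    where
    at : Bool → Fin 4 → Bool
    at ax i = negative ax (cross ax i) iffᵇ negative ax i

  negative-cross-not : ∀ ax i → negative (not ax) (cross ax i) ≡ not (negative (not ax) i)
  negative-cross-not ax i = xor-not _ _ (all₄-ok (at ax) (all₂-ok (λ ax → all₄ (at ax)) refl ax) i)
    where
    at : Bool → Fin 4 → Bool
    at ax i = negative (not ax) i xor negative (not ax) (cross ax i)

  cross≢ : ∀ ax i → ¬ cross ax i ≡ i
  cross≢ false = opp≢
  cross≢ true  = mate≢

  Side : Bool → Fin 4 → Fin 4 → Set
  Side ax i k = (k ≡ i ⊎ k ≡ cross ax i) ⊎ negative ax k ≡ not (negative ax i)

  side : ∀ ax i k → Side ax i k
  side ax i k = decide (∨⁻ {⌊ k ≟F i ⌋} (all₄-ok (at ax i) (all₄-ok (λ i → all₄ (at ax i)) (all₂-ok (λ ax → all₄ λ i → all₄ (at ax i)) refl ax) i) k))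
    where
    at : Bool → Fin 4 → Fin 4 → Bool
    at ax i k = ⌊ k ≟F i ⌋ ∨ ⌊ k ≟F cross ax i ⌋ ∨ (negative ax i xor negative ax k)
    decide : ⌊ k ≟F i ⌋ ≡ true ⊎ ⌊ k ≟F cross ax i ⌋ ∨ (negative ax i xor negative ax k) ≡ true → Side ax i k
    decide (inj₁ h) = inj₁ (inj₁ (isYes⁻ (k ≟F i) h))
    decide (inj₂ h) = [ (λ h → inj₁ (inj₂ (isYes⁻ (k ≟F cross ax i) h))) , (λ h → inj₂ (xor-not _ _ h)) ]′ (∨⁻ {⌊ k ≟F cross ax i ⌋} h)

  on-side : ∀ ax i k → k ≡ i ⊎ k ≡ cross ax i → negative ax k ≡ negative ax i
  on-side ax i k (inj₁ refl) = refl
  on-side ax i k (inj₂ refl) = negative-cross ax i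

  separated : ∀ i k → k ≡ i ⊎ ∃ λ ax → negative ax k ≡ not (negative ax i)
  separated i k = decide (side false i k) (side true i k)
    where
    opp≢mate : ∀ i → ¬ opp i ≡ mate i
    opp≢mate i q = mate≢opp i (sym q)
    decide : Side false i k → Side true i k → k ≡ i ⊎ ∃ λ ax → negative ax k ≡ not (negative ax i)
    decide (inj₂ h)           _                  = inj₂ (false , h)
    decide _                  (inj₂ h)           = inj₂ (true , h)
    decide (inj₁ (inj₁ h))    (inj₁ _)           = inj₁ h
    decide (inj₁ (inj₂ _))    (inj₁ (inj₁ h))    = inj₁ h
    decide (inj₁ (inj₂ refl)) (inj₁ (inj₂ h))    = ⊥-elim (opp≢mate i h)

  -- The signed distance from `o` in the direction given by axis and sign. The lines `wall` are its
  -- level lines.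
  depth : Point → Bool → Bool → Point → ℚ
  depth o ax s p = mirror s (π ax p - π ax o)

  wall : Point → Bool → Bool → ℚ → Line
  wall (x , y) false s m = mirror s 1ℚ , 0ℚ , mirror s (- x) - m
  wall (x , y) true  s m = 0ℚ , mirror s 1ℚ , mirror s (- y) - m

  ev-wall : ∀ o ax s m p → ev (wall o ax s m) p ≡ depth o ax s p - m
  ev-wall (a , b) false false m (x , y) = solve 4 (λ a m x y → con (+ 1) :* x :+ con (+ 0) :* y :+ (:- a :- m) := (x :- a) :- m) refl a m x y
  ev-wall (a , b) false true  m (x , y) = solve 4 (λ a m x y → (:- con (+ 1)) :* x :+ con (+ 0) :* y :+ (:- :- a :- m) := :- (x :- a) :- m) refl a m x y
  ev-wall (a , b) true  false m (x , y) = solve 4 (λ a m x y → con (+ 0) :* x :+ con (+ 1) :* y :+ (:- a :- m) := (y :- a) :- m) refl b m x y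
  ev-wall (a , b) true  true  m (x , y) = solve 4 (λ a m x y → con (+ 0) :* x :+ (:- con (+ 1)) :* y :+ (:- :- a :- m) := :- (y :- a) :- m) refl b m x y

  -- A level line of the sum of the two depths: a diagonal line that cuts off one corner of the
  -- square.
  slant : Point → Bool → Bool → ℚ → Line
  slant (x , y) s s′ m = mirror s 1ℚ , mirror s′ 1ℚ , (mirror s (- x) + mirror s′ (- y)) - m

  ev-slant : ∀ o s s′ m p → ev (slant o s s′ m) p ≡ (depth o false s p + depth o true s′ p) - m
  ev-slant (a , b) false false m (x , y) = solve 5 (λ a b m x y → con (+ 1) :* x :+ con (+ 1) :* y :+ ((:- a :+ :- b) :- m) := ((x :- a) :+ (y :- b)) :- m) refl a b m x y
  ev-slant (a , b) false true  m (x , y) = solve 5 (λ a b m x y → con (+ 1) :* x :+ (:- con (+ 1)) :* y :+ ((:- a :+ :- :- b) :- m) := ((x :- a) :+ :- (y :- b)) :- m) refl a b m x y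
  ev-slant (a , b) true  false m (x , y) = solve 5 (λ a b m x y → (:- con (+ 1)) :* x :+ con (+ 1) :* y :+ ((:- :- a :+ :- b) :- m) := (:- (x :- a) :+ (y :- b)) :- m) refl a b m x y
  ev-slant (a , b) true  true  m (x , y) = solve 5 (λ a b m x y → (:- con (+ 1)) :* x :+ (:- con (+ 1)) :* y :+ ((:- :- a :+ :- :- b) :- m) := (:- (x :- a) :+ :- (y :- b)) :- m) refl a b m x y

  corner : Point → ℚ → Fin 4 → Point
  corner (x , y) t k = x + mirror (negative false k) t , y + mirror (negative true k) t

  mirror-offset : ∀ s a t → mirror s ((a + mirror s t) - a) ≡ t
  mirror-offset false a t = solve 2 (λ a t → (a :+ t) :- a := t) refl a t
  mirror-offset true  a t = solve 2 (λ a t → :- ((a :+ :- t) :- a) := t) refl a t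

  depth-corner : ∀ o t ax k → depth o ax (negative ax k) (corner o t k) ≡ t
  depth-corner o t false k = mirror-offset (negative false k) (proj₁ o) t
  depth-corner o t true  k = mirror-offset (negative true k) (proj₂ o) t

  -- Written so that the corner of the smaller square lies on the diagonal of the larger one, the
  -- fraction f of the way to the far corner. Strict affine bounds at the old corners then pass to
  -- the new ones by convexity.
  shrink : ℚ → ℚ → ℚ
  shrink f t = t - f * (t + t)

  mirror-shrink : ∀ f s a t → a + mirror s (shrink f t) ≡ (a + mirror s t) + f * ((a + mirror (not s) t) - (a + mirror s t))
  mirror-shrink f false a t = solve 3 (λ f a t → a :+ (t :- f :* (t :+ t)) := (a :+ t) :+ f :* ((a :+ :- t) :- (a :+ t))) refl f a t
  mirror-shrink f true  a t = solve 3 (λ f a t → a :+ :- (t :- f :* (t :+ t)) := (a :+ :- t) :+ f :* ((a :+ t) :- (a :+ :- t))) refl f a t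

  module _ (f : ℚ) (o : Point) (t : ℚ) (k : Fin 4) where

    shrink₁ : proj₁ (corner o (shrink f t) k) ≡ proj₁ (corner o t k) + f * (proj₁ (corner o t (far k)) - proj₁ (corner o t k))
    shrink₁ = trans (mirror-shrink f (negative false k) (proj₁ o) t)
      (cong (λ s → proj₁ (corner o t k) + f * ((proj₁ o + mirror s t) - proj₁ (corner o t k))) (sym (negative-far false k)))

    shrink₂ : proj₂ (corner o (shrink f t) k) ≡ proj₂ (corner o t k) + f * (proj₂ (corner o t (far k)) - proj₂ (corner o t k))
    shrink₂ = trans (mirror-shrink f (negative true k) (proj₂ o) t)
      (cong (λ s → proj₂ (corner o t k) + f * ((proj₂ o + mirror s t) - proj₂ (corner o t k))) (sym (negative-far true k)))

    ev-shrink : ∀ L → ev L (corner o (shrink f t) k) ≡ ev L (corner o t k) + f * (ev L (corner o t (far k)) - ev L (corner o t k))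
    ev-shrink L = ev-segment L (corner o (shrink f t) k) (corner o t k) (corner o t (far k)) f shrink₁ shrink₂

  between-> : ∀ {s u v} → 0ℚ ≤ s → s ≤ 1ℚ → 0ℚ < u → 0ℚ < v → 0ℚ < u + s * (v - u)
  between-> s≥0 s≤1 hu hv with ≤-total _ _
  ... | inj₁ u≤v = <-≤-trans hu (between-≥ s≥0 s≤1 ≤-refl u≤v)
  ... | inj₂ v≤u = <-≤-trans hv (between-≥ s≥0 s≤1 v≤u ≤-refl)

  ¼ : ℚ
  ¼ = ½ * ½

  ¼≥0 : 0ℚ ≤ ¼
  ¼≥0 = from-yes (0ℚ ≤? ¼)

  ¼≤1 : ¼ ≤ 1ℚ
  ¼≤1 = from-yes (¼ ≤? 1ℚ)

  0<* : ∀ {p q} → 0ℚ < p → 0ℚ < q → 0ℚ < p * q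
  0<* {p} {q} hp hq = positive⁻¹ (p * q) {{pos*pos⇒pos p {{positive hp}} q {{positive hq}}}}

  abstract

    -- The arguments need only that the fraction lies strictly between 0 and 1/2, so the value is
    -- hidden behind its bounds.
    quarter : ℚ
    quarter = ¼

    quarter≥0 : 0ℚ ≤ quarter
    quarter≥0 = ¼≥0

    quarter≤1 : quarter ≤ 1ℚ
    quarter≤1 = ¼≤1

    quarter>0 : 0ℚ < quarter
    quarter>0 = from-yes (0ℚ <? ¼)

    rest>0 : 0ℚ < (1ℚ - quarter) - quarter
    rest>0 = from-yes (0ℚ <? (1ℚ - ¼) - ¼)

  0<+ : ∀ {p q} → 0ℚ < p → 0ℚ < q → 0ℚ < p + q
  0<+ {p} {q} hp hq = subst (_< p + q) (+-identityʳ 0ℚ) (+-mono-< hp hq)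

  shrink>0 : ∀ {t} → 0ℚ < t → 0ℚ < shrink quarter t
  shrink>0 {t} h = subst (0ℚ <_) (solve 2 (λ f t → ((con (+ 1) :- f) :- f) :* t := t :- f :* (t :+ t)) refl quarter t) (0<* rest>0 h)

  shrink< : ∀ {t} → 0ℚ < t → shrink quarter t < t
  shrink< {t} h = subst (shrink quarter t <_) (+-identityʳ t) (+-monoʳ-< t (neg-antimono-< (0<* quarter>0 (0<+ h h))))

  record Inside (p : Point) : Set where
    field
      left     : proj₁ p < 0ℚ
      above    : 0ℚ < proj₂ p
      beyond-b : 0ℚ < ev (κᴸ line-b) p
      beyond-c : 0ℚ < ev (κᴸ line-c) p

  shrink-inside : ∀ o t → (∀ k → Inside (corner o t k)) → ∀ k → Inside (corner o (shrink quarter t) k)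
  shrink-inside o t h k = record
    { left     = subst (_< 0ℚ) (sym (shrink₁ quarter o t k)) (between-< quarter≥0 quarter≤1 (left (h k)) (left (h (far k))))
    ; above    = subst (0ℚ <_) (sym (shrink₂ quarter o t k)) (between-> quarter≥0 quarter≤1 (above (h k)) (above (h (far k))))
    ; beyond-b = subst (0ℚ <_) (sym (ev-shrink quarter o t k (κᴸ line-b))) (between-> quarter≥0 quarter≤1 (beyond-b (h k)) (beyond-b (h (far k))))
    ; beyond-c = subst (0ℚ <_) (sym (ev-shrink quarter o t k (κᴸ line-c))) (between-> quarter≥0 quarter≤1 (beyond-c (h k)) (beyond-c (h (far k))))
    }
    where open Inside

  -- A line that separates the interior of the square with corners corner o t k from the edge uv.
  record Barrier {V : Set} (place : V → Point) (ring : Fin 4 → V) (o : Point) (t : ℚ) (u v : V) : Set where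
    field
      line  : Line
      end₁  : 0ℚ ≤ ev line (place u)
      end₂  : 0ℚ ≤ ev line (place v)
      -- A ring vertex that is an end of uv may lie on the line; there uv and the spoke form a fan.
      outer : ∀ i → ev line (place (ring i)) < 0ℚ ⊎ (ev line (place (ring i)) ≡ 0ℚ × (ring i ≡ u ⊎ ring i ≡ v))
      inner : ∀ k → ev line (corner o t k) < 0ℚ

  barrier-swap : ∀ {V : Set} {place : V → Point} {ring o t u v} → Barrier place ring o t u v → Barrier place ring o t v u
  barrier-swap β = record
    { line = line; end₁ = end₂; end₂ = end₁; inner = inner
    ; outer = λ i → [ inj₁ , (λ { (z , e) → inj₂ (z , [ inj₂ , inj₁ ]′ e) }) ]′ (outer i) }
    where open Barrier β

  -- The ring surrounds an empty square with half-width `t`, whose corners become the next ring. The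
  -- ring need not be a square: `deep` asks only that each ring vertex lies beyond its corner in
  -- both coordinates. The barriers ensure that no edge reaches into the square.
  record Nested (G : Growing) : Set where
    open Growing G
    field
      place    : Maybe X → Point
      centre   : Point
      t        : ℚ
      t>0      : 0ℚ < t
      at-a     : place nothing ≡ κᴾ corner-a
      at-b     : place B ≡ κᴾ corner-b
      at-c     : place C ≡ κᴾ corner-c
      left     : ∀ x → proj₁ (place (just x)) < 0ℚ
      above    : ∀ x → 0ℚ < proj₂ (place (just x))
      beyond-b : ∀ x → ¬ x ≡ inj₁ b → 0ℚ < ev (κᴸ line-b) (place (just x))
      beyond-c : ∀ x → ¬ x ≡ inj₁ c → 0ℚ < ev (κᴸ line-c) (place (just x))
      inside   : ∀ k → Inside (corner centre t k)
      deep     : ∀ ax i → t < depth centre ax (negative ax i) (place (q i))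
      barrier  : ∀ u v → adj u v ≡ true → Barrier place q centre t u v
      nbr      : ∀ u → ∃ λ v → adj u v ≡ true
      nondegenerate : ∀ u v → adj u v ≡ true → ¬ place u ≡ place v
      planar   : ∀ u v w z → adj u v ≡ true → adj w z ≡ true → Meet place u v w z

  drawing : ∀ {G} → Nested G → Drawing (fragment G)
  drawing D = record
    { place = place; at-a = at-a; at-b = at-b; at-c = at-c; left = left; above = above
    ; beyond-b = beyond-b; beyond-c = beyond-c; nbr = nbr; nondegenerate = nondegenerate; planar = planar }
    where open Nested D

  module NextPlane (G : Growing) (D : Nested G) where

    open Growing G
    open Lift _≟O_ adj
    open Nested D

    place′ : Maybe X′ → Point
    place′ nothing         = place nothing
    place′ (just (inj₁ x)) = place (just x)
    place′ (just (inj₂ k)) = corner centre t k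

    open Meets place′

    place-old : ∀ u → place′ (old u) ≡ place u
    place-old nothing  = refl
    place-old (just x) = refl

    r : ℚ
    r = shrink quarter t

    data Edge : Maybe X′ → Maybe X′ → Set where
      plainE  : ∀ u v → adj u v ≡ true → Edge (old u) (old v)
      spokeE  : ∀ i → Edge (old (q i)) (new i)
      spokeE′ : ∀ i → Edge (new i) (old (q i))
      ringE   : ∀ ax i → Edge (new i) (new (cross ax i))

    edge-old : ∀ u v → adj′ (old u) (old v) ≡ true → Edge (old u) (old v)
    edge-old u v h = plainE u v (kept⇒adj u v (trans (sym (adj′-old u v)) h))

    edge : ∀ u v → adj′ u v ≡ true → Edge u v
    edge nothing                nothing                h = edge-old nothing nothing h
    edge nothing                (just (inj₁ y))        h = edge-old nothing (just y) h
    edge (just (inj₁ x))        nothing                h = edge-old (just x) nothing h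
    edge (just (inj₁ x))        (just (inj₁ y))        h = edge-old (just x) (just y) h
    edge (just (inj₁ (inj₂ j))) (just (inj₂ i))        h = subst (λ k → Edge (old (q k)) (new i)) (isYes⁻ (i ≟F j) h) (spokeE i)
    edge (just (inj₂ i))        (just (inj₁ (inj₂ j))) h = subst (λ k → Edge (new i) (old (q k))) (isYes⁻ (i ≟F j) h) (spokeE′ i)
    edge (just (inj₂ i))        (just (inj₂ j))        h = decide (∨⁻ {⌊ j ≟F mate i ⌋} h)
      where
      decide : ⌊ j ≟F mate i ⌋ ≡ true ⊎ ⌊ j ≟F opp i ⌋ ≡ true → Edge (new i) (new j)
      decide (inj₁ e) = subst (λ k → Edge (new i) (new k)) (sym (isYes⁻ (j ≟F mate i) e)) (ringE true i)
      decide (inj₂ e) = subst (λ k → Edge (new i) (new k)) (sym (isYes⁻ (j ≟F opp i) e)) (ringE false i)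

    -t<t : - t < t
    -t<t = <-trans (neg-antimono-< t>0) t>0

    W : Bool → Fin 4 → Line
    W ax i = wall centre ax (negative ax i) t

    depth-off : ∀ s ax i k → negative ax k ≡ not (negative ax i) → depth centre ax (negative ax i) (corner centre s k) ≡ - s
    depth-off s ax i k e = trans (lemma (negative ax i) (negative ax k) e) (cong -_ (depth-corner centre s ax k))
      where
      lemma : ∀ a b → b ≡ not a → depth centre ax a (corner centre s k) ≡ - depth centre ax b (corner centre s k)
      lemma false .true  refl = trans (solve 1 (λ q → q := :- :- q) refl (depth centre ax false (corner centre s k))) refl
      lemma true  .false refl = refl

    W-on : ∀ ax i k → k ≡ i ⊎ k ≡ cross ax i → ev (W ax i) (place′ (new k)) ≡ 0ℚ
    W-on ax i k e = trans (ev-wall centre ax (negative ax i) t (corner centre t k))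
      (-≡0⁺ (trans (cong (λ s → depth centre ax s (corner centre t k)) (sym (on-side ax i k e))) (depth-corner centre t ax k)))

    W-off : ∀ ax i k → negative ax k ≡ not (negative ax i) → ev (W ax i) (place′ (new k)) < 0ℚ
    W-off ax i k e = subst (_< 0ℚ) (sym (ev-wall centre ax (negative ax i) t (corner centre t k)))
      (-<0⁺ (subst (_< t) (sym (depth-off t ax i k e)) -t<t))

    W-above : ∀ ax i k → k ≡ i ⊎ k ≡ cross ax i → 0ℚ < ev (W ax i) (place (q k))
    W-above ax i k e = subst (0ℚ <_) (sym (ev-wall centre ax (negative ax i) t (place (q k))))
      (0<-⁺ (subst (λ s → t < depth centre ax s (place (q k))) (on-side ax i k e) (deep ax k)))

    W-below : ∀ ax i k → negative ax k ≡ not (negative ax i) → ev (W ax i) (place (q k)) < 0ℚ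
    W-below ax i k e = subst (_< 0ℚ) (sym (ev-wall centre ax (negative ax i) t (place (q k))))
      (-<0⁺ (<-trans (subst (_< - t) (lemma (negative ax i) (negative ax k) e) (neg-antimono-< (deep ax k))) -t<t))
      where
      lemma : ∀ a b → b ≡ not a → - depth centre ax b (place (q k)) ≡ depth centre ax a (place (q k))
      lemma false .true  refl = solve 1 (λ q → :- :- q := q) refl (depth centre ax false (place (q k)))
      lemma true  .false refl = refl

    lineOpposite : Line → Line
    lineOpposite (α , β , γ) = - α , - β , - γ

    ev-opposite : ∀ L p → ev (lineOpposite L) p ≡ - ev L p
    ev-opposite (α , β , γ) (x , y) = solve 5 (λ α β γ x y → (:- α) :* x :+ (:- β) :* y :+ (:- γ) := :- (α :* x :+ β :* y :+ γ)) refl α β γ x y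

    fan⁻ : ∀ L {x b d} → ev L (place′ x) ≡ 0ℚ → ev L (place′ b) < 0ℚ → 0ℚ ≤ ev L (place′ d) → Meet place′ x b x d
    fan⁻ L {x} {b} {d} hx hb hd = fan (lineOpposite L) (trans (ev-opposite L (place′ x)) (cong -_ hx))
      (subst (0ℚ <_) (sym (ev-opposite L (place′ b))) (neg-antimono-< hb))
      (subst (_≤ 0ℚ) (sym (ev-opposite L (place′ d))) (neg-antimono-≤ hd))

    meet-swap₂ : ∀ {a b c d} → Meet place′ a b c d → Meet place′ a b d c
    meet-swap₂ m = meet-flip (meet-swap (meet-flip m))

    meet-old : ∀ u v w z → Meet place u v w z → Meet place′ (old u) (old v) (old w) (old z)
    meet-old u v w z m p i j = up-meeting (m p (subst₂ (OnSegment p) (place-old u) (place-old v) i) (subst₂ (OnSegment p) (place-old w) (place-old z) j))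
      where
      up-meeting : Meeting place u v w z p → Meeting place′ (old u) (old v) (old w) (old z) p
      up-meeting (inj₁ (refl , refl))            = inj₁ (refl , refl)
      up-meeting (inj₂ (inj₁ (refl , refl)))     = inj₂ (inj₁ (refl , refl))
      up-meeting (inj₂ (inj₂ (x , xa , xc , e))) = inj₂ (inj₂ (old x , ends xa , ends xc , trans e (sym (place-old x))))
        where
        ends : ∀ {a b} → x ≡ a ⊎ x ≡ b → old x ≡ old a ⊎ old x ≡ old b
        ends = [ (λ e → inj₁ (cong old e)) , (λ e → inj₂ (cong old e)) ]′

    module Wall {u v} (β : Barrier place q centre t u v) where
      open Barrier β public
      start : 0ℚ ≤ ev line (place′ (old u))
      start = subst (λ p → 0ℚ ≤ ev line p) (sym (place-old u)) end₁
      end : 0ℚ ≤ ev line (place′ (old v))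
      end = subst (λ p → 0ℚ ≤ ev line p) (sym (place-old v)) end₂

    -- The spoke runs from the ring vertex to a corner strictly behind the barrier. It is separated
    -- from uv if the ring vertex is strictly behind as well, and otherwise starts at an end of uv.
    plain-spoke : ∀ u v i → Barrier place q centre t u v → Meet place′ (old u) (old v) (old (q i)) (new i)
    plain-spoke u v i β = decide (outer i)
      where
      open Wall β
      decide : _ → Meet place′ (old u) (old v) (old (q i)) (new i)
      decide (inj₁ h)               = strict line {old u} {old v} start end h (inner i)
      decide (inj₂ (z , inj₁ refl)) = meet-flip (fan⁻ line {old u} {new i} {old v} z (inner i) end)
      decide (inj₂ (z , inj₂ refl)) = meet-swap (meet-flip (fan⁻ line {old v} {new i} {old u} z (inner i) start))

    plain-ring : ∀ u v i j → Barrier place q centre t u v → Meet place′ (old u) (old v) (new i) (new j)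
    plain-ring u v i j β = strict line {old u} {old v} {new i} {new j} start end (inner i) (inner j)
      where open Wall β

    near : ∀ ax i → i ≡ i ⊎ i ≡ cross ax i
    near ax i = inj₁ refl

    next-to : ∀ ax i → cross ax i ≡ i ⊎ cross ax i ≡ cross ax i
    next-to ax i = inj₂ refl

    -- Different corners have opposite signs on some axis, and the side of the square on that axis
    -- separates their spokes.
    spoke-spoke : ∀ i k → Meet place′ (old (q i)) (new i) (old (q k)) (new k)
    spoke-spoke i k = decide (separated i k)
      where
      decide : _ → Meet place′ (old (q i)) (new i) (old (q k)) (new k)
      decide (inj₁ refl)     = meet-same
      decide (inj₂ (ax , e)) = strict (W ax i) {old (q i)} {new i} {old (q k)} {new k} (<⇒≤ (W-above ax i i (near ax i)))
        (≤-reflexive (sym (W-on ax i i (near ax i)))) (W-below ax i k e) (W-off ax i k e)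

    spoke-ring : ∀ k ax i → Meet place′ (old (q k)) (new k) (new i) (new (cross ax i))
    spoke-ring k ax i = decide (side ax i k)
      where
      on₁ = W-on ax i i (near ax i)
      on₂ = W-on ax i (cross ax i) (next-to ax i)
      decide : Side ax i k → Meet place′ (old (q k)) (new k) (new i) (new (cross ax i))
      decide (inj₂ e)           = meet-flip (strict (W ax i) {new i} {new (cross ax i)} {old (q k)} {new k}
        (≤-reflexive (sym on₁)) (≤-reflexive (sym on₂)) (W-below ax i k e) (W-off ax i k e))
      decide (inj₁ (inj₁ refl)) = meet-swap (fan (W ax i) {new i} {old (q i)} {new (cross ax i)} on₁ (W-above ax i i (near ax i)) (≤-reflexive on₂))
      decide (inj₁ (inj₂ refl)) = meet-swap (meet-swap₂ (fan (W ax i) {new k} {old (q k)} {new i} on₂ (W-above ax i k (next-to ax i)) (≤-reflexive on₁)))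

    touch : ∀ ax i k l → k ≡ i ⊎ k ≡ cross ax i → negative ax l ≡ not (negative ax i) →
            Meet place′ (new i) (new (cross ax i)) (new k) (new l)
    touch ax i k l (inj₁ refl) e = meet-flip (fan⁻ (W ax i) {new i} {new l} {new (cross ax i)} (W-on ax i i (near ax i)) (W-off ax i l e)
      (≤-reflexive (sym (W-on ax i (cross ax i) (next-to ax i)))))
    touch ax i k l (inj₂ refl) e = meet-swap (meet-flip (fan⁻ (W ax i) {new k} {new l} {new i} (W-on ax i k (next-to ax i)) (W-off ax i l e)
      (≤-reflexive (sym (W-on ax i i (near ax i))))))

    ring-ring : ∀ ax i k l → ¬ l ≡ k → Meet place′ (new i) (new (cross ax i)) (new k) (new l)
    ring-ring ax i k l l≢k = decide (side ax i k) (side ax i l)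
      where
      decide : Side ax i k → Side ax i l → Meet place′ (new i) (new (cross ax i)) (new k) (new l)
      decide (inj₂ e) (inj₂ e′) = strict (W ax i) {new i} {new (cross ax i)} {new k} {new l}
        (≤-reflexive (sym (W-on ax i i (near ax i)))) (≤-reflexive (sym (W-on ax i (cross ax i) (next-to ax i)))) (W-off ax i k e) (W-off ax i l e′)
      decide (inj₁ n) (inj₂ e)  = touch ax i k l n e
      decide (inj₂ e) (inj₁ n)  = meet-swap₂ (touch ax i l k n e)
      decide (inj₁ (inj₁ refl)) (inj₁ (inj₁ refl)) = ⊥-elim (l≢k refl)
      decide (inj₁ (inj₁ refl)) (inj₁ (inj₂ refl)) = meet-same
      decide (inj₁ (inj₂ refl)) (inj₁ (inj₁ refl)) = meet-swap₂ meet-same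
      decide (inj₁ (inj₂ refl)) (inj₁ (inj₂ refl)) = ⊥-elim (l≢k refl)

    meets : ∀ {u v w z} → Edge u v → Edge w z → Meet place′ u v w z
    meets (plainE u v h) (plainE w z h′) = meet-old u v w z (planar u v w z h h′)
    meets (plainE u v h) (spokeE i)      = plain-spoke u v i (barrier u v h)
    meets (plainE u v h) (spokeE′ i)     = meet-swap₂ (plain-spoke u v i (barrier u v h))
    meets (plainE u v h) (ringE ax i)    = plain-ring u v i (cross ax i) (barrier u v h)
    meets (spokeE i)     (plainE u v h)  = meet-flip (plain-spoke u v i (barrier u v h))
    meets (spokeE i)     (spokeE k)      = spoke-spoke i k
    meets (spokeE i)     (spokeE′ k)     = meet-swap₂ (spoke-spoke i k)
    meets (spokeE i)     (ringE ax k)    = spoke-ring i ax k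
    meets (spokeE′ i)    (plainE u v h)  = meet-flip (meet-swap₂ (plain-spoke u v i (barrier u v h)))
    meets (spokeE′ i)    (spokeE k)      = meet-swap (spoke-spoke i k)
    meets (spokeE′ i)    (spokeE′ k)     = meet-swap (meet-swap₂ (spoke-spoke i k))
    meets (spokeE′ i)    (ringE ax k)    = meet-swap (spoke-ring i ax k)
    meets (ringE ax i)   (plainE u v h)  = meet-flip (plain-ring u v i (cross ax i) (barrier u v h))
    meets (ringE ax i)   (spokeE k)      = meet-flip (spoke-ring k ax i)
    meets (ringE ax i)   (spokeE′ k)     = meet-flip (meet-swap (spoke-ring k ax i))
    meets (ringE ax i)   (ringE ax′ k)   = ring-ring ax i k (cross ax′ k) (cross≢ ax′ k)

    Barrier′ : Maybe X′ → Maybe X′ → Set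
    Barrier′ = Barrier place′ new centre r

    -- The old line serves again: the new ring consists of corners of the old square, strictly
    -- behind the line, and the smaller square lies between them.
    plain-barrier : ∀ u v → Barrier place q centre t u v → Barrier′ (old u) (old v)
    plain-barrier u v β = record
      { line = line; end₁ = start; end₂ = end; outer = λ k → inj₁ (inner k)
      ; inner = λ k → subst (_< 0ℚ) (sym (ev-shrink quarter centre t k line)) (between-< quarter≥0 quarter≤1 (inner k) (inner (far k))) }
      where open Wall β

    depth-≤ : ∀ s → 0ℚ < s → ∀ ax i k → depth centre ax (negative ax i) (corner centre s k) ≤ s
    depth-≤ s s>0 ax i k = decide (side ax i k)
      where
      decide : Side ax i k → depth centre ax (negative ax i) (corner centre s k) ≤ s
      decide (inj₁ n) = ≤-reflexive (trans (cong (λ a → depth centre ax a (corner centre s k)) (sym (on-side ax i k n))) (depth-corner centre s ax k))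
      decide (inj₂ e) = ≤-trans (≤-reflexive (depth-off s ax i k e)) (<⇒≤ (<-trans (neg-antimono-< s>0) s>0))

    ring-barrier : ∀ ax i → Barrier′ (new i) (new (cross ax i))
    ring-barrier ax i = record
      { line = W ax i
      ; end₁ = ≤-reflexive (sym (W-on ax i i (near ax i))); end₂ = ≤-reflexive (sym (W-on ax i (cross ax i) (next-to ax i)))
      ; outer = λ k → decide k (side ax i k)
      ; inner = λ k → subst (_< 0ℚ) (sym (ev-wall centre ax (negative ax i) t (corner centre r k)))
          (-<0⁺ (≤-<-trans (depth-≤ r (shrink>0 t>0) ax i k) (shrink< t>0))) }
      where
      decide : ∀ k → Side ax i k → ev (W ax i) (place′ (new k)) < 0ℚ ⊎ (ev (W ax i) (place′ (new k)) ≡ 0ℚ × (new k ≡ new i ⊎ new k ≡ new (cross ax i)))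
      decide k (inj₁ n) = inj₂ (W-on ax i k n , [ (λ e → inj₁ (cong new e)) , (λ e → inj₂ (cong new e)) ]′ n)
      decide k (inj₂ e) = inj₁ (W-off ax i k e)

    -- The diagonal line through the corner i. By `deep` the old end of the spoke lies beyond it,
    -- while the other corners and the smaller square have a smaller sum of depths.
    spoke-barrier : ∀ i → Barrier′ (old (q i)) (new i)
    spoke-barrier i = record
      { line = S
      ; end₁ = <⇒≤ (subst (0ℚ <_) (sym (value (place (q i)))) (0<-⁺ (+-mono-< (deep false i) (deep true i))))
      ; end₂ = ≤-reflexive (sym on-line)
      ; outer = λ k → decide k (separated i k)
      ; inner = λ k → subst (_< 0ℚ) (sym (value (corner centre r k)))
          (-<0⁺ (≤-<-trans (+-mono-≤ (depth-≤ r (shrink>0 t>0) false i k) (depth-≤ r (shrink>0 t>0) true i k)) (+-mono-< (shrink< t>0) (shrink< t>0)))) }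
      where
      S : Line
      S = slant centre (negative false i) (negative true i) (t + t)
      δ : Bool → Point → ℚ
      δ ax p = depth centre ax (negative ax i) p
      value : ∀ p → ev S p ≡ (δ false p + δ true p) - (t + t)
      value = ev-slant centre (negative false i) (negative true i) (t + t)
      on-line : ev S (corner centre t i) ≡ 0ℚ
      on-line = trans (value (corner centre t i)) (-≡0⁺ (cong₂ _+_ (depth-corner centre t false i) (depth-corner centre t true i)))
      less : ∀ k ax → negative ax k ≡ not (negative ax i) → δ false (corner centre t k) + δ true (corner centre t k) < t + t
      less k false e = +-mono-<-≤ (subst (_< t) (sym (depth-off t false i k e)) -t<t) (depth-≤ t t>0 true i k)
      less k true  e = +-mono-≤-< (depth-≤ t t>0 false i k) (subst (_< t) (sym (depth-off t true i k e)) -t<t)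
      decide : ∀ k → k ≡ i ⊎ (∃ λ ax → negative ax k ≡ not (negative ax i)) →
               ev S (place′ (new k)) < 0ℚ ⊎ (ev S (place′ (new k)) ≡ 0ℚ × (new k ≡ old (q i) ⊎ new k ≡ new i))
      decide k (inj₁ refl)     = inj₂ (on-line , inj₂ refl)
      decide k (inj₂ (ax , e)) = inj₁ (subst (_< 0ℚ) (sym (value (corner centre t k))) (-<0⁺ (less k ax e)))

    barrier′ : ∀ {u v} → Edge u v → Barrier′ u v
    barrier′ (plainE u v h) = plain-barrier u v (barrier u v h)
    barrier′ (spokeE i)     = spoke-barrier i
    barrier′ (spokeE′ i)    = barrier-swap (spoke-barrier i)
    barrier′ (ringE ax i)   = ring-barrier ax i

    distinct : ∀ {u v} → Edge u v → ¬ place′ u ≡ place′ v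
    distinct (plainE u v h) e = nondegenerate u v h (trans (sym (place-old u)) (trans e (place-old v)))
    distinct (spokeE i)     e = <-irrefl (sym (depth-corner centre t false i)) (subst (λ p → t < depth centre false (negative false i) p) e (deep false i))
    distinct (spokeE′ i)    e = distinct (spokeE i) (sym e)
    distinct (ringE ax i)   e = <-irrefl (trans (sym (depth-off t (not ax) i (cross ax i) (negative-cross-not ax i)))
      (trans (cong (depth centre (not ax) (negative (not ax) i)) (sym e)) (depth-corner centre t (not ax) i))) -t<t

    nbr′ : ∀ u → ∃ λ v → adj′ u v ≡ true
    nbr′ nothing                = old (proj₁ (nbr nothing)) , trans (adj′-old nothing (proj₁ (nbr nothing))) (proj₂ (nbr nothing))
    nbr′ (just (inj₁ (inj₁ o))) = old (proj₁ (nbr (just (inj₁ o)))) , trans (adj′-old (just (inj₁ o)) (proj₁ (nbr (just (inj₁ o))))) (proj₂ (nbr (just (inj₁ o))))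
    nbr′ (just (inj₁ (inj₂ i))) = new i , isYes⁺ (i ≟F i) refl
    nbr′ (just (inj₂ i))        = new (mate i) , all₄-ok (λ i → ringAdj i (mate i)) refl i

    nested : Nested (next G)
    nested = record
      { place = place′; centre = centre; t = r; t>0 = shrink>0 t>0
      ; at-a = at-a; at-b = at-b; at-c = at-c
      ; left = λ { (inj₁ x) → left x ; (inj₂ k) → Inside.left (inside k) }
      ; above = λ { (inj₁ x) → above x ; (inj₂ k) → Inside.above (inside k) }
      ; beyond-b = λ { (inj₁ x) n → beyond-b x (λ e → n (cong inj₁ e)) ; (inj₂ k) _ → Inside.beyond-b (inside k) }
      ; beyond-c = λ { (inj₁ x) n → beyond-c x (λ e → n (cong inj₁ e)) ; (inj₂ k) _ → Inside.beyond-c (inside k) }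
      ; inside = shrink-inside centre t inside
      ; deep = λ ax i → subst (r <_) (sym (depth-corner centre t ax i)) (shrink< t>0)
      ; barrier = λ u v h → barrier′ (edge u v h)
      ; nbr = nbr′
      ; nondegenerate = λ u v h → distinct (edge u v h)
      ; planar = λ u v w z h h′ → meets (edge u v h) (edge w z h′)
      }

  grow-nested : ∀ k G → Nested G → Nested (grow k G)
  grow-nested zero    G D = D
  grow-nested (suc k) G D = NextPlane.nested (grow k G) (grow-nested k G D)

-- Checks for the seed of the growth

module Seed where

  open import Defs using (Point)
  open Refute using (elemᵇ; refute)
  open Sound
  open PathCycle using (isYes⁻)
  open Contract using (parity)
  open QSolver using (κ; κ-+; κ-neg)
  open Plane
  open FramePlane using (corner-a; corner-b; corner-c; line-b; line-c; mirror)
  open Base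
  open Grow hiding (p; s; c; d; d′; e; e′)
  open GrowRoutes
  open Growth
  open GrowPlane
  open import Data.Bool using (Bool; true; false; _∧_; _∨_)
  open import Data.Nat using (ℕ; zero; suc; _+_; _∸_; _≡ᵇ_)
  open import Data.Fin using (Fin; zero; suc; toℕ; join; splitAt) renaming (_≟_ to _≟F_)
  open import Data.Fin.Properties using (toℕ<n; splitAt-join)
  open import Data.Integer as ℤ using (ℤ; +_; -[1+_])
  open import Data.List using (List; []; _∷_; map; _++_; upTo)
  open import Data.Maybe using (Maybe; just; nothing)
  open import Data.Product using (∃; _×_; _,_; proj₁; proj₂)
  open import Data.Rational using (ℚ; 0ℚ; 1ℚ; _<_; _≤_)
  open import Data.Rational.Properties using (<-≤-trans)
  open import Data.Sum using (_⊎_; inj₁; inj₂; [_,_]′)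
  open import Relation.Nullary using (⌊_⌋)
  open import Relation.Nullary.Decidable using (from-yes)
  open import Relation.Binary.PropositionalEquality

  anyᵇ : {A : Set} → (A → Bool) → List A → Bool
  anyᵇ P []       = false
  anyᵇ P (x ∷ xs) = P x ∨ anyᵇ P xs

  anyᵇ-ok : ∀ {A : Set} (P : A → Bool) l → anyᵇ P l ≡ true → ∃ λ x → P x ≡ true
  anyᵇ-ok P (x ∷ xs) h = [ (λ e → x , e) , anyᵇ-ok P xs ]′ (∨⁻ {P x} h)

  πᶻ : Bool → Pointᶻ → ℤ
  πᶻ false = proj₁
  πᶻ true  = proj₂

  mirrorᶻ : Bool → ℤ → ℤ
  mirrorᶻ false z = z
  mirrorᶻ true  z = ℤ.- z

  mirror-κ : ∀ s z → mirror s (κ z) ≡ κ (mirrorᶻ s z)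
  mirror-κ false z = refl
  mirror-κ true  z = sym (κ-neg z)

  depthᶻ : Pointᶻ → Bool → Bool → Pointᶻ → ℤ
  depthᶻ o ax s p = mirrorᶻ s (πᶻ ax p ℤ.- πᶻ ax o)

  κ-minus : ∀ a b → κ a Data.Rational.- κ b ≡ κ (a ℤ.- b)
  κ-minus a b = sym (trans (κ-+ a (ℤ.- b)) (cong (κ a Data.Rational.+_) (κ-neg b)))

  depth-κ : ∀ o ax s p → depth (κᴾ o) ax s (κᴾ p) ≡ κ (depthᶻ o ax s p)
  depth-κ o false s p = trans (cong (mirror s) (κ-minus (proj₁ p) (proj₁ o))) (mirror-κ s _)
  depth-κ o true  s p = trans (cong (mirror s) (κ-minus (proj₂ p) (proj₂ o))) (mirror-κ s _)

  cornerᶻ : Pointᶻ → Fin 4 → Pointᶻ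
  cornerᶻ (x , y) k = x ℤ.+ mirrorᶻ (negative false k) (+ 1) , y ℤ.+ mirrorᶻ (negative true k) (+ 1)

  corner-κ : ∀ o k → corner (κᴾ o) 1ℚ k ≡ κᴾ (cornerᶻ o k)
  corner-κ (x , y) k = cong₂ _,_ (at (negative false k) x) (at (negative true k) y)
    where
    at : ∀ s a → κ a Data.Rational.+ mirror s 1ℚ ≡ κ (a ℤ.+ mirrorᶻ s (+ 1))
    at s a = trans (cong (κ a Data.Rational.+_) (mirror-κ s (+ 1))) (sym (κ-+ a _))

  -- A tour cut at the edges {0 , 1} and {2 , 3} of the ring; the first cut is after the ring vertex u, the second after w.
  data Trail : Set where
    cut  : (u : Fin 4) → (l₁ l₂ : List ℕ) → Trail
    cut₂ : (u w : Fin 4) → (l₁ l₂ l₃ : List ℕ) → Trail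

  record SeedData : Set where
    field
      table                      : List (List ℕ)
      order                      : List ℕ
      coords                     : List Pointᶻ
      tour-bc tour-ba tour-ca    : Trail
      tour-b tour-c              : Trail
      avoiding ring-avoiding     : List (ℕ × Trail)
      outs                       : List ℕ
      centre                     : Pointᶻ
      -- Candidates for the barriers; the check looks among them for one that suits the edge at
      -- hand.
      lines                      : List Lineᶻ

  module Seed (M : ℕ) (𝔻 : SeedData) where

    open SeedData 𝔻

    m : ℕ
    m = suc (suc M)

    open Passes (_≟F_ {m}) public using (X; _≟X_; q; is)
    -- The outer vertices come first in the code, so the ring has the last four codes.
    open Base.Base {suc M + 4} {X} _≟X_ (join m 4) (splitAt m) (splitAt-join m 4) table coords public
    open Passes.Pass (_≟F_ {m}) adj public using (kept; Other; Once; Twice; Passing; onceAt; twiceAt)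

    b c : Fin m
    b = zero
    c = suc zero

    B C : A
    B = just (inj₁ b)
    C = just (inj₁ c)

    os : List (Fin m)
    os = map clamp (upTo m)

    indexᵇ : (Fin m → Bool) → Bool
    indexᵇ P = below m λ k → P (clamp k)

    indexᵇ-ok : ∀ P → indexᵇ P ≡ true → ∀ x → P x ≡ true
    indexᵇ-ok P h x = subst (λ y → P y ≡ true) (clamp-toℕ x) (below-ok m (λ k → P (clamp k)) h (toℕ x) (toℕ<n x))

    last : List ℕ → ℕ
    last []           = 0
    last (k ∷ [])     = k
    last (_ ∷ k ∷ ks) = last (k ∷ ks)

    end : Trail → ℕ
    end (cut u l₁ l₂)       = last l₂
    end (cut₂ u w l₁ l₂ l₃) = last l₃

    outside : ℕ → Fin m
    outside k = clamp (k ∸ 2)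

    otherᵇ : Fin 4 → Fin 4 → Bool
    otherᵇ u w = ⌊ w ≟F opp u ⌋ ∨ ⌊ w ≟F mate (opp u) ⌋

    otherᵇ-ok : ∀ u w → otherᵇ u w ≡ true → Other u w
    otherᵇ-ok u w h = [ (λ e → inj₁ (isYes⁻ (w ≟F opp u) e)) , (λ e → inj₂ (isYes⁻ (w ≟F mate (opp u)) e)) ]′ (∨⁻ {⌊ w ≟F opp u ⌋} h)

    cutᵇ : (A → Bool) → A → A → Fin 4 → List ℕ → List ℕ → Bool
    cutᵇ miss x y u l₁ l₂ = routeᵇ kept x (path l₁) (q u) ∧ routeᵇ kept (q (mate u)) (path l₂) y ∧ spansᵇ miss (path l₁ ++ path l₂)

    cutᵇ-ok : ∀ {allowed} miss x y u l₁ l₂ → allowed u → cutᵇ miss x y u l₁ l₂ ≡ true → Once allowed miss x y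
    cutᵇ-ok miss x y u l₁ l₂ ok h = onceAt u ok (path l₁) (path l₂)
      (routeᵇ-ok kept x (path l₁) (q u) (proj₁ h₁)) (routeᵇ-ok kept (q (mate u)) (path l₂) y (proj₁ h₂))
      (spansᵇ-ok miss (path l₁ ++ path l₂) (proj₂ h₂))
      where
      h₁ = ∧⁻ {routeᵇ kept x (path l₁) (q u)} h
      h₂ = ∧⁻ {routeᵇ kept (q (mate u)) (path l₂) y} (proj₂ h₁)

    passingᵇ : (A → Bool) → A → A → Trail → Bool
    passingᵇ miss x y (cut u l₁ l₂)       = cutᵇ miss x y u l₁ l₂
    passingᵇ miss x y (cut₂ u w l₁ l₂ l₃) = otherᵇ u w ∧ routeᵇ kept x (path l₁) (q u) ∧ routeᵇ kept (q (mate u)) (path l₂) (q w) ∧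
      routeᵇ kept (q (mate w)) (path l₃) y ∧ spansᵇ miss (path l₁ ++ (path l₂ ++ path l₃))

    passingᵇ-ok : ∀ miss x y tr → passingᵇ miss x y tr ≡ true → Passing miss x y
    passingᵇ-ok miss x y (cut u l₁ l₂)       h = inj₁ (cutᵇ-ok miss x y u l₁ l₂ true h)
    passingᵇ-ok miss x y (cut₂ u w l₁ l₂ l₃) h = inj₂ (twiceAt u w (otherᵇ-ok u w (proj₁ h₀)) (path l₁) (path l₂) (path l₃)
      (routeᵇ-ok kept x (path l₁) (q u) (proj₁ h₁)) (routeᵇ-ok kept (q (mate u)) (path l₂) (q w) (proj₁ h₂))
      (routeᵇ-ok kept (q (mate w)) (path l₃) y (proj₁ h₃)) (spansᵇ-ok miss (path l₁ ++ (path l₂ ++ path l₃)) (proj₂ h₃)))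
      where
      h₀ = ∧⁻ {otherᵇ u w} h
      h₁ = ∧⁻ {routeᵇ kept x (path l₁) (q u)} (proj₂ h₀)
      h₂ = ∧⁻ {routeᵇ kept (q (mate u)) (path l₂) (q w)} (proj₂ h₁)
      h₃ = ∧⁻ {routeᵇ kept (q (mate w)) (path l₃) y} (proj₂ h₂)

    Linked : (A → A → Set) → Set
    Linked P = P B C ⊎ P B nothing ⊎ P C nothing

    linkedᵇ : (A → A → Trail → Bool) → ℕ × Trail → Bool
    linkedᵇ P (0 , tr) = P B C tr
    linkedᵇ P (1 , tr) = P B nothing tr
    linkedᵇ P (_ , tr) = P C nothing tr

    linkedᵇ-ok : ∀ P (Q : A → A → Set) → (∀ x y tr → P x y tr ≡ true → Q x y) → ∀ r → linkedᵇ P r ≡ true → Linked Q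
    linkedᵇ-ok P Q f (0 , tr)           h = inj₁ (f B C tr h)
    linkedᵇ-ok P Q f (1 , tr)           h = inj₂ (inj₁ (f B nothing tr h))
    linkedᵇ-ok P Q f (suc (suc _) , tr) h = inj₂ (inj₂ (f C nothing tr h))

    avoidᵇ : Fin m → Bool
    avoidᵇ o = linkedᵇ (passingᵇ (is (just (inj₁ o)))) (nth (0 , cut 0F [] []) avoiding (toℕ o))

    dodgeᵇ : Fin 4 → A → A → Trail → Bool
    dodgeᵇ i x y (cut u l₁ l₂) = otherᵇ i u ∧ cutᵇ (is (q i)) x y u l₁ l₂
    dodgeᵇ i x y _             = false

    dodgeᵇ-ok : ∀ i x y tr → dodgeᵇ i x y tr ≡ true → Once (Other i) (is (q i)) x y
    dodgeᵇ-ok i x y (cut u l₁ l₂) h = cutᵇ-ok (is (q i)) x y u l₁ l₂ (otherᵇ-ok i u (proj₁ (∧⁻ h))) (proj₂ (∧⁻ {otherᵇ i u} h))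

    avoidRingᵇ : Fin 4 → Bool
    avoidRingᵇ i = linkedᵇ (dodgeᵇ i) (nth (0 , cut 0F [] []) ring-avoiding (toℕ i))

    out : Fin 4 → Maybe (Fin m)
    out i = just (outside (nth 0 outs (toℕ i)))

    ringNbrᵇ : Fin 4 → A → Bool
    ringNbrᵇ i z = adj (q i) z ⇒ᵇ (is z (q (mate i)) ∨ is z (q (opp i)) ∨ is z (Data.Maybe.map inj₁ (out i)))

    ring-nbrsᵇ : Bool
    ring-nbrsᵇ = all₄ λ i → allA (ringNbrᵇ i)

    deepᵇ : Bool → Fin 4 → Bool
    deepᵇ ax i = ⌊ + 1 ℤ.≤? depthᶻ centre ax (negative ax i) (posᶻ (codeA (q i))) ⌋

    cornersᵇ : (Pointᶻ → Bool) → Bool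
    cornersᵇ P = all₄ λ k → P (cornerᶻ centre k)

    outerᵇ : Lineᶻ → ℕ → ℕ → Fin 4 → Bool
    outerᵇ L u v i = neg? (evᶻ L (posᶻ (codeA (q i)))) ∨ (zero? (evᶻ L (posᶻ (codeA (q i)))) ∧ ((codeA (q i) ≡ᵇ u) ∨ (codeA (q i) ≡ᵇ v)))

    wallᵇ : ℕ → ℕ → Lineᶻ → Bool
    wallᵇ u v L = nonneg? (evᶻ L (posᶻ u)) ∧ nonneg? (evᶻ L (posᶻ v)) ∧ all₄ (outerᵇ L u v) ∧ cornersᵇ (λ p → neg? (evᶻ L p))

    barrierᵇ : ℕ → ℕ → Bool
    barrierᵇ u v = anyᵇ (wallᵇ u v) lines

    record Checks : Set where
      field
        symmetric     : symmetricᵇ ≡ true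
        irreflexive   : irreflexiveᵇ ≡ true
        once          : indexᵇ (λ x → parity (λ y → ⌊ y ≟F x ⌋) os) ≡ true
        rim-mate      : all₄ (λ i → adj (q i) (q (mate i))) ≡ true
        rim-opp       : all₄ (λ i → adj (q i) (q (opp i))) ≡ true
        rim-nbrs      : ring-nbrsᵇ ≡ true
        terminals     : (elemᵇ 0 (keys 1) ∧ elemᵇ 1 (keys 0)) ∧ (elemᵇ 0 (keys 2) ∧ elemᵇ 2 (keys 0)) ∧ (elemᵇ 0 (keys 3) ∧ elemᵇ 3 (keys 0)) ≡ true
        valid         : validᵇ order ≡ true
        refuted       : refute 200 (initial order) ≡ true
        bc            : passingᵇ (is nothing) B C tour-bc ≡ true
        ba            : adj (just (inj₁ (outside (end tour-ba)))) nothing ∧ passingᵇ (λ v → is nothing v ∨ is C v) B (just (inj₁ (outside (end tour-ba)))) tour-ba ≡ true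
        ca            : adj (just (inj₁ (outside (end tour-ca)))) nothing ∧ passingᵇ (λ v → is nothing v ∨ is B v) C (just (inj₁ (outside (end tour-ca)))) tour-ca ≡ true
        b-all         : passingᵇ (λ _ → false) B (vertex (end tour-b)) tour-b ≡ true
        c-all         : passingᵇ (λ _ → false) C (vertex (end tour-c)) tour-c ≡ true
        avoids        : indexᵇ avoidᵇ ≡ true
        avoids-ring   : all₄ avoidRingᵇ ≡ true
        left          : pointsᵇ (λ p → neg? (proj₁ p)) ≡ true
        above         : pointsᵇ (λ p → pos? (proj₂ p)) ≡ true
        beyond-b      : beyondᵇ 0 line-b ≡ true
        beyond-c      : beyondᵇ 1 line-c ≡ true
        corner-left   : cornersᵇ (λ p → neg? (proj₁ p)) ≡ true
        corner-above  : cornersᵇ (λ p → pos? (proj₂ p)) ≡ true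
        nook-b        : cornersᵇ (λ p → pos? (evᶻ line-b p)) ≡ true
        nook-c        : cornersᵇ (λ p → pos? (evᶻ line-c p)) ≡ true
        deep          : all₂ (λ ax → all₄ (deepᵇ ax)) ≡ true
        barriers      : edgesᵇ barrierᵇ ≡ true
        neighbours    : neighbourᵇ ≡ true
        nondegenerate : nondegenerateᵇ ≡ true
        planar        : planarᵇ ≡ true
        corners       : (posᶻ 1 ≡ corner-a) × (posᶻ 2 ≡ corner-b) × (posᶻ 3 ≡ corner-c)

    module _ (checks : Checks) where

      private
        module C = Checks checks

      growing : Growing
      growing = record
        { O = Fin m; _≟O_ = _≟F_; os = os
        ; once = indexᵇ-ok (λ x → parity (λ y → ⌊ y ≟F x ⌋) os) C.once
        ; adj = adj; adj-sym = adj-sym C.symmetric; adj-irr = adj-irr C.irreflexive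
        ; ring-mate = all₄-ok (λ i → adj (q i) (q (mate i))) C.rim-mate
        ; ring-opp = all₄-ok (λ i → adj (q i) (q (opp i))) C.rim-opp
        ; out = out; ring-nbrs = rim
        ; b = b; c = c; b≢c = λ ()
        ; nonham = Nonham.nonham (inj₁ b) (inj₁ c) order (proj₁ t) (proj₁ t′) (proj₂ t′) C.valid C.refuted
        ; b→c = passingᵇ-ok (is nothing) B C tour-bc C.bc
        ; b↠a = outside (end tour-ba) , proj₁ ba , passingᵇ-ok (λ v → is nothing v ∨ is C v) B (just (inj₁ (outside (end tour-ba)))) tour-ba (proj₂ ba)
        ; c↠a = outside (end tour-ca) , proj₁ ca , passingᵇ-ok (λ v → is nothing v ∨ is B v) C (just (inj₁ (outside (end tour-ca)))) tour-ca (proj₂ ca)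
        ; b↠ = vertex (end tour-b) , passingᵇ-ok (λ _ → false) B (vertex (end tour-b)) tour-b C.b-all
        ; c↠ = vertex (end tour-c) , passingᵇ-ok (λ _ → false) C (vertex (end tour-c)) tour-c C.c-all
        ; avoid = λ o → linkedᵇ-ok (passingᵇ (is (just (inj₁ o)))) (Passing (is (just (inj₁ o)))) (passingᵇ-ok (is (just (inj₁ o))))
            (nth (0 , cut 0F [] []) avoiding (toℕ o)) (indexᵇ-ok avoidᵇ C.avoids o)
        ; avoidRing = λ i → linkedᵇ-ok (dodgeᵇ i) (Once (Other i) (is (q i))) (dodgeᵇ-ok i)
            (nth (0 , cut 0F [] []) ring-avoiding (toℕ i)) (all₄-ok avoidRingᵇ C.avoids-ring i)
        }
        where
        t  = ∧⁻ {elemᵇ 0 (keys 1) ∧ elemᵇ 1 (keys 0)} C.terminals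
        t′ = ∧⁻ {elemᵇ 0 (keys 2) ∧ elemᵇ 2 (keys 0)} (proj₂ t)
        ba = ∧⁻ {adj (just (inj₁ (outside (end tour-ba)))) nothing} C.ba
        ca = ∧⁻ {adj (just (inj₁ (outside (end tour-ca)))) nothing} C.ca
        rim : ∀ i z → adj (q i) z ≡ true → z ≡ q (mate i) ⊎ z ≡ q (opp i) ⊎ z ≡ Data.Maybe.map inj₁ (out i)
        rim i z h = [ (λ e → inj₁ (isYes⁻ (z ≟A q (mate i)) e)) , (λ e → inj₂
            ([ (λ e → inj₁ (isYes⁻ (z ≟A q (opp i)) e)) , (λ e → inj₂ (isYes⁻ (z ≟A Data.Maybe.map inj₁ (out i)) e)) ]′ (∨⁻ {is z (q (opp i))} e))) ]′
          (∨⁻ {is z (q (mate i))} (⇒ᵇ-ok (allA-ok (ringNbrᵇ i) (all₄-ok (λ i → allA (ringNbrᵇ i)) C.rim-nbrs i) z) h))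

      o : Point
      o = κᴾ centre

      -- The integer checks refer to the square of half-width 1 around the centre, and some ring
      -- vertices have depth exactly 1. The shrunken square makes `deep` strict.
      t : ℚ
      t = shrink quarter 1ℚ

      1>0 : 0ℚ < 1ℚ
      1>0 = from-yes (0ℚ Data.Rational.<? 1ℚ)

      κ-corner : ∀ {P : Point → Set} k → P (κᴾ (cornerᶻ centre k)) → P (corner o 1ℚ k)
      κ-corner {P} k h = subst P (sym (corner-κ centre k)) h

      ev-corner : ∀ {P : ℚ → Set} L k → P (κ (evᶻ L (cornerᶻ centre k))) → P (ev (κᴸ L) (corner o 1ℚ k))
      ev-corner {P} L k h = κ-corner {λ p → P (ev (κᴸ L) p)} k (subst P (sym (ev-κ L (cornerᶻ centre k))) h)

      at-corner : ∀ P → cornersᵇ P ≡ true → ∀ k → P (cornerᶻ centre k) ≡ true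
      at-corner P h k = all₄-ok (λ k → P (cornerᶻ centre k)) h k

      inside₁ : ∀ k → Inside (corner o 1ℚ k)
      inside₁ k = record
        { left = κ-corner {λ p → proj₁ p < 0ℚ} k (neg-ok _ (at-corner (λ p → neg? (proj₁ p)) C.corner-left k))
        ; above = κ-corner {λ p → 0ℚ < proj₂ p} k (pos-ok _ (at-corner (λ p → pos? (proj₂ p)) C.corner-above k))
        ; beyond-b = ev-corner {0ℚ <_} line-b k (pos-ok _ (at-corner (λ p → pos? (evᶻ line-b p)) C.nook-b k))
        ; beyond-c = ev-corner {0ℚ <_} line-c k (pos-ok _ (at-corner (λ p → pos? (evᶻ line-c p)) C.nook-c k))
        }

      barrier : ∀ u v → adj u v ≡ true → Barrier place q o t u v
      barrier u v e = build (anyᵇ-ok (wallᵇ (codeA u) (codeA v)) lines (edgesᵇ-ok barrierᵇ C.barriers u v e))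
        where
        build : (∃ λ L → wallᵇ (codeA u) (codeA v) L ≡ true) → Barrier place q o t u v
        build (L , h) = record
          { line = κᴸ L
          ; end₁ = subst (0ℚ ≤_) (sym (ev-κ L _)) (nonneg-ok _ (proj₁ h₁))
          ; end₂ = subst (0ℚ ≤_) (sym (ev-κ L _)) (nonneg-ok _ (proj₁ h₂))
          ; outer = λ i → at i (∨⁻ {neg? (evᶻ L (posᶻ (codeA (q i))))} (all₄-ok (outerᵇ L (codeA u) (codeA v)) (proj₁ h₃) i))
          ; inner = λ k → subst (_< 0ℚ) (sym (ev-shrink quarter o 1ℚ k (κᴸ L))) (between-< quarter≥0 quarter≤1 (negative-at k) (negative-at (far k)))
          }
          where
          h₁ = ∧⁻ {nonneg? (evᶻ L (posᶻ (codeA u)))} h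
          h₂ = ∧⁻ {nonneg? (evᶻ L (posᶻ (codeA v)))} (proj₂ h₁)
          h₃ = ∧⁻ {all₄ (outerᵇ L (codeA u) (codeA v))} (proj₂ h₂)
          negative-at : ∀ k → ev (κᴸ L) (corner o 1ℚ k) < 0ℚ
          negative-at k = ev-corner {_< 0ℚ} L k (neg-ok _ (at-corner (λ p → neg? (evᶻ L p)) (proj₂ h₃) k))
          at : ∀ i → neg? (evᶻ L (posᶻ (codeA (q i)))) ≡ true ⊎ zero? (evᶻ L (posᶻ (codeA (q i)))) ∧ ((codeA (q i) ≡ᵇ codeA u) ∨ (codeA (q i) ≡ᵇ codeA v)) ≡ true →
               ev (κᴸ L) (place (q i)) < 0ℚ ⊎ (ev (κᴸ L) (place (q i)) ≡ 0ℚ × (q i ≡ u ⊎ q i ≡ v))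
          at i (inj₁ e) = inj₁ (subst (_< 0ℚ) (sym (ev-κ L _)) (neg-ok _ e))
          at i (inj₂ e) = inj₂ (trans (ev-κ L _) (zero-ok _ (proj₁ (∧⁻ e))) ,
            [ (λ e → inj₁ (codeA-injective {q i} {u} (≡ᵇ⁻ e))) , (λ e → inj₂ (codeA-injective {q i} {v} (≡ᵇ⁻ e))) ]′
              (∨⁻ {codeA (q i) ≡ᵇ codeA u} (proj₂ (∧⁻ {zero? (evᶻ L (posᶻ (codeA (q i))))} e))))

      nested : Nested growing
      nested = record
        { place = place; centre = o; t = t; t>0 = shrink>0 1>0
        ; at-a = cong κᴾ (proj₁ C.corners); at-b = cong κᴾ (proj₁ (proj₂ C.corners)); at-c = cong κᴾ (proj₂ (proj₂ C.corners))
        ; left = λ x → neg-ok _ (pointsᵇ-ok (λ p → neg? (proj₁ p)) C.left x)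
        ; above = λ x → pos-ok _ (pointsᵇ-ok (λ p → pos? (proj₂ p)) C.above x)
        ; beyond-b = beyondᵇ-ok (inj₁ b) line-b C.beyond-b
        ; beyond-c = beyondᵇ-ok (inj₁ c) line-c C.beyond-c
        ; inside = shrink-inside o 1ℚ inside₁
        ; deep = λ ax i → <-≤-trans (shrink< 1>0) (subst (1ℚ ≤_) (sym (depth-κ centre ax (negative ax i) (posᶻ (codeA (q i)))))
            (κ-≤ (isYes⁻ (_ ℤ.≤? _) (all₄-ok (deepᵇ ax) (all₂-ok (λ ax → all₄ (deepᵇ ax)) C.deep ax) i))))
        ; barrier = barrier
        ; nbr = λ u → neighbour u , allA-ok (λ a → adj a (neighbour a)) C.neighbours u
        ; nondegenerate = nondegenerateᵇ-ok C.nondegenerate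
        ; planar = planarᵇ-ok C.planar
        }

-- The seed, a fragment with 37 vertices

module SeedGraph where

  open Seed
  open Grow using (0F; 1F; 2F; 3F)
  open import Data.Integer using (+_; -[1+_])
  open import Data.List using ([]; _∷_)
  open import Data.Product using (_,_)
  open import Relation.Binary.PropositionalEquality

  -- The table is that of `data₃₄` with the growth step done once at the quadrangle 8 4 6 7: the
  -- edges 8 4 and 6 7 are removed, and the ring 34 35 36 37 is joined to 8, 4, 6, 7 in this order.
  -- The original quadrangle cannot serve itself, as some of its vertices have two neighbours
  -- outside; those of the new ring have one.
  data₃₈ : SeedData
  data₃₈ = record
    { table =
        (2 ∷ 3 ∷ 1 ∷ [])
        ∷ (4 ∷ 0 ∷ 11 ∷ 15 ∷ [])
        ∷ (4 ∷ 5 ∷ 0 ∷ [])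
        ∷ (5 ∷ 0 ∷ 12 ∷ 22 ∷ [])
        ∷ (2 ∷ 6 ∷ 1 ∷ 35 ∷ [])
        ∷ (2 ∷ 6 ∷ 3 ∷ 9 ∷ [])
        ∷ (4 ∷ 5 ∷ 36 ∷ [])
        ∷ (8 ∷ 9 ∷ 37 ∷ [])
        ∷ (7 ∷ 10 ∷ 30 ∷ 34 ∷ [])
        ∷ (5 ∷ 7 ∷ 13 ∷ 33 ∷ [])
        ∷ (8 ∷ 11 ∷ 32 ∷ [])
        ∷ (1 ∷ 10 ∷ 16 ∷ [])
        ∷ (3 ∷ 13 ∷ 24 ∷ [])
        ∷ (9 ∷ 12 ∷ 27 ∷ [])
        ∷ (15 ∷ 16 ∷ 19 ∷ [])
        ∷ (1 ∷ 14 ∷ 22 ∷ [])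
        ∷ (11 ∷ 14 ∷ 21 ∷ [])
        ∷ (19 ∷ 20 ∷ 21 ∷ [])
        ∷ (19 ∷ 22 ∷ 24 ∷ [])
        ∷ (14 ∷ 17 ∷ 18 ∷ [])
        ∷ (17 ∷ 24 ∷ 26 ∷ [])
        ∷ (16 ∷ 17 ∷ 32 ∷ [])
        ∷ (3 ∷ 15 ∷ 18 ∷ [])
        ∷ (24 ∷ 25 ∷ 27 ∷ [])
        ∷ (12 ∷ 18 ∷ 20 ∷ 23 ∷ [])
        ∷ (23 ∷ 26 ∷ 29 ∷ [])
        ∷ (20 ∷ 25 ∷ 32 ∷ [])
        ∷ (13 ∷ 23 ∷ 28 ∷ [])
        ∷ (27 ∷ 29 ∷ 33 ∷ [])
        ∷ (25 ∷ 28 ∷ 31 ∷ [])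
        ∷ (8 ∷ 31 ∷ 33 ∷ [])
        ∷ (29 ∷ 30 ∷ 32 ∷ [])
        ∷ (10 ∷ 21 ∷ 26 ∷ 31 ∷ [])
        ∷ (9 ∷ 28 ∷ 30 ∷ [])
        ∷ (8 ∷ 37 ∷ 35 ∷ [])
        ∷ (4 ∷ 36 ∷ 34 ∷ [])
        ∷ (6 ∷ 37 ∷ 35 ∷ [])
        ∷ (7 ∷ 36 ∷ 34 ∷ [])
        ∷ []
    ; order = 25 ∷ 23 ∷ 26 ∷ 29 ∷ 24 ∷ 27 ∷ 20 ∷ 32 ∷ 28 ∷ 31 ∷ 12 ∷ 18 ∷ 13 ∷ 17 ∷ 10 ∷ 21 ∷ 33 ∷ 30 ∷ 3 ∷ 19 ∷ 22 ∷ 9 ∷ 8 ∷ 11 ∷ 16 ∷ 5 ∷ 0 ∷ 14 ∷ 15 ∷ 7 ∷ 34 ∷ 1 ∷ 2 ∷ 6 ∷ 37 ∷ 35 ∷ 4 ∷ 36 ∷ []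
    ; coords =
        (+ 0 , + 0)
        ∷ (+ 0 , + 300)
        ∷ (-[1+ 599 ] , + 1)
        ∷ (-[1+ 299 ] , + 1)
        ∷ (-[1+ 307 ] , + 128)
        ∷ (-[1+ 383 ] , + 44)
        ∷ (-[1+ 332 ] , + 93)
        ∷ (-[1+ 280 ] , + 105)
        ∷ (-[1+ 249 ] , + 123)
        ∷ (-[1+ 303 ] , + 81)
        ∷ (-[1+ 189 ] , + 158)
        ∷ (-[1+ 113 ] , + 212)
        ∷ (-[1+ 270 ] , + 59)
        ∷ (-[1+ 277 ] , + 78)
        ∷ (-[1+ 152 ] , + 169)
        ∷ (-[1+ 120 ] , + 190)
        ∷ (-[1+ 149 ] , + 177)
        ∷ (-[1+ 195 ] , + 136)
        ∷ (-[1+ 210 ] , + 113)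
        ∷ (-[1+ 186 ] , + 139)
        ∷ (-[1+ 216 ] , + 119)
        ∷ (-[1+ 183 ] , + 151)
        ∷ (-[1+ 210 ] , + 101)
        ∷ (-[1+ 243 ] , + 101)
        ∷ (-[1+ 235 ] , + 98)
        ∷ (-[1+ 234 ] , + 112)
        ∷ (-[1+ 219 ] , + 123)
        ∷ (-[1+ 259 ] , + 94)
        ∷ (-[1+ 257 ] , + 101)
        ∷ (-[1+ 241 ] , + 112)
        ∷ (-[1+ 251 ] , + 115)
        ∷ (-[1+ 233 ] , + 122)
        ∷ (-[1+ 206 ] , + 138)
        ∷ (-[1+ 270 ] , + 99)
        ∷ (-[1+ 278 ] , + 116)
        ∷ (-[1+ 297 ] , + 117)
        ∷ (-[1+ 305 ] , + 106)
        ∷ (-[1+ 288 ] , + 109)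
        ∷ []
    ; tour-bc = cut₂ 3F 1F (2 ∷ 4 ∷ 6 ∷ 5 ∷ 9 ∷ 7 ∷ 37 ∷ []) (36 ∷ 35 ∷ []) (34 ∷ 8 ∷ 10 ∷ 11 ∷ 16 ∷ 14 ∷ 15 ∷ 22 ∷ 18 ∷ 19 ∷ 17 ∷ 21 ∷ 32 ∷ 31 ∷ 30 ∷ 33 ∷ 28 ∷ 29 ∷ 25 ∷ 26 ∷ 20 ∷ 24 ∷ 23 ∷ 27 ∷ 13 ∷ 12 ∷ 3 ∷ [])
    ; tour-ba = cut 2F (2 ∷ 5 ∷ 6 ∷ 4 ∷ 35 ∷ 36 ∷ []) (37 ∷ 34 ∷ 8 ∷ 7 ∷ 9 ∷ 13 ∷ 12 ∷ 24 ∷ 23 ∷ 27 ∷ 28 ∷ 33 ∷ 30 ∷ 31 ∷ 29 ∷ 25 ∷ 26 ∷ 20 ∷ 17 ∷ 21 ∷ 32 ∷ 10 ∷ 11 ∷ 16 ∷ 14 ∷ 19 ∷ 18 ∷ 22 ∷ 15 ∷ [])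
    ; tour-ca = cut 2F (3 ∷ 5 ∷ 6 ∷ 4 ∷ 35 ∷ 36 ∷ []) (37 ∷ 34 ∷ 8 ∷ 7 ∷ 9 ∷ 13 ∷ 12 ∷ 24 ∷ 23 ∷ 27 ∷ 28 ∷ 33 ∷ 30 ∷ 31 ∷ 29 ∷ 25 ∷ 26 ∷ 20 ∷ 17 ∷ 21 ∷ 32 ∷ 10 ∷ 11 ∷ 16 ∷ 14 ∷ 19 ∷ 18 ∷ 22 ∷ 15 ∷ [])
    ; tour-b = cut₂ 3F 1F (2 ∷ 5 ∷ 3 ∷ 12 ∷ 13 ∷ 9 ∷ 7 ∷ 37 ∷ []) (36 ∷ 6 ∷ 4 ∷ 35 ∷ []) (34 ∷ 8 ∷ 10 ∷ 11 ∷ 1 ∷ 15 ∷ 22 ∷ 18 ∷ 24 ∷ 20 ∷ 17 ∷ 19 ∷ 14 ∷ 16 ∷ 21 ∷ 32 ∷ 26 ∷ 25 ∷ 23 ∷ 27 ∷ 28 ∷ 33 ∷ 30 ∷ 31 ∷ 29 ∷ [])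
    ; tour-c = cut 0F (3 ∷ 22 ∷ 18 ∷ 19 ∷ 14 ∷ 15 ∷ 1 ∷ 11 ∷ 16 ∷ 21 ∷ 17 ∷ 20 ∷ 26 ∷ 32 ∷ 10 ∷ 8 ∷ 30 ∷ 31 ∷ 29 ∷ 25 ∷ 23 ∷ 24 ∷ 12 ∷ 13 ∷ 27 ∷ 28 ∷ 33 ∷ 9 ∷ 7 ∷ 37 ∷ 34 ∷ []) (35 ∷ 36 ∷ 6 ∷ 5 ∷ 2 ∷ 4 ∷ [])
    ; avoiding =
        (2 , cut 2F (3 ∷ 5 ∷ 6 ∷ 4 ∷ 35 ∷ 36 ∷ []) (37 ∷ 34 ∷ 8 ∷ 7 ∷ 9 ∷ 13 ∷ 12 ∷ 24 ∷ 23 ∷ 27 ∷ 28 ∷ 33 ∷ 30 ∷ 31 ∷ 29 ∷ 25 ∷ 26 ∷ 20 ∷ 17 ∷ 21 ∷ 32 ∷ 10 ∷ 11 ∷ 16 ∷ 14 ∷ 19 ∷ 18 ∷ 22 ∷ 15 ∷ 1 ∷ []))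
        ∷ (1 , cut 2F (2 ∷ 5 ∷ 6 ∷ 4 ∷ 35 ∷ 36 ∷ []) (37 ∷ 34 ∷ 8 ∷ 7 ∷ 9 ∷ 13 ∷ 12 ∷ 24 ∷ 23 ∷ 27 ∷ 28 ∷ 33 ∷ 30 ∷ 31 ∷ 29 ∷ 25 ∷ 26 ∷ 20 ∷ 17 ∷ 21 ∷ 32 ∷ 10 ∷ 11 ∷ 16 ∷ 14 ∷ 19 ∷ 18 ∷ 22 ∷ 15 ∷ 1 ∷ []))
        ∷ (0 , cut 1F (2 ∷ 5 ∷ 6 ∷ 36 ∷ 35 ∷ []) (34 ∷ 37 ∷ 7 ∷ 8 ∷ 10 ∷ 11 ∷ 1 ∷ 15 ∷ 14 ∷ 16 ∷ 21 ∷ 32 ∷ 26 ∷ 25 ∷ 23 ∷ 27 ∷ 28 ∷ 29 ∷ 31 ∷ 30 ∷ 33 ∷ 9 ∷ 13 ∷ 12 ∷ 24 ∷ 20 ∷ 17 ∷ 19 ∷ 18 ∷ 22 ∷ 3 ∷ []))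
        ∷ (0 , cut 1F (2 ∷ 4 ∷ 6 ∷ 36 ∷ 35 ∷ []) (34 ∷ 37 ∷ 7 ∷ 8 ∷ 10 ∷ 11 ∷ 1 ∷ 15 ∷ 14 ∷ 16 ∷ 21 ∷ 32 ∷ 26 ∷ 25 ∷ 23 ∷ 27 ∷ 28 ∷ 29 ∷ 31 ∷ 30 ∷ 33 ∷ 9 ∷ 13 ∷ 12 ∷ 24 ∷ 20 ∷ 17 ∷ 19 ∷ 18 ∷ 22 ∷ 3 ∷ []))
        ∷ (2 , cut₂ 0F 2F (3 ∷ 12 ∷ 13 ∷ 27 ∷ 23 ∷ 24 ∷ 20 ∷ 26 ∷ 25 ∷ 29 ∷ 28 ∷ 33 ∷ 30 ∷ 31 ∷ 32 ∷ 21 ∷ 17 ∷ 19 ∷ 18 ∷ 22 ∷ 15 ∷ 14 ∷ 16 ∷ 11 ∷ 10 ∷ 8 ∷ 34 ∷ []) (35 ∷ 36 ∷ []) (37 ∷ 7 ∷ 9 ∷ 5 ∷ 2 ∷ 4 ∷ 1 ∷ []))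
        ∷ (0 , cut₂ 1F 3F (2 ∷ 4 ∷ 35 ∷ []) (34 ∷ 37 ∷ []) (36 ∷ 6 ∷ 5 ∷ 9 ∷ 13 ∷ 12 ∷ 24 ∷ 23 ∷ 27 ∷ 28 ∷ 33 ∷ 30 ∷ 8 ∷ 10 ∷ 11 ∷ 1 ∷ 15 ∷ 14 ∷ 16 ∷ 21 ∷ 32 ∷ 31 ∷ 29 ∷ 25 ∷ 26 ∷ 20 ∷ 17 ∷ 19 ∷ 18 ∷ 22 ∷ 3 ∷ []))
        ∷ (0 , cut 0F (2 ∷ 4 ∷ 1 ∷ 11 ∷ 10 ∷ 32 ∷ 21 ∷ 16 ∷ 14 ∷ 15 ∷ 22 ∷ 18 ∷ 19 ∷ 17 ∷ 20 ∷ 26 ∷ 25 ∷ 29 ∷ 31 ∷ 30 ∷ 33 ∷ 28 ∷ 27 ∷ 23 ∷ 24 ∷ 12 ∷ 13 ∷ 9 ∷ 7 ∷ 37 ∷ 34 ∷ []) (35 ∷ 36 ∷ 6 ∷ 5 ∷ 3 ∷ []))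
        ∷ (1 , cut 0F (2 ∷ 5 ∷ 3 ∷ 12 ∷ 13 ∷ 27 ∷ 23 ∷ 25 ∷ 26 ∷ 20 ∷ 24 ∷ 18 ∷ 22 ∷ 15 ∷ 14 ∷ 19 ∷ 17 ∷ 21 ∷ 16 ∷ 11 ∷ 10 ∷ 32 ∷ 31 ∷ 29 ∷ 28 ∷ 33 ∷ 30 ∷ 8 ∷ 7 ∷ 37 ∷ 34 ∷ []) (35 ∷ 36 ∷ 6 ∷ 4 ∷ 1 ∷ []))
        ∷ (0 , cut₂ 1F 3F (2 ∷ 4 ∷ 35 ∷ []) (34 ∷ 37 ∷ []) (36 ∷ 6 ∷ 5 ∷ 9 ∷ 7 ∷ 8 ∷ 30 ∷ 33 ∷ 28 ∷ 27 ∷ 13 ∷ 12 ∷ 24 ∷ 23 ∷ 25 ∷ 29 ∷ 31 ∷ 32 ∷ 26 ∷ 20 ∷ 17 ∷ 21 ∷ 16 ∷ 11 ∷ 1 ∷ 15 ∷ 14 ∷ 19 ∷ 18 ∷ 22 ∷ 3 ∷ []))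
        ∷ (0 , cut 0F (2 ∷ 4 ∷ 1 ∷ 15 ∷ 14 ∷ 16 ∷ 21 ∷ 32 ∷ 10 ∷ 8 ∷ 7 ∷ 37 ∷ 34 ∷ []) (35 ∷ 36 ∷ 6 ∷ 5 ∷ 9 ∷ 13 ∷ 12 ∷ 24 ∷ 23 ∷ 27 ∷ 28 ∷ 33 ∷ 30 ∷ 31 ∷ 29 ∷ 25 ∷ 26 ∷ 20 ∷ 17 ∷ 19 ∷ 18 ∷ 22 ∷ 3 ∷ []))
        ∷ (0 , cut₂ 1F 3F (2 ∷ 4 ∷ 35 ∷ []) (34 ∷ 8 ∷ 7 ∷ 37 ∷ []) (36 ∷ 6 ∷ 5 ∷ 9 ∷ 13 ∷ 27 ∷ 28 ∷ 33 ∷ 30 ∷ 31 ∷ 29 ∷ 25 ∷ 23 ∷ 24 ∷ 18 ∷ 19 ∷ 14 ∷ 16 ∷ 21 ∷ 17 ∷ 20 ∷ 26 ∷ 32 ∷ 10 ∷ 11 ∷ 1 ∷ 15 ∷ 22 ∷ 3 ∷ []))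
        ∷ (0 , cut₂ 1F 3F (2 ∷ 4 ∷ 35 ∷ []) (34 ∷ 8 ∷ 7 ∷ 37 ∷ []) (36 ∷ 6 ∷ 5 ∷ 9 ∷ 33 ∷ 30 ∷ 31 ∷ 29 ∷ 28 ∷ 27 ∷ 23 ∷ 25 ∷ 26 ∷ 20 ∷ 17 ∷ 19 ∷ 14 ∷ 16 ∷ 21 ∷ 32 ∷ 10 ∷ 11 ∷ 1 ∷ 15 ∷ 22 ∷ 18 ∷ 24 ∷ 12 ∷ 3 ∷ []))
        ∷ (0 , cut₂ 1F 3F (2 ∷ 4 ∷ 35 ∷ []) (34 ∷ 8 ∷ 10 ∷ 32 ∷ 21 ∷ 16 ∷ 11 ∷ 1 ∷ 15 ∷ 22 ∷ 18 ∷ 19 ∷ 17 ∷ 20 ∷ 26 ∷ 25 ∷ 29 ∷ 31 ∷ 30 ∷ 33 ∷ 28 ∷ 27 ∷ 23 ∷ 24 ∷ 12 ∷ 13 ∷ 9 ∷ 7 ∷ 37 ∷ []) (36 ∷ 6 ∷ 5 ∷ 3 ∷ []))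
        ∷ (0 , cut₂ 2F 0F (2 ∷ 5 ∷ 6 ∷ 36 ∷ []) (37 ∷ 7 ∷ 9 ∷ 33 ∷ 28 ∷ 27 ∷ 13 ∷ 12 ∷ 24 ∷ 23 ∷ 25 ∷ 29 ∷ 31 ∷ 30 ∷ 8 ∷ 34 ∷ []) (35 ∷ 4 ∷ 1 ∷ 11 ∷ 10 ∷ 32 ∷ 26 ∷ 20 ∷ 17 ∷ 21 ∷ 16 ∷ 14 ∷ 19 ∷ 18 ∷ 22 ∷ 3 ∷ []))
        ∷ (0 , cut₂ 1F 3F (2 ∷ 4 ∷ 35 ∷ []) (34 ∷ 8 ∷ 7 ∷ 37 ∷ []) (36 ∷ 6 ∷ 5 ∷ 9 ∷ 13 ∷ 12 ∷ 24 ∷ 23 ∷ 27 ∷ 28 ∷ 33 ∷ 30 ∷ 31 ∷ 29 ∷ 25 ∷ 26 ∷ 20 ∷ 17 ∷ 21 ∷ 32 ∷ 10 ∷ 11 ∷ 1 ∷ 15 ∷ 14 ∷ 19 ∷ 18 ∷ 22 ∷ 3 ∷ []))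
        ∷ (0 , cut₂ 1F 3F (2 ∷ 4 ∷ 35 ∷ []) (34 ∷ 37 ∷ []) (36 ∷ 6 ∷ 5 ∷ 9 ∷ 7 ∷ 8 ∷ 10 ∷ 11 ∷ 1 ∷ 15 ∷ 22 ∷ 18 ∷ 19 ∷ 14 ∷ 16 ∷ 21 ∷ 32 ∷ 31 ∷ 30 ∷ 33 ∷ 28 ∷ 29 ∷ 25 ∷ 26 ∷ 20 ∷ 24 ∷ 23 ∷ 27 ∷ 13 ∷ 12 ∷ 3 ∷ []))
        ∷ (0 , cut₂ 1F 3F (2 ∷ 4 ∷ 35 ∷ []) (34 ∷ 8 ∷ 7 ∷ 37 ∷ []) (36 ∷ 6 ∷ 5 ∷ 9 ∷ 33 ∷ 30 ∷ 31 ∷ 29 ∷ 28 ∷ 27 ∷ 13 ∷ 12 ∷ 24 ∷ 23 ∷ 25 ∷ 26 ∷ 20 ∷ 17 ∷ 19 ∷ 14 ∷ 16 ∷ 21 ∷ 32 ∷ 10 ∷ 11 ∷ 1 ∷ 15 ∷ 22 ∷ 3 ∷ []))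
        ∷ (0 , cut₂ 1F 3F (2 ∷ 4 ∷ 35 ∷ []) (34 ∷ 37 ∷ []) (36 ∷ 6 ∷ 5 ∷ 9 ∷ 7 ∷ 8 ∷ 10 ∷ 11 ∷ 1 ∷ 15 ∷ 14 ∷ 16 ∷ 21 ∷ 17 ∷ 20 ∷ 26 ∷ 32 ∷ 31 ∷ 30 ∷ 33 ∷ 28 ∷ 29 ∷ 25 ∷ 23 ∷ 27 ∷ 13 ∷ 12 ∷ 24 ∷ 18 ∷ 22 ∷ 3 ∷ []))
        ∷ (0 , cut₂ 1F 3F (2 ∷ 4 ∷ 35 ∷ []) (34 ∷ 8 ∷ 7 ∷ 37 ∷ []) (36 ∷ 6 ∷ 5 ∷ 9 ∷ 13 ∷ 12 ∷ 24 ∷ 23 ∷ 27 ∷ 28 ∷ 33 ∷ 30 ∷ 31 ∷ 29 ∷ 25 ∷ 26 ∷ 32 ∷ 10 ∷ 11 ∷ 1 ∷ 15 ∷ 14 ∷ 16 ∷ 21 ∷ 17 ∷ 19 ∷ 18 ∷ 22 ∷ 3 ∷ []))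
        ∷ (0 , cut₂ 1F 3F (2 ∷ 4 ∷ 35 ∷ []) (34 ∷ 37 ∷ []) (36 ∷ 6 ∷ 5 ∷ 9 ∷ 7 ∷ 8 ∷ 10 ∷ 32 ∷ 31 ∷ 30 ∷ 33 ∷ 28 ∷ 29 ∷ 25 ∷ 26 ∷ 20 ∷ 17 ∷ 19 ∷ 14 ∷ 16 ∷ 11 ∷ 1 ∷ 15 ∷ 22 ∷ 18 ∷ 24 ∷ 23 ∷ 27 ∷ 13 ∷ 12 ∷ 3 ∷ []))
        ∷ (0 , cut₂ 1F 3F (2 ∷ 4 ∷ 35 ∷ []) (34 ∷ 37 ∷ []) (36 ∷ 6 ∷ 5 ∷ 9 ∷ 7 ∷ 8 ∷ 10 ∷ 11 ∷ 1 ∷ 15 ∷ 14 ∷ 16 ∷ 21 ∷ 32 ∷ 31 ∷ 30 ∷ 33 ∷ 28 ∷ 29 ∷ 25 ∷ 26 ∷ 20 ∷ 17 ∷ 19 ∷ 18 ∷ 24 ∷ 23 ∷ 27 ∷ 13 ∷ 12 ∷ 3 ∷ []))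
        ∷ (0 , cut₂ 1F 3F (2 ∷ 4 ∷ 35 ∷ []) (34 ∷ 37 ∷ []) (36 ∷ 6 ∷ 5 ∷ 9 ∷ 7 ∷ 8 ∷ 30 ∷ 33 ∷ 28 ∷ 27 ∷ 13 ∷ 12 ∷ 24 ∷ 20 ∷ 26 ∷ 25 ∷ 29 ∷ 31 ∷ 32 ∷ 10 ∷ 11 ∷ 1 ∷ 15 ∷ 14 ∷ 16 ∷ 21 ∷ 17 ∷ 19 ∷ 18 ∷ 22 ∷ 3 ∷ []))
        ∷ (0 , cut₂ 1F 3F (2 ∷ 4 ∷ 35 ∷ []) (34 ∷ 37 ∷ []) (36 ∷ 6 ∷ 5 ∷ 9 ∷ 7 ∷ 8 ∷ 10 ∷ 11 ∷ 1 ∷ 15 ∷ 22 ∷ 18 ∷ 19 ∷ 14 ∷ 16 ∷ 21 ∷ 17 ∷ 20 ∷ 26 ∷ 32 ∷ 31 ∷ 30 ∷ 33 ∷ 28 ∷ 29 ∷ 25 ∷ 23 ∷ 27 ∷ 13 ∷ 12 ∷ 3 ∷ []))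
        ∷ (1 , cut 0F (2 ∷ 5 ∷ 3 ∷ 12 ∷ 13 ∷ 9 ∷ 33 ∷ 30 ∷ 31 ∷ 29 ∷ 28 ∷ 27 ∷ 23 ∷ 24 ∷ 20 ∷ 26 ∷ 32 ∷ 21 ∷ 17 ∷ 19 ∷ 18 ∷ 22 ∷ 15 ∷ 14 ∷ 16 ∷ 11 ∷ 10 ∷ 8 ∷ 7 ∷ 37 ∷ 34 ∷ []) (35 ∷ 36 ∷ 6 ∷ 4 ∷ 1 ∷ []))
        ∷ (0 , cut₂ 1F 3F (2 ∷ 4 ∷ 35 ∷ []) (34 ∷ 37 ∷ []) (36 ∷ 6 ∷ 5 ∷ 9 ∷ 7 ∷ 8 ∷ 10 ∷ 32 ∷ 31 ∷ 30 ∷ 33 ∷ 28 ∷ 29 ∷ 25 ∷ 23 ∷ 27 ∷ 13 ∷ 12 ∷ 24 ∷ 20 ∷ 17 ∷ 21 ∷ 16 ∷ 11 ∷ 1 ∷ 15 ∷ 14 ∷ 19 ∷ 18 ∷ 22 ∷ 3 ∷ []))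
        ∷ (0 , cut₂ 1F 3F (2 ∷ 4 ∷ 35 ∷ []) (34 ∷ 8 ∷ 10 ∷ 11 ∷ 1 ∷ 15 ∷ 22 ∷ 18 ∷ 19 ∷ 14 ∷ 16 ∷ 21 ∷ 17 ∷ 20 ∷ 26 ∷ 32 ∷ 31 ∷ 30 ∷ 33 ∷ 28 ∷ 29 ∷ 25 ∷ 23 ∷ 24 ∷ 12 ∷ 13 ∷ 9 ∷ 7 ∷ 37 ∷ []) (36 ∷ 6 ∷ 5 ∷ 3 ∷ []))
        ∷ (0 , cut₂ 1F 3F (2 ∷ 4 ∷ 35 ∷ []) (34 ∷ 8 ∷ 7 ∷ 37 ∷ []) (36 ∷ 6 ∷ 5 ∷ 9 ∷ 33 ∷ 30 ∷ 31 ∷ 29 ∷ 25 ∷ 26 ∷ 20 ∷ 17 ∷ 19 ∷ 14 ∷ 16 ∷ 21 ∷ 32 ∷ 10 ∷ 11 ∷ 1 ∷ 15 ∷ 22 ∷ 18 ∷ 24 ∷ 23 ∷ 27 ∷ 13 ∷ 12 ∷ 3 ∷ []))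
        ∷ (0 , cut₂ 1F 3F (2 ∷ 4 ∷ 35 ∷ []) (34 ∷ 37 ∷ []) (36 ∷ 6 ∷ 5 ∷ 9 ∷ 7 ∷ 8 ∷ 10 ∷ 11 ∷ 1 ∷ 15 ∷ 22 ∷ 18 ∷ 19 ∷ 14 ∷ 16 ∷ 21 ∷ 17 ∷ 20 ∷ 24 ∷ 23 ∷ 25 ∷ 26 ∷ 32 ∷ 31 ∷ 30 ∷ 33 ∷ 28 ∷ 27 ∷ 13 ∷ 12 ∷ 3 ∷ []))
        ∷ (0 , cut₂ 1F 3F (2 ∷ 4 ∷ 35 ∷ []) (34 ∷ 8 ∷ 10 ∷ 11 ∷ 1 ∷ 15 ∷ 22 ∷ 18 ∷ 19 ∷ 14 ∷ 16 ∷ 21 ∷ 17 ∷ 20 ∷ 26 ∷ 32 ∷ 31 ∷ 29 ∷ 25 ∷ 23 ∷ 24 ∷ 12 ∷ 13 ∷ 27 ∷ 28 ∷ 33 ∷ 9 ∷ 7 ∷ 37 ∷ []) (36 ∷ 6 ∷ 5 ∷ 3 ∷ []))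
        ∷ (0 , cut₂ 1F 3F (2 ∷ 4 ∷ 35 ∷ []) (34 ∷ 37 ∷ []) (36 ∷ 6 ∷ 5 ∷ 9 ∷ 7 ∷ 8 ∷ 30 ∷ 33 ∷ 28 ∷ 29 ∷ 25 ∷ 23 ∷ 27 ∷ 13 ∷ 12 ∷ 24 ∷ 20 ∷ 26 ∷ 32 ∷ 10 ∷ 11 ∷ 1 ∷ 15 ∷ 14 ∷ 16 ∷ 21 ∷ 17 ∷ 19 ∷ 18 ∷ 22 ∷ 3 ∷ []))
        ∷ (0 , cut₂ 1F 3F (2 ∷ 4 ∷ 35 ∷ []) (34 ∷ 8 ∷ 10 ∷ 11 ∷ 1 ∷ 15 ∷ 22 ∷ 18 ∷ 19 ∷ 14 ∷ 16 ∷ 21 ∷ 17 ∷ 20 ∷ 26 ∷ 25 ∷ 29 ∷ 31 ∷ 30 ∷ 33 ∷ 28 ∷ 27 ∷ 23 ∷ 24 ∷ 12 ∷ 13 ∷ 9 ∷ 7 ∷ 37 ∷ []) (36 ∷ 6 ∷ 5 ∷ 3 ∷ []))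
        ∷ (0 , cut₂ 1F 3F (2 ∷ 4 ∷ 35 ∷ []) (34 ∷ 8 ∷ 30 ∷ 31 ∷ 29 ∷ 28 ∷ 27 ∷ 23 ∷ 25 ∷ 26 ∷ 20 ∷ 17 ∷ 19 ∷ 14 ∷ 16 ∷ 21 ∷ 32 ∷ 10 ∷ 11 ∷ 1 ∷ 15 ∷ 22 ∷ 18 ∷ 24 ∷ 12 ∷ 13 ∷ 9 ∷ 7 ∷ 37 ∷ []) (36 ∷ 6 ∷ 5 ∷ 3 ∷ []))
        ∷ []
    ; ring-avoiding =
        (0 , cut 2F (2 ∷ 5 ∷ 6 ∷ 4 ∷ 35 ∷ 36 ∷ []) (37 ∷ 7 ∷ 8 ∷ 10 ∷ 11 ∷ 1 ∷ 15 ∷ 14 ∷ 16 ∷ 21 ∷ 32 ∷ 31 ∷ 30 ∷ 33 ∷ 9 ∷ 13 ∷ 12 ∷ 24 ∷ 23 ∷ 27 ∷ 28 ∷ 29 ∷ 25 ∷ 26 ∷ 20 ∷ 17 ∷ 19 ∷ 18 ∷ 22 ∷ 3 ∷ []))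
        ∷ (0 , cut 3F (2 ∷ 4 ∷ 1 ∷ 15 ∷ 22 ∷ 18 ∷ 19 ∷ 14 ∷ 16 ∷ 11 ∷ 10 ∷ 32 ∷ 21 ∷ 17 ∷ 20 ∷ 26 ∷ 25 ∷ 29 ∷ 31 ∷ 30 ∷ 33 ∷ 28 ∷ 27 ∷ 23 ∷ 24 ∷ 12 ∷ 13 ∷ 9 ∷ 7 ∷ 8 ∷ 34 ∷ 37 ∷ []) (36 ∷ 6 ∷ 5 ∷ 3 ∷ []))
        ∷ (0 , cut 1F (2 ∷ 5 ∷ 6 ∷ 4 ∷ 35 ∷ []) (34 ∷ 37 ∷ 7 ∷ 8 ∷ 30 ∷ 31 ∷ 29 ∷ 25 ∷ 23 ∷ 27 ∷ 28 ∷ 33 ∷ 9 ∷ 13 ∷ 12 ∷ 24 ∷ 20 ∷ 26 ∷ 32 ∷ 10 ∷ 11 ∷ 1 ∷ 15 ∷ 14 ∷ 16 ∷ 21 ∷ 17 ∷ 19 ∷ 18 ∷ 22 ∷ 3 ∷ []))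
        ∷ (0 , cut 0F (2 ∷ 4 ∷ 1 ∷ 11 ∷ 10 ∷ 32 ∷ 21 ∷ 16 ∷ 14 ∷ 15 ∷ 22 ∷ 18 ∷ 19 ∷ 17 ∷ 20 ∷ 26 ∷ 25 ∷ 29 ∷ 31 ∷ 30 ∷ 33 ∷ 28 ∷ 27 ∷ 23 ∷ 24 ∷ 12 ∷ 13 ∷ 9 ∷ 7 ∷ 8 ∷ 34 ∷ []) (35 ∷ 36 ∷ 6 ∷ 5 ∷ 3 ∷ []))
        ∷ []
    ; outs = 8 ∷ 4 ∷ 6 ∷ 7 ∷ []
    ; centre = -[1+ 296 ] , + 110
    ; lines =
        (-[1+ 10 ] , + 8 , -[1+ 4213 ])
        ∷ (-[1+ 0 ] , + 0 , -[1+ 383 ])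
        ∷ (-[1+ 0 ] , + 0 , -[1+ 332 ])
        ∷ (-[1+ 0 ] , + 0 , -[1+ 307 ])
        ∷ (-[1+ 0 ] , + 0 , -[1+ 305 ])
        ∷ (+ 0 , -[1+ 0 ] , + 44)
        ∷ (+ 0 , -[1+ 0 ] , + 59)
        ∷ (+ 0 , -[1+ 0 ] , + 78)
        ∷ (+ 0 , -[1+ 0 ] , + 81)
        ∷ (+ 0 , -[1+ 0 ] , + 94)
        ∷ (+ 0 , -[1+ 0 ] , + 98)
        ∷ (+ 0 , -[1+ 0 ] , + 99)
        ∷ (+ 0 , -[1+ 0 ] , + 101)
        ∷ (+ 0 , -[1+ 0 ] , + 105)
        ∷ (+ 0 , + 1 , -[1+ 211 ])
        ∷ (+ 0 , + 1 , -[1+ 189 ])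
        ∷ (+ 0 , + 1 , -[1+ 176 ])
        ∷ (+ 0 , + 1 , -[1+ 168 ])
        ∷ (+ 0 , + 1 , -[1+ 157 ])
        ∷ (+ 0 , + 1 , -[1+ 150 ])
        ∷ (+ 0 , + 1 , -[1+ 138 ])
        ∷ (+ 0 , + 1 , -[1+ 137 ])
        ∷ (+ 0 , + 1 , -[1+ 135 ])
        ∷ (+ 0 , + 1 , -[1+ 127 ])
        ∷ (+ 0 , + 1 , -[1+ 122 ])
        ∷ (+ 0 , + 1 , -[1+ 121 ])
        ∷ (+ 0 , + 1 , -[1+ 118 ])
        ∷ (+ 0 , + 1 , -[1+ 116 ])
        ∷ (+ 1 , -[1+ 1 ] , + 507)
        ∷ (+ 1 , -[1+ 0 ] , + 386)
        ∷ (+ 1 , + 0 , + 211)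
        ∷ (+ 1 , + 0 , + 235)
        ∷ (+ 1 , + 0 , + 236)
        ∷ (+ 1 , + 0 , + 242)
        ∷ (+ 1 , + 0 , + 244)
        ∷ (+ 1 , + 0 , + 252)
        ∷ (+ 1 , + 0 , + 258)
        ∷ (+ 1 , + 0 , + 271)
        ∷ (+ 1 , + 0 , + 279)
        ∷ (+ 1 , + 19 , -[1+ 1924 ])
        ∷ (+ 3 , -[1+ 16 ] , + 2720)
        ∷ (+ 7 , -[1+ 9 ] , + 3113)
        ∷ []
    }

  module G38 = Seed.Seed 30 data₃₈

  checks₃₈ : G38.Checks
  checks₃₈ = record
    { symmetric = refl; irreflexive = refl; once = refl; rim-mate = refl; rim-opp = refl; rim-nbrs = refl
    ; terminals = refl; valid = refl; refuted = refl; bc = refl; ba = refl; ca = refl; b-all = refl; c-all = refl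
    ; avoids = refl; avoids-ring = refl; left = refl; above = refl; beyond-b = refl; beyond-c = refl
    ; corner-left = refl; corner-above = refl; nook-b = refl; nook-c = refl; deep = refl; barriers = refl
    ; neighbours = refl; nondegenerate = refl; planar = refl; corners = refl , refl , refl
    }

-- Assembly for the required numbers of vertices

open import Defs using (Graph; Planar; Hypotraceable)
open Frame using (Fragment)
open FramePlane using (Drawing)
open Graphs
open Growth using (grow; ringed; grow-size) renaming (fragment to grown-fragment)
open GrowPlane using (grow-nested; drawing)
open SeedGraph
open import Data.Bool using (Bool; true; false)
open import Data.Nat using (ℕ; zero; suc; _+_; _*_; _∸_; _≤_)
open import Data.Nat.Properties using (m+[n∸m]≡n)
open import Data.Nat.DivMod using (_divMod_; result)
open import Data.Nat.Tactic.RingSolver using (solve-∀)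
open import Data.Fin using (Fin; zero; suc; toℕ)
open import Data.Product using (Σ-syntax; _×_; _,_)
open import Function.Bundles using (_↔_)
open import Function.Construct.Identity using (↔-id)
open import Relation.Binary.PropositionalEquality

Example : ℕ → Set
Example n = Σ[ G ∈ Graph n ] (Planar G × Hypotraceable G)

record Piece (s : ℕ) : Set₁ where
  field
    fragment : Fragment
    drawn    : Drawing fragment
    count    : Fragment.X fragment ↔ Fin s

piece₃₂ : Piece 32
piece₃₂ = record { fragment = G34.fragment checks₃₄; drawn = G34.drawing checks₃₄; count = ↔-id _ }

piece₃₅ : Piece 35
piece₃₅ = record { fragment = G37.fragment checks₃₇; drawn = G37.drawing checks₃₇; count = ↔-id _ }

-- The seed already has four ring vertices and 32 others besides the apex, and each growth step adds
-- four.
piece : ∀ k → Piece (4 + (k * 4 + 32))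
piece k = record
  { fragment = grown-fragment (grow k G)
  ; drawn    = drawing (grow-nested k G (G38.nested checks₃₈))
  ; count    = ringed (grow-size k G (↔-id (Fin 32)))
  }
  where G = G38.growing checks₃₈

example : ∀ {s₀ s₁ s₂ s₃ n} → Piece s₀ → Piece s₁ → Piece s₂ → Piece s₃ → s₀ + (s₁ + (s₂ + (s₃ + 2))) ≡ suc n → Example (suc n)
example {s₀} {s₁} {s₂} {s₃} {n} p₀ p₁ p₂ p₃ e =
  T.result (subst (λ k → Frame.Frame.V F ↔ Fin k) e (T.V↔Fin (Piece.count p₀) (Piece.count p₁) (Piece.count p₂) (Piece.count p₃)))
  where
  F : Bool → Bool → Fragment
  F false false = Piece.fragment p₀
  F false true  = Piece.fragment p₁
  F true  false = Piece.fragment p₂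
  F true  true  = Piece.fragment p₃
  D : ∀ i j → Drawing (F i j)
  D false false = Piece.drawn p₀
  D false true  = Piece.drawn p₁
  D true  false = Piece.drawn p₂
  D true  true  = Piece.drawn p₃
  module T = Transfer.Transfer F D

-- Here `x` is the variable part of the growing fragment, `a + b` its fixed part, and `c` counts the
-- other three fragments and the two apices.
total : ∀ a x b c → (a + (x + b)) + c ≡ (a + (b + c)) + x
total = solve-∀

-- The sizes 32 and 36 + 4k are 0 modulo 4, and 35 is 3. With none, three, two or one fragments of
-- size 35 the orders are 2, 3, 0 and 1 modulo 4, and the numbers 5, 3, 4, 5 of growth steps let
-- these classes start at 154, 155, 156 and 157.
large : ∀ k (r : Fin 4) → Example (154 + (toℕ r + k * 4))
large k zero                   = example (piece (5 + k)) piece₃₂ piece₃₂ piece₃₂ (total 24 (k * 4) 32 98)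
large k (suc zero)             = example (piece (3 + k)) piece₃₅ piece₃₅ piece₃₅ (total 16 (k * 4) 32 107)
large k (suc (suc zero))       = example (piece (4 + k)) piece₃₅ piece₃₅ piece₃₂ (total 20 (k * 4) 32 104)
large k (suc (suc (suc zero))) = example (piece (5 + k)) piece₃₅ piece₃₂ piece₃₂ (total 24 (k * 4) 32 101)

theorem3p6 : (Σ[ G ∈ Graph 130 ] (Planar G × Hypotraceable G))
           × (∀ (n : ℕ) → 154 ≤ n → Σ[ G ∈ Graph n ] (Planar G × Hypotraceable G))
theorem3p6 = example piece₃₂ piece₃₂ piece₃₂ piece₃₂ refl , from-154
  where
  from-154 : ∀ n → 154 ≤ n → Example n
  from-154 n h with (n ∸ 154) divMod 4
  ... | result k r e = subst Example (trans (cong (154 +_) (sym e)) (m+[n∸m]≡n h)) (large k r)
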